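{- If an edge ordering $f$ of $K_n$ is chosen uniformly at random from all bijections $E(K_n)\to\{1,2,\dots,\binom n2\}$, then an $f$-increasing Hamiltonian path exists in $K_n$ with probability at least $\frac1e+o(1)$ as $n\to\infty$.
   Context: An edge ordering of $K_n$ is a bijection $f:E(K_n)\to\{1,2,\dots,\binom n2\}$; $f(e)$ is the label of $e$. An $f$-increasing path is a simple path along which the label of each edge is greater than the label of the previous edge. It is Hamiltonian if it visits all $n$ vertices. -}

module Defs where

open import Data.Empty.Irrelevant using (⊥-elim)
open import Data.Fin.Base as Fin using (Fin; zero; suc; finToFun; funToFin)
open import Data.Fin.Properties as Fin using (_≟_; <-cmp; all?; any?; +↔⊎; finToFun-funToFin; funToFin-finToFin)
open import Data.Integer.Base as ℤ using (+_; +[1+_])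
import Data.Integer.Properties as ℤ
open import Data.List.Base as List using (List; []; _∷_; length; filter; allFin; cartesianProductWith)
import Data.List.Membership.DecPropositional as DecMembership
open import Data.List.Membership.Propositional using (_∈_; lose)
open import Data.List.Membership.Propositional.Properties using (∈-allFin; ∈-lookup; ∈-cartesianProductWith⁺)
open import Data.List.Relation.Unary.All as All using (All; []; _∷_)
open import Data.List.Relation.Unary.AllPairs as AllPairs using (AllPairs; []; _∷_)
import Data.List.Relation.Unary.AllPairs.Properties as AllPairs
open import Data.List.Relation.Unary.Any as Any using (Any; here; there)
import Data.List.Relation.Unary.Any.Properties as Any
open import Data.List.Relation.Unary.Enumerates.Setoid using (IsEnumeration)
open import Data.List.Relation.Unary.Linked as Linked using (Linked)
import Data.List.Relation.Unary.Unique.DecPropositional as DecUnique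
open import Data.List.Relation.Unary.Unique.Propositional using (Unique)
open import Data.List.Relation.Unary.Unique.Propositional.Properties using (allFin⁺)
import Data.List.Relation.Unary.Unique.Setoid as SetoidUnique
open import Data.Nat.Base as ℕ using (ℕ; zero; suc; _!; NonZero; z<s; s<s; s<s⁻¹; s≤s⁻¹)
open import Data.Nat.Combinatorics using (_C_; nC1≡n; nCk+nC[k+1]≡[n+1]C[k+1])
open import Data.Nat.Properties as ℕ using (_!≢0)
open import Data.Product.Base using (Σ; ∃; _×_; _,_; proj₁; proj₂)
open import Data.Rational.Base as ℚ using (ℚ; mkℚ; 0ℚ; 1ℚ; _/_; 1/_; toℚᵘ; *<*)
import Data.Rational.Properties as ℚ
import Data.Rational.Unnormalised.Base as ℚᵘ
open ℚᵘ using (mkℚᵘ)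
import Data.Rational.Unnormalised.Properties as ℚᵘ
open import Data.Sum.Base using (_⊎_; inj₁; inj₂)
open import Data.Sum.Function.Propositional using (_⊎-↔_)
open import Function.Base using (_∘_; _on_)
open import Function.Bundles using (_⤖_; _↔_; mk⤖; mk↔ₛ′; Bijection; Inverse)
open import Function.Consequences.Propositional using (strictlySurjective⇒surjective; surjective⇒strictlySurjective)
open import Function.Construct.Composition using (_⤖-∘_; _↔-∘_)
open import Function.Definitions using (Injective; Surjective; Bijective)
open import Function.Properties.Inverse using (↔⇒⤖; ↔-sym; ↔-refl)
open import Level using (Level; 0ℓ)
open import Relation.Binary.Bundles using (Setoid)
open import Relation.Binary.Definitions using (tri<; tri≈; tri>)
open import Relation.Binary.PropositionalEquality
  using (_≡_; _≢_; _≗_; refl; sym; trans; cong; cong₂; subst; module ≡-Reasoning)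
open import Relation.Nullary.Decidable using (Dec; yes; no; _×-dec_; _→-dec_; map′)
open import Relation.Nullary.Negation using (contradiction)
open import Relation.Unary using (Pred; Decidable)

open import Algebra.Properties.Group ℚ.+-0-group using (⁻¹-anti-homo-//)

private
  variable
    a p ℓ : Level
    n : ℕ

-- The edges of Kₙ: a two-element set of vertices is stored with its smaller element first.
record Edge (n : ℕ) : Set where
  constructor mkEdge
  field
    lower upper  : Fin n
    .lower<upper : lower Fin.< upper

edge : (u v : Fin n) → .(u ≢ v) → Edge n
edge u v u≢v with <-cmp u v
... | tri< u<v _ _ = mkEdge u v u<v
... | tri≈ _ u≡v _ = ⊥-elim (u≢v u≡v)
... | tri> _ _ v<u = mkEdge v u v<u

-- Labels start at 0 rather than 1; only their order is ever used.
EdgeOrdering : ℕ → Set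
EdgeOrdering n = Edge n ⤖ Fin (n C 2)

label : EdgeOrdering n → Edge n → Fin (n C 2)
label = Bijection.to

-- A simple path in Kₙ is a repetition-free sequence of vertices, since any two
-- distinct vertices are adjacent.
record Path (n : ℕ) : Set where
  field
    vertices : List (Fin n)
    simple   : Unique vertices

pathEdges : (vs : List (Fin n)) → .(Unique vs) → List (Edge n)
pathEdges []           _  = []
pathEdges (_ ∷ [])     _  = []
pathEdges (u ∷ v ∷ vs) vs! =
  edge u v (All.head (AllPairs.head vs!)) ∷ pathEdges (v ∷ vs) (AllPairs.tail vs!)

edges : Path n → List (Edge n)
edges π = pathEdges vertices simple where open Path π

Increasing : EdgeOrdering n → Path n → Set
Increasing f π = Linked (Fin._<_ on label f) (edges π)

Hamiltonian : Path n → Set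
Hamiltonian π = ∀ v → v ∈ Path.vertices π

HasIncreasingHamiltonianPath : Pred (EdgeOrdering n) 0ℓ
HasIncreasingHamiltonianPath {n} f = ∃ λ (π : Path n) → Increasing f π × Hamiltonian π

listsUpTo : (n k : ℕ) → List (List (Fin n))
listsUpTo n zero    = [] ∷ []
listsUpTo n (suc k) = [] ∷ cartesianProductWith _∷_ (allFin n) (listsUpTo n k)

∈-listsUpTo : ∀ k (vs : List (Fin n)) → length vs ℕ.≤ k → vs ∈ listsUpTo n k
∈-listsUpTo zero    []       _   = here refl
∈-listsUpTo (suc k) []       _   = here refl
∈-listsUpTo (suc k) (v ∷ vs) |vs|≤k =
  there (∈-cartesianProductWith⁺ _∷_ (∈-allFin v) (∈-listsUpTo k vs (s≤s⁻¹ |vs|≤k)))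

lookup-injective : {A : Set a} {xs : List A} → Unique xs → Injective _≡_ _≡_ (List.lookup xs)
lookup-injective (_    ∷ _)   {zero}  {zero}  _  = refl
lookup-injective (x∉xs ∷ _)   {zero}  {suc j} eq = contradiction eq (All.lookup x∉xs (∈-lookup j))
lookup-injective (x∉xs ∷ _)   {suc i} {zero}  eq = contradiction (sym eq) (All.lookup x∉xs (∈-lookup i))
lookup-injective (_    ∷ xs!) {suc i} {suc j} eq = cong suc (lookup-injective xs! eq)

hasIncreasingHamiltonianPath? : Decidable (HasIncreasingHamiltonianPath {n})
hasIncreasingHamiltonianPath? {n} f = map′ to from (Any.any? good? (listsUpTo n n))
  where
  Good : List (Fin n) → Set
  Good vs = Σ (Unique vs) λ vs! → let π = record { vertices = vs ; simple = vs! } in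
            Increasing f π × Hamiltonian π

  good? : Decidable Good
  good? vs with DecUnique.unique? _≟_ vs
  ... | no ¬vs! = no (¬vs! ∘ proj₁)
  ... | yes vs! = map′ (vs! ,_) proj₂
    (Linked.linked? (λ e e′ → label f e Fin.<? label f e′) _
      ×-dec all? (λ v → DecMembership._∈?_ _≟_ v vs))

  to : Any Good (listsUpTo n n) → HasIncreasingHamiltonianPath f
  to any = let vs , vs! , inc , ham = Any.satisfied any
           in record { vertices = vs ; simple = vs! } , inc , ham

  from : HasIncreasingHamiltonianPath f → Any Good (listsUpTo n n)
  from (π , inc , ham) =
    lose (∈-listsUpTo n vertices (Fin.injective⇒≤ (lookup-injective simple))) (simple , inc , ham)
    where open Path π

-- A finite sample space: every element of S is listed exactly once, up to its equality.
record Enumeration (S : Setoid a ℓ) : Set (a Level.⊔ ℓ) where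
  field
    elements : List (Setoid.Carrier S)
    complete : IsEnumeration S elements
    unique   : SetoidUnique.Unique S elements

-- The probability of E under the uniform distribution.
probability : {S : Setoid a ℓ} (Ω : Enumeration S) → let open Enumeration Ω in
              .{{_ : NonZero (length elements)}} →
              {E : Pred (Setoid.Carrier S) p} → Decidable E → ℚ
probability Ω E? = (+ length (filter E? elements)) / length elements
  where open Enumeration Ω

orderings : ℕ → Setoid 0ℓ 0ℓ
orderings n = record
  { Carrier       = EdgeOrdering n
  ; _≈_           = λ f g → label f ≗ label g
  ; isEquivalence = record
    { refl  = λ _ → refl
    ; sym   = λ f≈g e → sym (f≈g e)
    ; trans = λ f≈g g≈h e → trans (f≈g e) (g≈h e)
    }
  }

edge-index : ∀ n → Edge n ↔ Fin (n C 2)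
edge-index zero    = mk↔ₛ′ (λ ()) (λ ()) (λ ()) (λ ())
edge-index (suc n) = subst (λ m → Edge (suc n) ↔ Fin m) n+nC2≡[1+n]C2
  (↔-sym +↔⊎ ↔-∘ ((↔-refl ⊎-↔ edge-index n) ↔-∘ mk↔ₛ′ split unsplit split-unsplit unsplit-split))
  where
  n+nC2≡[1+n]C2 : n ℕ.+ n C 2 ≡ suc n C 2
  n+nC2≡[1+n]C2 = trans (cong (ℕ._+ n C 2) (sym (nC1≡n n))) (nCk+nC[k+1]≡[n+1]C[k+1] n 1)

  split : Edge (suc n) → Fin n ⊎ Edge n
  split (mkEdge zero    (suc j) _)   = inj₁ j
  split (mkEdge (suc i) (suc j) i<j) = inj₂ (mkEdge i j (s<s⁻¹ i<j))

  unsplit : Fin n ⊎ Edge n → Edge (suc n)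
  unsplit (inj₁ j)                = mkEdge zero (suc j) z<s
  unsplit (inj₂ (mkEdge i j i<j)) = mkEdge (suc i) (suc j) (s<s i<j)

  split-unsplit : ∀ x → split (unsplit x) ≡ x
  split-unsplit (inj₁ _) = refl
  split-unsplit (inj₂ _) = refl

  unsplit-split : ∀ e → unsplit (split e) ≡ e
  unsplit-split (mkEdge zero    (suc j) _) = refl
  unsplit-split (mkEdge (suc i) (suc j) _) = refl

module _ {A : Set a} {P : Pred A p} (P? : Decidable P) where

  collect : List A → List (Σ A P)
  collect []       = []
  collect (x ∷ xs) with P? x
  ... | yes px = (x , px) ∷ collect xs
  ... | no  _  = collect xs

  collect-complete : ∀ {x xs} → x ∈ xs → P x → ∃ λ px → (x , px) ∈ collect xs
  collect-complete {xs = x ∷ _} (here refl) px with P? x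
  ... | yes px′ = px′ , here refl
  ... | no  ¬px = contradiction px ¬px
  collect-complete {xs = y ∷ _} (there x∈xs) px with P? y
  ... | yes _ = let px′ , x∈ = collect-complete x∈xs px in px′ , there x∈
  ... | no  _ = collect-complete x∈xs px

  collect-all : ∀ {q} {Q : Pred A q} {xs} → All Q xs → All (Q ∘ proj₁) (collect xs)
  collect-all [] = []
  collect-all {xs = x ∷ _} (qx ∷ qxs) with P? x
  ... | yes _ = qx ∷ collect-all qxs
  ... | no  _ = collect-all qxs

  collect-unique : ∀ {xs} → Unique xs → AllPairs (_≢_ on proj₁) (collect xs)
  collect-unique [] = []
  collect-unique {xs = x ∷ _} (x∉xs ∷ xs!) with P? x
  ... | yes _ = collect-all x∉xs ∷ collect-unique xs!
  ... | no  _ = collect-unique xs!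

funToFin-cong : ∀ {m n} {f g : Fin m → Fin n} → f ≗ g → funToFin f ≡ funToFin g
funToFin-cong {zero}  _   = refl
funToFin-cong {suc _} f≗g = cong₂ Fin.combine (f≗g zero) (funToFin-cong (f≗g ∘ suc))

-- Fin (m ^ m) codes the functions Fin m → Fin m.
bijective? : ∀ {m} → Decidable (λ (k : Fin (m ℕ.^ m)) → Bijective _≡_ _≡_ (finToFun {m} {m} k))
bijective? {m} k = injective? ×-dec surjective?
  where
  g : Fin m → Fin m
  g = finToFun k

  injective? : Dec (Injective _≡_ _≡_ g)
  injective? = map′ (λ inj {x} {y} → inj x y) (λ inj x y → inj {x} {y})
    (all? λ x → all? λ y → (g x ≟ g y) →-dec (x ≟ y))

  surjective? : Dec (Surjective _≡_ _≡_ g)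
  surjective? = map′ strictlySurjective⇒surjective surjective⇒strictlySurjective
    (all? λ y → any? λ x → g x ≟ y)

edgeOrderings : ∀ n → Enumeration (orderings n)
edgeOrderings n = record
  { elements = List.map toOrdering (collect bijective? (allFin (m ℕ.^ m)))
  ; complete = complete
  ; unique   = AllPairs.map⁺ (AllPairs.map (λ {x} {y} k≢l → k≢l ∘ toOrdering-injective {x} {y})
                 (collect-unique bijective? (allFin⁺ (m ℕ.^ m))))
  }
  where
  m : ℕ
  m = n C 2

  open Inverse (edge-index n) using () renaming
    (to to index; from to index⁻¹; strictlyInverseˡ to index∘index⁻¹; strictlyInverseʳ to index⁻¹∘index)

  toOrdering : (∃ λ (k : Fin (m ℕ.^ m)) → Bijective _≡_ _≡_ (finToFun {m} {m} k)) → EdgeOrdering n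
  toOrdering (_ , bij) = mk⤖ bij ⤖-∘ ↔⇒⤖ (edge-index n)

  toOrdering-injective : ∀ {x y} → label (toOrdering x) ≗ label (toOrdering y) → proj₁ x ≡ proj₁ y
  toOrdering-injective {k , _} {l , _} eq = begin
    k                             ≡⟨ funToFin-finToFin {m} k ⟨
    funToFin (finToFun {m} {m} k) ≡⟨ funToFin-cong k≗l ⟩
    funToFin (finToFun {m} {m} l) ≡⟨ funToFin-finToFin {m} l ⟩
    l                             ∎
    where
    open ≡-Reasoning
    k≗l : finToFun {m} {m} k ≗ finToFun l
    k≗l i = subst (λ j → finToFun {m} {m} k j ≡ finToFun l j) (index∘index⁻¹ i) (eq (index⁻¹ i))

  complete : IsEnumeration (orderings n) _
  complete f = Any.map⁺ (Any.map (λ { refl e → f≗ e }) (proj₂ (collect-complete bijective? (∈-allFin k) bij)))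
    where
    g : Fin m → Fin m
    g = label f ∘ index⁻¹

    k : Fin (m ℕ.^ m)
    k = funToFin g

    k≗g : finToFun k ≗ g
    k≗g = finToFun-funToFin g

    f≗ : ∀ e → label f e ≡ finToFun k (index e)
    f≗ e = sym (trans (k≗g (index e)) (cong (label f) (index⁻¹∘index e)))

    g-bij : Bijective _≡_ _≡_ g
    g-bij = Bijection.bijective (f ⤖-∘ ↔⇒⤖ (↔-sym (edge-index n)))

    bij : Bijective _≡_ _≡_ (finToFun {m} {m} k)
    bij = (λ {x} {y} eq → proj₁ g-bij (trans (sym (k≗g x)) (trans eq (k≗g y))))
        , λ y → let x , gx≡y = proj₂ g-bij y in x , λ { {z} z≡x → trans (k≗g z) (gx≡y z≡x) }

edgeOrderings-nonZero : ∀ n → NonZero (length (Enumeration.elements (edgeOrderings n)))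
edgeOrderings-nonZero n = nonEmpty (complete (↔⇒⤖ (edge-index n)))
  where
  open Enumeration (edgeOrderings n)
  nonEmpty : ∀ {P : Pred (EdgeOrdering n) 0ℓ} {xs} → Any P xs → NonZero (length xs)
  nonEmpty (here  _) = _
  nonEmpty (there _) = _

increasingHamiltonianProbability : ℕ → ℚ
increasingHamiltonianProbability n =
  probability (edgeOrderings n) {{edgeOrderings-nonZero n}} hasIncreasingHamiltonianPath?

IsCauchy : (ℕ → ℚ) → Set
IsCauchy x = ∀ ε → 0ℚ ℚ.< ε →
  ∃ λ N → ∀ m n → N ℕ.≤ m → N ℕ.≤ n → ℚ.∣ x m ℚ.- x n ∣ ℚ.≤ ε

record ℝ : Set where
  field
    approx : ℕ → ℚ
    cauchy : IsCauchy approx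
open ℝ public

-- The order on limits; approximants need not be comparable index by index.
infix 4 _≤ᴿ_
_≤ᴿ_ : ℝ → ℝ → Set
x ≤ᴿ y = ∀ ε → 0ℚ ℚ.< ε → ∃ λ N → ∀ n → N ℕ.≤ n → approx x n ℚ.≤ approx y n ℚ.+ ε

p≤q+r⇒p-q≤r : ∀ p q r → p ℚ.≤ q ℚ.+ r → p ℚ.- q ℚ.≤ r
p≤q+r⇒p-q≤r p q r p≤q+r = begin
  p ℚ.- q             ≤⟨ ℚ.+-monoˡ-≤ (ℚ.- q) p≤q+r ⟩
  q ℚ.+ r ℚ.- q       ≡⟨ cong (ℚ._- q) (ℚ.+-comm q r) ⟩
  r ℚ.+ q ℚ.- q       ≡⟨ ℚ.+-assoc r q (ℚ.- q) ⟩
  r ℚ.+ (q ℚ.- q)     ≡⟨ cong (r ℚ.+_) (ℚ.+-inverseʳ q) ⟩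
  r ℚ.+ 0ℚ            ≡⟨ ℚ.+-identityʳ r ⟩
  r                   ∎
  where open ℚ.≤-Reasoning

p-q≤r⇒p≤r+q : ∀ p q r → p ℚ.- q ℚ.≤ r → p ℚ.≤ r ℚ.+ q
p-q≤r⇒p≤r+q p q r p-q≤r = begin
  p                         ≡⟨ ℚ.+-identityʳ p ⟨
  p ℚ.+ 0ℚ                  ≡⟨ cong (p ℚ.+_) (ℚ.+-inverseˡ q) ⟨
  p ℚ.+ (ℚ.- q ℚ.+ q)       ≡⟨ ℚ.+-assoc p (ℚ.- q) q ⟨
  p ℚ.- q ℚ.+ q             ≤⟨ ℚ.+-monoˡ-≤ q p-q≤r ⟩
  r ℚ.+ q                   ∎
  where open ℚ.≤-Reasoning

∣p-q∣≤r : ∀ p q r → p ℚ.≤ q ℚ.+ r → q ℚ.≤ p ℚ.+ r → ℚ.∣ p ℚ.- q ∣ ℚ.≤ r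
∣p-q∣≤r p q r p≤q+r q≤p+r with ℚ.∣p∣≡p∨∣p∣≡-p (p ℚ.- q)
... | inj₁ eq = subst (ℚ._≤ r) (sym eq) (p≤q+r⇒p-q≤r p q r p≤q+r)
... | inj₂ eq = subst (ℚ._≤ r) (sym (trans eq (⁻¹-anti-homo-// p q))) (p≤q+r⇒p-q≤r q p r q≤p+r)

p≤∣p∣ : ∀ p → p ℚ.≤ ℚ.∣ p ∣
p≤∣p∣ p with ℚ.≤-total 0ℚ p
... | inj₁ 0≤p = ℚ.≤-reflexive (sym (ℚ.0≤p⇒∣p∣≡p 0≤p))
... | inj₂ p≤0 = ℚ.≤-trans p≤0 (ℚ.0≤∣p∣ p)

∣p-q∣≤r⇒p≤r+q : ∀ p q r → ℚ.∣ p ℚ.- q ∣ ℚ.≤ r → p ℚ.≤ r ℚ.+ q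
∣p-q∣≤r⇒p≤r+q p q r le = p-q≤r⇒p≤r+q p q r (ℚ.≤-trans (p≤∣p∣ (p ℚ.- q)) le)

fromℚ : ℚ → ℝ
fromℚ q = record
  { approx = λ _ → q
  ; cauchy = λ ε 0<ε → 0 , λ _ _ _ _ →
      subst (ℚ._≤ ε) (cong ℚ.∣_∣ (sym (ℚ.+-inverseʳ q))) (ℚ.<⇒≤ 0<ε)
  }

1≤⇒nonZero : ∀ {p} → 1ℚ ℚ.≤ p → ℚ.NonZero p
1≤⇒nonZero {p} 1≤p = ℚ.>-nonZero {p} (ℚ.<-≤-trans (ℚ.positive⁻¹ 1ℚ) 1≤p)

-- The bound keeps x away from 0, and makes reciprocals of its approximants 1-Lipschitz.
module _ (x : ℝ) (1≤x : ∀ k → 1ℚ ℚ.≤ approx x k) where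
  inv : ℕ → ℚ
  inv k = (1/ approx x k) {{1≤⇒nonZero (1≤x k)}}

  private
    1/-≤ : ∀ {p q r} (1≤p : 1ℚ ℚ.≤ p) (1≤q : 1ℚ ℚ.≤ q) → 0ℚ ℚ.≤ r → q ℚ.≤ r ℚ.+ p →
           (1/ p) {{1≤⇒nonZero 1≤p}} ℚ.≤ (1/ q) {{1≤⇒nonZero 1≤q}} ℚ.+ r
    1/-≤ {p} {q} {r} 1≤p 1≤q 0≤r q≤r+p = begin
      p′                                ≡⟨ ℚ.*-identityʳ p′ ⟨
      p′ ℚ.* 1ℚ                         ≡⟨ cong (p′ ℚ.*_) (ℚ.*-inverseˡ q) ⟨
      p′ ℚ.* (q′ ℚ.* q)                 ≡⟨ ℚ.*-assoc p′ q′ q ⟨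
      p′ ℚ.* q′ ℚ.* q                   ≤⟨ ℚ.*-monoˡ-≤-nonNeg (p′ ℚ.* q′) q≤r+p ⟩
      p′ ℚ.* q′ ℚ.* (r ℚ.+ p)           ≡⟨ ℚ.*-distribˡ-+ (p′ ℚ.* q′) r p ⟩
      p′ ℚ.* q′ ℚ.* r ℚ.+ p′ ℚ.* q′ ℚ.* p ≤⟨ ℚ.+-mono-≤ (ℚ.*-monoʳ-≤-nonNeg r p′q′≤1) (ℚ.≤-reflexive p′q′p≡q′) ⟩
      1ℚ ℚ.* r ℚ.+ q′                   ≡⟨ cong (ℚ._+ q′) (ℚ.*-identityˡ r) ⟩
      r ℚ.+ q′                          ≡⟨ ℚ.+-comm r q′ ⟩
      q′ ℚ.+ r                          ∎
      where
      open ℚ.≤-Reasoning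
      instance
        _ = 1≤⇒nonZero 1≤p
        _ = 1≤⇒nonZero 1≤q
        _ = ℚ.nonNegative 0≤r
      p′ q′ : ℚ
      p′ = 1/ p
      q′ = 1/ q
      pos : ∀ {s} → 1ℚ ℚ.≤ s → ℚ.Positive s
      pos 1≤s = ℚ.positive (ℚ.<-≤-trans (ℚ.positive⁻¹ 1ℚ) 1≤s)
      inv-nonNeg : ∀ {s} (1≤s : 1ℚ ℚ.≤ s) → ℚ.NonNegative ((1/ s) {{1≤⇒nonZero 1≤s}})
      inv-nonNeg {s} 1≤s = ℚ.pos⇒nonNeg ((1/ s) {{1≤⇒nonZero 1≤s}}) {{ℚ.1/pos⇒pos s {{pos 1≤s}}}}
      instance
        _ = inv-nonNeg 1≤p
        _ = inv-nonNeg 1≤q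
        p′q′-nonNeg : ℚ.NonNegative (p′ ℚ.* q′)
        p′q′-nonNeg = ℚ.nonNeg*nonNeg⇒nonNeg p′ q′
      inv≤1 : ∀ {s} (1≤s : 1ℚ ℚ.≤ s) → (1/ s) {{1≤⇒nonZero 1≤s}} ℚ.≤ 1ℚ
      inv≤1 {s} 1≤s = let instance _ = 1≤⇒nonZero 1≤s ; instance _ = inv-nonNeg 1≤s in begin
        1/ s            ≡⟨ ℚ.*-identityʳ (1/ s) ⟨
        1/ s ℚ.* 1ℚ     ≤⟨ ℚ.*-monoˡ-≤-nonNeg (1/ s) 1≤s ⟩
        1/ s ℚ.* s      ≡⟨ ℚ.*-inverseˡ s ⟩
        1ℚ              ∎
      p′q′≤1 : p′ ℚ.* q′ ℚ.≤ 1ℚ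
      p′q′≤1 = begin
        p′ ℚ.* q′  ≤⟨ ℚ.*-monoˡ-≤-nonNeg p′ (inv≤1 1≤q) ⟩
        p′ ℚ.* 1ℚ  ≡⟨ ℚ.*-identityʳ p′ ⟩
        p′         ≤⟨ inv≤1 1≤p ⟩
        1ℚ         ∎
      p′q′p≡q′ : p′ ℚ.* q′ ℚ.* p ≡ q′
      p′q′p≡q′ = begin-equality
        p′ ℚ.* q′ ℚ.* p    ≡⟨ cong (ℚ._* p) (ℚ.*-comm p′ q′) ⟩
        q′ ℚ.* p′ ℚ.* p    ≡⟨ ℚ.*-assoc q′ p′ p ⟩
        q′ ℚ.* (p′ ℚ.* p)  ≡⟨ cong (q′ ℚ.*_) (ℚ.*-inverseˡ p) ⟩
        q′ ℚ.* 1ℚ          ≡⟨ ℚ.*-identityʳ q′ ⟩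
        q′                 ∎

  reciprocal : ℝ
  reciprocal = record
    { approx = inv
    ; cauchy = λ ε 0<ε → let N , h = cauchy x ε 0<ε ; xₖ = approx x in N , λ m n N≤m N≤n →
        ∣p-q∣≤r (inv m) (inv n) ε
          (1/-≤ (1≤x m) (1≤x n) (ℚ.<⇒≤ 0<ε) (∣p-q∣≤r⇒p≤r+q (xₖ n) (xₖ m) ε (h n m N≤n N≤m)))
          (1/-≤ (1≤x n) (1≤x m) (ℚ.<⇒≤ 0<ε) (∣p-q∣≤r⇒p≤r+q (xₖ m) (xₖ n) ε (h m n N≤m N≤n)))
    }

1/_! : ℕ → ℚ
1/ k ! = (+ 1 / (k !)) {{k !≢0}}

expSum : ℕ → ℚ
expSum zero    = 1/ 0 !
expSum (suc n) = expSum n ℚ.+ 1/ suc n !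

0≤1/k! : ∀ k → 0ℚ ℚ.≤ 1/ k !
0≤1/k! k = ℚ.nonNegative⁻¹ _ {{ℚ.normalize-nonNeg 1 (k !) {{k !≢0}}}}

expSum-≤-suc : ∀ n → expSum n ℚ.≤ expSum (suc n)
expSum-≤-suc n = begin
  expSum n                   ≡⟨ ℚ.+-identityʳ (expSum n) ⟨
  expSum n ℚ.+ 0ℚ            ≤⟨ ℚ.+-monoʳ-≤ (expSum n) (0≤1/k! (suc n)) ⟩
  expSum n ℚ.+ 1/ suc n !    ∎
  where open ℚ.≤-Reasoning

expSum-mono : ∀ {m n} → m ℕ.≤′ n → expSum m ℚ.≤ expSum n
expSum-mono (ℕ.≤′-reflexive refl) = ℚ.≤-refl
expSum-mono (ℕ.≤′-step {n = n} m≤n) = ℚ.≤-trans (expSum-mono m≤n) (expSum-≤-suc n)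

1≤expSum : ∀ n → 1ℚ ℚ.≤ expSum n
1≤expSum n = expSum-mono {0} {n} (ℕ.≤⇒≤′ ℕ.z≤n)

n≤n! : ∀ n → n ℕ.≤ n !
n≤n! zero    = ℕ.z≤n
n≤n! (suc n) = ℕ.m≤m*n (suc n) (n !) {{n !≢0}}

1/a+1/b≤1/c : ∀ a b c .{{_ : ℕ.NonZero a}} .{{_ : ℕ.NonZero b}} .{{_ : ℕ.NonZero c}} →
              c ℕ.* (a ℕ.+ b) ℕ.≤ a ℕ.* b → + 1 / a ℚ.+ + 1 / b ℚ.≤ + 1 / c
1/a+1/b≤1/c a@(suc a-1) b@(suc b-1) c@(suc c-1) h = ℚ.toℚᵘ-cancel-≤ (begin
  toℚᵘ (+ 1 / a ℚ.+ + 1 / b)            ≃⟨ ℚ.toℚᵘ-homo-+ (+ 1 / a) (+ 1 / b) ⟩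
  toℚᵘ (+ 1 / a) ℚᵘ.+ toℚᵘ (+ 1 / b)    ≃⟨ ℚᵘ.+-cong (ℚ.toℚᵘ-fromℚᵘ (mkℚᵘ (+ 1) a-1)) (ℚ.toℚᵘ-fromℚᵘ (mkℚᵘ (+ 1) b-1)) ⟩
  mkℚᵘ (+ 1) a-1 ℚᵘ.+ mkℚᵘ (+ 1) b-1    ≤⟨ ℚᵘ.*≤* (ℤ.+≤+ cross) ⟩
  mkℚᵘ (+ 1) c-1                        ≃⟨ ℚ.toℚᵘ-fromℚᵘ (mkℚᵘ (+ 1) c-1) ⟨
  toℚᵘ (+ 1 / c)                        ∎)
  where
  open ℚᵘ.≤-Reasoning
  cross : (1 ℕ.* b ℕ.+ 1 ℕ.* a) ℕ.* c ℕ.≤ 1 ℕ.* (a ℕ.* b)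
  cross = ℕ.≤-trans (ℕ.≤-reflexive (trans (ℕ.*-comm _ c) (cong (c ℕ.*_)
    (trans (cong₂ ℕ._+_ (ℕ.*-identityˡ b) (ℕ.*-identityˡ a)) (ℕ.+-comm b a)))))
    (ℕ.≤-trans h (ℕ.≤-reflexive (sym (ℕ.*-identityˡ (a ℕ.* b)))))

1/-step : ∀ j → 1/ suc (suc j) ! ℚ.+ + 1 / suc (suc j) ℚ.≤ + 1 / suc j
1/-step j = 1/a+1/b≤1/c (suc k !) (suc k) k {{suc k !≢0}} (begin
  k ℕ.* (suc k ! ℕ.+ suc k)             ≡⟨ ℕ.*-distribˡ-+ k (suc k !) (suc k) ⟩
  k ℕ.* suc k ! ℕ.+ k ℕ.* suc k         ≤⟨ ℕ.+-monoʳ-≤ (k ℕ.* suc k !) (ℕ.≤-trans (ℕ.≤-reflexive (ℕ.*-comm k (suc k))) (ℕ.*-monoʳ-≤ (suc k) (n≤n! k))) ⟩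
  k ℕ.* suc k ! ℕ.+ suc k !             ≡⟨ ℕ.+-comm (k ℕ.* suc k !) (suc k !) ⟩
  suc k ℕ.* suc k !                     ≡⟨ ℕ.*-comm (suc k) (suc k !) ⟩
  suc k ! ℕ.* suc k                     ∎)
  where
  open ℕ.≤-Reasoning
  k = suc j

expSum+1/-anti : ∀ {m n} → m ℕ.≤′ n →
  expSum (suc n) ℚ.+ + 1 / suc n ℚ.≤ expSum (suc m) ℚ.+ + 1 / suc m
expSum+1/-anti (ℕ.≤′-reflexive refl) = ℚ.≤-refl
expSum+1/-anti {m} (ℕ.≤′-step {n = n} m≤n) = begin
  expSum (suc n) ℚ.+ 1/ suc (suc n) ! ℚ.+ + 1 / suc (suc n)    ≡⟨ ℚ.+-assoc (expSum (suc n)) (1/ suc (suc n) !) (+ 1 / suc (suc n)) ⟩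
  expSum (suc n) ℚ.+ (1/ suc (suc n) ! ℚ.+ + 1 / suc (suc n))  ≤⟨ ℚ.+-monoʳ-≤ (expSum (suc n)) (1/-step n) ⟩
  expSum (suc n) ℚ.+ + 1 / suc n                               ≤⟨ expSum+1/-anti m≤n ⟩
  expSum (suc m) ℚ.+ + 1 / suc m                               ∎
  where open ℚ.≤-Reasoning

expSum-≤-+1/ : ∀ d {m n} → suc d ℕ.≤ m → suc d ℕ.≤ n → expSum m ℚ.≤ expSum n ℚ.+ + 1 / suc d
expSum-≤-+1/ d {suc m} {n} (ℕ.s≤s d≤m) 1+d≤n = begin
  expSum (suc m)                     ≡⟨ ℚ.+-identityʳ (expSum (suc m)) ⟨
  expSum (suc m) ℚ.+ 0ℚ              ≤⟨ ℚ.+-monoʳ-≤ (expSum (suc m)) (ℚ.nonNegative⁻¹ (+ 1 / suc m) {{ℚ.normalize-nonNeg 1 (suc m)}}) ⟩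
  expSum (suc m) ℚ.+ + 1 / suc m     ≤⟨ expSum+1/-anti (ℕ.≤⇒≤′ d≤m) ⟩
  expSum (suc d) ℚ.+ + 1 / suc d     ≤⟨ ℚ.+-monoˡ-≤ (+ 1 / suc d) (expSum-mono (ℕ.≤⇒≤′ 1+d≤n)) ⟩
  expSum n ℚ.+ + 1 / suc d           ∎
  where open ℚ.≤-Reasoning

1/denominator≤ : ∀ ε → 0ℚ ℚ.< ε → + 1 / (ℚ.↧ₙ ε) ℚ.≤ ε
1/denominator≤ ε@(mkℚ +[1+ p ] d _) _ = ℚ.toℚᵘ-cancel-≤ (begin
  toℚᵘ (+ 1 / suc d)  ≃⟨ ℚ.toℚᵘ-fromℚᵘ (mkℚᵘ (+ 1) d) ⟩
  mkℚᵘ (+ 1) d        ≤⟨ ℚᵘ.*≤* (ℤ.*-monoʳ-≤-nonNeg (+ suc d) (ℤ.+≤+ (ℕ.s≤s (ℕ.z≤n {p})))) ⟩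
  toℚᵘ ε              ∎)
  where open ℚᵘ.≤-Reasoning
1/denominator≤ (mkℚ (+ 0)       _ _) (*<* (ℤ.+<+ ()))
1/denominator≤ (mkℚ (ℤ.-[1+ _ ]) _ _) (*<* ())

e : ℝ
e = record
  { approx = expSum
  ; cauchy = λ ε 0<ε → (ℚ.↧ₙ ε) , λ m n N≤m N≤n →
      ℚ.≤-trans (∣p-q∣≤r (expSum m) (expSum n) _ (expSum-≤-+1/ _ N≤m N≤n) (expSum-≤-+1/ _ N≤n N≤m))
                (1/denominator≤ ε 0<ε)
  }

1/e : ℝ
1/e = reciprocal e 1≤expSum

-- Second moment method, for the number X of increasing Hamiltonian paths on n vertices.  A fixed path is
-- increasing with probability 1/(n-1)!, so E X = n, and P(X > 0) ≥ (E X)² / E X² reduces the claim to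
-- E X² ≤ (e + o(1)) n².
--
-- Fix a path P.  If P and Q are both increasing, merging their edges by label gives a word recording which
-- edges belong to P, to Q or to both; given P, Q and the word, the merged sequence of r edges is increasing
-- with probability 1/r!.  Shared edges come in m runs of k edges in all, and a run prescribes entries of Q;
-- at most (n-k-m)! paths Q agree with all of them.  Counting words, such Q contribute asymptotically
-- n² 2^(m-k) / m! for each choice of the m run lengths, a run of one edge counting twice (it has two
-- directions).  As 2 + 1/2 + 1/4 + ... = 3, this sums up to e³ n².
--
-- But Q must share no edge with P beyond those of the word, which costs a factor e⁻²: exchanging two vertices
-- of Q with the two ends of an edge of P creates one more shared edge, and comparing the number of ways to
-- do and to undo this shows that the number of further shared edges is, in the limit, Poisson with mean 2.
-- This argument serves for k ≤ K; the classes with k > K are negligible by crude estimates.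

module Submission where

open import Data.Empty using (⊥; ⊥-elim)
open import Data.Fin.Base as Fin using (Fin)
open import Data.List.Base using (_++_; List; []; allFin; cartesianProduct; catMaybes; concatMap; filter;
  length; map; replicate; upTo; _∷_; _∷ʳ_)
open import Data.List.Membership.Propositional using (find; lose; _∈_; _∉_)
open import Data.List.Properties using (applyUpTo-∷ʳ; filter-all; length-++; length-map; length-replicate;
  length-tabulate; map-injective; map-∘; ∷-injectiveʳ; ∷-injectiveˡ)
open import Data.List.Relation.Unary.All as All using (All; []; _∷_)
open import Data.List.Relation.Unary.AllPairs as AllPairs using (AllPairs; []; _∷_)
open import Data.List.Relation.Unary.Any as Any using (Any; here; there; _─_)
open import Data.List.Relation.Unary.Unique.Propositional using (Unique)
open import Data.Maybe.Base using (Maybe; just; nothing)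
open import Data.Product.Base as × using (_,_; proj₁; proj₂; _×_; Σ; ∃; ∃₂)
open import Data.Sum.Base as Sum using ([_,_]′; inj₁; inj₂; _⊎_)
open import Function.Base using (const; id; _on_; _∘_)
open import Function.Bundles using (Bijection; Inverse; mk↔ₛ′; _↔_)
open import Relation.Binary.Definitions using (DecidableEquality; tri<; tri>; tri≈)
open import Relation.Nullary.Decidable using (Dec; from-yes; map′; no; yes; ¬?; _×-dec_; _⊎-dec_)
open import Relation.Nullary.Negation using (contradiction; ¬_)
open import Relation.Unary using (Decidable)
open import Relation.Binary.PropositionalEquality hiding ([_])

-- No limit is taken before the very end: everything is an inequality between rationals at a fixed
-- cut-off `K`. Three truncated exponentials occur, with argument 3 from the runs, with argument 2
-- from the exchanges, and `expSum K`. A product of truncated series contains all terms of the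
-- truncated product series, so `E (ι 3) K ≤ E (ι 2) K * expSum K`, and dividing turns e³ / e² into
-- e. The corrections for finite n are powers of θ = d / n with n - d depending on `K` only, and
-- Bernoulli's inequality disposes of them.
--
-- The obstacle is the factor e⁻². An exchange creates at most one hit but may destroy others, so
-- the classes of exactly i hits are unsuitable, and classes of at most i hits are used. One-sided
-- inequalities are enough for these: they force the classes to grow at least as fast as the partial
-- sums of exp 2, and so bound the class without hits from above. The mean is 2 because about n
-- steps of Q and 2n directed edges of P can be chosen for an exchange, against at most n² pairs of
-- displaced vertices for undoing it.

-- Finite sums and injections between lists

module Counting where

  open import Data.Nat.Base
  open import Data.Nat.Properties
  open import Algebra.Properties.CommutativeSemigroup +-commutativeSemigroup using (interchange; x∙yz≈y∙xz)

  private
    variable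
      A B : Set
      P Q : A → Set
      x : A
      xs ys : List A
      g h : A → ℕ

  ∑ : List A → (A → ℕ) → ℕ
  ∑ []       g = 0
  ∑ (x ∷ xs) g = g x + ∑ xs g

  𝟙 : {P : Set} → Dec P → ℕ
  𝟙 (yes _) = 1
  𝟙 (no  _) = 0

  𝟙-yes : {P : Set} (P? : Dec P) → P → 𝟙 P? ≡ 1
  𝟙-yes (yes _) _ = refl
  𝟙-yes (no ¬p) p = contradiction p ¬p

  𝟙-no : {P : Set} (P? : Dec P) → ¬ P → 𝟙 P? ≡ 0
  𝟙-no (yes p) ¬p = contradiction p ¬p
  𝟙-no (no  _) _  = refl

  𝟙≤1 : {P : Set} (P? : Dec P) → 𝟙 P? ≤ 1
  𝟙≤1 (yes _) = s≤s z≤n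
  𝟙≤1 (no  _) = z≤n

  𝟙-mono : {P Q : Set} (P? : Dec P) (Q? : Dec Q) → (P → Q) → 𝟙 P? ≤ 𝟙 Q?
  𝟙-mono (yes p) Q? P⇒Q = ≤-reflexive (sym (𝟙-yes Q? (P⇒Q p)))
  𝟙-mono (no  _) _  _   = z≤n

  ∑-mono : ∀ xs → (∀ {x} → x ∈ xs → g x ≤ h x) → ∑ xs g ≤ ∑ xs h
  ∑-mono []       _   = z≤n
  ∑-mono (x ∷ xs) g≤h = +-mono-≤ (g≤h (here refl)) (∑-mono xs (g≤h ∘ there))

  ∑-cong : ∀ xs → (∀ {x} → x ∈ xs → g x ≡ h x) → ∑ xs g ≡ ∑ xs h
  ∑-cong []       _   = refl
  ∑-cong (x ∷ xs) g≡h = cong₂ _+_ (g≡h (here refl)) (∑-cong xs (g≡h ∘ there))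

  ∑-+ : ∀ (xs : List A) g h → ∑ xs (λ x → g x + h x) ≡ ∑ xs g + ∑ xs h
  ∑-+ []       g h = refl
  ∑-+ (x ∷ xs) g h = trans (cong ((g x + h x) +_) (∑-+ xs g h)) (interchange (g x) (h x) (∑ xs g) (∑ xs h))

  ∑-*ˡ : ∀ c (xs : List A) g → ∑ xs (λ x → c * g x) ≡ c * ∑ xs g
  ∑-*ˡ c []       g = sym (*-zeroʳ c)
  ∑-*ˡ c (x ∷ xs) g = trans (cong (c * g x +_) (∑-*ˡ c xs g)) (sym (*-distribˡ-+ c (g x) (∑ xs g)))

  ∑-*ʳ : ∀ c (xs : List A) g → ∑ xs (λ x → g x * c) ≡ ∑ xs g * c
  ∑-*ʳ c xs g = trans (∑-cong xs (λ {x} _ → *-comm (g x) c)) (trans (∑-*ˡ c xs g) (*-comm c _))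

  ∑-const : ∀ (xs : List A) c → ∑ xs (const c) ≡ length xs * c
  ∑-const []       c = refl
  ∑-const (x ∷ xs) c = cong (c +_) (∑-const xs c)

  ∑-1 : ∀ (xs : List A) → ∑ xs (const 1) ≡ length xs
  ∑-1 xs = trans (∑-const xs 1) (*-identityʳ (length xs))

  ∑-0 : ∀ (xs : List A) → ∑ xs (const 0) ≡ 0
  ∑-0 xs = trans (∑-const xs 0) (*-zeroʳ (length xs))

  ∑-≤-const : ∀ (xs : List A) c → (∀ {x} → x ∈ xs → g x ≤ c) → ∑ xs g ≤ length xs * c
  ∑-≤-const xs c g≤c = ≤-trans (∑-mono xs g≤c) (≤-reflexive (∑-const xs c))

  ∑-++ : ∀ (xs ys : List A) g → ∑ (xs ++ ys) g ≡ ∑ xs g + ∑ ys g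
  ∑-++ []       ys g = refl
  ∑-++ (x ∷ xs) ys g = trans (cong (g x +_) (∑-++ xs ys g)) (sym (+-assoc (g x) (∑ xs g) (∑ ys g)))

  ∑-map : ∀ (f : A → B) xs g → ∑ (map f xs) g ≡ ∑ xs (g ∘ f)
  ∑-map f []       g = refl
  ∑-map f (x ∷ xs) g = cong (g (f x) +_) (∑-map f xs g)

  ∑-concatMap : ∀ (f : A → List B) xs g → ∑ (concatMap f xs) g ≡ ∑ xs (λ x → ∑ (f x) g)
  ∑-concatMap f []       g = refl
  ∑-concatMap f (x ∷ xs) g = trans (∑-++ (f x) (concatMap f xs) g) (cong (∑ (f x) g +_) (∑-concatMap f xs g))

  ∑-swap : ∀ (xs : List A) (ys : List B) (g : A → B → ℕ) →
           ∑ xs (λ x → ∑ ys (g x)) ≡ ∑ ys (λ y → ∑ xs (λ x → g x y))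
  ∑-swap []       ys g = sym (∑-0 ys)
  ∑-swap (x ∷ xs) ys g = trans (cong (∑ ys (g x) +_) (∑-swap xs ys g)) (sym (∑-+ ys (g x) _))

  ∑-∈ : x ∈ xs → g x ≤ ∑ xs g
  ∑-∈ {xs = _ ∷ xs} {g = g} (here refl) = m≤m+n _ (∑ xs g)
  ∑-∈ {xs = y ∷ _}  {g = g} (there x∈)  = ≤-trans (∑-∈ x∈) (m≤n+m _ (g y))

  ∑-filter : ∀ (P? : Decidable P) xs g → ∑ (filter P? xs) g ≡ ∑ xs (λ x → 𝟙 (P? x) * g x)
  ∑-filter P? []       g = refl
  ∑-filter P? (x ∷ xs) g with P? x
  ... | yes _ = cong₂ _+_ (sym (+-identityʳ (g x))) (∑-filter P? xs g)
  ... | no  _ = ∑-filter P? xs g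

  length-filter : ∀ (P? : Decidable P) xs → length (filter P? xs) ≡ ∑ xs (𝟙 ∘ P?)
  length-filter P? xs = trans (sym (∑-1 (filter P? xs)))
    (trans (∑-filter P? xs (const 1)) (∑-cong xs (λ {x} _ → *-identityʳ (𝟙 (P? x)))))

  private
    ∑-─ : (i : Any P ys) → ∑ ys h ≡ h (Any.lookup i) + ∑ (ys ─ i) h
    ∑-─         (here  _)                  = refl
    ∑-─ {h = h} (there {x = y} {xs = ys} i) =
      trans (cong (h y +_) (∑-─ i)) (x∙yz≈y∙xz (h y) (h (Any.lookup i)) (∑ (ys ─ i) h))

    any-─ : (i : Any P ys) → Any Q ys → Q (Any.lookup i) ⊎ Any Q (ys ─ i)
    any-─ (here  _) (here  q) = inj₁ q
    any-─ (here  _) (there j) = inj₂ j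
    any-─ (there i) (here  q) = inj₂ (here q)
    any-─ (there i) (there j) = Sum.map₂ there (any-─ i j)

    any-lookup : (i : Any P ys) → P (Any.lookup i)
    any-lookup (here  p) = p
    any-lookup (there i) = any-lookup i

  -- The image of each `x` is deleted from `ys` before the next one is chosen, and disjointness says
  -- that no deletion takes away what a later `x` needs. `R` is a relation and not a function so
  -- that it also serves for orderings, which are identified only up to pointwise equality of
  -- labels.
  ∑-inj : ∀ {A B : Set} {xs : List A} {ys : List B} {g h} {R : A → B → Set} → AllPairs (λ x x′ → ∀ {y} → R x y → R x′ y → ⊥) xs →
          (∀ {x} → x ∈ xs → Any (λ y → R x y × g x ≤ h y) ys) → ∑ xs g ≤ ∑ ys h
  ∑-inj []                        _   = z≤n
  ∑-inj {xs = x ∷ xs} {ys = ys} {g = g} {h = h} {R = R} (x# ∷ xs#) img = begin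
    g x + ∑ xs g                    ≤⟨ +-mono-≤ (proj₂ (any-lookup i)) (∑-inj {R = R} xs# img′) ⟩
    h (Any.lookup i) + ∑ (ys ─ i) h ≡⟨ ∑-─ i ⟨
    ∑ ys h                         ∎
    where
    open ≤-Reasoning
    i = img (here refl)
    img′ : ∀ {x′} → x′ ∈ xs → Any (λ y → R x′ y × g x′ ≤ h y) (ys ─ i)
    img′ x′∈ with any-─ i (img (there x′∈))
    ... | inj₁ (r , _) = contradiction r (All.lookup x# x′∈ (proj₁ (any-lookup i)))
    ... | inj₂ j       = j

  AllPairs-map-∈ : ∀ {R S : A → A → Set} → (∀ {x y} → x ∈ xs → y ∈ xs → R x y → S x y) →
                   AllPairs R xs → AllPairs S xs
  AllPairs-map-∈ f []         = []
  AllPairs-map-∈ f (rx ∷ rxs) =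
    All.tabulate (λ y∈ → f (here refl) (there y∈) (All.lookup rx y∈)) ∷
    AllPairs-map-∈ (λ x∈ y∈ → f (there x∈) (there y∈)) rxs

  length-inj : {ys : List B} (f : A → B) → Unique xs → (∀ {x} → x ∈ xs → f x ∈ ys) →
               (∀ {x y} → x ∈ xs → y ∈ xs → f x ≡ f y → x ≡ y) → length xs ≤ length ys
  length-inj {xs = xs} {ys = ys} f xs! f∈ f-inj = begin
    length xs       ≡⟨ ∑-1 xs ⟨
    ∑ xs (const 1)  ≤⟨ ∑-inj {R = λ x y → f x ≡ y}
                        (AllPairs-map-∈ (λ x∈ y∈ x≢y p q → x≢y (f-inj x∈ y∈ (trans p (sym q)))) xs!)
                        (λ x∈ → Any.map (λ eq → eq , ≤-refl) (f∈ x∈)) ⟩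
    ∑ ys (const 1)  ≡⟨ ∑-1 ys ⟩
    length ys       ∎
    where open ≤-Reasoning

-- Repetition-free lists and their number

module Arrangements where

  open Counting
  open import Data.List.Membership.Propositional.Properties using (∈-filter⁺; ∈-filter⁻; ∈-map⁺; ∈-map⁻; ∈-concatMap⁺; ∈-concatMap⁻)
  open import Data.List.Relation.Unary.Unique.Propositional.Properties as Unique using (filter⁺; map⁺)
  open import Data.Nat.Base
  open import Data.Nat.Properties hiding (_≟_)

  private
    variable
      A B : Set

  Unique-concatMap : (f : A → List B) {xs : List A} → Unique xs → (∀ {x} → x ∈ xs → Unique (f x)) →
                     (∀ {x y z} → z ∈ f x → z ∈ f y → x ≡ y) → Unique (concatMap f xs)
  Unique-concatMap f []           _  _   = []
  Unique-concatMap f (x# ∷ xs!) f! sep = Unique.++⁺ (f! (here refl)) (Unique-concatMap f xs! (f! ∘ there) sep)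
    λ (z∈ , z∈′) → let y , y∈ , z∈fy = find (∈-concatMap⁻ f z∈′) in
      All.lookup x# y∈ (sep z∈ z∈fy)

  module _ {V : Set} (_≟_ : DecidableEquality V) where

    remove : V → List V → List V
    remove x = filter (λ y → ¬? (x ≟ y))

    arrangements : ℕ → List V → List (List V)
    arrangements zero    p = [] ∷ []
    arrangements (suc M) p = concatMap (λ x → map (x ∷_) (arrangements M (remove x p))) p

    ∈-arrangements⁺ : ∀ {q p} → Unique q → (∀ {v} → v ∈ q → v ∈ p) → q ∈ arrangements (length q) p
    ∈-arrangements⁺ {[]}    _          _   = here refl
    ∈-arrangements⁺ {x ∷ q} {p} (x# ∷ q!) q⊆p = ∈-concatMap⁺ _ (Any.map
      (λ {refl → ∈-map⁺ (x ∷_) (∈-arrangements⁺ q! (λ v∈ →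
        ∈-filter⁺ (λ y → ¬? (x ≟ y)) (q⊆p (there v∈)) (All.lookup x# v∈)))})
      (q⊆p (here refl)))

    ∈-arrangements⁻ : ∀ M {q p} → q ∈ arrangements M p →
                      Unique q × (∀ {v} → v ∈ q → v ∈ p) × length q ≡ M
    ∈-arrangements⁻ zero    (here refl) = [] , (λ ()) , refl
    ∈-arrangements⁻ (suc M) {p = p} q∈ with find (∈-concatMap⁻ _ {p} q∈)
    ... | x , x∈p , q∈x with ∈-map⁻ (x ∷_) q∈x
    ... | q , q∈ , refl =
      let q! , q⊆ , |q| = ∈-arrangements⁻ M q∈
          q⊆′ : ∀ {v} → v ∈ q → v ∈ p × x ≢ v
          q⊆′ v∈ = ∈-filter⁻ (λ y → ¬? (x ≟ y)) (q⊆ v∈)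
      in All.tabulate (λ v∈ → proj₂ (q⊆′ v∈)) ∷ q! ,
         (λ { (here refl) → x∈p ; (there v∈) → proj₁ (q⊆′ v∈) }) ,
         cong suc |q|

    arrangements-unique : ∀ M {p} → Unique p → Unique (arrangements M p)
    arrangements-unique zero    _  = [] ∷ []
    arrangements-unique (suc M) p! = Unique-concatMap _ p!
      (λ {x} _ → map⁺ ∷-injectiveʳ (arrangements-unique M (filter⁺ (λ y → ¬? (x ≟ y)) p!)))
      λ {x} {y} z∈x z∈y → let _ , _ , eq = ∈-map⁻ (x ∷_) z∈x ; _ , _ , eq′ = ∈-map⁻ (y ∷_) z∈y in
        ∷-injectiveˡ (trans (sym eq) eq′)

    length-remove : ∀ {x p} → Unique p → x ∈ p → suc (length (remove x p)) ≡ length p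
    length-remove {x} {y ∷ p} (y# ∷ p!) x∈ with x ≟ y | x∈
    ... | yes refl | _          = cong (suc ∘ length) (filter-all (λ z → ¬? (x ≟ z)) y#)
    ... | no  x≢y  | here refl  = contradiction refl x≢y
    ... | no  _    | there x∈p  = cong suc (length-remove p! x∈p)

    length-arrangements : ∀ {p} → Unique p → length (arrangements (length p) p) ≡ length p !
    length-arrangements {p} = go (length p) refl
      where
      go : ∀ M {p} → length p ≡ M → Unique p → length (arrangements M p) ≡ M !
      go zero    _    _  = refl
      go (suc M) {p} |p| p! = begin
        length (concatMap f p)             ≡⟨ ∑-1 (concatMap f p) ⟨
        ∑ (concatMap f p) (const 1)        ≡⟨ ∑-concatMap f p (const 1) ⟩
        ∑ p (λ x → ∑ (f x) (const 1))      ≡⟨ ∑-cong p (λ {x} x∈ → trans (∑-1 (f x)) (trans (length-map (x ∷_) (arrangements M (remove x p)))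
                                               (go M (suc-injective (trans (length-remove p! x∈) |p|)) (filter⁺ (λ y → ¬? (x ≟ y)) p!)))) ⟩
        ∑ p (const (M !))                  ≡⟨ ∑-const p (M !) ⟩
        length p * M !                     ≡⟨ cong (_* M !) |p| ⟩
        suc M !                            ∎
        where
        open ≡-Reasoning
        f = λ x → map (x ∷_) (arrangements M (remove x p))

    Unique-⊆⇒length-≤ : ∀ {p q : List V} → Unique q → (∀ {v} → v ∈ q → v ∈ p) → length q ≤ length p
    Unique-⊆⇒length-≤ q! q⊆p = length-inj id q! q⊆p (λ _ _ eq → eq)

    -- Pigeonhole: a full-length repetition-free list inside p omits nothing.
    Unique-⊆⇒⊇ : ∀ {p q : List V} → Unique p → Unique q → length q ≡ length p →
                 (∀ {v} → v ∈ q → v ∈ p) → ∀ {v} → v ∈ p → v ∈ q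
    Unique-⊆⇒⊇ {p} {q} p! q! |q|≡|p| q⊆p {v} v∈p with Any.any? (v ≟_) q
    ... | yes v∈q = v∈q
    ... | no  v∉q = ⊥-elim (1+n≰n (≤-trans (≤-reflexive (trans (length-remove p! v∈p) (sym |q|≡|p|)))
      (Unique-⊆⇒length-≤ q! (λ u∈q → ∈-filter⁺ (λ y → ¬? (v ≟ y)) (q⊆p u∈q) (λ { refl → v∉q u∈q })))))

-- Lists of dependent triples

module Triples where

  open Counting
  open Arrangements using (Unique-concatMap)
  open import Data.List.Membership.Propositional.Properties using (∈-map⁺; ∈-map⁻; ∈-concatMap⁺; ∈-concatMap⁻)
  open import Data.List.Relation.Unary.Unique.Propositional.Properties using (map⁺)
  open import Data.Nat.Base

  module _ {A B C : Set} (xs : List A) (g : A → List B) (h : A → B → List C) where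

    private
      at : A → B → List (A × B × C)
      at x y = map (λ z → x , y , z) (h x y)

      from : A → List (A × B × C)
      from x = concatMap (at x) (g x)

    triples : List (A × B × C)
    triples = concatMap from xs

    ∈-triples⁺ : ∀ {x y z} → x ∈ xs → y ∈ g x → z ∈ h x y → (x , y , z) ∈ triples
    ∈-triples⁺ {x} {y} x∈ y∈ z∈ = ∈-concatMap⁺ from (lose x∈ (∈-concatMap⁺ (at x) (lose y∈ (∈-map⁺ (λ z → x , y , z) z∈))))

    private
      ∈-from : ∀ {x x′ y z} → (x′ , y , z) ∈ from x → x′ ≡ x × y ∈ g x × z ∈ h x y
      ∈-from {x} t∈ with find (∈-concatMap⁻ (at x) {g x} t∈)
      ... | y , y∈ , t∈y with ∈-map⁻ (λ z → x , y , z) t∈y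
      ... | z , z∈ , refl = refl , y∈ , z∈

    ∈-triples⁻ : ∀ {x y z} → (x , y , z) ∈ triples → x ∈ xs × y ∈ g x × z ∈ h x y
    ∈-triples⁻ t∈ with find (∈-concatMap⁻ from {xs} t∈)
    ... | x , x∈ , t∈x with ∈-from t∈x
    ... | refl , y∈ , z∈ = x∈ , y∈ , z∈

    triples-unique : Unique xs → (∀ {x} → x ∈ xs → Unique (g x)) → (∀ {x} y → x ∈ xs → Unique (h x y)) → Unique triples
    triples-unique xs! g! h! = Unique-concatMap from xs!
      (λ {x} x∈ → Unique-concatMap (at x) (g! x∈) (λ {y} _ → map⁺ (cong (proj₂ ∘ proj₂)) (h! y x∈))
        λ {y} {y′} t∈ t∈′ → trans (sym (second y t∈)) (second y′ t∈′))
      λ t∈ t∈′ → trans (sym (proj₁ (∈-from t∈))) (proj₁ (∈-from t∈′))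
      where
      second : ∀ {x t} y → t ∈ at x y → proj₁ (proj₂ t) ≡ y
      second {x} y t∈ with ∈-map⁻ (λ z → x , y , z) t∈
      ... | _ , _ , refl = refl

    length-triples : length triples ≡ ∑ xs (λ x → ∑ (g x) (λ y → length (h x y)))
    length-triples = trans (sym (∑-1 triples)) (trans (∑-concatMap from xs (const 1)) (∑-cong xs λ {x} _ →
      trans (∑-concatMap (at x) (g x) (const 1)) (∑-cong (g x) λ {y} _ →
        trans (∑-1 (at x y)) (length-map (λ z → x , y , z) (h x y)))))

-- Transpositions

module Swapping where


  module _ {V : Set} (_≟_ : DecidableEquality V) where

    swap : V → V → V → V
    swap x y z with z ≟ x | z ≟ y
    ... | yes _ | _     = y
    ... | no  _ | yes _ = x
    ... | no  _ | no  _ = z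

    swap-left : ∀ x y → swap x y x ≡ y
    swap-left x y with x ≟ x | x ≟ y
    ... | yes _   | _ = refl
    ... | no  x≢x | _ = contradiction refl x≢x

    swap-right : ∀ x y → swap x y y ≡ x
    swap-right x y with y ≟ x | y ≟ y
    ... | yes y≡x | _       = y≡x
    ... | no  _   | yes _   = refl
    ... | no  _   | no  y≢y = contradiction refl y≢y

    swap-fixes : ∀ {x y z} → z ≢ x → z ≢ y → swap x y z ≡ z
    swap-fixes {x} {y} {z} z≢x z≢y with z ≟ x | z ≟ y
    ... | yes z≡x | _       = contradiction z≡x z≢x
    ... | no  _   | yes z≡y = contradiction z≡y z≢y
    ... | no  _   | no  _   = refl

    swap-involutive : ∀ x y z → swap x y (swap x y z) ≡ z
    swap-involutive x y z with z ≟ x | z ≟ y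
    ... | yes refl | _        = swap-right z y
    ... | no  _    | yes refl = swap-left x z
    ... | no  z≢x  | no  z≢y  = swap-fixes z≢x z≢y

    swap-injective : ∀ x y {z w} → swap x y z ≡ swap x y w → z ≡ w
    swap-injective x y {z} {w} eq =
      trans (sym (swap-involutive x y z)) (trans (cong (swap x y) eq) (swap-involutive x y w))

    swap-↔ : V → V → V ↔ V
    swap-↔ x y = mk↔ₛ′ (swap x y) (swap x y) (swap-involutive x y) (swap-involutive x y)

    map-swap-fixes : ∀ {x y zs} → x ∉ zs → y ∉ zs → map (swap x y) zs ≡ zs
    map-swap-fixes {zs = []}     _   _   = refl
    map-swap-fixes {zs = z ∷ zs} x∉ y∉ = cong₂ _∷_
      (swap-fixes (λ eq → x∉ (here (sym eq))) (λ eq → y∉ (here (sym eq))))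
      (map-swap-fixes (x∉ ∘ there) (y∉ ∘ there))

-- The switching inequality for arrangements that hit the edges of a path

module Switching where

  open Counting
  open Swapping
  open Triples
  import Data.List.Membership.DecPropositional as DecMembership
  open import Data.List.Membership.Propositional.Properties
  open import Data.List.Relation.Unary.Unique.Propositional.Properties as Unique using (filter⁺; map⁺)
  open import Data.Nat.Base
  open import Data.Nat.Properties hiding (_≟_)
  open import Data.Product.Properties using (≡-dec)

  private
    variable
      A V : Set

  -- What is kept of the steps of a path: at most one step leaves a vertex and at most one enters
  -- it, so no vertex has more than two neighbours. `asym` also forbids loops, since `(u , u)` is
  -- its own reverse.
  record Linear (l : List (V × V)) : Set where
    field
      sources! : Unique (map proj₁ l)
      targets! : Unique (map proj₂ l)
      asym     : ∀ {u v} → (u , v) ∈ l → (v , u) ∉ l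

  undirected : List (V × V) → List (V × V)
  undirected l = l ++ map ×.swap l

  undirected-sym : ∀ (l : List (V × V)) {u v} → (u , v) ∈ undirected l → (v , u) ∈ undirected l
  undirected-sym l uv∈ with ∈-++⁻ l uv∈
  ... | inj₁ uv∈l = ∈-++⁺ʳ l (∈-map⁺ ×.swap uv∈l)
  ... | inj₂ uv∈l′ with ∈-map⁻ ×.swap uv∈l′
  ... | _ , vu∈l , refl = ∈-++⁺ˡ vu∈l

  ∑-≟ : ∀ (_≟_ : DecidableEquality A) {xs} z → Unique xs → ∑ xs (λ x → 𝟙 (x ≟ z)) ≤ 1
  ∑-≟ _≟_ z [] = z≤n
  ∑-≟ _≟_ {x ∷ xs} z (x# ∷ xs!) with x ≟ z
  ... | no  _    = ∑-≟ _≟_ z xs!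
  ... | yes refl = ≤-reflexive (cong suc (trans (∑-cong xs (λ {y} y∈ → 𝟙-no (y ≟ z) (λ { refl → All.lookup x# y∈ refl }))) (∑-0 xs)))

  length-concatMap-≤ : ∀ {A B : Set} (f : A → List B) xs {c} → (∀ x → length (f x) ≤ c) → length (concatMap f xs) ≤ length xs * c
  length-concatMap-≤ f []       _  = z≤n
  length-concatMap-≤ f (x ∷ xs) f≤ =
    ≤-trans (≤-reflexive (length-++ (f x))) (+-mono-≤ (f≤ x) (length-concatMap-≤ f xs f≤))

  module _ {V : Set} (_≟_ : DecidableEquality V) where

    _≟²_ : DecidableEquality (V × V)
    _≟²_ = ≡-dec _≟_ _≟_

    open DecMembership _≟²_ using () renaming (_∈?_ to _∈²?_)
    open DecMembership _≟_ using () renaming (_∈?_ to _∈¹?_)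

    module _ {l : List (V × V)} (lin : Linear l) where
      open Linear lin

      undirected-unique : Unique (undirected l)
      undirected-unique = Unique.++⁺ l! (Unique.map⁺ (cong ×.swap) l!)
        λ (e∈ , e∈′) → let _ , e″∈ , eq = ∈-map⁻ ×.swap e∈′ in asym e∈ (subst (_∈ l) (cong ×.swap (sym eq)) e″∈)
        where
        l! : Unique l
        l! = Unique.map⁻ sources!

      undirected-irrefl : ∀ {u v} → (u , v) ∈ undirected l → u ≢ v
      undirected-irrefl uv∈ refl with ∈-++⁻ l uv∈
      ... | inj₁ uu∈ = asym uu∈ uu∈
      ... | inj₂ uu∈′ with ∈-map⁻ ×.swap uu∈′
      ... | _ , uu∈ , refl = asym uu∈ uu∈

      out-degree : ∀ z → ∑ (undirected l) (λ e → 𝟙 (proj₁ e ≟ z)) ≤ 2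
      out-degree z = begin
        ∑ (undirected l) (λ e → 𝟙 (proj₁ e ≟ z))
          ≡⟨ ∑-++ l (map ×.swap l) _ ⟩
        ∑ l (λ e → 𝟙 (proj₁ e ≟ z)) + ∑ (map ×.swap l) (λ e → 𝟙 (proj₁ e ≟ z))
          ≡⟨ cong₂ _+_ (sym (∑-map proj₁ l (λ x → 𝟙 (x ≟ z))))
              (trans (∑-map ×.swap l _) (sym (∑-map proj₂ l (λ x → 𝟙 (x ≟ z))))) ⟩
        ∑ (map proj₁ l) (λ x → 𝟙 (x ≟ z)) + ∑ (map proj₂ l) (λ x → 𝟙 (x ≟ z))
          ≤⟨ +-mono-≤ (∑-≟ _≟_ z sources!) (∑-≟ _≟_ z targets!) ⟩
        2 ∎
        where open ≤-Reasoning

      in-degree : ∀ z → ∑ (undirected l) (λ e → 𝟙 (proj₂ e ≟ z)) ≤ 2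
      in-degree z = begin
        ∑ (undirected l) (λ e → 𝟙 (proj₂ e ≟ z))
          ≡⟨ ∑-++ l (map ×.swap l) _ ⟩
        ∑ l (λ e → 𝟙 (proj₂ e ≟ z)) + ∑ (map ×.swap l) (λ e → 𝟙 (proj₂ e ≟ z))
          ≡⟨ cong₂ _+_ (sym (∑-map proj₂ l (λ x → 𝟙 (x ≟ z))))
              (trans (∑-map ×.swap l _) (sym (∑-map proj₁ l (λ x → 𝟙 (x ≟ z))))) ⟩
        ∑ (map proj₂ l) (λ x → 𝟙 (x ≟ z)) + ∑ (map proj₁ l) (λ x → 𝟙 (x ≟ z))
          ≤⟨ +-mono-≤ (∑-≟ _≟_ z targets!) (∑-≟ _≟_ z sources!) ⟩
        2 ∎
        where open ≤-Reasoning

    neighbours : List (V × V) → V → List V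
    neighbours l z = map proj₂ (filter (λ e → proj₁ e ≟ z) (undirected l))

    ∈-neighbours : ∀ l {z w} → (z , w) ∈ undirected l → w ∈ neighbours l z
    ∈-neighbours l {z} zw∈ = ∈-map⁺ proj₂ (∈-filter⁺ (λ e → proj₁ e ≟ z) zw∈ refl)

    length-neighbours : ∀ {l} → Linear l → ∀ z → length (neighbours l z) ≤ 2
    length-neighbours {l} lin z = ≤-trans
      (≤-reflexive (trans (length-map proj₂ (filter (λ e → proj₁ e ≟ z) (undirected l)))
        (length-filter (λ e → proj₁ e ≟ z) (undirected l))))
      (out-degree lin z)

    -- The endpoints a new edge must avoid so that writing it into the step (x , y) creates no other hit.
    forbidden : (l st : List (V × V)) → V × V → List V
    forbidden l st (x , y) = (x ∷ y ∷ []) ++ near ++ concatMap (neighbours l) near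
      ++ concatMap (neighbours st) (neighbours l x ++ neighbours l y)
      where near = neighbours st x ++ neighbours st y

    Bad : (l st : List (V × V)) → V × V → V × V → Set
    Bad l st s (u , v) = u ∈ forbidden l st s ⊎ v ∈ forbidden l st s

    bad? : ∀ l st s e → Dec (Bad l st s e)
    bad? l st s (u , v) = (u ∈¹? forbidden l st s) ⊎-dec (v ∈¹? forbidden l st s)

    module _ {l : List (V × V)} (lin : Linear l) {st : List (V × V)} (st-lin : Linear st) where

      private
        E : List (V × V)
        E = undirected l

      -- All degrees are at most two. So there are 2 vertices `x` and `y`, at most 4 step neighbours
      -- of these, at most 8 `l`-neighbours of the latter, and at most 8 step neighbours of the at
      -- most 4 `l`-neighbours of `x` and `y`: 2 + 4 + 8 + 8 = 22.
      length-forbidden : ∀ s → length (forbidden l st s) ≤ 22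
      length-forbidden (x , y) = begin
        length ((x ∷ y ∷ []) ++ near ++ concatMap (neighbours l) near ++ far)
          ≡⟨ cong (2 +_) (trans (length-++ near) (cong (length near +_) (length-++ (concatMap (neighbours l) near)))) ⟩
        2 + (length near + (length (concatMap (neighbours l) near) + length far))
          ≤⟨ +-monoʳ-≤ 2 (+-mono-≤ near≤ (+-mono-≤
              (≤-trans (length-concatMap-≤ (neighbours l) near (length-neighbours lin)) (*-monoˡ-≤ 2 near≤))
              (≤-trans (length-concatMap-≤ (neighbours st) (neighbours l x ++ neighbours l y) (length-neighbours st-lin))
                (*-monoˡ-≤ 2 {length (neighbours l x ++ neighbours l y)} {4} (two lin))))) ⟩
        22 ∎
        where
        open ≤-Reasoning
        near = neighbours st x ++ neighbours st y
        far = concatMap (neighbours st) (neighbours l x ++ neighbours l y)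
        two : ∀ {k} → Linear k → length (neighbours k x ++ neighbours k y) ≤ 4
        two {k} k-lin = ≤-trans (≤-reflexive (length-++ (neighbours k x)))
          (+-mono-≤ (length-neighbours k-lin x) (length-neighbours k-lin y))
        near≤ = two st-lin

      -- Each of the 22 forbidden vertices is the source of at most two directed edges and the
      -- target of at most two: 22 * 4 = 88.
      bad-count : ∀ s → ∑ E (λ e → 𝟙 (bad? l st s e)) ≤ 88
      bad-count s = begin
        ∑ E (λ e → 𝟙 (bad? l st s e))
          ≤⟨ ∑-mono E (λ {e} _ → bad-≤ e) ⟩
        ∑ E (λ e → ∑ F (λ z → 𝟙 (proj₁ e ≟ z) + 𝟙 (proj₂ e ≟ z)))
          ≡⟨ ∑-swap E F _ ⟩
        ∑ F (λ z → ∑ E (λ e → 𝟙 (proj₁ e ≟ z) + 𝟙 (proj₂ e ≟ z)))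
          ≤⟨ ∑-≤-const F 4 (λ {z} _ → ≤-trans (≤-reflexive (∑-+ E (λ e → 𝟙 (proj₁ e ≟ z)) (λ e → 𝟙 (proj₂ e ≟ z))))
              (+-mono-≤ (out-degree lin z) (in-degree lin z))) ⟩
        length F * 4
          ≤⟨ *-monoˡ-≤ 4 (length-forbidden s) ⟩
        88 ∎
        where
        open ≤-Reasoning
        F = forbidden l st s
        bad-≤ : ∀ e → 𝟙 (bad? l st s e) ≤ ∑ F (λ z → 𝟙 (proj₁ e ≟ z) + 𝟙 (proj₂ e ≟ z))
        bad-≤ e@(u , v) with bad? l st s e
        ... | no  _         = z≤n
        ... | yes (inj₁ u∈) = ≤-trans (≤-trans (≤-reflexive (sym (𝟙-yes (u ≟ u) refl))) (m≤m+n _ _))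
                (∑-∈ {g = λ z → 𝟙 (u ≟ z) + 𝟙 (v ≟ z)} u∈)
        ... | yes (inj₂ v∈) = ≤-trans (≤-trans (≤-reflexive (sym (𝟙-yes (v ≟ v) refl))) (m≤n+m _ _))
                (∑-∈ {g = λ z → 𝟙 (u ≟ z) + 𝟙 (v ≟ z)} v∈)

    -- For a step and an edge that is not `Bad` the four vertices are distinct, so the two
    -- transpositions commute and `(x , y)` goes to `(u , v)`.
    exchange : V × V → V × V → V → V
    exchange (x , y) (u , v) = swap _≟_ y v ∘ swap _≟_ x u

    exchange-injective : ∀ s e {z w} → exchange s e z ≡ exchange s e w → z ≡ w
    exchange-injective (x , y) (u , v) = swap-injective _≟_ x u ∘ swap-injective _≟_ y v

    map² : (V → V) → V × V → V × V
    map² π (c , d) = π c , π d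

    module _ {l : List (V × V)} (lin : Linear l) {st : List (V × V)} (st-lin : Linear st)
             {x y u v : V} (s∈ : (x , y) ∈ st) (e∈ : (u , v) ∈ undirected l)
             (good : ¬ Bad l st (x , y) (u , v)) where

      private
        π = exchange (x , y) (u , v)
        E = undirected l
        S̄ = undirected st
        near = neighbours st x ++ neighbours st y
        u∉ : u ∉ forbidden l st (x , y)
        u∉ = good ∘ inj₁
        v∉ : v ∉ forbidden l st (x , y)
        v∉ = good ∘ inj₂
        near∈ : ∀ {z} → z ∈ near → z ∈ forbidden l st (x , y)
        near∈ z∈ = there (there (∈-++⁺ˡ z∈))
        nearE∈ : ∀ {z w} → w ∈ near → (w , z) ∈ E → z ∈ forbidden l st (x , y)
        nearE∈ w∈ wz∈ = there (there (∈-++⁺ʳ near (∈-++⁺ˡ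
          (∈-concatMap⁺ (neighbours l) (lose w∈ (∈-neighbours l wz∈))))))
        far∈ : ∀ {z w} → w ∈ neighbours l x ++ neighbours l y → (w , z) ∈ S̄ → z ∈ forbidden l st (x , y)
        far∈ w∈ wz∈ = there (there (∈-++⁺ʳ near (∈-++⁺ʳ (concatMap (neighbours l) near)
          (∈-concatMap⁺ (neighbours st) (lose w∈ (∈-neighbours st wz∈))))))
        nearˣ : ∀ {z} → (x , z) ∈ S̄ → z ∈ near
        nearˣ = ∈-++⁺ˡ ∘ ∈-neighbours st
        nearʸ : ∀ {z} → (y , z) ∈ S̄ → z ∈ near
        nearʸ = ∈-++⁺ʳ (neighbours st x) ∘ ∈-neighbours st
        x≢y : x ≢ y
        x≢y = undirected-irrefl st-lin (∈-++⁺ˡ s∈)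
        u≢v : u ≢ v
        u≢v = undirected-irrefl lin e∈
        u≢y : u ≢ y
        u≢y refl = u∉ (there (here refl))
        v≢x : v ≢ x
        v≢x refl = v∉ (here refl)
        E-sym = undirected-sym l
        S-sym = undirected-sym st

      exchange-x : π x ≡ u
      exchange-x = trans (cong (swap _≟_ y v) (swap-left _≟_ x u)) (swap-fixes _≟_ u≢y u≢v)

      exchange-y : π y ≡ v
      exchange-y = trans (cong (swap _≟_ y v) (swap-fixes _≟_ (x≢y ∘ sym) (u≢y ∘ sym))) (swap-left _≟_ y v)

      private
        exchange-u : π u ≡ x
        exchange-u = trans (cong (swap _≟_ y v) (swap-right _≟_ x u)) (swap-fixes _≟_ x≢y (v≢x ∘ sym))
        exchange-v : π v ≡ y
        exchange-v = trans (cong (swap _≟_ y v) (swap-fixes _≟_ v≢x (u≢v ∘ sym))) (swap-right _≟_ y v)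

        exchange-fixes : ∀ {c} → c ≢ x → c ≢ y → c ≢ u → c ≢ v → π c ≡ c
        exchange-fixes c≢x c≢y c≢u c≢v =
          trans (cong (swap _≟_ y v) (swap-fixes _≟_ c≢x c≢u)) (swap-fixes _≟_ c≢y c≢v)

        data Place (c : V) : Set where
          isx : c ≡ x → Place c
          isy : c ≡ y → Place c
          isu : c ≡ u → Place c
          isv : c ≡ v → Place c

        place : ∀ {c} → Dec (c ≡ x) → Dec (c ≡ y) → Dec (c ≡ u) → Dec (c ≡ v) → Place c ⊎ π c ≡ c
        place (yes p) _       _       _       = inj₁ (isx p)
        place (no  _) (yes p) _       _       = inj₁ (isy p)
        place (no  _) (no  _) (yes p) _       = inj₁ (isu p)
        place (no  _) (no  _) (no  _) (yes p) = inj₁ (isv p)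
        place (no  a) (no  b) (no  c) (no  d) = inj₂ (exchange-fixes a b c d)

        place? : ∀ c → Place c ⊎ π c ≡ c
        place? c = place (c ≟ x) (c ≟ y) (c ≟ u) (c ≟ v)

        -- A step `(x , d)` with `d` unmoved becomes `(u , d)`, a hit only if `u` is an
        -- `l`-neighbour of a step neighbour of `x`. A step `(u , d)` becomes `(x , d)`, a hit only
        -- if `u` is a step neighbour of an `l`-neighbour of `x`. Both are forbidden, and likewise
        -- for `y` and `v`. If both ends move, one of `u`, `v` would be a step neighbour of `x` or
        -- `y`, again forbidden, unless the step joins `u` and `v` and is a hit already.
        half : ∀ {c d} → Place c → (c , d) ∈ S̄ → (c , d) ≢ (x , y) → (c , d) ≢ (y , x) →
               (π c , π d) ∈ E → (c , d) ∈ E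
        half {d = d} (isx refl) cd∈ ≢xy _ hit with place? d
        ... | inj₁ (isx refl) = contradiction refl (undirected-irrefl st-lin cd∈)
        ... | inj₁ (isy refl) = contradiction refl ≢xy
        ... | inj₁ (isu refl) = contradiction (near∈ (nearˣ cd∈)) u∉
        ... | inj₁ (isv refl) = contradiction (near∈ (nearˣ cd∈)) v∉
        ... | inj₂ πd = contradiction (nearE∈ (nearˣ cd∈) (E-sym (subst (_∈ E) (cong₂ _,_ exchange-x πd) hit))) u∉
        half {d = d} (isy refl) cd∈ _ ≢yx hit with place? d
        ... | inj₁ (isx refl) = contradiction refl ≢yx
        ... | inj₁ (isy refl) = contradiction refl (undirected-irrefl st-lin cd∈)
        ... | inj₁ (isu refl) = contradiction (near∈ (nearʸ cd∈)) u∉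
        ... | inj₁ (isv refl) = contradiction (near∈ (nearʸ cd∈)) v∉
        ... | inj₂ πd = contradiction (nearE∈ (nearʸ cd∈) (E-sym (subst (_∈ E) (cong₂ _,_ exchange-y πd) hit))) v∉
        half {d = d} (isu refl) cd∈ _ _ hit with place? d
        ... | inj₁ (isx refl) = contradiction (near∈ (nearˣ (S-sym cd∈))) u∉
        ... | inj₁ (isy refl) = contradiction (near∈ (nearʸ (S-sym cd∈))) u∉
        ... | inj₁ (isu refl) = contradiction refl (undirected-irrefl st-lin cd∈)
        ... | inj₁ (isv refl) = e∈
        ... | inj₂ πd = contradiction (far∈ (∈-++⁺ˡ (∈-neighbours l (subst (_∈ E) (cong₂ _,_ exchange-u πd) hit))) (S-sym cd∈)) u∉
        half {d = d} (isv refl) cd∈ _ _ hit with place? d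
        ... | inj₁ (isx refl) = contradiction (near∈ (nearˣ (S-sym cd∈))) v∉
        ... | inj₁ (isy refl) = contradiction (near∈ (nearʸ (S-sym cd∈))) v∉
        ... | inj₁ (isu refl) = E-sym e∈
        ... | inj₁ (isv refl) = contradiction refl (undirected-irrefl st-lin cd∈)
        ... | inj₂ πd = contradiction (far∈ (∈-++⁺ʳ (neighbours l x) (∈-neighbours l (subst (_∈ E) (cong₂ _,_ exchange-v πd) hit))) (S-sym cd∈)) v∉

      no-new-hit : ∀ {t} → t ∈ st → t ≢ (x , y) → map² π t ∈ E → t ∈ E
      no-new-hit {c , d} t∈ t≢s hit with place? c | place? d
      ... | inj₁ pc | _       = half pc (∈-++⁺ˡ t∈) t≢s t≢s′ hit
        where t≢s′ : (c , d) ≢ (y , x)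
              t≢s′ refl = Linear.asym st-lin s∈ t∈
      ... | inj₂ _  | inj₁ pd = E-sym (half pd (S-sym (∈-++⁺ˡ t∈)) (λ { refl → Linear.asym st-lin s∈ t∈ }) (λ { refl → t≢s refl }) (E-sym hit))
      ... | inj₂ πc | inj₂ πd = subst (_∈ E) (cong₂ _,_ πc πd) hit

    module _ {l : List (V × V)} (lin : Linear l) {p : List V} (l⊆p : ∀ {u v} → (u , v) ∈ l → u ∈ p × v ∈ p)
             (𝒬 : List (List V)) (𝒬! : Unique 𝒬)
             (steps : List V → List (V × V)) (L : ℕ)
             (steps-map : ∀ π q → steps (map π q) ≡ map (map² π) (steps q))
             (steps-linear : ∀ {q} → q ∈ 𝒬 → Linear (steps q))
             (steps⊆p : ∀ {q c d} → q ∈ 𝒬 → (c , d) ∈ steps q → c ∈ p × d ∈ p)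
             (length-steps : ∀ {q} → q ∈ 𝒬 → length (steps q) ≡ L)
             (closed : ∀ {q x y} → q ∈ 𝒬 → x ∈ p → y ∈ p → map (swap _≟_ x y) q ∈ 𝒬) where

      hits : List V → ℕ
      hits q = ∑ (steps q) (λ s → 𝟙 (s ∈²? undirected l))

      private
        E = undirected l

        E⊆p : ∀ {u v} → (u , v) ∈ E → u ∈ p × v ∈ p
        E⊆p uv∈ with ∈-++⁻ l uv∈
        ... | inj₁ uv∈l = l⊆p uv∈l
        ... | inj₂ uv∈l′ with ∈-map⁻ ×.swap uv∈l′
        ... | _ , vu∈l , refl = ×.swap (l⊆p vu∈l)

      module _ {q s e} (q∈ : q ∈ 𝒬) (s∈ : s ∈ steps q) (e∈ : e ∈ E)
               (good : ¬ Bad l (steps q) s e) where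

        private
          π = exchange s e

        exchange-closed : map π q ∈ 𝒬
        exchange-closed = subst (_∈ 𝒬) (sym (map-∘ q))
          (closed (closed q∈ (proj₁ (steps⊆p q∈ s∈)) (proj₁ (E⊆p e∈))) (proj₂ (steps⊆p q∈ s∈)) (proj₂ (E⊆p e∈)))

        exchange-hit : e ∈ steps (map π q)
        exchange-hit = subst₂ _∈_ (cong₂ _,_ (exchange-x lin (steps-linear q∈) s∈ e∈ good) (exchange-y lin (steps-linear q∈) s∈ e∈ good))
          (sym (steps-map π q)) (∈-map⁺ (map² π) s∈)

        -- Only the step `s` can turn into a hit. Hits at the other places may be lost, so there is
        -- no bound from below, and the families are cut out by `hits q ≤ i` instead of an equation.
        exchange-hits : hits (map π q) ≤ suc (hits q)
        exchange-hits = begin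
          ∑ (steps (map π q)) (λ t → 𝟙 (t ∈²? E))
            ≡⟨ cong (λ ts → ∑ ts (λ t → 𝟙 (t ∈²? E))) (steps-map π q) ⟩
          ∑ (map (map² π) (steps q)) (λ t → 𝟙 (t ∈²? E))
            ≡⟨ ∑-map (map² π) (steps q) _ ⟩
          ∑ (steps q) (λ t → 𝟙 (map² π t ∈²? E))
            ≤⟨ ∑-mono (steps q) (λ {t} t∈ → pointwise t t∈) ⟩
          ∑ (steps q) (λ t → 𝟙 (t ≟² s) + 𝟙 (t ∈²? E))
            ≡⟨ ∑-+ (steps q) (λ t → 𝟙 (t ≟² s)) (λ t → 𝟙 (t ∈²? E)) ⟩
          ∑ (steps q) (λ t → 𝟙 (t ≟² s)) + hits q
            ≤⟨ +-monoˡ-≤ (hits q) (∑-≟ _≟²_ s (Unique.map⁻ (Linear.sources! (steps-linear q∈)))) ⟩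
          suc (hits q) ∎
          where
          open ≤-Reasoning
          pointwise : ∀ t → t ∈ steps q → 𝟙 (map² π t ∈²? E) ≤ 𝟙 (t ≟² s) + 𝟙 (t ∈²? E)
          pointwise t t∈ with t ≟² s
          ... | yes _  = ≤-trans (𝟙≤1 (map² π t ∈²? E)) (m≤m+n 1 _)
          ... | no t≢s = 𝟙-mono (map² π t ∈²? E) (t ∈²? E) (no-new-hit lin (steps-linear q∈) s∈ e∈ good t∈ t≢s)

      private
        few : ℕ → List (List V)
        few i = filter (λ q → hits q ≤? i) 𝒬

        goods : List V → V × V → List (V × V)
        goods q s = filter (λ e → ¬? (bad? l (steps q) s e)) E

        hitSteps : List V → List (V × V)
        hitSteps q = filter (_∈²? E) (steps q)

        moves marks : ℕ → List (List V × (V × V) × (V × V))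
        moves i = triples (few i) steps goods
        marks i = triples (few i) hitSteps (λ _ _ → cartesianProduct p p)

        ∈-few : ∀ {i q} → q ∈ few i → q ∈ 𝒬 × hits q ≤ i
        ∈-few {i} = ∈-filter⁻ (λ q → hits q ≤? i)

        moves-unique : ∀ i → Unique (moves i)
        moves-unique i = triples-unique (few i) steps goods (filter⁺ (λ q → hits q ≤? i) 𝒬!)
          (λ q∈ → Unique.map⁻ (Linear.sources! (steps-linear (proj₁ (∈-few {i} q∈)))))
          (λ {q} s _ → filter⁺ (λ e → ¬? (bad? l (steps q) s e)) (undirected-unique lin))

        length-marks : ∀ i → length (marks i) ≡ ∑ (few i) hits * (length p * length p)
        length-marks i = begin
          length (marks i)
            ≡⟨ length-triples (few i) hitSteps (λ _ _ → cartesianProduct p p) ⟩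
          ∑ (few i) (λ q → ∑ (hitSteps q) (const (length (cartesianProduct p p))))
            ≡⟨ ∑-cong (few i) (λ {q} _ → trans (∑-const (hitSteps q) (length (cartesianProduct p p)))
                (cong₂ _*_ (length-filter (_∈²? E) (steps q)) (length-cartesianProduct p p))) ⟩
          ∑ (few i) (λ q → hits q * (length p * length p))
            ≡⟨ ∑-*ʳ (length p * length p) (few i) hits ⟩
          ∑ (few i) hits * (length p * length p) ∎
          where
          open ≡-Reasoning
          length-cartesianProduct : ∀ (xs ys : List V) → length (cartesianProduct xs ys) ≡ length xs * length ys
          length-cartesianProduct []       ys = refl
          length-cartesianProduct (x ∷ xs) ys =
            trans (length-++ (map (x ,_) ys)) (cong₂ _+_ (length-map (x ,_) ys) (length-cartesianProduct xs ys))

        switch : List V × (V × V) × (V × V) → List V × (V × V) × (V × V)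
        switch (q , s , e) = map (exchange s e) q , e , s

        -- The image of a move keeps both `s` and `e`, hence the permutation `exchange s e`, and
        -- this being injective the arrangement can be recovered.
        moves≤marks : ∀ i → length (moves i) ≤ length (marks (suc i))
        moves≤marks i = length-inj switch (moves-unique i)
          (λ {m} m∈ → let q∈i , s∈ , e∈g = ∈-triples⁻ (few i) steps goods m∈
                          q∈ , h≤i = ∈-few {i} q∈i
                          e∈ , good = ∈-filter⁻ (λ e → ¬? (bad? l (steps (proj₁ m)) (proj₁ (proj₂ m)) e)) e∈g
                          sp = steps⊆p q∈ s∈ in
            ∈-triples⁺ (few (suc i)) hitSteps (λ _ _ → cartesianProduct p p) (∈-filter⁺ (λ q → hits q ≤? suc i) (exchange-closed q∈ s∈ e∈ good)
                      (≤-trans (exchange-hits q∈ s∈ e∈ good) (s≤s h≤i)))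
                    (∈-filter⁺ (_∈²? E) (exchange-hit q∈ s∈ e∈ good) e∈)
                    (∈-cartesianProduct⁺ (proj₁ sp) (proj₂ sp)))
          (λ {m} {m′} _ _ → inj m m′)
          where
          inj : ∀ m m′ → switch m ≡ switch m′ → m ≡ m′
          inj (q , s , e) (q′ , s′ , e′) eq with cong (proj₁ ∘ proj₂) eq | cong (proj₂ ∘ proj₂) eq
          ... | refl | refl = cong (_, s , e) (map-injective (exchange-injective s e) (cong proj₁ eq))

        goods+88 : ∀ {q} s → q ∈ 𝒬 → length E ≤ length (goods q s) + 88
        goods+88 {q} s q∈ = begin
          length E
            ≡⟨ ∑-1 E ⟨
          ∑ E (const 1)
            ≤⟨ ∑-mono E (λ {e} _ → either e) ⟩
          ∑ E (λ e → 𝟙 (¬? (bad? l (steps q) s e)) + 𝟙 (bad? l (steps q) s e))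
            ≡⟨ ∑-+ E (λ e → 𝟙 (¬? (bad? l (steps q) s e))) (λ e → 𝟙 (bad? l (steps q) s e)) ⟩
          ∑ E (λ e → 𝟙 (¬? (bad? l (steps q) s e))) + ∑ E (λ e → 𝟙 (bad? l (steps q) s e))
            ≡⟨ cong (_+ ∑ E (λ e → 𝟙 (bad? l (steps q) s e))) (length-filter (λ e → ¬? (bad? l (steps q) s e)) E) ⟨
          length (goods q s) + ∑ E (λ e → 𝟙 (bad? l (steps q) s e))
            ≤⟨ +-monoʳ-≤ (length (goods q s)) (bad-count lin (steps-linear q∈) s) ⟩
          length (goods q s) + 88 ∎
          where
          open ≤-Reasoning
          either : ∀ e → 1 ≤ 𝟙 (¬? (bad? l (steps q) s e)) + 𝟙 (bad? l (steps q) s e)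
          either e with bad? l (steps q) s e
          ... | yes _ = s≤s z≤n
          ... | no  _ = s≤s z≤n

      -- Each arrangement with at most i hits offers L * length E moves, all but 88 L of which lead, injectively,
      -- to an arrangement with at most suc i hits one of which is marked, together with a pair of displaced vertices.
      switching : ∀ i → let few = λ j → filter (λ q → hits q ≤? j) 𝒬 in
        length (few i) * (L * length (undirected l)) ≤
        ∑ (few (suc i)) hits * (length p * length p) + length (few i) * (L * 88)
      switching i = begin
        length (few i) * (L * length E)
          ≡⟨ ∑-const (few i) (L * length E) ⟨
        ∑ (few i) (const (L * length E))
          ≤⟨ ∑-mono (few i) (λ {q} q∈ → perArrangement (proj₁ (∈-few {i} q∈))) ⟩
        ∑ (few i) (λ q → ∑ (steps q) (λ s → length (goods q s)) + L * 88)
          ≡⟨ ∑-+ (few i) _ _ ⟩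
        ∑ (few i) (λ q → ∑ (steps q) (λ s → length (goods q s))) + ∑ (few i) (const (L * 88))
          ≡⟨ cong₂ _+_ (sym (length-triples (few i) steps goods)) (∑-const (few i) (L * 88)) ⟩
        length (moves i) + length (few i) * (L * 88)
          ≤⟨ +-monoˡ-≤ _ (≤-trans (moves≤marks i) (≤-reflexive (length-marks (suc i)))) ⟩
        ∑ (few (suc i)) hits * (length p * length p) + length (few i) * (L * 88) ∎
        where
        open ≤-Reasoning
        perArrangement : ∀ {q} → q ∈ 𝒬 → L * length E ≤ ∑ (steps q) (λ s → length (goods q s)) + L * 88
        perArrangement {q} q∈ = begin
          L * length E
            ≡⟨ cong (_* length E) (length-steps q∈) ⟨
          length (steps q) * length E
            ≡⟨ ∑-const (steps q) (length E) ⟨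
          ∑ (steps q) (const (length E))
            ≤⟨ ∑-mono (steps q) (λ {s} _ → goods+88 s q∈) ⟩
          ∑ (steps q) (λ s → length (goods q s) + 88)
            ≡⟨ ∑-+ (steps q) (λ s → length (goods q s)) (const 88) ⟩
          ∑ (steps q) (λ s → length (goods q s)) + ∑ (steps q) (const 88)
            ≡⟨ cong (∑ (steps q) (λ s → length (goods q s)) +_) (trans (∑-const (steps q) 88) (cong (_* 88) (length-steps q∈))) ⟩
          ∑ (steps q) (λ s → length (goods q s)) + L * 88 ∎

-- Arrangements with prescribed entries

module Planting where

  open Counting
  open Arrangements
  open Swapping
  open Switching
  import Data.List.Membership.DecPropositional as DecMembership
  open import Data.List.Membership.Propositional.Properties
  open import Data.List.Relation.Unary.Unique.Propositional.Properties as Unique using (filter⁺; map⁺; Unique[x∷xs]⇒x∉xs)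
  open import Data.Nat.Base
  open import Data.Nat.Properties hiding (_≟_)

  -- A template prescribes the entries of a list at some of its positions.
  Template : Set → Set
  Template V = List (Maybe V)

  private
    variable
      V : Set
      x y v : V
      τ : Template V
      q q′ : List V

  data Agree {V : Set} : Template V → List V → Set where
    []    : Agree [] []
    fixed : Agree τ q → Agree (just v ∷ τ) (v ∷ q)
    free  : Agree τ q → Agree (nothing ∷ τ) (x ∷ q)

  fixedOf : Template V → List V
  fixedOf = catMaybes

  freeOf : Template V → List V → List V
  freeOf (just _  ∷ τ) (_ ∷ q) = freeOf τ q
  freeOf (nothing ∷ τ) (x ∷ q) = x ∷ freeOf τ q
  freeOf _             _       = []

  -- The consecutive pairs of entries neither of which is prescribed.
  steps : Template V → List V → List (V × V)
  steps (nothing ∷ τ@(nothing ∷ _)) (x ∷ q@(y ∷ _)) = (x , y) ∷ steps τ q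
  steps (_ ∷ τ)                     (_ ∷ q)         = steps τ q
  steps _                           _               = []

  pairs : List V → List (V × V)
  pairs (x ∷ q@(y ∷ _)) = (x , y) ∷ pairs q
  pairs _               = []

  stepCount : Template V → ℕ
  stepCount (nothing ∷ τ@(nothing ∷ _)) = suc (stepCount τ)
  stepCount (_ ∷ τ)                     = stepCount τ
  stepCount []                          = 0

  agree? : DecidableEquality V → ∀ τ q → Dec (Agree {V} τ q)
  agree? _≟_ []            []      = yes []
  agree? _≟_ []            (_ ∷ _) = no λ ()
  agree? _≟_ (_ ∷ _)       []      = no λ ()
  agree? _≟_ (nothing ∷ τ) (x ∷ q) = map′ free (λ { (free a) → a }) (agree? _≟_ τ q)
  agree? _≟_ (just v ∷ τ)  (x ∷ q) with v ≟ x
  ... | yes refl = map′ fixed (λ { (fixed a) → a }) (agree? _≟_ τ q)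
  ... | no  v≢x  = no λ { (fixed _) → v≢x refl }

  fixedOf⊆ : Agree τ q → v ∈ fixedOf τ → v ∈ q
  fixedOf⊆ (fixed a) (here refl) = here refl
  fixedOf⊆ (fixed a) (there v∈)  = there (fixedOf⊆ a v∈)
  fixedOf⊆ (free  a) v∈          = there (fixedOf⊆ a v∈)

  freeOf⊆ : Agree τ q → v ∈ freeOf τ q → v ∈ q
  freeOf⊆ (fixed a) v∈          = there (freeOf⊆ a v∈)
  freeOf⊆ (free  a) (here refl) = here refl
  freeOf⊆ (free  a) (there v∈)  = there (freeOf⊆ a v∈)

  fixed-or-free : Agree τ q → v ∈ q → v ∈ fixedOf τ ⊎ v ∈ freeOf τ q
  fixed-or-free (fixed a) (here refl) = inj₁ (here refl)
  fixed-or-free (fixed a) (there v∈)  = Sum.map₁ there (fixed-or-free a v∈)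
  fixed-or-free (free  a) (here refl) = inj₂ (here refl)
  fixed-or-free (free  a) (there v∈)  = Sum.map₂ there (fixed-or-free a v∈)

  fixed-not-free : Agree τ q → Unique q → v ∈ fixedOf τ → v ∉ freeOf τ q
  fixed-not-free (fixed a) q!@(_ ∷ _)   (here refl) v∈′          = Unique[x∷xs]⇒x∉xs q! (freeOf⊆ a v∈′)
  fixed-not-free (fixed a) (_ ∷ q!)     (there v∈)  v∈′          = fixed-not-free a q! v∈ v∈′
  fixed-not-free (free  a) q!@(_ ∷ _)   v∈          (here refl)  = Unique[x∷xs]⇒x∉xs q! (fixedOf⊆ a v∈)
  fixed-not-free (free  a) (_ ∷ q!)     v∈          (there v∈′)  = fixed-not-free a q! v∈ v∈′

  freeOf-unique : Agree τ q → Unique q → Unique (freeOf τ q)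
  freeOf-unique []        _         = []
  freeOf-unique (fixed a) (_ ∷ q!)  = freeOf-unique a q!
  freeOf-unique (free  a) (x# ∷ q!) = All.tabulate (λ v∈ → All.lookup x# (freeOf⊆ a v∈)) ∷ freeOf-unique a q!

  length-freeOf : Agree τ q → length (freeOf τ q) + length (fixedOf τ) ≡ length q
  length-freeOf []                  = refl
  length-freeOf (fixed {τ} {q} a)   = trans (+-suc (length (freeOf τ q)) (length (fixedOf τ))) (cong suc (length-freeOf a))
  length-freeOf (free a)            = cong suc (length-freeOf a)

  freeOf-injective : Agree τ q → Agree τ q′ → freeOf τ q ≡ freeOf τ q′ → q ≡ q′
  freeOf-injective []        []         _  = refl
  freeOf-injective (fixed a) (fixed a′) eq = cong (_ ∷_) (freeOf-injective a a′ eq)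
  freeOf-injective (free a)  (free a′)  eq = cong₂ _∷_ (∷-injectiveˡ eq) (freeOf-injective a a′ (∷-injectiveʳ eq))

  Agree-length : Agree τ q → length τ ≡ length q
  Agree-length []        = refl
  Agree-length (fixed a) = cong suc (Agree-length a)
  Agree-length (free a)  = cong suc (Agree-length a)

  Agree-map : ∀ {π} → Agree τ q → (∀ {v} → v ∈ fixedOf τ → π v ≡ v) → Agree τ (map π q)
  Agree-map []        _   = []
  Agree-map {τ = just v ∷ τ} {q = _ ∷ q} {π} (fixed a) fix =
    subst (λ w → Agree (just v ∷ τ) (w ∷ map π q)) (sym (fix (here refl))) (fixed (Agree-map a (fix ∘ there)))
  Agree-map (free a)  fix = free (Agree-map a fix)

  steps-map : ∀ (π : V → V) τ q → steps τ (map π q) ≡ map (λ (c , d) → π c , π d) (steps τ q)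
  steps-map π []                      q           = refl
  steps-map π τ@(_ ∷ _)               []          = steps-[] τ
    where
    steps-[] : ∀ τ → steps τ [] ≡ map (λ (c , d) → π c , π d) (steps τ [])
    steps-[] []                      = refl
    steps-[] (just _ ∷ _)            = refl
    steps-[] (nothing ∷ [])          = refl
    steps-[] (nothing ∷ just _ ∷ _)  = refl
    steps-[] (nothing ∷ nothing ∷ _) = refl
  steps-map π (just _ ∷ τ)            (x ∷ q)     = steps-map π τ q
  steps-map π (nothing ∷ [])          (x ∷ q)     = refl
  steps-map π (nothing ∷ just v ∷ τ)  (x ∷ q)     = steps-map π (just v ∷ τ) q
  steps-map π (nothing ∷ nothing ∷ τ) (x ∷ [])    = steps-map π (nothing ∷ τ) []
  steps-map π (nothing ∷ nothing ∷ τ) (x ∷ y ∷ q) = cong (_ ∷_) (steps-map π (nothing ∷ τ) (y ∷ q))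

  length-steps : Agree τ q → length (steps τ q) ≡ stepCount τ
  length-steps []               = refl
  length-steps (fixed a)        = length-steps a
  length-steps (free [])        = refl
  length-steps (free a@(fixed _)) = length-steps a
  length-steps (free (free a))  = cong suc (length-steps (free a))

  private
    double : ∀ a b → 2 + (a + 2 * b) ≡ a + 2 * suc b
    double a b = trans (sym (trans (+-suc a _) (cong suc (+-suc a _)))) (cong (a +_) (sym (*-suc 2 b)))

  -- A list has one pair of consecutive positions fewer than positions, and each prescribed entry
  -- spoils at most the two pairs that contain it.
  stepCount-bound : ∀ (τ : Template V) → length τ ≤ suc (stepCount τ + 2 * length (fixedOf τ))
  stepCount-bound []                      = z≤n
  stepCount-bound (just v ∷ τ)            = begin
    suc (length τ)                                         ≤⟨ s≤s (stepCount-bound τ) ⟩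
    2 + (stepCount τ + 2 * length (fixedOf τ))             ≤⟨ n≤1+n _ ⟩
    3 + (stepCount τ + 2 * length (fixedOf τ))             ≡⟨ cong suc (double (stepCount τ) (length (fixedOf τ))) ⟩
    suc (stepCount τ + 2 * suc (length (fixedOf τ)))       ∎
    where open ≤-Reasoning
  stepCount-bound (nothing ∷ [])          = s≤s z≤n
  stepCount-bound (nothing ∷ just v ∷ τ)  = begin
    2 + length τ                                           ≤⟨ s≤s (s≤s (stepCount-bound τ)) ⟩
    3 + (stepCount τ + 2 * length (fixedOf τ))             ≡⟨ cong suc (double (stepCount τ) (length (fixedOf τ))) ⟩
    suc (stepCount τ + 2 * suc (length (fixedOf τ)))       ∎
    where open ≤-Reasoning
  stepCount-bound (nothing ∷ nothing ∷ τ) = s≤s (stepCount-bound (nothing ∷ τ))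

  steps⊆free : Agree τ q → (x , y) ∈ steps τ q → x ∈ freeOf τ q × y ∈ freeOf τ q
  steps⊆free (fixed a)        s∈          = steps⊆free a s∈
  steps⊆free (free a@(fixed _)) s∈        = ×.map there there (steps⊆free a s∈)
  steps⊆free (free (free a))  (here refl) = here refl , there (here refl)
  steps⊆free (free (free a))  (there s∈)  = ×.map there there (steps⊆free (free a) s∈)

  pairs-∷ : ∀ {V : Set} {q : List V} {s z} → s ∈ pairs q → s ∈ pairs (z ∷ q)
  pairs-∷ {q = _ ∷ _} = there

  steps⊆pairs : ∀ {V : Set} {τ : Template V} {q x y} → Agree τ q → (x , y) ∈ steps τ q → (x , y) ∈ pairs q
  steps⊆pairs (fixed a)        s∈          = pairs-∷ (steps⊆pairs a s∈)
  steps⊆pairs (free a@(fixed _)) s∈        = there (steps⊆pairs a s∈)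
  steps⊆pairs (free (free a))  (here refl) = here refl
  steps⊆pairs (free (free a))  (there s∈)  = there (steps⊆pairs (free a) s∈)

  pairs-source : ∀ {V : Set} {q : List V} {x y} → (x , y) ∈ pairs q → x ∈ q
  pairs-source {q = _ ∷ _ ∷ _} (here refl) = here refl
  pairs-source {q = _ ∷ _ ∷ _} (there s∈)  = there (pairs-source s∈)

  pairs-target : ∀ {V : Set} {q : List V} {x y z} → (x , y) ∈ pairs (z ∷ q) → y ∈ q
  pairs-target {q = _ ∷ _} (here refl) = here refl
  pairs-target {q = _ ∷ _} (there s∈)  = there (pairs-target s∈)

  steps-linear : Agree τ q → Unique q → Linear (steps τ q)
  steps-linear []        _         = record { sources! = [] ; targets! = [] ; asym = λ () }
  steps-linear (fixed a) (_ ∷ q!)  = steps-linear a q!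
  steps-linear (free []) _         = record { sources! = [] ; targets! = [] ; asym = λ () }
  steps-linear (free (fixed a)) (_ ∷ q!) = steps-linear (fixed a) q!
  steps-linear (free {x = x} a@(free {τ = τ} {q = q} {x = y} b)) (x# ∷ q!) = record
    { sources! = All.tabulate (λ v∈ → All.lookup x# (source v∈)) ∷ sources!
    ; targets! = All.tabulate (λ v∈ → All.lookup (AllPairs.head q!) (target v∈)) ∷ targets!
    ; asym     = λ { (here refl) (here eq)   → All.lookup x# (here refl) (sym (cong proj₁ eq))
                   ; (here refl) (there vu∈) → All.lookup x# (there (pairs-target (steps⊆pairs a vu∈))) refl
                   ; (there uv∈) (here refl) → All.lookup x# (there (pairs-target (steps⊆pairs a uv∈))) refl
                   ; (there uv∈) (there vu∈) → asym uv∈ vu∈ }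
    }
    where
    open Linear (steps-linear a q!)
    source : ∀ {v} → v ∈ map proj₁ (steps (nothing ∷ τ) (y ∷ q)) → v ∈ y ∷ q
    source v∈ with ∈-map⁻ proj₁ v∈
    ... | _ , s∈ , refl = pairs-source (steps⊆pairs a s∈)
    target : ∀ {v} → v ∈ map proj₂ (steps (nothing ∷ τ) (y ∷ q)) → v ∈ q
    target v∈ with ∈-map⁻ proj₂ v∈
    ... | _ , s∈ , refl = pairs-target (steps⊆pairs a s∈)

  module _ {V : Set} (_≟_ : DecidableEquality V) {vs : List V} (vs! : Unique vs) where

    hamiltonian : List (List V)
    hamiltonian = arrangements _≟_ (length vs) vs

    private
      n = length vs

      ∈-hamiltonian⁻ : ∀ {q} → q ∈ hamiltonian → Unique q × (∀ {v} → v ∈ q → v ∈ vs) × length q ≡ n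
      ∈-hamiltonian⁻ = ∈-arrangements⁻ _≟_ n

      covers : ∀ {q} → q ∈ hamiltonian → ∀ {v} → v ∈ vs → v ∈ q
      covers q∈ = let q! , q⊆ , len = ∈-hamiltonian⁻ q∈ in Unique-⊆⇒⊇ _≟_ vs! q! len q⊆

    planted : Template V → List (List V)
    planted τ = filter (agree? _≟_ τ) hamiltonian

    module _ {τ : Template V} {q₀ : List V} (q₀∈ : q₀ ∈ hamiltonian) (a₀ : Agree τ q₀) where

      private
        -- All members of `planted τ` have the same set of free vertices, the complement of
        -- `fixedOf τ`; the witness `q₀` provides it as a list.
        p = freeOf τ q₀
        t = length (fixedOf τ)

        q₀! : Unique q₀
        q₀! = proj₁ (∈-hamiltonian⁻ q₀∈)

        |p|+t : length p + t ≡ n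
        |p|+t = trans (length-freeOf a₀) (proj₂ (proj₂ (∈-hamiltonian⁻ q₀∈)))

        |p| : length p ≡ n ∸ t
        |p| = trans (sym (m+n∸n≡m (length p) t)) (cong (_∸ t) |p|+t)

        p! : Unique p
        p! = freeOf-unique a₀ q₀!

        p⊆vs : ∀ {v} → v ∈ p → v ∈ vs
        p⊆vs v∈ = proj₁ (proj₂ (∈-hamiltonian⁻ q₀∈)) (freeOf⊆ a₀ v∈)

        free-⊆ : ∀ {q} → q ∈ planted τ → ∀ {v} → v ∈ freeOf τ q → v ∈ p
        free-⊆ q∈ v∈ with ∈-filter⁻ (agree? _≟_ τ) q∈
        ... | q∈ , a with ∈-hamiltonian⁻ q∈
        ... | q! , q⊆ , _ with fixed-or-free a₀ (covers q₀∈ (q⊆ (freeOf⊆ a v∈)))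
        ... | inj₁ fix = contradiction v∈ (fixed-not-free a q! fix)
        ... | inj₂ fr  = fr

      private
        planted-length′ : length (planted τ) ≤ length p !
        planted-length′ = ≤-trans
          (length-inj (freeOf τ) (filter⁺ (agree? _≟_ τ) (arrangements-unique _≟_ n vs!))
            (λ {q} q∈ → let q∈h , a = ∈-filter⁻ (agree? _≟_ τ) q∈
                            q! , _ , len = ∈-hamiltonian⁻ q∈h in
              subst (λ k → freeOf τ q ∈ arrangements _≟_ k p)
                (+-cancelʳ-≡ t _ _ (trans (length-freeOf a) (trans len (sym |p|+t))))
                (∈-arrangements⁺ _≟_ (freeOf-unique a q!) (free-⊆ q∈)))
            (λ q∈ q′∈ → freeOf-injective (proj₂ (∈-filter⁻ (agree? _≟_ τ) {xs = hamiltonian} q∈))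
                                         (proj₂ (∈-filter⁻ (agree? _≟_ τ) {xs = hamiltonian} q′∈))))
          (≤-reflexive (length-arrangements _≟_ p!))

      planted-length : length (planted τ) ≤ (n ∸ t) !
      planted-length = subst (λ k → length (planted τ) ≤ k !) |p| planted-length′

      module _ {P : List V} (P∈ : P ∈ hamiltonian) where

        open DecMembership _≟_ using (_∈?_)

        private
          P! : Unique P
          P! = proj₁ (∈-hamiltonian⁻ P∈)

          -- Prescribes exactly the vertices outside `p`, so that `steps (mask q) q` are the steps
          -- of `q` with both ends in `p`. Applied to `P` it yields the edges that an exchange
          -- inside `planted τ` is able to create.
          mask : List V → Template V
          mask = map (λ z → mask₁ (z ∈? p))
            where
            mask₁ : ∀ {z} → Dec (z ∈ p) → Maybe V
            mask₁     (yes _) = nothing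
            mask₁ {z} (no  _) = just z

          agree-mask : ∀ q → Agree (mask q) q
          agree-mask []      = []
          agree-mask (z ∷ q) with z ∈? p
          ... | yes _ = free (agree-mask q)
          ... | no  _ = fixed (agree-mask q)

          free-mask⁻ : ∀ q {v} → v ∈ freeOf (mask q) q → v ∈ p
          free-mask⁻ (z ∷ q) v∈ with z ∈? p
          free-mask⁻ (z ∷ q) (here refl) | yes z∈ = z∈
          free-mask⁻ (z ∷ q) (there v∈)  | yes _  = free-mask⁻ q v∈
          free-mask⁻ (z ∷ q) v∈          | no  _  = free-mask⁻ q v∈

          fixed-mask⁻ : ∀ q {v} → v ∈ fixedOf (mask q) → v ∉ p
          fixed-mask⁻ (z ∷ q) v∈ with z ∈? p
          fixed-mask⁻ (z ∷ q) v∈          | yes _  = fixed-mask⁻ q v∈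
          fixed-mask⁻ (z ∷ q) (here refl) | no  z∉ = z∉
          fixed-mask⁻ (z ∷ q) (there v∈)  | no  _  = fixed-mask⁻ q v∈

          l = steps (mask P) P

          fixed≤t : length (fixedOf (mask P)) ≤ t
          fixed≤t = +-cancelˡ-≤ (length p) _ _ (begin
            length p + length (fixedOf (mask P))
              ≤⟨ +-monoˡ-≤ _ (Unique-⊆⇒length-≤ _≟_ p! λ v∈ → free-in v∈) ⟩
            length (freeOf (mask P) P) + length (fixedOf (mask P))
              ≡⟨ length-freeOf (agree-mask P) ⟩
            length P
              ≡⟨ proj₂ (proj₂ (∈-hamiltonian⁻ P∈)) ⟩
            n
              ≡⟨ |p|+t ⟨
            length p + t ∎)
            where
            open ≤-Reasoning
            free-in : ∀ {v} → v ∈ p → v ∈ freeOf (mask P) P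
            free-in v∈ with fixed-or-free (agree-mask P) (covers P∈ (p⊆vs v∈))
            ... | inj₁ fix = contradiction v∈ (fixed-mask⁻ P fix)
            ... | inj₂ fr  = fr

        freeHits : List V → ℕ
        freeHits q = ∑ (steps τ q) (λ s → 𝟙 (DecMembership._∈?_ (_≟²_ _≟_) s (undirected l)))

        atMost : ℕ → List (List V)
        atMost i = filter (λ q → freeHits q ≤? i) (planted τ)

        private
          closed : ∀ {q x y} → q ∈ planted τ → x ∈ p → y ∈ p → map (swap _≟_ x y) q ∈ planted τ
          closed {q} {x} {y} q∈ x∈ y∈ with ∈-filter⁻ (agree? _≟_ τ) q∈
          ... | q∈h , a with ∈-hamiltonian⁻ q∈h
          ... | q! , q⊆ , len = ∈-filter⁺ (agree? _≟_ τ)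
            (subst (λ k → map π q ∈ arrangements _≟_ k vs) (trans (length-map π q) len)
              (∈-arrangements⁺ _≟_ (map⁺ (swap-injective _≟_ x y) q!) λ v∈ →
                let u , u∈ , eq = ∈-map⁻ π v∈ in subst (_∈ vs) (sym eq) (π∈ u (q⊆ u∈))))
            (Agree-map a λ v∈ → swap-fixes _≟_ (λ { refl → fixed-not-free a₀ q₀! v∈ x∈ }) (λ { refl → fixed-not-free a₀ q₀! v∈ y∈ }))
            where
            π = swap _≟_ x y
            π∈ : ∀ u → u ∈ vs → π u ∈ vs
            π∈ u u∈ with u ≟ x | u ≟ y
            ... | yes _ | _     = p⊆vs y∈
            ... | no  _ | yes _ = p⊆vs x∈
            ... | no  _ | no  _ = u∈

          enough : ∀ {σ : Template V} {q} → Agree σ q → length q ≡ n → length (fixedOf σ) ≤ t → n ≤ suc (length (steps σ q) + 2 * t)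
          enough {σ} {q} a len fix≤ = begin
            n                                           ≡⟨ trans (Agree-length a) len ⟨
            length σ                                    ≤⟨ stepCount-bound σ ⟩
            suc (stepCount σ + 2 * length (fixedOf σ))  ≤⟨ s≤s (+-mono-≤ (≤-reflexive (sym (length-steps a))) (*-monoʳ-≤ 2 fix≤)) ⟩
            suc (length (steps σ q) + 2 * t)            ∎
            where open ≤-Reasoning

        -- The 45 leaves room for the 88 bad choices of a directed edge.
        planted-switching : ∀ d → d + (45 + 2 * t) ≤ n → ∀ i →
          length (atMost i) * (2 * (d * d)) ≤ ∑ (atMost (suc i)) freeHits * (n * n)
        planted-switching d d≤ i = +-cancelʳ-≤ (length (atMost i) * (L * 88)) _ _ (begin
          length (atMost i) * (2 * (d * d)) + length (atMost i) * (L * 88)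
            ≡⟨ *-distribˡ-+ (length (atMost i)) (2 * (d * d)) (L * 88) ⟨
          length (atMost i) * (2 * (d * d) + L * 88)
            ≤⟨ *-monoʳ-≤ (length (atMost i)) room ⟩
          length (atMost i) * (L * length (undirected l))
            ≤⟨ switching _≟_ (steps-linear (agree-mask P) P!)
                (λ uv∈ → ×.map (free-mask⁻ P) (free-mask⁻ P) (steps⊆free (agree-mask P) uv∈))
                (planted τ) (filter⁺ (agree? _≟_ τ) (arrangements-unique _≟_ n vs!))
                (steps τ) L (λ π → steps-map π τ)
                (λ q∈ → let q∈h , a = ∈-filter⁻ (agree? _≟_ τ) q∈ in steps-linear a (proj₁ (∈-hamiltonian⁻ q∈h)))
                (λ q∈ s∈ → ×.map (free-⊆ q∈) (free-⊆ q∈) (steps⊆free (proj₂ (∈-filter⁻ (agree? _≟_ τ) {xs = hamiltonian} q∈)) s∈))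
                (λ q∈ → length-steps (proj₂ (∈-filter⁻ (agree? _≟_ τ) {xs = hamiltonian} q∈)))
                closed i ⟩
          ∑ (atMost (suc i)) freeHits * (length p * length p) + length (atMost i) * (L * 88)
            ≤⟨ +-monoˡ-≤ _ (*-monoʳ-≤ (∑ (atMost (suc i)) freeHits) (*-mono-≤ |p|≤n |p|≤n)) ⟩
          ∑ (atMost (suc i)) freeHits * (n * n) + length (atMost i) * (L * 88) ∎)
          where
          open ≤-Reasoning
          L = stepCount τ
          |p|≤n : length p ≤ n
          |p|≤n = ≤-trans (m≤m+n (length p) t) (≤-reflexive |p|+t)
          -- 45 = 44 + 1. Here 44 is half of the 88 bad directed edges, each edge of `l` being
          -- available in two directions, and 1 makes up for `n` entries having only `n - 1`
          -- consecutive pairs. Used for `τ` and for `mask P`, it leaves `L ≥ d` steps with `2 * d`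
          -- good edges each.
          d+44≤ : ∀ {σ : Template V} {q} → Agree σ q → length q ≡ n → length (fixedOf σ) ≤ t → d + 44 ≤ length (steps σ q)
          d+44≤ {σ} {q} a len fix≤ = +-cancelʳ-≤ (2 * t) _ _ (s≤s⁻¹ (begin
            suc (d + 44 + 2 * t)             ≡⟨ trans (cong suc (+-assoc d 44 (2 * t))) (sym (+-suc d (44 + 2 * t))) ⟩
            d + (45 + 2 * t)                 ≤⟨ d≤ ⟩
            n                                ≤⟨ enough a len fix≤ ⟩
            suc (length (steps σ q) + 2 * t) ∎))
          d+44≤L : d + 44 ≤ L
          d+44≤L = ≤-trans (d+44≤ a₀ (proj₂ (proj₂ (∈-hamiltonian⁻ q₀∈))) ≤-refl) (≤-reflexive (length-steps a₀))
          room : 2 * (d * d) + L * 88 ≤ L * length (undirected l)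
          room = begin
            2 * (d * d) + L * 88                ≤⟨ +-monoˡ-≤ (L * 88) (≤-trans (≤-reflexive (sym (*-assoc 2 d d)))
                                                    (≤-trans (≤-reflexive (*-comm (2 * d) d)) (*-monoˡ-≤ (2 * d) (≤-trans (m≤m+n d 44) d+44≤L)))) ⟩
            L * (2 * d) + L * 88                ≡⟨ *-distribˡ-+ L (2 * d) 88 ⟨
            L * (2 * d + 88)                    ≡⟨ cong (L *_) (*-distribˡ-+ 2 d 44) ⟨
            L * (2 * (d + 44))                  ≤⟨ *-monoʳ-≤ L (*-monoʳ-≤ 2 (d+44≤ (agree-mask P) (proj₂ (proj₂ (∈-hamiltonian⁻ P∈))) fixed≤t)) ⟩
            L * (2 * length l)                  ≡⟨ cong (L *_) (trans (length-++ l) (cong (length l +_) (trans (length-map ×.swap l) (sym (+-identityʳ (length l)))))) ⟨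
            L * length (undirected l)           ∎

        freeHits-avoiding : ∀ {q} → All (_∉ undirected (pairs P)) (steps τ q) → freeHits q ≡ 0
        freeHits-avoiding {q} avoid = trans (∑-cong (steps τ q) λ {s} s∈ → 𝟙-no (DecMembership._∈?_ (_≟²_ _≟_) s (undirected l))
          (λ s∈l → All.lookup avoid s∈ (⊆-undirected s∈l))) (∑-0 (steps τ q))
          where
          ⊆-undirected : ∀ {s} → s ∈ undirected l → s ∈ undirected (pairs P)
          ⊆-undirected s∈ with ∈-++⁻ l s∈
          ... | inj₁ s∈l = ∈-++⁺ˡ (steps⊆pairs (agree-mask P) s∈l)
          ... | inj₂ s∈l′ with ∈-map⁻ ×.swap s∈l′
          ... | _ , s∈l , refl = ∈-++⁺ʳ (pairs P) (∈-map⁺ ×.swap (steps⊆pairs (agree-mask P) s∈l))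

-- How many orderings sort a given list of edges

module Orderings where

  open import Defs
  open Counting
  open Swapping
  import Data.Fin.Properties as Fin
  open import Data.List.Membership.Propositional.Properties using (∈-map⁻)
  import Data.List.Relation.Unary.All.Properties as All
  import Data.List.Relation.Unary.AllPairs.Properties as AllPairs
  import Data.List.Relation.Unary.Unique.DecPropositional as DecUnique
  open import Data.List.Relation.Unary.Unique.Propositional.Properties using (Unique[x∷xs]⇒x∉xs)
  open import Data.Nat.Base
  open import Data.Nat.Properties
  open import Function.Construct.Composition using (_↔-∘_; _⤖-∘_)
  open import Function.Construct.Identity using (↔-id)
  open import Function.Properties.Inverse using (↔⇒⤖; ↔-sym)

  module _ {V : Set} (_≟_ : DecidableEquality V) where

    -- The bijection has to extend to all of `V`, because orderings of all edges are going to be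
    -- relabelled by it; transpositions give the extension for free.
    match : ∀ {xs ys : List V} → Unique xs → Unique ys → length xs ≡ length ys →
            ∃ λ (σ : V ↔ V) → map (Inverse.to σ) xs ≡ ys
    match {[]}     {[]}     _          _          _   = ↔-id _ , refl
    match {x ∷ xs} {y ∷ ys} (x# ∷ xs!) (y# ∷ ys!) len with match xs! ys! (suc-injective len)
    ... | σ , refl = swap-↔ _≟_ (to x) y ↔-∘ σ ,
                     cong₂ _∷_ (swap-left _≟_ (to x) y) (trans (map-∘ xs) (map-swap-fixes _≟_ σx∉ y∉))
      where
      open Inverse σ using (to; from; strictlyInverseʳ)
      σx∉ : to x ∉ map to xs
      σx∉ σx∈ with ∈-map⁻ to σx∈
      ... | z , z∈ , eq = All.lookup x# z∈ (trans (sym (strictlyInverseʳ x)) (trans (cong from eq) (strictlyInverseʳ z)))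
      y∉ : y ∉ map to xs
      y∉ = Unique[x∷xs]⇒x∉xs (y# ∷ ys!)

  insertions : {A : Set} → A → List A → List (List A)
  insertions z []       = (z ∷ []) ∷ []
  insertions z (a ∷ as) = (z ∷ a ∷ as) ∷ map (a ∷_) (insertions z as)

  length-insertions : ∀ {A : Set} (z : A) as → length (insertions z as) ≡ suc (length as)
  length-insertions z []       = refl
  length-insertions z (a ∷ as) = cong suc (trans (length-map (a ∷_) (insertions z as)) (length-insertions z as))

  insertion-All : ∀ {A : Set} {P : A → Set} {z as zs} → zs ∈ insertions z as → P z → All P as → All P zs
  insertion-All {as = []}     (here refl) pz _          = pz ∷ []
  insertion-All {as = a ∷ as} (here refl) pz pas        = pz ∷ pas
  insertion-All {as = a ∷ as} (there zs∈) pz (pa ∷ pas) with ∈-map⁻ (a ∷_) zs∈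
  ... | _ , ys∈ , refl = pa ∷ insertion-All ys∈ pz pas

  insertion-All⁻ : ∀ {A : Set} {P : A → Set} {z as zs} → zs ∈ insertions z as → All P zs → P z × All P as
  insertion-All⁻ {as = []}     (here refl) (pz ∷ _) = pz , []
  insertion-All⁻ {as = a ∷ as} (here refl) (pz ∷ pas) = pz , pas
  insertion-All⁻ {as = a ∷ as} (there zs∈) all with ∈-map⁻ (a ∷_) zs∈
  insertion-All⁻ {as = a ∷ as} (there zs∈) (pa ∷ pzs) | _ , ys∈ , refl =
    let pz , pas = insertion-All⁻ ys∈ pzs in pz , pa ∷ pas

  insertion-unique : ∀ {A : Set} {z : A} {as zs} → zs ∈ insertions z as → Unique (z ∷ as) →
                     Unique zs × length zs ≡ suc (length as)
  insertion-unique {as = []}     (here refl) u = u , refl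
  insertion-unique {as = a ∷ as} (here refl) u = u , refl
  insertion-unique {as = a ∷ as} (there zs∈) ((z≢a ∷ z#) ∷ a# ∷ as!) with ∈-map⁻ (a ∷_) zs∈
  ... | _ , ys∈ , refl = let u , len = insertion-unique ys∈ (z# ∷ as!) in
    insertion-All ys∈ (z≢a ∘ sym) a# ∷ u , cong suc len

  _≟ᴱ_ : ∀ {n} → DecidableEquality (Edge n)
  mkEdge i j _ ≟ᴱ mkEdge i′ j′ _ =
    map′ (λ { (refl , refl) → refl }) (λ { refl → refl , refl }) ((i Fin.≟ i′) ×-dec (j Fin.≟ j′))

  Sorted : ∀ {n} → EdgeOrdering n → List (Edge n) → Set
  Sorted f = AllPairs (Fin._<_ on label f)

  sorted? : ∀ {n} (f : EdgeOrdering n) zs → Dec (Sorted f zs)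
  sorted? f = AllPairs.allPairs? (λ x y → label f x Fin.<? label f y)

  module _ {n : ℕ} where

    open Enumeration (edgeOrderings n) renaming (elements to Ω)

    sortedCount : List (Edge n) → ℕ
    sortedCount zs = ∑ Ω (λ f → 𝟙 (sorted? f zs))

    private
      -- Relabelling by σ acts bijectively on the orderings.
      sortedCount-map : ∀ (σ : Edge n ↔ Edge n) zs → sortedCount zs ≤ sortedCount (map (Inverse.to σ) zs)
      sortedCount-map σ zs = ∑-inj {R = R}
        (AllPairs.map (λ f≉f′ {_} r r′ → f≉f′ λ e → trans (sym (r e)) (r′ e)) unique)
        λ {f} _ → Any.map (λ {g} eq → let r = λ e → trans (sym (eq (to e))) (cong (label f) (strictlyInverseʳ e)) in
            r , 𝟙-mono (sorted? f zs) (sorted? g (map to zs)) λ s → AllPairs.map⁺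
              (AllPairs.map (λ {x} {y} lt → subst₂ Fin._<_ (sym (r x)) (sym (r y)) lt) s))
          (complete (f ⤖-∘ ↔⇒⤖ (↔-sym σ)))
        where
        open Inverse σ using (to; from; strictlyInverseˡ; strictlyInverseʳ)
        R : EdgeOrdering n → EdgeOrdering n → Set
        R f g = ∀ e → label g (to e) ≡ label f e

      sortedCount-≤ : ∀ {xs ys} → Unique xs → Unique ys → length xs ≡ length ys → sortedCount xs ≤ sortedCount ys
      sortedCount-≤ {xs} xs! ys! len with match _≟ᴱ_ xs! ys! len
      ... | σ , refl = sortedCount-map σ xs

      -- Labels are distinct, so a new edge fits into a sorted list at exactly one place; and
      -- deleting an edge from a sorted list leaves it sorted.
      sorted-insertions : ∀ (f : EdgeOrdering n) {z as} → z ∉ as →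
                          𝟙 (sorted? f as) ≡ ∑ (insertions z as) (λ zs → 𝟙 (sorted? f zs))
      sorted-insertions f {z} {[]}     _  = refl
      sorted-insertions f {z} {a ∷ as} z∉ with Fin.<-cmp (label f z) (label f a)
      ... | tri≈ _ eq _ = contradiction (here (Bijection.injective f eq)) z∉
      ... | tri< z<a _ _ = begin
        𝟙 (sorted? f (a ∷ as))
          ≡⟨ ≤-antisym
              (𝟙-mono (sorted? f (a ∷ as)) (sorted? f (z ∷ a ∷ as))
                λ { (a< ∷ as<) → (z<a ∷ All.map (Fin.<-trans z<a) a<) ∷ a< ∷ as< })
              (𝟙-mono (sorted? f (z ∷ a ∷ as)) (sorted? f (a ∷ as)) AllPairs.tail) ⟩
        𝟙 (sorted? f (z ∷ a ∷ as))
          ≡⟨ +-identityʳ _ ⟨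
        𝟙 (sorted? f (z ∷ a ∷ as)) + 0
          ≡⟨ cong (𝟙 (sorted? f (z ∷ a ∷ as)) +_) (trans (∑-map (a ∷_) (insertions z as) _)
              (trans (∑-cong (insertions z as) (λ {zs} zs∈ → 𝟙-no (sorted? f (a ∷ zs))
                λ s → Fin.<-asym z<a (proj₁ (insertion-All⁻ zs∈ (AllPairs.head s)))))
              (∑-0 (insertions z as)))) ⟨
        𝟙 (sorted? f (z ∷ a ∷ as)) + ∑ (map (a ∷_) (insertions z as)) (λ zs → 𝟙 (sorted? f zs)) ∎
        where
        open ≡-Reasoning
      ... | tri> _ _ a<z = begin
        𝟙 (sorted? f (a ∷ as))
          ≡⟨ split as ⟩
        𝟙 (above? as) * 𝟙 (sorted? f as)
          ≡⟨ cong (𝟙 (above? as) *_) (sorted-insertions f (z∉ ∘ there)) ⟩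
        𝟙 (above? as) * ∑ (insertions z as) (λ zs → 𝟙 (sorted? f zs))
          ≡⟨ ∑-*ˡ (𝟙 (above? as)) (insertions z as) _ ⟨
        ∑ (insertions z as) (λ zs → 𝟙 (above? as) * 𝟙 (sorted? f zs))
          ≡⟨ ∑-cong (insertions z as) (λ {zs} zs∈ → trans
              (cong (_* 𝟙 (sorted? f zs)) (≤-antisym
                (𝟙-mono (above? as) (above? zs) (insertion-All zs∈ a<z))
                (𝟙-mono (above? zs) (above? as) (proj₂ ∘ insertion-All⁻ zs∈))))
              (sym (split zs))) ⟩
        ∑ (insertions z as) (λ zs → 𝟙 (sorted? f (a ∷ zs)))
          ≡⟨ ∑-map (a ∷_) (insertions z as) _ ⟨
        ∑ (map (a ∷_) (insertions z as)) (λ zs → 𝟙 (sorted? f zs))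
          ≡⟨ cong (_+ ∑ (map (a ∷_) (insertions z as)) (λ zs → 𝟙 (sorted? f zs)))
               (𝟙-no (sorted? f (z ∷ a ∷ as)) (λ s → Fin.<-asym a<z (All.head (AllPairs.head s)))) ⟨
        𝟙 (sorted? f (z ∷ a ∷ as)) + ∑ (map (a ∷_) (insertions z as)) (λ zs → 𝟙 (sorted? f zs)) ∎
        where
        open ≡-Reasoning
        above? : ∀ zs → Dec (All (λ y → label f a Fin.< label f y) zs)
        above? = All.all? (λ y → label f a Fin.<? label f y)
        split : ∀ zs → 𝟙 (sorted? f (a ∷ zs)) ≡ 𝟙 (above? zs) * 𝟙 (sorted? f zs)
        split zs with above? zs | sorted? f zs
        ... | yes _ | yes _ = refl
        ... | yes _ | no  _ = refl
        ... | no  _ | yes _ = refl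
        ... | no  _ | no  _ = refl

      -- The `suc (length zs)` insertions of `z` are repetition-free lists of equal length, so by
      -- relabelling each is sorted by equally many orderings.
      sortedCount-∷ : ∀ {z zs} → Unique (z ∷ zs) → sortedCount zs ≡ suc (length zs) * sortedCount (z ∷ zs)
      sortedCount-∷ {z} {zs} u = begin
        ∑ Ω (λ f → 𝟙 (sorted? f zs))
          ≡⟨ ∑-cong Ω (λ {f} _ → sorted-insertions f (Unique[x∷xs]⇒x∉xs u)) ⟩
        ∑ Ω (λ f → ∑ (insertions z zs) (λ ys → 𝟙 (sorted? f ys)))
          ≡⟨ ∑-swap Ω (insertions z zs) _ ⟩
        ∑ (insertions z zs) sortedCount
          ≡⟨ ∑-cong (insertions z zs) (λ ys∈ → let ys! , len = insertion-unique ys∈ u in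
              ≤-antisym (sortedCount-≤ ys! u len) (sortedCount-≤ u ys! (sym len))) ⟩
        ∑ (insertions z zs) (const (sortedCount (z ∷ zs)))
          ≡⟨ ∑-const (insertions z zs) _ ⟩
        length (insertions z zs) * sortedCount (z ∷ zs)
          ≡⟨ cong (_* sortedCount (z ∷ zs)) (length-insertions z zs) ⟩
        suc (length zs) * sortedCount (z ∷ zs) ∎
        where open ≡-Reasoning

    sortedCount-unique : ∀ {zs} → Unique zs → length zs ! * sortedCount zs ≡ length Ω
    sortedCount-unique {[]}     _ = trans (*-identityˡ _) (∑-1 Ω)
    sortedCount-unique {z ∷ zs} u@(_ ∷ zs!) = begin
      suc (length zs) * length zs ! * sortedCount (z ∷ zs)   ≡⟨ cong (_* sortedCount (z ∷ zs)) (*-comm (suc (length zs)) (length zs !)) ⟩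
      length zs ! * suc (length zs) * sortedCount (z ∷ zs)   ≡⟨ *-assoc (length zs !) (suc (length zs)) _ ⟩
      length zs ! * (suc (length zs) * sortedCount (z ∷ zs)) ≡⟨ cong (length zs ! *_) (sortedCount-∷ u) ⟨
      length zs ! * sortedCount zs                           ≡⟨ sortedCount-unique zs! ⟩
      length Ω                                               ∎
      where open ≡-Reasoning

    sorted⇒unique : ∀ f {zs} → Sorted {n} f zs → Unique zs
    sorted⇒unique f = AllPairs.map (λ x<y x≡y → Fin.<⇒≢ x<y (cong (label f) x≡y))

    -- A list with a repeated edge is never sorted. Including this case allows the bound to be
    -- applied to the trail of any word, whether or not it arises from a merge.
    sortedCount-bound : ∀ zs → length zs ! * sortedCount zs ≤ length Ω
    sortedCount-bound zs with DecUnique.unique? _≟ᴱ_ zs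
    ... | yes zs! = ≤-reflexive (sortedCount-unique zs!)
    ... | no ¬zs! = ≤-trans (*-monoʳ-≤ (length zs !) (∑-mono {h = const 0} Ω λ {f} _ → ≤-reflexive (absurd f)))
                            (≤-trans (≤-reflexive (trans (cong (length zs ! *_) (∑-0 Ω)) (*-zeroʳ (length zs !)))) z≤n)
      where
      absurd : ∀ f → 𝟙 (sorted? f zs) ≡ 0
      absurd f with sorted? f zs
      ... | yes s = contradiction (sorted⇒unique f s) ¬zs!
      ... | no  _ = refl

-- Words of merged edge sequences and their number

module Words where

  open import Data.List.Membership.Propositional.Properties
  open import Data.Nat.Base
  open import Data.Nat.Properties
  open import Data.Nat.Tactic.RingSolver using (solve-∀)

  -- The letters of the merged edge sequence of two paths P and Q: an edge of P only, of Q only,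
  -- or a shared edge, which P and Q traverse in the same direction (up, or more inside a run
  -- of consecutive shared edges) or in opposite directions (down).
  data Letter : Set where
    onlyP onlyQ up more down : Letter

  -- A run is coded by a number: 0 is a single reversed edge, suc s is suc s edges in the same direction.
  runLetters : ℕ → List Letter
  runLetters zero    = down ∷ []
  runLetters (suc s) = up ∷ replicate s more

  runLength : ℕ → ℕ
  runLength zero    = 1
  runLength (suc s) = suc s

  total : List ℕ → ℕ
  total []       = 0
  total (r ∷ ρs) = runLength r + total ρs

  length-runLetters : ∀ r → length (runLetters r) ≡ runLength r
  length-runLetters zero    = refl
  length-runLetters (suc s) = cong suc (length-replicate s)

  -- Interleavings of `a` letters `onlyP`, `b` letters `onlyQ` and the runs `ρs` as blocks in this
  -- order. These are more words than can occur, since adjacent blocks are allowed, but their number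
  -- is a multinomial coefficient.
  words : ℕ → ℕ → List ℕ → List (List Letter)
  wordsP wordsQ wordsR : ℕ → ℕ → List ℕ → List (List Letter)

  wordsE : ℕ → ℕ → List ℕ → List (List Letter)
  wordsE zero zero [] = [] ∷ []
  wordsE _    _    _  = []

  words a b ρs = wordsE a b ρs ++ wordsP a b ρs ++ wordsQ a b ρs ++ wordsR a b ρs

  wordsP zero    b ρs = []
  wordsP (suc a) b ρs = map (onlyP ∷_) (words a b ρs)

  wordsQ a zero    ρs = []
  wordsQ a (suc b) ρs = map (onlyQ ∷_) (words a b ρs)

  wordsR a b []       = []
  wordsR a b (r ∷ ρs) = map (runLetters r ++_) (words a b ρs)

  module _ {a b ρs w} (w∈ : w ∈ words a b ρs) where

    words-P : onlyP ∷ w ∈ words (suc a) b ρs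
    words-P = ∈-++⁺ˡ (∈-map⁺ (onlyP ∷_) w∈)

    words-Q : onlyQ ∷ w ∈ words a (suc b) ρs
    words-Q = ∈-++⁺ʳ (wordsE a (suc b) ρs) (∈-++⁺ʳ (wordsP a (suc b) ρs) (∈-++⁺ˡ (∈-map⁺ (onlyQ ∷_) w∈)))

    words-R : ∀ r → runLetters r ++ w ∈ words a b (r ∷ ρs)
    words-R r = ∈-++⁺ʳ (wordsE a b (r ∷ ρs)) (∈-++⁺ʳ (wordsP a b (r ∷ ρs)) (∈-++⁺ʳ (wordsQ a b (r ∷ ρs)) (∈-map⁺ (runLetters r ++_) w∈)))

  wordCount : ℕ → ℕ → List ℕ → ℕ
  wordCount a b ρs = length (words a b ρs)

  private
    countP countQ countR : ℕ → ℕ → List ℕ → ℕ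
    countP a b ρs = length (wordsP a b ρs)
    countQ a b ρs = length (wordsQ a b ρs)
    countR a b ρs = length (wordsR a b ρs)

    split : ∀ a b ρs → wordCount a b ρs ≡ length (wordsE a b ρs) + (countP a b ρs + (countQ a b ρs + countR a b ρs))
    split a b ρs = trans (length-++ (wordsE a b ρs)) (cong (length (wordsE a b ρs) +_)
      (trans (length-++ (wordsP a b ρs)) (cong (countP a b ρs +_) (length-++ (wordsQ a b ρs)))))

  -- Multinomial recursion on the first block: multiplied by the factorials, the words beginning
  -- with `onlyP`, with `onlyQ` and with a run make up the shares `a`, `b` and `length ρs` of their
  -- total, each times the factorial of that total less one.
  length-words : ∀ a b ρs → length (words a b ρs) * (a ! * (b ! * length ρs !)) ≡ (a + b + length ρs) !
  length-words a b ρs = trans (cong (_* F a b ρs) (split a b ρs)) (go a b ρs)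
    where
    open ≡-Reasoning

    F : ℕ → ℕ → List ℕ → ℕ
    F a b ρs = a ! * (b ! * length ρs !)

    G : ℕ → ℕ → List ℕ → ℕ
    G a b ρs = pred (a + b + length ρs) !

    p-part : ∀ a b ρs → countP a b ρs * F a b ρs ≡ a * G a b ρs
    p-part zero    b ρs = refl
    p-part (suc a) b ρs = begin
      countP (suc a) b ρs * (suc a * a ! * (b ! * length ρs !))
        ≡⟨ cong (_* (suc a * a ! * (b ! * length ρs !))) (length-map (onlyP ∷_) (words a b ρs)) ⟩
      wordCount a b ρs * (suc a * a ! * (b ! * length ρs !))
        ≡⟨ lemma (wordCount a b ρs) (suc a) (a !) (b ! * length ρs !) ⟩
      suc a * (wordCount a b ρs * (a ! * (b ! * length ρs !)))
        ≡⟨ cong (suc a *_) (length-words a b ρs) ⟩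
      suc a * (a + b + length ρs) ! ∎
      where
      lemma : ∀ c s f g → c * (s * f * g) ≡ s * (c * (f * g))
      lemma = solve-∀

    q-part : ∀ a b ρs → countQ a b ρs * F a b ρs ≡ b * G a b ρs
    q-part a zero    ρs = refl
    q-part a (suc b) ρs = begin
      countQ a (suc b) ρs * (a ! * (suc b * b ! * length ρs !))
        ≡⟨ cong (_* (a ! * (suc b * b ! * length ρs !))) (length-map (onlyQ ∷_) (words a b ρs)) ⟩
      wordCount a b ρs * (a ! * (suc b * b ! * length ρs !))
        ≡⟨ lemma (wordCount a b ρs) (suc b) (a !) (b !) (length ρs !) ⟩
      suc b * (wordCount a b ρs * (a ! * (b ! * length ρs !)))
        ≡⟨ cong (suc b *_) (length-words a b ρs) ⟩
      suc b * (a + b + length ρs) !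
        ≡⟨ cong (λ k → suc b * (pred (k + length ρs)) !) (+-suc a b) ⟨
      suc b * pred (a + suc b + length ρs) ! ∎
      where
      lemma : ∀ c s f g h → c * (f * (s * g * h)) ≡ s * (c * (f * (g * h)))
      lemma = solve-∀

    r-part : ∀ a b ρs → countR a b ρs * F a b ρs ≡ length ρs * G a b ρs
    r-part a b []       = refl
    r-part a b (r ∷ ρs) = begin
      countR a b (r ∷ ρs) * (a ! * (b ! * (suc m * m !)))
        ≡⟨ cong (_* (a ! * (b ! * (suc m * m !)))) (length-map (runLetters r ++_) (words a b ρs)) ⟩
      wordCount a b ρs * (a ! * (b ! * (suc m * m !)))
        ≡⟨ lemma (wordCount a b ρs) (suc m) (a !) (b !) (m !) ⟩
      suc m * (wordCount a b ρs * (a ! * (b ! * m !)))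
        ≡⟨ cong (suc m *_) (length-words a b ρs) ⟩
      suc m * (a + b + m) !
        ≡⟨ cong (λ k → suc m * pred k !) (+-suc (a + b) m) ⟨
      suc m * pred (a + b + suc m) ! ∎
      where
      m = length ρs
      lemma : ∀ c s f g h → c * (f * (g * (s * h))) ≡ s * (c * (f * (g * h)))
      lemma = solve-∀

    parts : ∀ a b ρs → (countP a b ρs + (countQ a b ρs + countR a b ρs)) * F a b ρs ≡ (a + b + length ρs) * G a b ρs
    parts a b ρs = begin
      (countP a b ρs + (countQ a b ρs + countR a b ρs)) * F a b ρs
        ≡⟨ distrib (countP a b ρs) (countQ a b ρs) (countR a b ρs) (F a b ρs) ⟩
      countP a b ρs * F a b ρs + countQ a b ρs * F a b ρs + countR a b ρs * F a b ρs
        ≡⟨ cong₂ _+_ (cong₂ _+_ (p-part a b ρs) (q-part a b ρs)) (r-part a b ρs) ⟩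
      a * G a b ρs + b * G a b ρs + length ρs * G a b ρs
        ≡⟨ collect′ a b (length ρs) (G a b ρs) ⟩
      (a + b + length ρs) * G a b ρs ∎
      where
      distrib : ∀ x y z f → (x + (y + z)) * f ≡ x * f + y * f + z * f
      distrib = solve-∀
      collect′ : ∀ x y z g → x * g + y * g + z * g ≡ (x + y + z) * g
      collect′ = solve-∀

    go : ∀ a b ρs → (length (wordsE a b ρs) + (countP a b ρs + (countQ a b ρs + countR a b ρs))) * F a b ρs ≡ (a + b + length ρs) !
    go zero    zero    []       = refl
    go zero    zero    (r ∷ ρs) = parts zero zero (r ∷ ρs)
    go zero    (suc b) ρs       = parts zero (suc b) ρs
    go (suc a) b       ρs       = parts (suc a) b ρs

  -- `runs m k` has `m` runs with `k` edges in all, but `longRuns m k` has `suc m` runs, of which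
  -- the first is not reversed. Only such a run can be prolonged, which `lengthen` does.
  runs longRuns : ℕ → ℕ → List (List ℕ)

  runs zero    zero    = [] ∷ []
  runs zero    (suc k) = []
  runs (suc m) zero    = []
  runs (suc m) (suc k) = map (0 ∷_) (runs m k) ++ longRuns m (suc k)

  lengthen : List ℕ → List ℕ
  lengthen []       = []
  lengthen (r ∷ ρs) = suc r ∷ ρs

  longRuns m zero    = []
  longRuns m (suc k) = map (1 ∷_) (runs m k) ++ map lengthen (longRuns m k)

  ∈-runs : ∀ ρs → ρs ∈ runs (length ρs) (total ρs)
  ∈-runs []           = here refl
  ∈-runs (zero  ∷ ρs) = ∈-++⁺ˡ (∈-map⁺ (0 ∷_) (∈-runs ρs))
  ∈-runs (suc s ∷ ρs) = ∈-++⁺ʳ (map (0 ∷_) (runs (length ρs) (s + total ρs))) (long s)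
    where
    long : ∀ s → suc s ∷ ρs ∈ longRuns (length ρs) (suc s + total ρs)
    long zero    = ∈-++⁺ˡ (∈-map⁺ (1 ∷_) (∈-runs ρs))
    long (suc s) = ∈-++⁺ʳ (map (1 ∷_) (runs (length ρs) (suc s + total ρs))) (∈-map⁺ lengthen (long s))

  ∈-runs⁻ : ∀ m k {ρs} → ρs ∈ runs m k → length ρs ≡ m × total ρs ≡ k
  ∈-longRuns⁻ : ∀ m k {ρs} → ρs ∈ longRuns m k → length ρs ≡ suc m × total ρs ≡ k × ∃ λ s → ∃ λ σs → ρs ≡ suc s ∷ σs

  ∈-runs⁻ zero    zero    (here refl) = refl , refl
  ∈-runs⁻ (suc m) (suc k) ρs∈ with ∈-++⁻ (map (0 ∷_) (runs m k)) ρs∈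
  ... | inj₂ ρs∈l = let len , tot , _ = ∈-longRuns⁻ m (suc k) ρs∈l in len , tot
  ... | inj₁ ρs∈s with ∈-map⁻ (0 ∷_) ρs∈s
  ... | _ , σs∈ , refl = let len , tot = ∈-runs⁻ m k σs∈ in cong suc len , cong suc tot

  ∈-longRuns⁻ m (suc k) ρs∈ with ∈-++⁻ (map (1 ∷_) (runs m k)) ρs∈
  ... | inj₁ ρs∈s with ∈-map⁻ (1 ∷_) ρs∈s
  ... | σs , σs∈ , refl = let len , tot = ∈-runs⁻ m k σs∈ in cong suc len , cong suc tot , 0 , σs , refl
  ∈-longRuns⁻ m (suc k) ρs∈ | inj₂ ρs∈l with ∈-map⁻ lengthen ρs∈l
  ... | σs , σs∈ , refl with ∈-longRuns⁻ m k σs∈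
  ... | len , tot , s , πs , refl = len , cong suc tot , suc s , πs , refl

  runCount longRunCount : ℕ → ℕ → ℕ
  runCount m k     = length (runs m k)
  longRunCount m k = length (longRuns m k)

  runCount-suc : ∀ m k → runCount (suc m) (suc k) ≡ runCount m k + longRunCount m (suc k)
  runCount-suc m k = trans (length-++ (map (0 ∷_) (runs m k))) (cong (_+ longRunCount m (suc k)) (length-map (0 ∷_) (runs m k)))

  longRunCount-suc : ∀ m k → longRunCount m (suc k) ≡ runCount m k + longRunCount m k
  longRunCount-suc m k = trans (length-++ (map (1 ∷_) (runs m k)))
    (cong₂ _+_ (length-map (1 ∷_) (runs m k)) (length-map lengthen (longRuns m k)))

  ∈-words-length : ∀ a b ρs {w} → w ∈ words a b ρs → length w ≡ a + b + total ρs
  ∈-words-length a b ρs w∈ with ∈-++⁻ (wordsE a b ρs) w∈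
  ... | inj₁ w∈E = empty a b ρs w∈E
    where
    empty : ∀ a b ρs {w} → w ∈ wordsE a b ρs → length w ≡ a + b + total ρs
    empty zero zero [] (here refl) = refl
  ... | inj₂ w∈′ with ∈-++⁻ (wordsP a b ρs) w∈′
  ... | inj₁ w∈P = afterP a w∈P
    where
    afterP : ∀ a {w} → w ∈ wordsP a b ρs → length w ≡ a + b + total ρs
    afterP (suc a) w∈P with ∈-map⁻ (onlyP ∷_) w∈P
    ... | _ , v∈ , refl = cong suc (∈-words-length a b ρs v∈)
  ... | inj₂ w∈″ with ∈-++⁻ (wordsQ a b ρs) w∈″
  ... | inj₁ w∈Q = afterQ b w∈Q
    where
    afterQ : ∀ b {w} → w ∈ wordsQ a b ρs → length w ≡ a + b + total ρs
    afterQ (suc b) w∈Q with ∈-map⁻ (onlyQ ∷_) w∈Q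
    ... | _ , v∈ , refl = trans (cong suc (∈-words-length a b ρs v∈)) (cong (_+ total ρs) (sym (+-suc a b)))
  ... | inj₂ w∈R = afterR ρs w∈R
    where
    open ≡-Reasoning
    exchange : ∀ x y z → x + (y + z) ≡ y + (x + z)
    exchange = solve-∀
    afterR : ∀ ρs {w} → w ∈ wordsR a b ρs → length w ≡ a + b + total ρs
    afterR (r ∷ ρs) w∈R with ∈-map⁻ (runLetters r ++_) w∈R
    ... | w , v∈ , refl = begin
      length (runLetters r ++ w)          ≡⟨ length-++ (runLetters r) ⟩
      length (runLetters r) + length w    ≡⟨ cong₂ _+_ (length-runLetters r) (∈-words-length a b ρs v∈) ⟩
      runLength r + (a + b + total ρs)    ≡⟨ exchange (runLength r) (a + b) (total ρs) ⟩
      a + b + (runLength r + total ρs)    ∎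

  length≤total : ∀ ρs → length ρs ≤ total ρs
  length≤total []           = z≤n
  length≤total (zero  ∷ ρs) = s≤s (length≤total ρs)
  length≤total (suc s ∷ ρs) = s≤s (≤-trans (length≤total ρs) (m≤n+m (total ρs) s))

-- Merging two increasing paths into a word

module Merging where

  open import Defs using (Edge; edge; EdgeOrdering; label; pathEdges)
  open Switching using (undirected)
  open Planting
  open Orderings
  open Words
  import Data.Empty.Irrelevant as Irrelevant
  import Data.Fin.Properties as Fin
  open import Data.List.Membership.Propositional.Properties
  open import Data.List.Relation.Unary.Unique.Propositional.Properties using (Unique[x∷xs]⇒x∉xs)
  open import Data.Nat.Base
  open import Data.Nat.Properties hiding (_≟_)
  open import Data.Unit.Base using (⊤; tt)

  module _ {n : ℕ} where

    edge-sym : ∀ {u v : Fin n} .(u≢v : u ≢ v) .(v≢u : v ≢ u) → edge u v u≢v ≡ edge v u v≢u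
    edge-sym {u} {v} u≢v v≢u with Fin.<-cmp u v | Fin.<-cmp v u
    ... | tri< _ _ ¬v<u | tri> _ _ _    = refl
    ... | tri> _ _ _    | tri< _ _ _    = refl
    ... | tri< u<v _ _  | tri< v<u _ _  = contradiction v<u (Fin.<-asym u<v)
    ... | tri> _ _ v<u  | tri> _ _ u<v  = contradiction v<u (Fin.<-asym u<v)
    ... | tri≈ _ u≡v _  | _             = Irrelevant.⊥-elim (u≢v u≡v)
    ... | _             | tri≈ _ v≡u _  = Irrelevant.⊥-elim (v≢u v≡u)

    edge-injective : ∀ {u v x y : Fin n} .(u≢v : u ≢ v) .(x≢y : x ≢ y) → edge u v u≢v ≡ edge x y x≢y →
                     (u ≡ x × v ≡ y) ⊎ (u ≡ y × v ≡ x)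
    edge-injective {u} {v} {x} {y} u≢v x≢y eq with Fin.<-cmp u v | Fin.<-cmp x y
    ... | tri≈ _ u≡v _ | _            = Irrelevant.⊥-elim (u≢v u≡v)
    ... | _            | tri≈ _ x≡y _ = Irrelevant.⊥-elim (x≢y x≡y)
    edge-injective u≢v x≢y refl | tri< _ _ _ | tri< _ _ _ = inj₁ (refl , refl)
    edge-injective u≢v x≢y refl | tri< _ _ _ | tri> _ _ _ = inj₂ (refl , refl)
    edge-injective u≢v x≢y refl | tri> _ _ _ | tri< _ _ _ = inj₂ (refl , refl)
    edge-injective u≢v x≢y refl | tri> _ _ _ | tri> _ _ _ = inj₁ (refl , refl)

  -- Whether the current vertex of Q is the end of a run, and whether that run may still be prolonged.
  data State : Set where
    off running ended : State

  leave : State → State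
  leave off     = off
  leave running = ended
  leave ended   = ended

  module _ {V : Set} where

    -- The vertices of Q forced by the word w; unless the state is off, that of the current vertex is already recorded.
    template : List Letter → State → List V → Template V
    template []          off     _           = nothing ∷ []
    template []          _       _           = []
    template (onlyP ∷ w) s       (_ ∷ P)     = template w (leave s) P
    template (onlyQ ∷ w) off     P           = nothing ∷ template w off P
    template (onlyQ ∷ w) _       P           = template w off P
    template (up    ∷ w) off     (x ∷ y ∷ P) = just x ∷ just y ∷ template w running (y ∷ P)
    template (more  ∷ w) running (x ∷ y ∷ P) = just y ∷ template w running (y ∷ P)
    -- `Q` takes the edge from the other end and now stands at `x`, which `P` has left for good. The
    -- next edge of `Q` is therefore not on `P`, and a reversed run has only one edge.
    template (down  ∷ w) off     (x ∷ y ∷ P) = just y ∷ just x ∷ template w ended (y ∷ P)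
    template _           _       _           = []

    trail : List Letter → List V → List V → List (V × V)
    trail (onlyP ∷ w) (x ∷ P@(x′ ∷ _)) Q                = (x , x′) ∷ trail w P Q
    trail (onlyQ ∷ w) P                (y ∷ Q@(y′ ∷ _)) = (y , y′) ∷ trail w P Q
    trail (up    ∷ w) (x ∷ P@(x′ ∷ _)) (_ ∷ Q)          = (x , x′) ∷ trail w P Q
    trail (more  ∷ w) (x ∷ P@(x′ ∷ _)) (_ ∷ Q)          = (x , x′) ∷ trail w P Q
    trail (down  ∷ w) (x ∷ P@(x′ ∷ _)) (_ ∷ Q)          = (x , x′) ∷ trail w P Q
    trail _           _                _                = []

    -- The part of Q described by the template.
    current : State → List V → List V
    current off Q       = Q
    current _   (_ ∷ Q) = Q
    current _   []      = []

  module _ {n : ℕ} where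

    private
      variable
        w : List Letter
        s : State
        P Q : List (Fin n)
        x x′ y y′ : Fin n
        zs : List (Edge n)

    -- With the empty list for a loop, edge lists can be formed and summed over for all vertex
    -- lists, without carrying proofs of distinctness.
    link : Fin n × Fin n → List (Edge n)
    link (u , v) with u Fin.≟ v
    ... | yes _  = []
    ... | no u≢v = edge u v u≢v ∷ []

    link-≢ : .(u≢v : x ≢ y) → link (x , y) ≡ edge x y u≢v ∷ []
    link-≢ {x} {y} u≢v with x Fin.≟ y
    ... | yes u≡v = Irrelevant.⊥-elim (u≢v u≡v)
    ... | no  _   = refl

    links : List (Fin n × Fin n) → List (Edge n)
    links = concatMap link

    pathEdges-links : ∀ P .(P! : Unique P) → pathEdges P P! ≡ links (pairs P)
    pathEdges-links []           _  = refl
    pathEdges-links (_ ∷ [])     _  = refl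
    pathEdges-links (x ∷ y ∷ P)  P! = sym (cong₂ _++_ (link-≢ (All.head (AllPairs.head P!))) (sym (pathEdges-links (y ∷ P) (AllPairs.tail P!))))

    -- Fit w s P Q zs: the edges of the paths P and Q, merged as the word w tells, are zs.
    data Fit : List Letter → State → List (Fin n) → List (Fin n) → List (Edge n) → Set where
      stop  : Fit [] s (x ∷ []) (y ∷ []) []
      stepP : .(x≢x′ : x ≢ x′) → Fit w (leave s) (x′ ∷ P) (y ∷ Q) zs →
              Fit (onlyP ∷ w) s (x ∷ x′ ∷ P) (y ∷ Q) (edge x x′ x≢x′ ∷ zs)
      stepQ : .(y≢y′ : y ≢ y′) → Fit w off (x ∷ P) (y′ ∷ Q) zs →
              Fit (onlyQ ∷ w) s (x ∷ P) (y ∷ y′ ∷ Q) (edge y y′ y≢y′ ∷ zs)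
      start : .(x≢x′ : x ≢ x′) → Fit w running (x′ ∷ P) (x′ ∷ Q) zs →
              Fit (up ∷ w) off (x ∷ x′ ∷ P) (x ∷ x′ ∷ Q) (edge x x′ x≢x′ ∷ zs)
      go-on : .(x≢x′ : x ≢ x′) → Fit w running (x′ ∷ P) (x′ ∷ Q) zs →
              Fit (more ∷ w) running (x ∷ x′ ∷ P) (x ∷ x′ ∷ Q) (edge x x′ x≢x′ ∷ zs)
      turn  : .(x≢x′ : x ≢ x′) → Fit w ended (x′ ∷ P) (x ∷ Q) zs →
              Fit (down ∷ w) off (x ∷ x′ ∷ P) (x′ ∷ x ∷ Q) (edge x x′ x≢x′ ∷ zs)

    fit-trail : Fit w s P Q zs → links (trail w P Q) ≡ zs
    fit-trail stop          = refl
    fit-trail (stepP x≢ ft) = cong₂ _++_ (link-≢ x≢) (fit-trail ft)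
    fit-trail (stepQ y≢ ft) = cong₂ _++_ (link-≢ y≢) (fit-trail ft)
    fit-trail (start x≢ ft) = cong₂ _++_ (link-≢ x≢) (fit-trail ft)
    fit-trail (go-on x≢ ft) = cong₂ _++_ (link-≢ x≢) (fit-trail ft)
    fit-trail (turn  x≢ ft) = cong₂ _++_ (link-≢ x≢) (fit-trail ft)

    fit-agree : Fit w s P Q zs → Agree (template w s P) (current s Q)
    fit-agree {s = off}     stop         = free []
    fit-agree {s = running} stop         = []
    fit-agree {s = ended}   stop         = []
    fit-agree {s = off}     (stepP _ ft) = fit-agree ft
    fit-agree {s = running} (stepP _ ft) = fit-agree ft
    fit-agree {s = ended}   (stepP _ ft) = fit-agree ft
    fit-agree {s = off}     (stepQ _ ft) = free (fit-agree ft)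
    fit-agree {s = running} (stepQ _ ft) = fit-agree ft
    fit-agree {s = ended}   (stepQ _ ft) = fit-agree ft
    fit-agree (start _ ft)               = fixed (fixed (fit-agree ft))
    fit-agree (go-on _ ft)               = fixed (fit-agree ft)
    fit-agree (turn  _ ft)               = fixed (fixed (fit-agree ft))

    Joins : Fin n × Fin n → Edge n → Set
    Joins (u , v) z = Σ (u ≢ v) λ u≢v → z ≡ edge u v u≢v

    private
      fit-pairs : Unique P → Fit w s P Q zs → ∀ {u v} → (u , v) ∈ pairs P → ∃ λ z → z ∈ zs × Joins (u , v) z
      fit-pairs ((x# ∷ _) ∷ _) (stepP _ ft) (here refl) = _ , here refl , x# , refl
      fit-pairs ((x# ∷ _) ∷ _) (start _ ft) (here refl) = _ , here refl , x# , refl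
      fit-pairs ((x# ∷ _) ∷ _) (go-on _ ft) (here refl) = _ , here refl , x# , refl
      fit-pairs ((x# ∷ _) ∷ _) (turn  _ ft) (here refl) = _ , here refl , x# , refl
      fit-pairs (_ ∷ P!) (stepP _ ft) (there uv∈) = ×.map₂ (×.map₁ there) (fit-pairs P! ft uv∈)
      fit-pairs (_ ∷ P!) (start _ ft) (there uv∈) = ×.map₂ (×.map₁ there) (fit-pairs P! ft uv∈)
      fit-pairs (_ ∷ P!) (go-on _ ft) (there uv∈) = ×.map₂ (×.map₁ there) (fit-pairs P! ft uv∈)
      fit-pairs (_ ∷ P!) (turn  _ ft) (there uv∈) = ×.map₂ (×.map₁ there) (fit-pairs P! ft uv∈)
      fit-pairs P!       (stepQ _ ft) uv∈         = ×.map₂ (×.map₁ there) (fit-pairs P! ft uv∈)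

      undirected-∷⁻ : ∀ {u v a b} {l : List (Fin n × Fin n)} → (u , v) ∈ undirected ((a , b) ∷ l) →
                      (u , v) ≡ (a , b) ⊎ (u , v) ≡ (b , a) ⊎ (u , v) ∈ undirected l
      undirected-∷⁻ (here eq) = inj₁ eq
      undirected-∷⁻ {l = l} (there uv∈) with ∈-++⁻ l uv∈
      ... | inj₁ uv∈l        = inj₂ (inj₂ (∈-++⁺ˡ uv∈l))
      ... | inj₂ (here eq)   = inj₂ (inj₁ eq)
      ... | inj₂ (there vu∈) = inj₂ (inj₂ (∈-++⁺ʳ l vu∈))

    fit-undirected : Unique P → Fit w s P Q zs → ∀ {u v} → (u , v) ∈ undirected (pairs P) → ∃ λ z → z ∈ zs × Joins (u , v) z
    fit-undirected {P = P} P! ft uv∈ with ∈-++⁻ (pairs P) uv∈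
    ... | inj₁ uv∈P = fit-pairs P! ft uv∈P
    ... | inj₂ vu∈  with ∈-map⁻ ×.swap vu∈
    ... | _ , vu∈P , refl with fit-pairs P! ft vu∈P
    ... | z , z∈ , v≢u , refl = z , z∈ , v≢u ∘ sym , edge-sym v≢u (v≢u ∘ sym)

    -- A step of Q at two free vertices is an edge of Q only, so it occurs once in zs, and no edge of P equals it.
    record Private (P : List (Fin n)) (zs : List (Edge n)) (uv : Fin n × Fin n) : Set where
      constructor only
      field
        listed : ∃ λ z → z ∈ zs × Joins uv z
        ∉path  : uv ∉ undirected (pairs P)

    private
      shift : ∀ {uv} .(x≢x′ : x ≢ x′) → Unique (edge x x′ x≢x′ ∷ zs) → Private (x′ ∷ P) zs uv →
              Private (x ∷ x′ ∷ P) (edge x x′ x≢x′ ∷ zs) uv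
      shift {x = x} {x′ = x′} {zs = zs} {P = P} {uv = u , v} x≢x′ zs! (only (z , z∈ , j) ∉P) = only (z , there z∈ , j) λ uv∈ → go (undirected-∷⁻ uv∈) j
        where
        go : (u , v) ≡ (x , x′) ⊎ (u , v) ≡ (x′ , x) ⊎ (u , v) ∈ undirected (pairs (x′ ∷ P)) → Joins (u , v) z → ⊥
        go (inj₁ refl)        (_ , refl)   = Unique[x∷xs]⇒x∉xs zs! z∈
        go (inj₂ (inj₁ refl)) (u≢v , refl) = Unique[x∷xs]⇒x∉xs zs! (subst (_∈ zs) (edge-sym u≢v x≢x′) z∈)
        go (inj₂ (inj₂ uv∈))  _            = ∉P uv∈

      keep : ∀ {z zs P uv} → Private P zs uv → Private P (z ∷ zs) uv
      keep (only (z , z∈ , j) ∉P) = only (z , there z∈ , j) ∉P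

      fresh : .(y≢y′ : y ≢ y′) → y ≢ y′ → Unique P → Unique (edge y y′ y≢y′ ∷ zs) →
              Fit w s P Q zs → Private P (edge y y′ y≢y′ ∷ zs) (y , y′)
      fresh y≢y′ y≢ P! zs! ft = only (_ , here refl , y≢ , refl) λ uv∈ → case (fit-undirected P! ft uv∈)
        where
        case : ∃ (λ z → z ∈ _ × Joins (_ , _) z) → ⊥
        case (_ , z∈ , _ , refl) = Unique[x∷xs]⇒x∉xs zs! z∈

    fit-private : Unique P → Unique Q → Unique zs → Fit w s P Q zs →
                  All (Private P zs) (steps (template w s P) (current s Q))
    fit-private {s = off}     _ _ _ stop = []
    fit-private {s = running} _ _ _ stop = []
    fit-private {s = ended}   _ _ _ stop = []
    fit-private {s = off}     (_ ∷ P!) Q! zs!@(_ ∷ zs!′) (stepP x≢ ft) = All.map (shift x≢ zs!) (fit-private P! Q! zs!′ ft)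
    fit-private {s = running} (_ ∷ P!) Q! zs!@(_ ∷ zs!′) (stepP x≢ ft) = All.map (shift x≢ zs!) (fit-private P! Q! zs!′ ft)
    fit-private {s = ended}   (_ ∷ P!) Q! zs!@(_ ∷ zs!′) (stepP x≢ ft) = All.map (shift x≢ zs!) (fit-private P! Q! zs!′ ft)
    fit-private {s = running} P! (_ ∷ Q!) (_ ∷ zs!) (stepQ y≢ ft) = All.map keep (fit-private P! Q! zs! ft)
    fit-private {s = ended}   P! (_ ∷ Q!) (_ ∷ zs!) (stepQ y≢ ft) = All.map keep (fit-private P! Q! zs! ft)
    fit-private {P = P} {s = off} P! ((y# ∷ _) ∷ Q!) zs!@(_ ∷ zs!′) (stepQ {w = w} y≢ ft)
      with template w off P | fit-agree ft | fit-private P! Q! zs!′ ft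
    -- The edge just read is a step of the template only if its second vertex is free as well.
    ... | nothing ∷ _ | free  _ | ih = fresh y≢ y# P! zs! ft ∷ All.map keep ih
    ... | just _  ∷ _ | fixed _ | ih = All.map keep ih
    fit-private (_ ∷ P!) (_ ∷ Q!) zs!@(_ ∷ zs!′) (start x≢ ft) = All.map (shift x≢ zs!) (fit-private P! Q! zs!′ ft)
    fit-private (_ ∷ P!) (_ ∷ Q!) zs!@(_ ∷ zs!′) (go-on x≢ ft) = All.map (shift x≢ zs!) (fit-private P! Q! zs!′ ft)
    fit-private (_ ∷ P!) (_ ∷ Q!) zs!@(_ ∷ zs!′) (turn  x≢ ft) = All.map (shift x≢ zs!) (fit-private P! Q! zs!′ ft)

    -- Invariant of a partly read word. `prolonged` counts the leading letters `more`, which belong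
    -- to a run begun earlier. Each complete run prescribes one vertex more than it has edges; for
    -- the pending run the first vertex is already recorded.
    record Shape (w : List Letter) (s : State) (P Q : List (Fin n)) : Set where
      constructor shape
      field
        {prolonged}  : ℕ
        {a b}        : ℕ
        {ρs}         : List ℕ
        {rest}       : List Letter
        state-ok     : prolonged ≡ 0 ⊎ s ≡ running
        w≡           : w ≡ replicate prolonged more ++ rest
        rest∈        : rest ∈ words a b ρs
        length-P     : length P ≡ suc (prolonged + total ρs + a)
        length-Q     : length Q ≡ suc (prolonged + total ρs + b)
        length-fixed : length (fixedOf (template w s P)) ≡ prolonged + total ρs + length ρs

    fit-shape : Fit w s P Q zs → Shape w s P Q
    fit-shape {s = off}     stop = shape {prolonged = 0} {a = 0} {b = 0} {ρs = []} (inj₁ refl) refl (here refl) refl refl refl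
    fit-shape {s = running} stop = shape {prolonged = 0} {a = 0} {b = 0} {ρs = []} (inj₁ refl) refl (here refl) refl refl refl
    fit-shape {s = ended}   stop = shape {prolonged = 0} {a = 0} {b = 0} {ρs = []} (inj₁ refl) refl (here refl) refl refl refl
    fit-shape (start x≢ ft) with fit-shape ft
    ... | shape {c} {a} {b} {ρs} _ refl r∈ lP lQ lF =
      -- `up` and the `c` pending letters form a complete run of `suc c` edges. It adds two
      -- prescribed vertices, one for its edge and one for the additional run.
      shape {prolonged = 0} {a = a} {b = b} {ρs = suc c ∷ ρs} (inj₁ refl) refl (words-R {a} {b} {ρs} r∈ (suc c)) (cong suc lP) (cong suc lQ)
        (trans (cong (2 +_) lF) (cong suc (sym (+-suc (c + total ρs) (length ρs)))))
    fit-shape (go-on x≢ ft) with fit-shape ft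
    ... | shape {c} {a} {b} {ρs} _ refl r∈ lP lQ lF =
      shape {prolonged = suc c} {a = a} {b = b} {ρs = ρs} (inj₂ refl) refl r∈ (cong suc lP) (cong suc lQ) (cong suc lF)
    fit-shape (turn x≢ ft) with fit-shape ft
    ... | shape {a = a} {b} {ρs} (inj₁ refl) refl r∈ lP lQ lF =
      shape {prolonged = 0} {a = a} {b = b} {ρs = 0 ∷ ρs} (inj₁ refl) refl (words-R {a} {b} {ρs} r∈ 0) (cong suc lP) (cong suc lQ)
        (trans (cong (2 +_) lF) (cong suc (sym (+-suc (total ρs) (length ρs)))))
    fit-shape {s = off} (stepP x≢ ft) with fit-shape ft
    ... | shape {a = a} {b} {ρs} (inj₁ refl) refl r∈ lP lQ lF =
      shape {prolonged = 0} {a = suc a} {b = b} {ρs = ρs} (inj₁ refl) refl (words-P {a} {b} {ρs} r∈) (trans (cong suc lP) (cong suc (sym (+-suc (total ρs) a)))) lQ lF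
    fit-shape {s = running} (stepP x≢ ft) with fit-shape ft
    ... | shape {a = a} {b} {ρs} (inj₁ refl) refl r∈ lP lQ lF =
      shape {prolonged = 0} {a = suc a} {b = b} {ρs = ρs} (inj₁ refl) refl (words-P {a} {b} {ρs} r∈) (trans (cong suc lP) (cong suc (sym (+-suc (total ρs) a)))) lQ lF
    fit-shape {s = ended} (stepP x≢ ft) with fit-shape ft
    ... | shape {a = a} {b} {ρs} (inj₁ refl) refl r∈ lP lQ lF =
      shape {prolonged = 0} {a = suc a} {b = b} {ρs = ρs} (inj₁ refl) refl (words-P {a} {b} {ρs} r∈) (trans (cong suc lP) (cong suc (sym (+-suc (total ρs) a)))) lQ lF
    fit-shape {s = off} (stepQ y≢ ft) with fit-shape ft
    ... | shape {a = a} {b} {ρs} (inj₁ refl) refl r∈ lP lQ lF =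
      shape {prolonged = 0} {a = a} {b = suc b} {ρs = ρs} (inj₁ refl) refl (words-Q {a} {b} {ρs} r∈) lP (trans (cong suc lQ) (cong suc (sym (+-suc (total ρs) b)))) lF
    fit-shape {s = running} (stepQ y≢ ft) with fit-shape ft
    ... | shape {a = a} {b} {ρs} (inj₁ refl) refl r∈ lP lQ lF =
      shape {prolonged = 0} {a = a} {b = suc b} {ρs = ρs} (inj₁ refl) refl (words-Q {a} {b} {ρs} r∈) lP (trans (cong suc lQ) (cong suc (sym (+-suc (total ρs) b)))) lF
    fit-shape {s = ended} (stepQ y≢ ft) with fit-shape ft
    ... | shape {a = a} {b} {ρs} (inj₁ refl) refl r∈ lP lQ lF =
      shape {prolonged = 0} {a = a} {b = suc b} {ρs = ρs} (inj₁ refl) refl (words-Q {a} {b} {ρs} r∈) lP (trans (cong suc lQ) (cong suc (sym (+-suc (total ρs) b)))) lF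

    fit-length : Fit w s P Q zs → length zs ≡ length w
    fit-length stop         = refl
    fit-length (stepP _ ft) = cong suc (fit-length ft)
    fit-length (stepQ _ ft) = cong suc (fit-length ft)
    fit-length (start _ ft) = cong suc (fit-length ft)
    fit-length (go-on _ ft) = cong suc (fit-length ft)
    fit-length (turn  _ ft) = cong suc (fit-length ft)

    module _ (f : EdgeOrdering n) where

      private
        -- While a run goes on both paths stand at the same vertex; once it has ended, `Q` stands at
        -- a vertex off the rest of `P`. This is what limits where shared edges can occur.
        Position : State → Fin n → List (Fin n) → Fin n → Set
        Position off     x P y = ⊤
        Position running x P y = y ≡ x
        Position ended   x P y = y ∉ x ∷ P

        leave-position : ∀ s {x x′ P y} → Unique (x ∷ x′ ∷ P) → Position s x (x′ ∷ P) y → Position (leave s) x′ P y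
        leave-position off     _  _    = tt
        leave-position running P! refl = Unique[x∷xs]⇒x∉xs P!
        leave-position ended   _  y∉   = y∉ ∘ there

        Above : Edge n → List (Edge n) → Set
        Above e = All (λ z → label f e Fin.< label f z)

        -- The last component says that an edge below both paths is below the merged list. The
        -- induction needs it to place the smaller of the two first edges in front.
        Merged : State → List (Fin n) → List (Fin n) → List (Edge n) → List (Edge n) → Set
        Merged s P Q ps qs = ∃₂ λ w zs → Fit w s P Q zs × Sorted f zs × (∀ e → Above e ps → Above e qs → Above e zs)

        below : ∀ {e e′ zs} → label f e Fin.< label f e′ → Above e′ zs → Above e (e′ ∷ zs)
        below e<e′ above = e<e′ ∷ All.map (Fin.<-trans e<e′) above

        MergeFrom : ∀ s x P y Q → Unique (x ∷ P) → Unique (y ∷ Q) → Set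
        MergeFrom s x P y Q P! Q! = Merged s (x ∷ P) (y ∷ Q) (pathEdges (x ∷ P) P!) (pathEdges (y ∷ Q) Q!)

        -- The comparison of the first labels decides which shorter merge is used. All three come as
        -- arguments, so that the recursion stays in `mergeFrom`, where the lists visibly shrink.
        -- The third is given for every state, as the state after a shared edge depends on its
        -- direction.
        mergeStep : ∀ s x x′ P y y′ Q (P! : Unique (x ∷ x′ ∷ P)) (Q! : Unique (y ∷ y′ ∷ Q)) → Position s x (x′ ∷ P) y →
                  Sorted f (pathEdges (x ∷ x′ ∷ P) P!) → Sorted f (pathEdges (y ∷ y′ ∷ Q) Q!) →
                  MergeFrom (leave s) x′ P y (y′ ∷ Q) (AllPairs.tail P!) Q! →
                  MergeFrom off x (x′ ∷ P) y′ Q P! (AllPairs.tail Q!) →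
                  (∀ s → Position s x′ P y′ → MergeFrom s x′ P y′ Q (AllPairs.tail P!) (AllPairs.tail Q!)) →
                  MergeFrom s x (x′ ∷ P) y (y′ ∷ Q) P! Q!
        mergeStep s x x′ P y y′ Q P!@((x# ∷ _) ∷ P!′) Q!@((y# ∷ _) ∷ Q!′) pos ps@(p< ∷ ps<) qs@(q< ∷ qs<)
          (wᴾ , _ , ftᴾ , zsᴾ< , hiᴾ) (wᵠ , _ , ftᵠ , zsᵠ< , hiᵠ) both
          with Fin.<-cmp (label f (edge x x′ x#)) (label f (edge y y′ y#))
        ... | tri< e<e′ _ _ = onlyP ∷ wᴾ , _ , stepP x# ftᴾ , hiᴾ _ p< (below e<e′ q<) ∷ zsᴾ< ,
                              λ { e (e< ∷ es<) es<′ → e< ∷ hiᴾ e es< es<′ }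
        ... | tri> _ _ e′<e = onlyQ ∷ wᵠ , _ , stepQ y# ftᵠ , hiᵠ _ (below e′<e p<) q< ∷ zsᵠ< ,
                              λ { e es< (e<′ ∷ es<′) → e<′ ∷ hiᵠ e es< es<′ }
        ... | tri≈ _ e≈e′ _ with s | pos | edge-injective x# y# (Bijection.injective f e≈e′)
        ... | off | _ | inj₁ (refl , refl) =
          let _ , _ , ft , zs< , hi = both running refl
          in _ , _ , start x# ft , hi _ p< q< ∷ zs< , λ { e (e< ∷ es<) (_ ∷ es<′) → e< ∷ hi e es< es<′ }
        ... | off | _ | inj₂ (refl , refl) =
          let _ , _ , ft , zs< , hi = both ended (Unique[x∷xs]⇒x∉xs P!)
          in _ , _ , turn x# ft , hi _ p< (subst (λ e → Above e _) (edge-sym y# x#) q<) ∷ zs< ,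
             λ { e (e< ∷ es<) (_ ∷ es<′) → e< ∷ hi e es< es<′ }
        ... | running | refl | inj₁ (refl , refl) =
          let _ , _ , ft , zs< , hi = both running refl
          in _ , _ , go-on x# ft , hi _ p< q< ∷ zs< , λ { e (e< ∷ es<) (_ ∷ es<′) → e< ∷ hi e es< es<′ }
        -- During a run both paths stand at `x`, so a reversed edge would be a loop; after a run `Q`
        -- stands at a vertex that is not on the first edge of `P`.
        ... | running | refl | inj₂ (refl , refl) = contradiction refl x#
        ... | ended   | y∉   | inj₁ (refl , _)    = contradiction (here refl) y∉
        ... | ended   | y∉   | inj₂ (_ , refl)    = contradiction (there (here refl)) y∉

        mergeFrom : ∀ s x P y Q (P! : Unique (x ∷ P)) (Q! : Unique (y ∷ Q)) → Position s x P y →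
                    Sorted f (pathEdges (x ∷ P) P!) → Sorted f (pathEdges (y ∷ Q) Q!) → MergeFrom s x P y Q P! Q!
        mergeFrom s x [] y [] _ _ _ _ _ = [] , [] , stop , [] , λ _ _ _ → []
        mergeFrom s x (x′ ∷ P) y [] P!@((x# ∷ _) ∷ P!′) Q! pos (p< ∷ ps<) qs =
          let w , zs , ft , zs< , hi = mergeFrom (leave s) x′ P y [] P!′ Q! (leave-position s P! pos) ps< []
          in onlyP ∷ w , _ , stepP x# ft , hi _ p< [] ∷ zs< , λ { e (e< ∷ es<) _ → e< ∷ hi e es< [] }
        mergeFrom s x [] y (y′ ∷ Q) P! Q!@((y# ∷ _) ∷ Q!′) pos ps (q< ∷ qs<) =
          let w , zs , ft , zs< , hi = mergeFrom off x [] y′ Q P! Q!′ tt [] qs<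
          in onlyQ ∷ w , _ , stepQ y# ft , hi _ [] q< ∷ zs< , λ { e _ (e< ∷ es<) → e< ∷ hi e [] es< }
        mergeFrom s x (x′ ∷ P) y (y′ ∷ Q) P! Q! pos ps qs = mergeStep s x x′ P y y′ Q P! Q! pos ps qs
          (mergeFrom (leave s) x′ P y (y′ ∷ Q) (AllPairs.tail P!) Q! (leave-position s P! pos) (AllPairs.tail ps) qs)
          (mergeFrom off x (x′ ∷ P) y′ Q P! (AllPairs.tail Q!) tt ps (AllPairs.tail qs))
          (λ s pos → mergeFrom s x′ P y′ Q (AllPairs.tail P!) (AllPairs.tail Q!) pos (AllPairs.tail ps) (AllPairs.tail qs))

      merge : ∀ {x P y Q} (P! : Unique (x ∷ P)) (Q! : Unique (y ∷ Q)) →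
              Sorted f (pathEdges (x ∷ P) P!) → Sorted f (pathEdges (y ∷ Q) Q!) →
              ∃₂ λ w zs → Fit w off (x ∷ P) (y ∷ Q) zs × Sorted f zs
      merge P! Q! ps qs = let w , zs , ft , zs< , _ = mergeFrom off _ _ _ _ P! Q! tt ps qs in w , zs , ft , zs<

-- First and second moment of the number of increasing Hamiltonian paths

module SecondMoment where

  open import Defs using (Edge; edge; EdgeOrdering; pathEdges; edgeOrderings; Enumeration; HasIncreasingHamiltonianPath)
  open Counting
  open Arrangements
  open Switching using (undirected; _≟²_)
  open Planting
  open Orderings
  open Words
  open Merging
  import Data.Fin.Properties as Fin
  import Data.List.Membership.DecPropositional as DecMembership
  open import Data.List.Membership.Propositional.Properties
  import Data.List.Relation.Unary.Linked.Properties as Linked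
  open import Data.List.Relation.Unary.Unique.Propositional.Properties using (allFin⁺)
  open import Data.Nat.Base
  open import Data.Nat.Properties as ℕ hiding (_≟_)

  private
    variable
      n : ℕ

  pathEdges-joins : ∀ (P : List (Fin n)) (P! : Unique P) {z} → z ∈ pathEdges P P! →
                    ∃₂ λ u v → u ∈ P × v ∈ P × Joins (u , v) z
  pathEdges-joins (x ∷ y ∷ P) ((x# ∷ _) ∷ _) (here refl) = x , y , here refl , there (here refl) , x# , refl
  pathEdges-joins (x ∷ y ∷ P) (_ ∷ P!)       (there z∈)  =
    let u , v , u∈ , v∈ , j = pathEdges-joins (y ∷ P) P! z∈ in u , v , there u∈ , there v∈ , j

  pathEdges-unique : ∀ (P : List (Fin n)) (P! : Unique P) → Unique (pathEdges P P!)
  pathEdges-unique []          _  = []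
  pathEdges-unique (x ∷ [])    _  = []
  pathEdges-unique (x ∷ y ∷ P) (x#@(x≢y ∷ _) ∷ P!) =
    All.tabulate new ∷ pathEdges-unique (y ∷ P) P!
    where
    new : ∀ {z} → z ∈ pathEdges (y ∷ P) P! → edge x y x≢y ≢ z
    new z∈ refl with pathEdges-joins (y ∷ P) P! z∈
    ... | u , v , u∈ , v∈ , u≢v , eq with edge-injective x≢y u≢v eq
    ... | inj₁ (refl , _) = All.lookup x# u∈ refl
    ... | inj₂ (refl , _) = All.lookup x# v∈ refl

  length-pathEdges : ∀ (P : List (Fin n)) .(P! : Unique P) → length (pathEdges P P!) ≡ pred (length P)
  length-pathEdges []          _  = refl
  length-pathEdges (x ∷ [])    _  = refl
  length-pathEdges (x ∷ y ∷ P) P! = cong suc (length-pathEdges (y ∷ P) (AllPairs.tail P!))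

  trailEdges : List Letter → List (Fin n) → List (Fin n) → List (Edge n)
  trailEdges w P Q = links (trail w P Q)

  module _ (N : ℕ) where

    private
      n′ = suc N
      V  = Fin n′
      V! = allFin⁺ n′

    open Enumeration (edgeOrderings n′) using () renaming (elements to Ω)

    H : List (List V)
    H = hamiltonian Fin._≟_ V!

    private
      |V| : length (allFin n′) ≡ n′
      |V| = length-tabulate {n = n′} (λ i → i)

    H⁻ : ∀ {P} → P ∈ H → Unique P × length P ≡ n′
    H⁻ P∈ = let P! , _ , len = ∈-arrangements⁻ Fin._≟_ (length (allFin n′)) {p = allFin n′} P∈ in P! , trans len |V|

    length-H : length H ≡ n′ !
    length-H = trans (length-arrangements Fin._≟_ V!) (cong _! |V|)

    increasing? : ∀ (f : EdgeOrdering n′) P → Dec (Sorted f (links (pairs P)))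
    increasing? f P = sorted? f (links (pairs P))

    X : EdgeOrdering n′ → ℕ
    X f = ∑ H (λ P → 𝟙 (increasing? f P))

    sorted-links⇒ : ∀ (f : EdgeOrdering n′) {P} (P! : Unique P) → Sorted f (links (pairs P)) → Sorted f (pathEdges P P!)
    sorted-links⇒ f {P} P! = subst (Sorted f) (sym (pathEdges-links P P!))

    X-positive : ∀ (f : EdgeOrdering n′) → 0 < X f → HasIncreasingHamiltonianPath f
    X-positive f 0<X with Any.any? (increasing? f) H
    ... | no none  = contradiction 0<X (<-irrefl (sym (trans
            (∑-cong H (λ {P} P∈ → 𝟙-no (increasing? f P) (λ s → none (Any.map (λ { refl → s }) P∈)))) (∑-0 H))))
    ... | yes some with find some
    ... | P , P∈ , s = record { vertices = P ; simple = P! } , Linked.AllPairs⇒Linked (sorted-links⇒ f P! s) ,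
            λ v → Unique-⊆⇒⊇ Fin._≟_ V! P! (trans len (sym |V|)) (λ _ → ∈-allFin _) (∈-allFin v)
      where
      P!  = proj₁ (H⁻ P∈)
      len = proj₂ (H⁻ P∈)

    firstMoment : N ! * ∑ Ω X ≡ n′ ! * length Ω
    firstMoment = begin
      N ! * ∑ Ω X
        ≡⟨ cong (N ! *_) (∑-swap Ω H (λ f P → 𝟙 (increasing? f P))) ⟩
      N ! * ∑ H (λ P → sortedCount (links (pairs P)))
        ≡⟨ ∑-*ˡ (N !) H _ ⟨
      ∑ H (λ P → N ! * sortedCount (links (pairs P)))
        ≡⟨ ∑-cong H (λ {P} P∈ → perPath P P∈) ⟩
      ∑ H (const (length Ω))
        ≡⟨ ∑-const H (length Ω) ⟩
      length H * length Ω
        ≡⟨ cong (_* length Ω) length-H ⟩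
      n′ ! * length Ω ∎
      where
      open ≡-Reasoning
      perPath : ∀ P → P ∈ H → N ! * sortedCount (links (pairs P)) ≡ length Ω
      perPath P P∈ = begin
        N ! * sortedCount (links (pairs P))
          ≡⟨ cong₂ (λ k es → k ! * sortedCount es) (sym (trans (length-pathEdges P P!) (cong pred len))) (sym (pathEdges-links P P!)) ⟩
        length (pathEdges P P!) ! * sortedCount (pathEdges P P!)
          ≡⟨ sortedCount-unique (pathEdges-unique P P!) ⟩
        length Ω ∎
        where
        P!  = proj₁ (H⁻ P∈)
        len = proj₂ (H⁻ P∈)

    -- Merged words in which k edges are shared, in m runs; each path then has N ∸ k edges of its own.
    module Class (k m : ℕ) where

      private
        a = N ∸ k

      -- The two conditions on lengths hold for every pair that comes from a merge. Imposing them
      -- makes the later bounds immediate, with no analysis of words that fit no pair.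
      Good : List V → List Letter → List V → Set
      Good P w Q = Agree (template w off P) Q
                 × All (_∉ undirected (pairs P)) (steps (template w off P) Q)
                 × length (trailEdges w P Q) ≡ a + a + k
                 × length (fixedOf (template w off P)) ≡ k + m

      good? : ∀ P w Q → Dec (Good P w Q)
      good? P w Q = agree? Fin._≟_ (template w off P) Q
        ×-dec All.all? (λ s → ¬? (DecMembership._∈?_ (_≟²_ Fin._≟_) s (undirected (pairs P)))) (steps (template w off P) Q)
        ×-dec (length (trailEdges w P Q) ℕ.≟ a + a + k)
        ×-dec (length (fixedOf (template w off P)) ℕ.≟ k + m)

      goodCount : List V → List Letter → ℕ
      goodCount P w = length (filter (good? P w) H)

      classSum : List V → ℕ
      classSum P = ∑ (runs m k) λ ρs → ∑ (words a a ρs) λ w → ∑ H λ Q → 𝟙 (good? P w Q) * sortedCount (trailEdges w P Q)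

      classSum-bound : ∀ P → (a + a + k) ! * classSum P ≤ ∑ (runs m k) (λ ρs → ∑ (words a a ρs) (goodCount P)) * length Ω
      classSum-bound P = begin
        (a + a + k) ! * classSum P
          ≡⟨ ∑-*ˡ ((a + a + k) !) (runs m k) _ ⟨
        ∑ (runs m k) (λ ρs → (a + a + k) ! * ∑ (words a a ρs) (λ w → ∑ H λ Q → 𝟙 (good? P w Q) * sortedCount (trailEdges w P Q)))
          ≤⟨ ∑-mono (runs m k) (λ {ρs} _ → begin
              (a + a + k) ! * ∑ (words a a ρs) (λ w → ∑ H λ Q → 𝟙 (good? P w Q) * sortedCount (trailEdges w P Q))
                ≡⟨ ∑-*ˡ ((a + a + k) !) (words a a ρs) _ ⟨
              ∑ (words a a ρs) (λ w → (a + a + k) ! * ∑ H λ Q → 𝟙 (good? P w Q) * sortedCount (trailEdges w P Q))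
                ≤⟨ ∑-mono (words a a ρs) (λ {w} _ → perWord w) ⟩
              ∑ (words a a ρs) (λ w → goodCount P w * length Ω)
                ≡⟨ ∑-*ʳ (length Ω) (words a a ρs) (goodCount P) ⟩
              ∑ (words a a ρs) (goodCount P) * length Ω ∎) ⟩
        ∑ (runs m k) (λ ρs → ∑ (words a a ρs) (goodCount P) * length Ω)
          ≡⟨ ∑-*ʳ (length Ω) (runs m k) _ ⟩
        ∑ (runs m k) (λ ρs → ∑ (words a a ρs) (goodCount P)) * length Ω ∎
        where
        open ≤-Reasoning
        perPair : ∀ w Q → (a + a + k) ! * (𝟙 (good? P w Q) * sortedCount (trailEdges w P Q)) ≤ 𝟙 (good? P w Q) * length Ω
        perPair w Q with good? P w Q
        ... | no  _ = ≤-reflexive (*-zeroʳ ((a + a + k) !))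
        ... | yes (_ , _ , len , _) = begin
          (a + a + k) ! * (1 * sortedCount (trailEdges w P Q))
            ≡⟨ cong₂ (λ l c → l ! * c) (sym len) (*-identityˡ (sortedCount (trailEdges w P Q))) ⟩
          length (trailEdges w P Q) ! * sortedCount (trailEdges w P Q)
            ≤⟨ sortedCount-bound (trailEdges w P Q) ⟩
          length Ω
            ≡⟨ *-identityˡ (length Ω) ⟨
          1 * length Ω ∎
        perWord : ∀ w → (a + a + k) ! * ∑ H (λ Q → 𝟙 (good? P w Q) * sortedCount (trailEdges w P Q)) ≤ goodCount P w * length Ω
        perWord w = begin
          (a + a + k) ! * ∑ H (λ Q → 𝟙 (good? P w Q) * sortedCount (trailEdges w P Q))
            ≡⟨ ∑-*ˡ ((a + a + k) !) H _ ⟨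
          ∑ H (λ Q → (a + a + k) ! * (𝟙 (good? P w Q) * sortedCount (trailEdges w P Q)))
            ≤⟨ ∑-mono H (λ {Q} _ → perPair w Q) ⟩
          ∑ H (λ Q → 𝟙 (good? P w Q) * length Ω)
            ≡⟨ ∑-*ʳ (length Ω) H _ ⟩
          ∑ H (λ Q → 𝟙 (good? P w Q)) * length Ω
            ≡⟨ cong (_* length Ω) (length-filter (good? P w) H) ⟨
          goodCount P w * length Ω ∎

      length-wordsʳ : ∀ {ρs} → ρs ∈ runs m k → length (words a a ρs) * (a ! * (a ! * m !)) ≡ (a + a + m) !
      length-wordsʳ {ρs} ρs∈ with ∈-runs⁻ m k ρs∈
      ... | refl , _ = length-words a a ρs

    open Class public

    private
      pairSum : EdgeOrdering n′ → List V → List V → ℕ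
      pairSum f P Q = ∑ (upTo n′) λ k → ∑ (upTo (suc k)) λ m → ∑ (runs m k) λ ρs → ∑ (words (N ∸ k) (N ∸ k) ρs) λ w →
        𝟙 (good? k m P w Q) * 𝟙 (sorted? f (trailEdges w P Q))

      -- The word of the merged paths, with its `k`, `m` and run codes, picks out one summand of
      -- `pairSum` that equals 1.
      pair-≤ : ∀ (f : EdgeOrdering n′) {P Q} → P ∈ H → Q ∈ H → 𝟙 (increasing? f P) * 𝟙 (increasing? f Q) ≤ pairSum f P Q
      pair-≤ f {P} {Q} P∈ Q∈ with increasing? f P | increasing? f Q
      ... | no  _ | _     = z≤n
      ... | yes _ | no  _ = z≤n
      pair-≤ f {[]}    {_}     P∈ Q∈ | yes p | yes q = contradiction (proj₂ (H⁻ P∈)) λ ()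
      pair-≤ f {_ ∷ _} {[]}    P∈ Q∈ | yes p | yes q = contradiction (proj₂ (H⁻ Q∈)) λ ()
      pair-≤ f {P@(x ∷ P′)} {Q@(y ∷ Q′)} P∈ Q∈ | yes p | yes q = found
        (let w , zs , ft , zs< = merge f P! Q! (sorted-links⇒ f P! p) (sorted-links⇒ f Q! q) in w , zs , ft , zs< , fit-shape ft)
        where
        P! = proj₁ (H⁻ P∈)
        Q! = proj₁ (H⁻ Q∈)

        own : ∀ {R c t a} → R ∈ H → length R ≡ suc (c + t + a) → c ≡ 0 → a ≡ N ∸ t × t < n′
        own {t = t} {a} R∈ lenR refl = trans (sym (m+n∸m≡n t a)) (cong (_∸ t) t+a≡N) , s≤s (≤-trans (m≤m+n t a) (≤-reflexive t+a≡N))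
          where t+a≡N = suc-injective (trans (sym lenR) (proj₂ (H⁻ R∈)))

        found : (∃₂ λ w zs → Fit w off P Q zs × Sorted f zs × Shape w off P Q) → 1 ≤ pairSum f P Q
        found (w , zs , ft , zs< , shape (inj₂ ()) _ _ _ _ _)
        found (w , zs , ft , zs< , shape {a = a} {b} {ρs} (inj₁ refl) refl w∈ lP lQ lF) with own {c = 0} {t = total ρs} P∈ lP refl | own {c = 0} {t = total ρs} Q∈ lQ refl
        ... | refl , k< | refl , _ = begin
          1
            ≡⟨ cong₂ _*_ (𝟙-yes (good? k m P w Q) good) (𝟙-yes (sorted? f (trailEdges w P Q)) (subst (Sorted f) (sym (fit-trail ft)) zs<)) ⟨
          𝟙 (good? k m P w Q) * 𝟙 (sorted? f (trailEdges w P Q))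
            ≤⟨ ∑-∈ {g = λ w → 𝟙 (good? k m P w Q) * 𝟙 (sorted? f (trailEdges w P Q))} w∈ ⟩
          _ ≤⟨ ∑-∈ {g = λ ρs → ∑ (words (N ∸ k) (N ∸ k) ρs) λ w → 𝟙 (good? k m P w Q) * 𝟙 (sorted? f (trailEdges w P Q))} (∈-runs ρs) ⟩
          _ ≤⟨ ∑-∈ {g = λ m → ∑ (runs m k) λ ρs → ∑ (words (N ∸ k) (N ∸ k) ρs) λ w → 𝟙 (good? k m P w Q) * 𝟙 (sorted? f (trailEdges w P Q))}
                 (∈-upTo⁺ (s≤s (length≤total ρs))) ⟩
          _ ≤⟨ ∑-∈ {g = λ k → ∑ (upTo (suc k)) λ m → ∑ (runs m k) λ ρs → ∑ (words (N ∸ k) (N ∸ k) ρs) λ w → 𝟙 (good? k m P w Q) * 𝟙 (sorted? f (trailEdges w P Q))}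
                 (∈-upTo⁺ k<) ⟩
          pairSum f P Q ∎
          where
          open ≤-Reasoning
          k = total ρs
          m = length ρs
          good : Good k m P w Q
          good = fit-agree ft , All.map (Private.∉path) (fit-private P! Q! (sorted⇒unique f zs<) ft) ,
                 trans (trans (cong length (fit-trail ft)) (fit-length ft)) (∈-words-length a b ρs w∈) , lF

      ∑-swap₄ : ∀ {A B C D : Set} (F : A → List B) (G : A → B → List C) (as : List A) (ds : List D) (g : A → B → C → D → ℕ) →
                ∑ ds (λ d → ∑ as λ a → ∑ (F a) λ b → ∑ (G a b) λ c → g a b c d) ≡ ∑ as λ a → ∑ (F a) λ b → ∑ (G a b) λ c → ∑ ds (g a b c)
      ∑-swap₄ F G as ds g = trans (∑-swap ds as _) (∑-cong as λ {a} _ →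
        trans (∑-swap ds (F a) _) (∑-cong (F a) λ {b} _ → ∑-swap ds (G a b) _))

      pairSum-swap : ∀ P → ∑ H (λ Q → ∑ Ω λ f → pairSum f P Q) ≡ ∑ (upTo n′) λ k → ∑ (upTo (suc k)) λ m → classSum k m P
      pairSum-swap P = begin
        ∑ H (λ Q → ∑ Ω λ f → pairSum f P Q)
          ≡⟨ ∑-cong H (λ {Q} _ → ∑-swap₄ (upTo ∘ suc) (λ k m → runs m k) (upTo n′) Ω _) ⟩
        ∑ H (λ Q → ∑ (upTo n′) λ k → ∑ (upTo (suc k)) λ m → ∑ (runs m k) λ ρs → ∑ Ω λ f → ∑ (words (N ∸ k) (N ∸ k) ρs) λ w → g f Q k m w)
          ≡⟨ ∑-swap₄ (upTo ∘ suc) (λ k m → runs m k) (upTo n′) H _ ⟩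
        ∑ (upTo n′) (λ k → ∑ (upTo (suc k)) λ m → ∑ (runs m k) λ ρs → ∑ H λ Q → ∑ Ω λ f → ∑ (words (N ∸ k) (N ∸ k) ρs) λ w → g f Q k m w)
          ≡⟨ ∑-cong (upTo n′) (λ {k} _ → ∑-cong (upTo (suc k)) λ {m} _ → ∑-cong (runs m k) λ {ρs} _ → begin
              ∑ H (λ Q → ∑ Ω λ f → ∑ (words (N ∸ k) (N ∸ k) ρs) λ w → g f Q k m w)
                ≡⟨ ∑-cong H (λ {Q} _ → trans (∑-swap Ω (words (N ∸ k) (N ∸ k) ρs) (λ f w → g f Q k m w))
                    (∑-cong (words (N ∸ k) (N ∸ k) ρs) λ {w} _ → ∑-*ˡ (𝟙 (good? k m P w Q)) Ω (λ f → 𝟙 (sorted? f (trailEdges w P Q))))) ⟩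
              ∑ H (λ Q → ∑ (words (N ∸ k) (N ∸ k) ρs) λ w → 𝟙 (good? k m P w Q) * sortedCount (trailEdges w P Q))
                ≡⟨ ∑-swap H (words (N ∸ k) (N ∸ k) ρs) _ ⟩
              ∑ (words (N ∸ k) (N ∸ k) ρs) (λ w → ∑ H λ Q → 𝟙 (good? k m P w Q) * sortedCount (trailEdges w P Q)) ∎) ⟩
        ∑ (upTo n′) (λ k → ∑ (upTo (suc k)) λ m → classSum k m P) ∎
        where
        open ≡-Reasoning
        g = λ f Q k m w → 𝟙 (good? k m P w Q) * 𝟙 (sorted? f (trailEdges w P Q))

    secondMoment : ∑ Ω (λ f → X f * X f) ≤ ∑ H λ P → ∑ (upTo n′) λ k → ∑ (upTo (suc k)) λ m → classSum k m P
    secondMoment = begin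
      ∑ Ω (λ f → X f * X f)
        ≡⟨ ∑-cong Ω (λ {f} _ → trans (sym (∑-*ʳ (X f) H _)) (∑-cong H λ {P} _ → sym (∑-*ˡ (𝟙 (increasing? f P)) H _))) ⟩
      ∑ Ω (λ f → ∑ H λ P → ∑ H λ Q → 𝟙 (increasing? f P) * 𝟙 (increasing? f Q))
        ≤⟨ ∑-mono Ω (λ {f} _ → ∑-mono H λ P∈ → ∑-mono H λ Q∈ → pair-≤ f P∈ Q∈) ⟩
      ∑ Ω (λ f → ∑ H λ P → ∑ H λ Q → pairSum f P Q)
        ≡⟨ trans (∑-swap Ω H _) (∑-cong H λ {P} _ → ∑-swap Ω H (λ f Q → pairSum f P Q)) ⟩
      ∑ H (λ P → ∑ H λ Q → ∑ Ω λ f → pairSum f P Q)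
        ≡⟨ ∑-cong H (λ {P} _ → pairSum-swap P) ⟩
      ∑ H (λ P → ∑ (upTo n′) λ k → ∑ (upTo (suc k)) λ m → classSum k m P) ∎
      where open ≤-Reasoning

-- The paths of a class and their hit counts

module GoodCount where

  open Counting
  open Arrangements
  open Planting
  open Words
  open Merging
  open SecondMoment
  import Data.Fin.Properties as Fin
  open import Data.List.Membership.Propositional.Properties using (∈-filter⁺; ∈-filter⁻)
  open import Data.List.Relation.Unary.Unique.Propositional.Properties using (allFin⁺; filter⁺)
  open import Data.Nat.Base
  open import Data.Nat.Properties

  -- s i counts the members of a family of size at most T that have at most i hits, u i counts their hits,
  -- and g is the number of members without hits.
  record HitCounts (g T Λ M : ℕ) : Set where
    field
      s u    : ℕ → ℕ
      g≤s    : g ≤ s 0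
      s≤T    : ∀ i → s i ≤ T
      u-zero : u 0 ≡ 0
      u-suc  : ∀ i → u (suc i) + suc i * s i ≡ u i + suc i * s (suc i)
      switch : ∀ i → s i * Λ ≤ u (suc i) * M

  module _ {A : Set} (xs : List A) (h : A → ℕ) where

    private
      upTo′ : ℕ → List A
      upTo′ i = filter (λ x → h x ≤? i) xs

    ∑-atMost-zero : ∑ (upTo′ 0) h ≡ 0
    ∑-atMost-zero = trans (∑-cong (upTo′ 0) λ x∈ → n≤0⇒n≡0 (proj₂ (∈-filter⁻ (λ x → h x ≤? 0) {xs = xs} x∈))) (∑-0 (upTo′ 0))

    -- The two families differ by the members with exactly `suc i` hits, each of which adds `suc i`
    -- to the sum of the hits and 1 to the number of members.
    ∑-atMost-suc : ∀ i → ∑ (upTo′ (suc i)) h + suc i * length (upTo′ i) ≡ ∑ (upTo′ i) h + suc i * length (upTo′ (suc i))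
    ∑-atMost-suc i = begin
      ∑ (upTo′ (suc i)) h + suc i * length (upTo′ i)
        ≡⟨ expand (suc i) i ⟩
      ∑ xs (λ x → 𝟙 (h x ≤? suc i) * h x + suc i * 𝟙 (h x ≤? i))
        ≡⟨ ∑-cong xs (λ {x} _ → pointwise (h x)) ⟩
      ∑ xs (λ x → 𝟙 (h x ≤? i) * h x + suc i * 𝟙 (h x ≤? suc i))
        ≡⟨ expand i (suc i) ⟨
      ∑ (upTo′ i) h + suc i * length (upTo′ (suc i)) ∎
      where
      open ≡-Reasoning
      expand : ∀ a b → ∑ (upTo′ a) h + suc i * length (upTo′ b) ≡ ∑ xs (λ x → 𝟙 (h x ≤? a) * h x + suc i * 𝟙 (h x ≤? b))
      expand a b = trans (cong₂ _+_ (∑-filter (λ x → h x ≤? a) xs h)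
        (trans (cong (suc i *_) (length-filter (λ x → h x ≤? b) xs)) (sym (∑-*ˡ (suc i) xs _)))) (sym (∑-+ xs _ _))
      pointwise : ∀ y → 𝟙 (y ≤? suc i) * y + suc i * 𝟙 (y ≤? i) ≡ 𝟙 (y ≤? i) * y + suc i * 𝟙 (y ≤? suc i)
      pointwise y with y ≤? i | y ≤? suc i
      ... | yes _   | yes _   = refl
      ... | yes y≤i | no y≰i′ = contradiction (m≤n⇒m≤1+n y≤i) y≰i′
      ... | no  _   | no  _   = refl
      ... | no y≰i  | yes y≤i′ with ≤-antisym y≤i′ (≰⇒> y≰i)
      ... | refl = trans (cong₂ _+_ (*-identityˡ (suc i)) (*-zeroʳ (suc i))) (trans (+-identityʳ (suc i)) (sym (*-identityʳ (suc i))))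

  module _ (N k m : ℕ) {P : List (Fin (suc N))} (P∈ : P ∈ H N) (w : List Letter) where

    private
      n = suc N

      |V| : length (allFin n) ≡ n
      |V| = length-tabulate {n = n} id

      τ = template w off P

      goods = filter (good? N k m P w) (H N)

      planted-goods : ∀ {Q} → Q ∈ goods → Q ∈ planted Fin._≟_ (allFin⁺ n) τ
      planted-goods Q∈ with ∈-filter⁻ (good? N k m P w) {xs = H N} Q∈
      ... | Q∈H , a , _ = ∈-filter⁺ (agree? Fin._≟_ τ) Q∈H a

      goods! = filter⁺ (good? N k m P w) (arrangements-unique Fin._≟_ (length (allFin n)) (allFin⁺ n))

      -- Every bound on a planted family starts from one path that agrees with the template. If none
      -- exists the count is 0, which is the other alternative in the results below.
      module Witness {Q} (Q∈ : Q ∈ goods) where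
        Q∈H = proj₁ (∈-filter⁻ (good? N k m P w) {xs = H N} Q∈)
        agree = proj₁ (proj₂ (∈-filter⁻ (good? N k m P w) {xs = H N} Q∈))
        fixed≡ : length (fixedOf τ) ≡ k + m
        fixed≡ = proj₂ (proj₂ (proj₂ (proj₂ (∈-filter⁻ (good? N k m P w) {xs = H N} Q∈))))

        k+m≤n : k + m ≤ n
        k+m≤n = begin
          k + m                                        ≡⟨ fixed≡ ⟨
          length (fixedOf τ)                           ≤⟨ m≤n+m _ (length (freeOf τ Q)) ⟩
          length (freeOf τ Q) + length (fixedOf τ)     ≡⟨ length-freeOf agree ⟩
          length Q                                     ≡⟨ proj₂ (H⁻ N Q∈H) ⟩
          n                                            ∎
          where open ≤-Reasoning

        planted≤ : length (planted Fin._≟_ (allFin⁺ n) τ) ≤ (n ∸ (k + m)) !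
        planted≤ = subst₂ (λ a t → length (planted Fin._≟_ (allFin⁺ n) τ) ≤ (a ∸ t) !) |V| fixed≡
          (planted-length Fin._≟_ (allFin⁺ n) Q∈H agree)

        hitCounts : ∀ d → d + (45 + 2 * (k + m)) ≤ n →
                    HitCounts (goodCount N k m P w) ((n ∸ (k + m)) !) (2 * (d * d)) (n * n)
        hitCounts d d≤ = record
          { s      = λ i → length (few i)
          ; u      = λ i → ∑ (few i) hits
          ; g≤s    = length-inj id goods! (λ {R} R∈ → ∈-filter⁺ (λ q → hits q ≤? 0) (planted-goods R∈)
                       (≤-reflexive (freeHits-avoiding Fin._≟_ (allFin⁺ n) Q∈H agree P∈
                         (proj₁ (proj₂ (proj₂ (∈-filter⁻ (good? N k m P w) {xs = H N} R∈)))))))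
                       (λ _ _ eq → eq)
          ; s≤T    = λ i → ≤-trans (length-inj {ys = planted Fin._≟_ (allFin⁺ n) τ} id (filter⁺ (λ q → hits q ≤? i)
                       (filter⁺ (agree? Fin._≟_ τ) (arrangements-unique Fin._≟_ (length (allFin n)) (allFin⁺ n))))
                       (λ q∈ → proj₁ (∈-filter⁻ (λ q → hits q ≤? i) {xs = planted Fin._≟_ (allFin⁺ n) τ} q∈)) (λ _ _ eq → eq)) planted≤
          ; u-zero = ∑-atMost-zero (planted Fin._≟_ (allFin⁺ n) τ) hits
          ; u-suc  = ∑-atMost-suc (planted Fin._≟_ (allFin⁺ n) τ) hits
          ; switch = λ i → subst (λ a → length (few i) * (2 * (d * d)) ≤ ∑ (few (suc i)) hits * (a * a)) |V|
                       (planted-switching Fin._≟_ (allFin⁺ n) Q∈H agree P∈ d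
                         (subst₂ (λ a t → d + (45 + 2 * t) ≤ a) (sym |V|) (sym fixed≡) d≤) i)
          }
          where
          hits = freeHits Fin._≟_ (allFin⁺ n) Q∈H agree P∈
          few  = atMost Fin._≟_ (allFin⁺ n) Q∈H agree P∈

    -- `k + m ≤ n` is recorded because truncated subtraction would otherwise produce `0 !`, which is
    -- 1, for a class that is empty. The guard in `entry` relies on it.
    goodCount-bound : goodCount N k m P w ≡ 0 ⊎ k + m ≤ n × goodCount N k m P w ≤ (n ∸ (k + m)) !
    goodCount-bound with goods in eq
    ... | []     = inj₁ refl
    ... | Q ∷ Qs = inj₂ (Witness.k+m≤n Q∈ , subst (λ l → length l ≤ (n ∸ (k + m)) !) eq
        (≤-trans (length-inj {ys = planted Fin._≟_ (allFin⁺ n) τ} id goods! planted-goods (λ _ _ eq → eq)) (Witness.planted≤ Q∈)))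
      where Q∈ = subst (Q ∈_) (sym eq) (here refl)

    goodCount-hits : ∀ d → d + (45 + 2 * (k + m)) ≤ n →
                     goodCount N k m P w ≡ 0 ⊎ HitCounts (goodCount N k m P w) ((n ∸ (k + m)) !) (2 * (d * d)) (n * n)
    goodCount-hits d d≤ = byCases goods refl
      where
      byCases : ∀ gs → goods ≡ gs → length gs ≡ 0 ⊎ HitCounts (length gs) ((n ∸ (k + m)) !) (2 * (d * d)) (n * n)
      byCases []      _  = inj₁ refl
      byCases (Q ∷ _) eq = inj₂ (subst (λ gs → HitCounts (length gs) ((n ∸ (k + m)) !) (2 * (d * d)) (n * n)) eq
        (Witness.hitCounts (subst (Q ∈_) (sym eq) (here refl)) d d≤))

-- Rational arithmetic and sums over initial segments

module Rationals where

  open import Defs using (1/_!; 1/denominator≤)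
  open Counting using (∑; ∑-++)
  open import Data.Integer.Base as ℤ using (+_)
  import Data.Integer.Properties as ℤ
  open import Data.Nat.Base as ℕ using (ℕ; zero; suc; _!)
  import Data.Nat.Properties as ℕ
  open import Data.Rational.Base hiding (1/_)
  open import Data.Rational.Properties
  import Data.Rational.Unnormalised.Base as ℚᵘ
  import Data.Rational.Unnormalised.Properties as ℚᵘ
  open import Tactic.RingSolver using (solve-∀)
  open import Tactic.RingSolver.Core.AlmostCommutativeRing using (AlmostCommutativeRing; fromCommutativeRing)
  open import Level using (0ℓ)

  ℚ-ring : AlmostCommutativeRing 0ℓ 0ℓ
  ℚ-ring = fromCommutativeRing +-*-commutativeRing isZero?
    where
    isZero? : ∀ x → Maybe (0ℚ ≡ x)
    isZero? x with 0ℚ ≟ x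
    ... | yes eq = just eq
    ... | no  _  = nothing

  ι : ℕ → ℚ
  ι m = + m / 1

  private
    ι-toℚᵘ : ∀ m → toℚᵘ (ι m) ℚᵘ.≃ ℚᵘ.mkℚᵘ (+ m) 0
    ι-toℚᵘ m = toℚᵘ-fromℚᵘ (ℚᵘ.mkℚᵘ (+ m) 0)

  ι-+ : ∀ a b → ι (a ℕ.+ b) ≡ ι a + ι b
  ι-+ a b = toℚᵘ-injective (begin-equality
    toℚᵘ (ι (a ℕ.+ b))                             ≃⟨ ι-toℚᵘ (a ℕ.+ b) ⟩
    ℚᵘ.mkℚᵘ (+ (a ℕ.+ b)) 0                        ≃⟨ ℚᵘ.*≡* (cong (ℤ._* + 1) (trans (ℤ.pos-+ a b)
                                                       (sym (cong₂ ℤ._+_ (ℤ.*-identityʳ (+ a)) (ℤ.*-identityʳ (+ b)))))) ⟩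
    ℚᵘ.mkℚᵘ (+ a) 0 ℚᵘ.+ ℚᵘ.mkℚᵘ (+ b) 0           ≃⟨ ℚᵘ.+-cong (ι-toℚᵘ a) (ι-toℚᵘ b) ⟨
    toℚᵘ (ι a) ℚᵘ.+ toℚᵘ (ι b)                     ≃⟨ toℚᵘ-homo-+ (ι a) (ι b) ⟨
    toℚᵘ (ι a + ι b)                               ∎)
    where open ℚᵘ.≤-Reasoning

  ι-* : ∀ a b → ι (a ℕ.* b) ≡ ι a * ι b
  ι-* a b = toℚᵘ-injective (begin-equality
    toℚᵘ (ι (a ℕ.* b))                             ≃⟨ ι-toℚᵘ (a ℕ.* b) ⟩
    ℚᵘ.mkℚᵘ (+ (a ℕ.* b)) 0                        ≃⟨ ℚᵘ.*≡* (cong (ℤ._* + 1) (ℤ.pos-* a b)) ⟩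
    ℚᵘ.mkℚᵘ (+ a) 0 ℚᵘ.* ℚᵘ.mkℚᵘ (+ b) 0           ≃⟨ ℚᵘ.*-cong (ι-toℚᵘ a) (ι-toℚᵘ b) ⟨
    toℚᵘ (ι a) ℚᵘ.* toℚᵘ (ι b)                     ≃⟨ toℚᵘ-homo-* (ι a) (ι b) ⟨
    toℚᵘ (ι a * ι b)                               ∎)
    where open ℚᵘ.≤-Reasoning

  ι-mono : ∀ {a b} → a ℕ.≤ b → ι a ≤ ι b
  ι-mono {a} {b} a≤b = toℚᵘ-cancel-≤ (begin
    toℚᵘ (ι a)       ≃⟨ ι-toℚᵘ a ⟩
    ℚᵘ.mkℚᵘ (+ a) 0  ≤⟨ ℚᵘ.*≤* (ℤ.*-monoʳ-≤-nonNeg (+ 1) (ℤ.+≤+ a≤b)) ⟩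
    ℚᵘ.mkℚᵘ (+ b) 0  ≃⟨ ι-toℚᵘ b ⟨
    toℚᵘ (ι b)       ∎)
    where open ℚᵘ.≤-Reasoning

  0≤ι : ∀ a → 0ℚ ≤ ι a
  0≤ι a = ι-mono (ℕ.z≤n {a})

  ι-suc : ∀ a → ι (suc a) ≡ 1ℚ + ι a
  ι-suc a = ι-+ 1 a

  0<ι : ∀ a .{{_ : ℕ.NonZero a}} → 0ℚ < ι a
  0<ι (suc a) = <-≤-trans (positive⁻¹ 1ℚ) (ι-mono (ℕ.s≤s (ℕ.z≤n {a})))

  *-mono : ∀ {p q r s} → 0ℚ ≤ p → 0ℚ ≤ s → p ≤ q → r ≤ s → p * r ≤ q * s
  *-mono {p} {q} {r} {s} 0≤p 0≤s p≤q r≤s = ≤-trans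
    (*-monoˡ-≤-nonNeg p {{nonNegative 0≤p}} r≤s)
    (*-monoʳ-≤-nonNeg s {{nonNegative 0≤s}} p≤q)

  0≤* : ∀ {p q} → 0ℚ ≤ p → 0ℚ ≤ q → 0ℚ ≤ p * q
  0≤* {p} {q} 0≤p 0≤q = subst (_≤ p * q) (*-zeroʳ p) (*-monoˡ-≤-nonNeg p {{nonNegative 0≤p}} 0≤q)

  0≤+ : ∀ {p q} → 0ℚ ≤ p → 0ℚ ≤ q → 0ℚ ≤ p + q
  0≤+ {p} {q} 0≤p 0≤q = subst (_≤ p + q) (+-identityʳ 0ℚ) (+-mono-≤ 0≤p 0≤q)

  *-monoˡ : ∀ {p q r} → 0ℚ ≤ r → p ≤ q → r * p ≤ r * q
  *-monoˡ {r = r} 0≤r = *-monoˡ-≤-nonNeg r {{nonNegative 0≤r}}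

  *-monoʳ : ∀ {p q r} → 0ℚ ≤ r → p ≤ q → p * r ≤ q * r
  *-monoʳ {r = r} 0≤r = *-monoʳ-≤-nonNeg r {{nonNegative 0≤r}}

  *-cancelʳ : ∀ {p q r} → 0ℚ < r → p * r ≤ q * r → p ≤ q
  *-cancelʳ {r = r} 0<r = *-cancelʳ-≤-pos r {{positive 0<r}}

  p≤p+q : ∀ {p q} → 0ℚ ≤ q → p ≤ p + q
  p≤p+q {p} {q} 0≤q = subst (_≤ p + q) (+-identityʳ p) (+-monoʳ-≤ p 0≤q)

  p≤q+p : ∀ {p q} → 0ℚ ≤ q → p ≤ q + p
  p≤q+p {p} {q} 0≤q = subst (_≤ q + p) (+-identityˡ p) (+-monoˡ-≤ p 0≤q)

  k!*1/k! : ∀ k → ι (k !) * 1/ k ! ≡ 1ℚ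
  k!*1/k! k = toℚᵘ-injective (begin-equality
    toℚᵘ (ι (k !) * 1/ k !)                             ≃⟨ toℚᵘ-homo-* (ι (k !)) (1/ k !) ⟩
    toℚᵘ (ι (k !)) ℚᵘ.* toℚᵘ (1/ k !)                   ≃⟨ ℚᵘ.*-cong (ι-toℚᵘ (k !)) (recip (k !) {{k ℕ.!≢0}}) ⟩
    ℚᵘ.mkℚᵘ (+ (k !)) 0 ℚᵘ.* (+ 1 ℚᵘ./ (k !)) {{k ℕ.!≢0}} ≃⟨ cancel (k !) {{k ℕ.!≢0}} ⟩
    toℚᵘ 1ℚ                                             ∎)
    where
    open ℚᵘ.≤-Reasoning
    recip : ∀ m .{{_ : ℕ.NonZero m}} → toℚᵘ (+ 1 / m) ℚᵘ.≃ (+ 1 ℚᵘ./ m)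
    recip (suc m) = toℚᵘ-fromℚᵘ (ℚᵘ.mkℚᵘ (+ 1) m)
    cancel : ∀ m .{{_ : ℕ.NonZero m}} → ℚᵘ.mkℚᵘ (+ m) 0 ℚᵘ.* (+ 1 ℚᵘ./ m) ℚᵘ.≃ toℚᵘ 1ℚ
    cancel (suc m) = ℚᵘ.*≡* (trans (cong (ℤ._* + 1) (ℤ.*-identityʳ (+ suc m))) (trans (ℤ.*-identityʳ (+ suc m))
      (sym (trans (ℤ.*-identityˡ _) (cong (λ x → + suc x) (ℕ.+-identityʳ m))))))

  1/suc! : ∀ k → ι (suc k) * 1/ suc k ! ≡ 1/ k !
  1/suc! k = begin
    ι (suc k) * 1/ suc k !                          ≡⟨ *-identityʳ _ ⟨
    ι (suc k) * 1/ suc k ! * 1ℚ                     ≡⟨ cong (ι (suc k) * 1/ suc k ! *_) (k!*1/k! k) ⟨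
    ι (suc k) * 1/ suc k ! * (ι (k !) * 1/ k !)     ≡⟨ lemma (ι (suc k)) (1/ suc k !) (ι (k !)) (1/ k !) ⟩
    ι (suc k) * ι (k !) * 1/ suc k ! * 1/ k !       ≡⟨ cong (λ x → x * 1/ suc k ! * 1/ k !) (ι-* (suc k) (k !)) ⟨
    ι (suc k !) * 1/ suc k ! * 1/ k !               ≡⟨ cong (_* 1/ k !) (k!*1/k! (suc k)) ⟩
    1ℚ * 1/ k !                                     ≡⟨ *-identityˡ _ ⟩
    1/ k !                                          ∎
    where
    open ≡-Reasoning
    lemma : ∀ a b c d → a * b * (c * d) ≡ a * c * b * d
    lemma = solve-∀ ℚ-ring

  infixr 8 _^_
  _^_ : ℚ → ℕ → ℚ
  p ^ zero  = 1ℚ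
  p ^ suc k = p * p ^ k

  0≤^ : ∀ {p} → 0ℚ ≤ p → ∀ k → 0ℚ ≤ p ^ k
  0≤^ 0≤p zero    = nonNegative⁻¹ 1ℚ
  0≤^ 0≤p (suc k) = 0≤* 0≤p (0≤^ 0≤p k)

  ^-mono : ∀ {p q} → 0ℚ ≤ p → p ≤ q → ∀ k → p ^ k ≤ q ^ k
  ^-mono 0≤p p≤q zero    = ≤-refl
  ^-mono 0≤p p≤q (suc k) = *-mono 0≤p (0≤^ (≤-trans 0≤p p≤q) k) p≤q (^-mono 0≤p p≤q k)

  ^-+ : ∀ p a b → p ^ (a ℕ.+ b) ≡ p ^ a * p ^ b
  ^-+ p zero    b = sym (*-identityˡ (p ^ b))
  ^-+ p (suc a) b = trans (cong (p *_) (^-+ p a b)) (sym (*-assoc p (p ^ a) (p ^ b)))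

  ^-* : ∀ p q k → (p * q) ^ k ≡ p ^ k * q ^ k
  ^-* p q zero    = refl
  ^-* p q (suc k) = trans (cong (p * q *_) (^-* p q k)) (lemma p q (p ^ k) (q ^ k))
    where
    lemma : ∀ a b c d → a * b * (c * d) ≡ a * c * (b * d)
    lemma = solve-∀ ℚ-ring

  1^ : ∀ k → 1ℚ ^ k ≡ 1ℚ
  1^ zero    = refl
  1^ (suc k) = trans (*-identityˡ (1ℚ ^ k)) (1^ k)

  ι-^ : ∀ a k → ι (a ℕ.^ k) ≡ ι a ^ k
  ι-^ a zero    = refl
  ι-^ a (suc k) = trans (ι-* a (a ℕ.^ k)) (cong (ι a *_) (ι-^ a k))

  ^-anti : ∀ {p} → 0ℚ ≤ p → p ≤ 1ℚ → ∀ {a b} → a ℕ.≤ b → p ^ b ≤ p ^ a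
  ^-anti {p} 0≤p p≤1 {a} {b} a≤b = begin
    p ^ b                   ≡⟨ cong (p ^_) (ℕ.m+[n∸m]≡n a≤b) ⟨
    p ^ (a ℕ.+ (b ℕ.∸ a))   ≡⟨ ^-+ p a (b ℕ.∸ a) ⟩
    p ^ a * p ^ (b ℕ.∸ a)   ≤⟨ *-monoˡ (0≤^ 0≤p a) (≤-trans (^-mono 0≤p p≤1 (b ℕ.∸ a)) (≤-reflexive (1^ (b ℕ.∸ a)))) ⟩
    p ^ a * 1ℚ              ≡⟨ *-identityʳ (p ^ a) ⟩
    p ^ a                   ∎
    where open ≤-Reasoning

  Σ< : ℕ → (ℕ → ℚ) → ℚ
  Σ< zero    f = 0ℚ
  Σ< (suc n) f = Σ< n f + f n

  module _ where
    private variable f g : ℕ → ℚ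

    Σ<-mono : ∀ n → (∀ {i} → i ℕ.< n → f i ≤ g i) → Σ< n f ≤ Σ< n g
    Σ<-mono zero    _   = ≤-refl
    Σ<-mono (suc n) f≤g = +-mono-≤ (Σ<-mono n (λ i< → f≤g (ℕ.m<n⇒m<1+n i<))) (f≤g ℕ.≤-refl)

    Σ<-cong : ∀ n → (∀ {i} → i ℕ.< n → f i ≡ g i) → Σ< n f ≡ Σ< n g
    Σ<-cong zero    _   = refl
    Σ<-cong (suc n) f≡g = cong₂ _+_ (Σ<-cong n (λ i< → f≡g (ℕ.m<n⇒m<1+n i<))) (f≡g ℕ.≤-refl)

    0≤Σ< : ∀ n → (∀ i → 0ℚ ≤ f i) → 0ℚ ≤ Σ< n f
    0≤Σ< zero    _   = ≤-refl
    0≤Σ< (suc n) 0≤f = 0≤+ (0≤Σ< n 0≤f) (0≤f n)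

    Σ<-+ : ∀ n f g → Σ< n (λ i → f i + g i) ≡ Σ< n f + Σ< n g
    Σ<-+ zero    f g = refl
    Σ<-+ (suc n) f g = trans (cong (_+ (f n + g n)) (Σ<-+ n f g)) (lemma (Σ< n f) (Σ< n g) (f n) (g n))
      where
      lemma : ∀ a b c d → a + b + (c + d) ≡ a + c + (b + d)
      lemma = solve-∀ ℚ-ring

    Σ<-*ˡ : ∀ n c f → Σ< n (λ i → c * f i) ≡ c * Σ< n f
    Σ<-*ˡ zero    c f = sym (*-zeroʳ c)
    Σ<-*ˡ (suc n) c f = trans (cong (_+ c * f n) (Σ<-*ˡ n c f)) (sym (*-distribˡ-+ c (Σ< n f) (f n)))

    Σ<-*ʳ : ∀ n c f → Σ< n (λ i → f i * c) ≡ Σ< n f * c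
    Σ<-*ʳ n c f = trans (Σ<-cong n (λ {i} _ → *-comm (f i) c)) (trans (Σ<-*ˡ n c f) (*-comm c (Σ< n f)))

    Σ<-0 : ∀ n → Σ< n (const 0ℚ) ≡ 0ℚ
    Σ<-0 zero    = refl
    Σ<-0 (suc n) = trans (+-identityʳ _) (Σ<-0 n)

    Σ<-swap : ∀ n m (f : ℕ → ℕ → ℚ) → Σ< n (λ i → Σ< m (f i)) ≡ Σ< m (λ j → Σ< n (λ i → f i j))
    Σ<-swap zero    m f = sym (Σ<-0 m)
    Σ<-swap (suc n) m f = trans (cong (_+ Σ< m (f n)) (Σ<-swap n m f)) (sym (Σ<-+ m _ (f n)))

    Σ<-shift : ∀ n f → Σ< (suc n) f ≡ f 0 + Σ< n (f ∘ suc)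
    Σ<-shift zero    f = trans (+-identityˡ (f 0)) (sym (+-identityʳ (f 0)))
    Σ<-shift (suc n) f = trans (cong (_+ f (suc n)) (Σ<-shift n f)) (+-assoc (f 0) _ _)

    Σ<-split : ∀ a b f → Σ< (a ℕ.+ b) f ≡ Σ< a f + Σ< b (λ i → f (a ℕ.+ i))
    Σ<-split a zero    f = trans (cong (λ n → Σ< n f) (ℕ.+-identityʳ a)) (sym (+-identityʳ _))
    Σ<-split a (suc b) f = trans (cong (λ n → Σ< n f) (ℕ.+-suc a b))
      (trans (cong (_+ f (a ℕ.+ b)) (Σ<-split a b f)) (+-assoc (Σ< a f) _ _))

    Σ<-extend : ∀ {a b} → (∀ i → 0ℚ ≤ f i) → a ℕ.≤ b → Σ< a f ≤ Σ< b f
    Σ<-extend {f = f} {a} {b} 0≤f a≤b = begin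
      Σ< a f                                      ≤⟨ p≤p+q (0≤Σ< (b ℕ.∸ a) (λ i → 0≤f (a ℕ.+ i))) ⟩
      Σ< a f + Σ< (b ℕ.∸ a) (λ i → f (a ℕ.+ i))   ≡⟨ Σ<-split a (b ℕ.∸ a) f ⟨
      Σ< (a ℕ.+ (b ℕ.∸ a)) f                      ≡⟨ cong (λ n → Σ< n f) (ℕ.m+[n∸m]≡n a≤b) ⟩
      Σ< b f                                      ∎
      where open ≤-Reasoning

    Σ<-reverse : ∀ n f → Σ< n (λ i → f (n ℕ.∸ suc i)) ≡ Σ< n f
    Σ<-reverse zero    f = refl
    Σ<-reverse (suc n) f = trans (Σ<-shift n (λ i → f (n ℕ.∸ i))) (trans (+-comm (f n) _) (cong (_+ f n) (Σ<-reverse n f)))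

  ι-∑-upTo : ∀ n g → ι (∑ (upTo n) g) ≡ Σ< n (ι ∘ g)
  ι-∑-upTo zero    g = refl
  ι-∑-upTo (suc n) g = begin
    ι (∑ (upTo (suc n)) g)             ≡⟨ cong (λ xs → ι (∑ xs g)) (applyUpTo-∷ʳ (λ i → i) n) ⟨
    ι (∑ (upTo n ∷ʳ n) g)              ≡⟨ cong ι (∑-++ (upTo n) (n ∷ []) g) ⟩
    ι (∑ (upTo n) g ℕ.+ (g n ℕ.+ 0))   ≡⟨ ι-+ (∑ (upTo n) g) (g n ℕ.+ 0) ⟩
    ι (∑ (upTo n) g) + ι (g n ℕ.+ 0)   ≡⟨ cong₂ _+_ (ι-∑-upTo n g) (cong ι (ℕ.+-identityʳ (g n))) ⟩
    Σ< n (ι ∘ g) + ι (g n)             ∎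
    where
    open ≡-Reasoning

  ι-∑-≤ : ∀ {A : Set} (xs : List A) (g : A → ℕ) {c G} → (∀ {x} → x ∈ xs → ι (g x) * c ≤ G) → ι (∑ xs g) * c ≤ ι (length xs) * G
  ι-∑-≤ []       g {c} {G} _  = ≤-reflexive (trans (*-zeroˡ c) (sym (*-zeroˡ G)))
  ι-∑-≤ (x ∷ xs) g {c} {G} g≤ = begin
    ι (g x ℕ.+ ∑ xs g) * c            ≡⟨ cong (_* c) (ι-+ (g x) (∑ xs g)) ⟩
    (ι (g x) + ι (∑ xs g)) * c        ≡⟨ *-distribʳ-+ c (ι (g x)) (ι (∑ xs g)) ⟩
    ι (g x) * c + ι (∑ xs g) * c      ≤⟨ +-mono-≤ (g≤ (here refl)) (ι-∑-≤ xs g (g≤ ∘ there)) ⟩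
    G + ι (length xs) * G             ≡⟨ cong (_+ ι (length xs) * G) (*-identityˡ G) ⟨
    1ℚ * G + ι (length xs) * G        ≡⟨ *-distribʳ-+ G 1ℚ (ι (length xs)) ⟨
    (1ℚ + ι (length xs)) * G          ≡⟨ cong (_* G) (ι-suc (length xs)) ⟨
    ι (suc (length xs)) * G           ∎
    where open ≤-Reasoning

  archimedean : ∀ ε → 0ℚ < ε → ∀ c → ∃ λ M → ∀ n → M ℕ.≤ n → ι c ≤ ε * ι n
  archimedean ε 0<ε c = c ℕ.* b , λ n cb≤n → *-cancelʳ 0<ιb (begin
    ι c * ι b             ≡⟨ ι-* c b ⟨
    ι (c ℕ.* b)           ≤⟨ ι-mono cb≤n ⟩
    ι n                   ≡⟨ *-identityˡ (ι n) ⟨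
    1ℚ * ι n              ≡⟨ cong (_* ι n) (unit b) ⟨
    + 1 / b * ι b * ι n   ≤⟨ *-monoʳ (0≤ι n) (*-monoʳ (0≤ι b) (1/denominator≤ ε 0<ε)) ⟩
    ε * ι b * ι n         ≡⟨ lemma ε (ι b) (ι n) ⟩
    ε * ι n * ι b         ∎)
    where
    open ≤-Reasoning
    b = ↧ₙ ε
    0<ιb : 0ℚ < ι b
    0<ιb = 0<ι b
    lemma : ∀ x y z → x * y * z ≡ x * z * y
    lemma = solve-∀ ℚ-ring
    unit : ∀ b .{{_ : ℕ.NonZero b}} → + 1 / b * ι b ≡ 1ℚ
    unit (suc m) = toℚᵘ-injective (ℚᵘ.≃-trans (toℚᵘ-homo-* (+ 1 / suc m) (ι (suc m)))
      (ℚᵘ.≃-trans (ℚᵘ.*-cong (toℚᵘ-fromℚᵘ (ℚᵘ.mkℚᵘ (+ 1) m)) (ι-toℚᵘ (suc m)))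
        (ℚᵘ.*≡* (trans (ℤ.*-identityʳ _) (trans (ℤ.*-identityˡ (+ suc m))
          (sym (trans (ℤ.*-identityˡ _) (cong (λ x → + suc x) (ℕ.*-identityʳ m)))))))))

-- Partial sums of the exponential series and the bound from hit counts

module Exponential where

  open import Defs using (1/_!; 0≤1/k!; expSum)
  open GoodCount using (HitCounts)
  open Rationals
  open import Data.Nat.Base as ℕ using (ℕ; zero; suc; _!)
  import Data.Nat.Properties as ℕ
  open import Data.Rational.Base hiding (1/_)
  open import Data.Rational.Properties
  open import Tactic.RingSolver using (solve-∀)

  module _ (x : ℚ) where

    term : ℕ → ℚ
    term i = x ^ i * 1/ i !

    E : ℕ → ℚ
    E k = Σ< (suc k) term

    term-suc : ∀ i → ι (suc i) * term (suc i) ≡ x * term i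
    term-suc i = begin
      ι (suc i) * (x * x ^ i * 1/ suc i !)    ≡⟨ lemma (ι (suc i)) x (x ^ i) (1/ suc i !) ⟩
      x * (x ^ i * (ι (suc i) * 1/ suc i !))  ≡⟨ cong (λ y → x * (x ^ i * y)) (1/suc! i) ⟩
      x * (x ^ i * 1/ i !)                    ∎
      where
      open ≡-Reasoning
      lemma : ∀ a b c d → a * (b * c * d) ≡ b * (c * (a * d))
      lemma = solve-∀ ℚ-ring

    0≤term : 0ℚ ≤ x → ∀ i → 0ℚ ≤ term i
    0≤term 0≤x i = 0≤* (0≤^ 0≤x i) (0≤1/k! i)

    -- Summation by parts of `term-suc`. It has the shape of `summation` below, with `x * E j` in
    -- the place of `u (suc j)`.
    E-recurrence : ∀ j → ι (suc j) * E (suc j) ≡ x * E j + Σ< (suc j) E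
    E-recurrence zero    = begin
      1ℚ * (0ℚ + term 0 + term 1)           ≡⟨ lemma (term 0) (term 1) ⟩
      1ℚ * term 1 + (0ℚ + (0ℚ + term 0))    ≡⟨ cong (_+ (0ℚ + (0ℚ + term 0))) (term-suc 0) ⟩
      x * term 0 + (0ℚ + (0ℚ + term 0))     ≡⟨ cong (λ y → x * y + (0ℚ + (0ℚ + term 0))) (+-identityˡ (term 0)) ⟨
      x * (0ℚ + term 0) + (0ℚ + (0ℚ + term 0)) ∎
      where
      open ≡-Reasoning
      lemma : ∀ a b → 1ℚ * (0ℚ + a + b) ≡ 1ℚ * b + (0ℚ + (0ℚ + a))
      lemma = solve-∀ ℚ-ring
    E-recurrence (suc j) = begin
      ι (suc (suc j)) * (E (suc j) + t)
        ≡⟨ *-distribˡ-+ (ι (suc (suc j))) (E (suc j)) t ⟩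
      ι (suc (suc j)) * E (suc j) + ι (suc (suc j)) * t
        ≡⟨ cong₂ _+_ (trans (cong (_* E (suc j)) (ι-suc (suc j))) (trans (*-distribʳ-+ (E (suc j)) 1ℚ (ι (suc j)))
             (cong (1ℚ * E (suc j) +_) (E-recurrence j)))) (term-suc (suc j)) ⟩
      1ℚ * E (suc j) + (x * E j + Σ< (suc j) E) + x * term (suc j)
        ≡⟨ lemma (E (suc j)) x (E j) (Σ< (suc j) E) (term (suc j)) ⟩
      x * (E j + term (suc j)) + (Σ< (suc j) E + E (suc j)) ∎
      where
      open ≡-Reasoning
      t = term (suc (suc j))
      lemma : ∀ a x b c d → 1ℚ * a + (x * b + c) + x * d ≡ x * (b + d) + (c + a)
      lemma = solve-∀ ℚ-ring

  -- The inequalities λ s_j ≤ u_{j+1} become equalities for the partial sums of exp λ, so s dominates these.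
  module _ {g T Λ M : ℕ} (hc : HitCounts g T Λ M) (0<M : 0ℚ < ι M) {l : ℚ} (0≤l : 0ℚ ≤ l) (l*M : l * ι M ≡ ι Λ) where
    open HitCounts hc renaming (s to s′; u to u′)

    private
      s u : ℕ → ℚ
      s = ι ∘ s′
      u = ι ∘ u′

      switchℚ : ∀ i → l * s i ≤ u (suc i)
      switchℚ i = *-cancelʳ 0<M (begin
        l * s i * ι M          ≡⟨ lemma l (s i) (ι M) ⟩
        s i * (l * ι M)        ≡⟨ cong (s i *_) l*M ⟩
        s i * ι Λ              ≡⟨ ι-* (s′ i) Λ ⟨
        ι (s′ i ℕ.* Λ)         ≤⟨ ι-mono (switch i) ⟩
        ι (u′ (suc i) ℕ.* M)   ≡⟨ ι-* (u′ (suc i)) M ⟩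
        u (suc i) * ι M        ∎)
        where
        open ≤-Reasoning
        lemma : ∀ a b c → a * b * c ≡ b * (a * c)
        lemma = solve-∀ ℚ-ring

      -- The increments of `u` are `suc i` times those of `s`, by `u-suc`; this is their sum after
      -- summation by parts.
      summation : ∀ j → ι j * s j ≡ u j + Σ< j s
      summation zero    = trans (*-zeroˡ (s 0)) (sym (cong (λ y → ι y + 0ℚ) u-zero))
      summation (suc j) = +-cancelʳ (u j) _ _ (begin
        ι (suc j) * s (suc j) + u j                ≡⟨ +-comm _ (u j) ⟩
        u j + ι (suc j) * s (suc j)                ≡⟨ cong (u j +_) (ι-* (suc j) (s′ (suc j))) ⟨
        u j + ι (suc j ℕ.* s′ (suc j))             ≡⟨ ι-+ (u′ j) _ ⟨
        ι (u′ j ℕ.+ suc j ℕ.* s′ (suc j))          ≡⟨ cong ι (u-suc j) ⟨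
        ι (u′ (suc j) ℕ.+ suc j ℕ.* s′ j)          ≡⟨ ι-+ (u′ (suc j)) _ ⟩
        u (suc j) + ι (suc j ℕ.* s′ j)             ≡⟨ cong (u (suc j) +_) (trans (ι-* (suc j) (s′ j)) (cong (_* s j) (ι-suc j))) ⟩
        u (suc j) + (1ℚ + ι j) * s j               ≡⟨ lemma (u (suc j)) (ι j) (s j) ⟩
        u (suc j) + s j + ι j * s j                ≡⟨ cong (u (suc j) + s j +_) (summation j) ⟩
        u (suc j) + s j + (u j + Σ< j s)           ≡⟨ lemma′ (u (suc j)) (s j) (u j) (Σ< j s) ⟩
        u (suc j) + (Σ< j s + s j) + u j           ∎)
        where
        open ≡-Reasoning
        lemma : ∀ a b c → a + (1ℚ + b) * c ≡ a + c + b * c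
        lemma = solve-∀ ℚ-ring
        lemma′ : ∀ a b c d → a + b + (c + d) ≡ a + (d + b) + c
        lemma′ = solve-∀ ℚ-ring
        +-cancelʳ : ∀ z x y → x + z ≡ y + z → x ≡ y
        +-cancelʳ z x y eq = trans (undo x) (trans (cong (_- z) eq) (sym (undo y)))
          where
          undo : ∀ x → x ≡ x + z - z
          undo x = sym (trans (+-assoc x z (- z)) (trans (cong (λ w → x + w) (+-inverseʳ z)) (+-identityʳ x)))

      -- The running sums are part of the induction because both recurrences express the value at
      -- `suc j` through all earlier ones.
      dominates : ∀ j → s 0 * E l j ≤ s j × s 0 * Σ< j (E l) ≤ Σ< j s
      dominates zero    = ≤-reflexive (unit (s 0)) , ≤-reflexive (*-zeroʳ (s 0))
        where
        unit : ∀ a → a * (0ℚ + 1ℚ * 1ℚ) ≡ a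
        unit = *-identityʳ
      dominates (suc j) = *-cancelʳ (0<ι (suc j)) (begin
          s 0 * E l (suc j) * ι (suc j)               ≡⟨ lemma (s 0) (E l (suc j)) (ι (suc j)) ⟩
          s 0 * (ι (suc j) * E l (suc j))             ≡⟨ cong (s 0 *_) (E-recurrence l j) ⟩
          s 0 * (l * E l j + Σ< (suc j) (E l))        ≡⟨ lemma′ (s 0) l (E l j) (Σ< (suc j) (E l)) ⟩
          l * (s 0 * E l j) + s 0 * Σ< (suc j) (E l)  ≤⟨ +-mono-≤ (≤-trans (*-monoˡ 0≤l (proj₁ (dominates j))) (switchℚ j)) sums ⟩
          u (suc j) + Σ< (suc j) s                    ≡⟨ summation (suc j) ⟨
          ι (suc j) * s (suc j)                       ≡⟨ *-comm (ι (suc j)) (s (suc j)) ⟩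
          s (suc j) * ι (suc j)                       ∎)
        , sums
        where
        open ≤-Reasoning
        sums : s 0 * Σ< (suc j) (E l) ≤ Σ< (suc j) s
        sums = ≤-trans (≤-reflexive (*-distribˡ-+ (s 0) (Σ< j (E l)) (E l j)))
          (+-mono-≤ (proj₂ (dominates j)) (proj₁ (dominates j)))
        lemma : ∀ a b c → a * b * c ≡ a * (c * b)
        lemma = solve-∀ ℚ-ring
        lemma′ : ∀ a b c d → a * (b * c + d) ≡ b * (a * c) + a * d
        lemma′ = solve-∀ ℚ-ring

    hitCounts-bound : ∀ K → ι g * E l K ≤ ι T
    hitCounts-bound K = begin
      ι g * E l K   ≤⟨ *-monoʳ (0≤Σ< (suc K) (0≤term l 0≤l)) (ι-mono g≤s) ⟩
      s 0 * E l K   ≤⟨ proj₁ (dominates K) ⟩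
      s K           ≤⟨ ι-mono (s≤T K) ⟩
      ι T           ∎
      where open ≤-Reasoning

  E-1 : ∀ K → E 1ℚ K ≡ expSum K
  E-1 zero    = refl
  E-1 (suc K) = cong₂ _+_ (E-1 K) (trans (cong (_* 1/ suc K !) (1^ (suc K))) (*-identityˡ _))

  -- Only powers up to `K` occur in the partial sum, so lowering the argument by the factor `φ`
  -- costs at most `φ ^ K`.
  E-scale : ∀ {x φ} → 0ℚ ≤ x → 0ℚ ≤ φ → φ ≤ 1ℚ → ∀ K → φ ^ K * E x K ≤ E (x * φ) K
  E-scale {x} {φ} 0≤x 0≤φ φ≤1 K = begin
    φ ^ K * E x K                            ≡⟨ Σ<-*ˡ (suc K) (φ ^ K) (term x) ⟨
    Σ< (suc K) (λ i → φ ^ K * term x i)      ≤⟨ Σ<-mono (suc K) (λ {i} i<K → begin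
        φ ^ K * (x ^ i * 1/ i !)   ≤⟨ *-monoʳ (0≤term x 0≤x i) (^-anti 0≤φ φ≤1 (ℕ.s≤s⁻¹ i<K)) ⟩
        φ ^ i * (x ^ i * 1/ i !)   ≡⟨ lemma (φ ^ i) (x ^ i) (1/ i !) ⟩
        x ^ i * φ ^ i * 1/ i !     ≡⟨ cong (_* 1/ i !) (^-* x φ i) ⟨
        (x * φ) ^ i * 1/ i !       ∎) ⟩
    E (x * φ) K                              ∎
    where
    open ≤-Reasoning
    lemma : ∀ a b c → a * (b * c) ≡ b * a * c
    lemma = solve-∀ ℚ-ring

  module _ {x y : ℚ} (0≤x : 0ℚ ≤ x) (0≤y : 0ℚ ≤ y) where

    private
      -- The sum of term x a * term y (b + j) over a + b = i.
      antidiagonal : ℕ → ℕ → ℚ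
      antidiagonal zero    j = term x 0 * term y j
      antidiagonal (suc i) j = term x (suc i) * term y j + antidiagonal i (suc j)

      -- Multiplying a product of two terms by its total degree and splitting the degree between the
      -- factors, `term-suc` takes one `x` off the first factor or one `y` off the second. This
      -- avoids binomial coefficients.
      antidiagonal-suc : ∀ i j → ι (suc i ℕ.+ suc j) * antidiagonal (suc i) (suc j) ≡
                         x * antidiagonal i (suc j) + y * antidiagonal (suc i) j
      antidiagonal-suc i j = begin
        ι (suc i ℕ.+ suc j) * (term x (suc i) * term y (suc j) + antidiagonal i (suc (suc j)))
          ≡⟨ expand ⟩
        x * (term x i * term y (suc j)) + y * (term x (suc i) * term y j) + ι (suc i ℕ.+ suc j) * antidiagonal i (suc (suc j))
          ≡⟨ rest i ⟩
        x * antidiagonal i (suc j) + y * (term x (suc i) * term y j + antidiagonal i (suc j)) ∎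
        where
        open ≡-Reasoning
        expand : ι (suc i ℕ.+ suc j) * (term x (suc i) * term y (suc j) + antidiagonal i (suc (suc j))) ≡
                 x * (term x i * term y (suc j)) + y * (term x (suc i) * term y j) + ι (suc i ℕ.+ suc j) * antidiagonal i (suc (suc j))
        expand = trans (*-distribˡ-+ (ι (suc i ℕ.+ suc j)) (term x (suc i) * term y (suc j)) (antidiagonal i (suc (suc j))))
          (cong (_+ ι (suc i ℕ.+ suc j) * antidiagonal i (suc (suc j))) (begin
            ι (suc i ℕ.+ suc j) * (term x (suc i) * term y (suc j))
              ≡⟨ cong (_* (term x (suc i) * term y (suc j))) (ι-+ (suc i) (suc j)) ⟩
            (ι (suc i) + ι (suc j)) * (term x (suc i) * term y (suc j))
              ≡⟨ lemma (ι (suc i)) (ι (suc j)) (term x (suc i)) (term y (suc j)) ⟩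
            ι (suc i) * term x (suc i) * term y (suc j) + term x (suc i) * (ι (suc j) * term y (suc j))
              ≡⟨ cong₂ (λ a b → a * term y (suc j) + term x (suc i) * b) (term-suc x i) (term-suc y j) ⟩
            x * term x i * term y (suc j) + term x (suc i) * (y * term y j)
              ≡⟨ lemma′ x (term x i) (term y (suc j)) (term x (suc i)) y (term y j) ⟩
            x * (term x i * term y (suc j)) + y * (term x (suc i) * term y j) ∎))
          where
          lemma : ∀ a b c d → (a + b) * (c * d) ≡ a * c * d + c * (b * d)
          lemma = solve-∀ ℚ-ring
          lemma′ : ∀ a b c d e f → a * b * c + d * (e * f) ≡ a * (b * c) + e * (d * f)
          lemma′ = solve-∀ ℚ-ring
        rest : ∀ i {t} → x * (term x i * term y (suc j)) + y * t + ι (suc i ℕ.+ suc j) * antidiagonal i (suc (suc j)) ≡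
               x * antidiagonal i (suc j) + y * (t + antidiagonal i (suc j))
        rest zero {t} = begin
          x * a + y * t + ι (suc (suc j)) * (term x 0 * term y (suc (suc j)))
            ≡⟨ cong (x * a + y * t +_) (trans (swap (ι (suc (suc j))) (term x 0) (term y (suc (suc j))))
                (cong (term x 0 *_) (term-suc y (suc j)))) ⟩
          x * a + y * t + term x 0 * (y * term y (suc j))
            ≡⟨ lemma (x * a) y t (term x 0) (term y (suc j)) ⟩
          x * a + y * (t + a) ∎
          where
          a = term x 0 * term y (suc j)
          swap : ∀ a b c → a * (b * c) ≡ b * (a * c)
          swap = solve-∀ ℚ-ring
          lemma : ∀ a y t b c → a + y * t + b * (y * c) ≡ a + y * (t + b * c)
          lemma = solve-∀ ℚ-ring
        rest (suc i) {t} = begin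
          x * w + y * t + ι (suc (suc i) ℕ.+ suc j) * antidiagonal (suc i) (suc (suc j))
            ≡⟨ cong (λ k → x * w + y * t + ι k * antidiagonal (suc i) (suc (suc j))) (sym (ℕ.+-suc (suc i) (suc j))) ⟩
          x * w + y * t + ι (suc i ℕ.+ suc (suc j)) * antidiagonal (suc i) (suc (suc j))
            ≡⟨ cong (x * w + y * t +_) (antidiagonal-suc i (suc j)) ⟩
          x * w + y * t + (x * antidiagonal i (suc (suc j)) + y * antidiagonal (suc i) (suc j))
            ≡⟨ lemma x y w t (antidiagonal i (suc (suc j))) (antidiagonal (suc i) (suc j)) ⟩
          x * (w + antidiagonal i (suc (suc j))) + y * (t + antidiagonal (suc i) (suc j)) ∎
          where
          w = term x (suc i) * term y (suc j)
          lemma : ∀ x y w t a b → x * w + y * t + (x * a + y * b) ≡ x * (w + a) + y * (t + b)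
          lemma = solve-∀ ℚ-ring

      -- The binomial theorem divided by `i !`: both sides satisfy `term-suc` for `x + y`, which
      -- determines them.
      antidiagonal-zero : ∀ i → antidiagonal i 0 ≡ term (x + y) i
      antidiagonal-zero zero    = refl
      antidiagonal-zero (suc i) = ≤-antisym
        (*-cancelʳ (0<ι (suc i)) (≤-reflexive (trans (*-comm _ (ι (suc i))) (trans step (*-comm (ι (suc i)) _)))))
        (*-cancelʳ (0<ι (suc i)) (≤-reflexive (sym (trans (*-comm _ (ι (suc i))) (trans step (*-comm (ι (suc i)) _))))))
        where
        open ≡-Reasoning
        row : ∀ i → ι (suc i) * antidiagonal (suc i) 0 ≡ (x + y) * antidiagonal i 0
        row i = begin
          ι (suc i) * (term x (suc i) * term y 0 + antidiagonal i 1)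
            ≡⟨ lemma (ι (suc i)) (term x (suc i)) (term y 0) (antidiagonal i 1) ⟩
          ι (suc i) * term x (suc i) * term y 0 + ι (suc i) * antidiagonal i 1
            ≡⟨ cong (λ a → a * term y 0 + ι (suc i) * antidiagonal i 1) (term-suc x i) ⟩
          x * term x i * term y 0 + ι (suc i) * antidiagonal i 1
            ≡⟨ tail i ⟩
          (x + y) * antidiagonal i 0 ∎
          where
          lemma : ∀ a b c d → a * (b * c + d) ≡ a * b * c + a * d
          lemma = solve-∀ ℚ-ring
          tail : ∀ i → x * term x i * term y 0 + ι (suc i) * antidiagonal i 1 ≡ (x + y) * antidiagonal i 0
          tail zero    = trans (cong (x * term x 0 * term y 0 +_) (trans (swap 1ℚ (term x 0) (term y 1)) (cong (term x 0 *_) (term-suc y 0))))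
            (lemma′ x (term x 0) (term y 0) y)
            where
            swap : ∀ a b c → a * (b * c) ≡ b * (a * c)
            swap = solve-∀ ℚ-ring
            lemma′ : ∀ a b c d → a * b * c + b * (d * c) ≡ (a + d) * (b * c)
            lemma′ = solve-∀ ℚ-ring
          tail (suc i) = begin
            x * term x (suc i) * term y 0 + ι (suc (suc i)) * antidiagonal (suc i) 1
              ≡⟨ cong (λ k → x * term x (suc i) * term y 0 + ι k * antidiagonal (suc i) 1) (ℕ.+-comm 1 (suc i)) ⟩
            x * term x (suc i) * term y 0 + ι (suc i ℕ.+ 1) * antidiagonal (suc i) 1
              ≡⟨ cong (x * term x (suc i) * term y 0 +_) (antidiagonal-suc i 0) ⟩
            x * term x (suc i) * term y 0 + (x * antidiagonal i 1 + y * antidiagonal (suc i) 0)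
              ≡⟨ lemma′ x (term x (suc i)) (term y 0) (antidiagonal i 1) y ⟩
            (x + y) * (term x (suc i) * term y 0 + antidiagonal i 1) ∎
            where
            lemma′ : ∀ x a b c y → x * a * b + (x * c + y * (a * b + c)) ≡ (x + y) * (a * b + c)
            lemma′ = solve-∀ ℚ-ring
        step : ι (suc i) * antidiagonal (suc i) 0 ≡ ι (suc i) * term (x + y) (suc i)
        step = trans (row i) (trans (cong ((x + y) *_) (antidiagonal-zero i)) (sym (term-suc (x + y) i)))

      antidiagonal-sum : ∀ M j → Σ< M (λ i → antidiagonal i j) ≤ Σ< M (term x) * Σ< M (λ i → term y (j ℕ.+ i))
      antidiagonal-sum zero    j = ≤-refl
      antidiagonal-sum (suc M) j = begin
        Σ< (suc M) (λ i → antidiagonal i j)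
          ≡⟨ peel (suc M) ⟩
        Σ< (suc M) (term x) * term y j + Σ< M (λ i → antidiagonal i (suc j))
          ≤⟨ +-monoʳ-≤ (Σ< (suc M) (term x) * term y j) (≤-trans (antidiagonal-sum M (suc j))
              (*-monoʳ (0≤Σ< M (λ i → 0≤term y 0≤y (suc j ℕ.+ i))) (Σ<-extend (0≤term x 0≤x) (ℕ.n≤1+n M)))) ⟩
        Σ< (suc M) (term x) * term y j + Σ< (suc M) (term x) * Σ< M (λ i → term y (suc j ℕ.+ i))
          ≡⟨ *-distribˡ-+ (Σ< (suc M) (term x)) _ _ ⟨
        Σ< (suc M) (term x) * (term y j + Σ< M (λ i → term y (suc j ℕ.+ i)))
          ≡⟨ cong (Σ< (suc M) (term x) *_) (trans (Σ<-shift M (λ i → term y (j ℕ.+ i)))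
              (cong₂ _+_ (cong (term y) (ℕ.+-identityʳ j)) (Σ<-cong M (λ {i} _ → cong (term y) (ℕ.+-suc j i))))) ⟨
        Σ< (suc M) (term x) * Σ< (suc M) (λ i → term y (j ℕ.+ i)) ∎
        where
        open ≤-Reasoning
        peel : ∀ M → Σ< M (λ i → antidiagonal i j) ≡ Σ< M (term x) * term y j + Σ< (ℕ.pred M) (λ i → antidiagonal i (suc j))
        peel zero          = sym (trans (+-identityʳ _) (*-zeroˡ (term y j)))
        peel (suc zero)    = lemma (term x 0) (term y j)
          where
          lemma : ∀ a b → 0ℚ + a * b ≡ (0ℚ + a) * b + 0ℚ
          lemma = solve-∀ ℚ-ring
        peel (suc (suc M)) = trans (cong (_+ antidiagonal (suc M) j) (peel (suc M)))
          (lemma (Σ< (suc M) (term x)) (term y j) (Σ< M (λ i → antidiagonal i (suc j))) (term x (suc M)) (antidiagonal M (suc j)))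
          where
          lemma : ∀ a b c d e → a * b + c + (d * b + e) ≡ (a + d) * b + (c + e)
          lemma = solve-∀ ℚ-ring

    -- With nonnegative terms, the products over the triangle `a + b ≤ K` sum to at most those over
    -- the square `a, b ≤ K`.
    E-+ : ∀ K → E (x + y) K ≤ E x K * E y K
    E-+ K = ≤-trans (≤-reflexive (Σ<-cong (suc K) (λ {i} _ → sym (antidiagonal-zero i)))) (antidiagonal-sum (suc K) 0)

-- The generating function of run sequences at 1/2

module RunSums where

  open Rationals
  open Words
  open import Data.Nat.Base as ℕ using (ℕ; zero; suc)
  import Data.Nat.Properties as ℕ
  open import Data.Rational.Base hiding (1/_)
  open import Data.Rational.Properties
  open import Tactic.RingSolver using (solve-∀)

  private
    r v : ℕ → ℕ → ℚ
    r m k = ι (runCount m k) * ½ ^ k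
    v m k = ι (longRunCount m k) * ½ ^ k

    0≤½^ : ∀ k → 0ℚ ≤ ½ ^ k
    0≤½^ = 0≤^ (nonNegative⁻¹ ½)

    0≤r : ∀ m k → 0ℚ ≤ r m k
    0≤r m k = 0≤* (0≤ι (runCount m k)) (0≤½^ k)

    v-suc : ∀ m k → v m (suc k) ≡ ½ * (r m k + v m k)
    v-suc m k = trans (cong (_* ½ ^ suc k) (trans (cong ι (longRunCount-suc m k)) (ι-+ (runCount m k) (longRunCount m k))))
      (lemma (ι (runCount m k)) (ι (longRunCount m k)) (½ ^ k) ½)
      where
      lemma : ∀ a b c h → (a + b) * (h * c) ≡ h * (a * c + b * c)
      lemma = solve-∀ ℚ-ring

    r-suc : ∀ m k → r (suc m) (suc k) ≡ ½ * r m k + v m (suc k)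
    r-suc m k = trans (cong (_* ½ ^ suc k) (trans (cong ι (runCount-suc m k)) (ι-+ (runCount m k) (longRunCount m (suc k)))))
      (lemma (ι (runCount m k)) (ι (longRunCount m (suc k))) (½ ^ k) ½)
      where
      lemma : ∀ a b c h → (a + b) * (h * c) ≡ h * (a * c) + b * (h * c)
      lemma = solve-∀ ℚ-ring

    v-sum-suc : ∀ m M → Σ< (suc M) (v m) ≡ ½ * (Σ< M (r m) + Σ< M (v m))
    v-sum-suc m M = begin
      Σ< (suc M) (v m)                            ≡⟨ Σ<-shift M (v m) ⟩
      0ℚ * 1ℚ + Σ< M (v m ∘ suc)                  ≡⟨ +-identityˡ _ ⟩
      Σ< M (v m ∘ suc)                            ≡⟨ Σ<-cong M (λ {k} _ → v-suc m k) ⟩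
      Σ< M (λ k → ½ * (r m k + v m k))            ≡⟨ Σ<-*ˡ M ½ _ ⟩
      ½ * Σ< M (λ k → r m k + v m k)              ≡⟨ cong (½ *_) (Σ<-+ M (r m) (v m)) ⟩
      ½ * (Σ< M (r m) + Σ< M (v m))               ∎
      where open ≡-Reasoning

    halves : ∀ a → ½ * (a + a) ≡ a
    halves a = trans (*-distribˡ-+ ½ a a) (trans (sym (*-distribʳ-+ a ½ ½)) (*-identityˡ a))

    -- Each further edge of the first run halves the weight, and ½ + ¼ + ... is at most 1.
    v-sum-≤ : ∀ m M → Σ< M (v m) ≤ Σ< M (r m)
    v-sum-≤ m zero    = ≤-refl
    v-sum-≤ m (suc M) = begin
      Σ< (suc M) (v m)                  ≡⟨ v-sum-suc m M ⟩
      ½ * (Σ< M (r m) + Σ< M (v m))     ≤⟨ *-monoˡ (nonNegative⁻¹ ½) (+-monoʳ-≤ (Σ< M (r m)) (v-sum-≤ m M)) ⟩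
      ½ * (Σ< M (r m) + Σ< M (r m))     ≡⟨ halves (Σ< M (r m)) ⟩
      Σ< M (r m)                        ≤⟨ p≤p+q (0≤r m M) ⟩
      Σ< (suc M) (r m)                  ∎
      where open ≤-Reasoning

  -- A run of s edges weighs 2 ^ (1 - s); counting the two directions of a single edge, the runs weigh
  -- 2 + 1/2 + 1/4 + ... = 3 in all.
  runSum : ∀ m M → Σ< M (λ k → ι (runCount m k) * ½ ^ k) ≤ (1ℚ + ½) ^ m
  runSum zero    zero          = nonNegative⁻¹ 1ℚ
  runSum zero    (suc zero)    = ≤-refl
  runSum zero    (suc (suc M)) = ≤-trans (≤-reflexive (trans (cong (Σ< (suc M) (r 0) +_) (*-zeroˡ (½ ^ suc M))) (+-identityʳ _))) (runSum zero (suc M))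
  runSum (suc m) zero          = 0≤^ (nonNegative⁻¹ (1ℚ + ½)) (suc m)
  runSum (suc m) (suc M)       = begin
    Σ< (suc M) (r (suc m))                              ≡⟨ Σ<-shift M (r (suc m)) ⟩
    0ℚ * 1ℚ + Σ< M (r (suc m) ∘ suc)                    ≡⟨ +-identityˡ _ ⟩
    Σ< M (r (suc m) ∘ suc)                              ≡⟨ Σ<-cong M (λ {k} _ → r-suc m k) ⟩
    Σ< M (λ k → ½ * r m k + v m (suc k))                ≡⟨ Σ<-+ M (λ k → ½ * r m k) (v m ∘ suc) ⟩
    Σ< M (λ k → ½ * r m k) + Σ< M (v m ∘ suc)           ≡⟨ cong₂ _+_ (Σ<-*ˡ M ½ (r m)) (sym (trans (Σ<-shift M (v m)) (+-identityˡ _))) ⟩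
    ½ * Σ< M (r m) + Σ< (suc M) (v m)                   ≡⟨ cong (½ * Σ< M (r m) +_) (v-sum-suc m M) ⟩
    ½ * Σ< M (r m) + ½ * (Σ< M (r m) + Σ< M (v m))      ≤⟨ +-monoʳ-≤ (½ * Σ< M (r m)) (*-monoˡ (nonNegative⁻¹ ½) (+-monoʳ-≤ (Σ< M (r m)) (v-sum-≤ m M))) ⟩
    ½ * Σ< M (r m) + ½ * (Σ< M (r m) + Σ< M (r m))      ≡⟨ cong (½ * Σ< M (r m) +_) (trans (halves (Σ< M (r m))) (sym (*-identityˡ _))) ⟩
    ½ * Σ< M (r m) + 1ℚ * Σ< M (r m)                    ≡⟨ *-distribʳ-+ (Σ< M (r m)) ½ 1ℚ ⟨
    (1ℚ + ½) * Σ< M (r m)                               ≤⟨ *-monoˡ (nonNegative⁻¹ (1ℚ + ½)) (runSum m M) ⟩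
    (1ℚ + ½) * (1ℚ + ½) ^ m                             ∎
    where open ≤-Reasoning

-- Weights of the classes with few shared edges

module Weights where

  open import Defs using (1/_!; 0≤1/k!)
  open Rationals
  open import Data.Nat.Base as ℕ using (ℕ; zero; suc; _!)
  import Data.Nat.Properties as ℕ
  import Data.Nat.Tactic.RingSolver as ℕ-solver
  open import Data.Rational.Base hiding (1/_)
  open import Data.Rational.Properties
  open import Tactic.RingSolver using (solve-∀)

  numerator : ℕ → ℕ → ℕ → ℕ
  numerator a k m = (a ℕ.+ k) ! ℕ.* ((a ℕ.+ a ℕ.+ m) ! ℕ.* (suc (a ℕ.+ k) ℕ.∸ (k ℕ.+ m)) !)

  -- With k shared edges in m runs, and a further edges on either path, weight a k m / m ! times the number
  -- of run sequences bounds (N ! times) the class sum of the second moment, where N = a + k.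
  weight : ℕ → ℕ → ℕ → ℚ
  weight a k m = ι (numerator a k m)
               * (1/ (a ℕ.+ a ℕ.+ k) ! * (1/ a ! * 1/ a !))

  0≤weight : ∀ a k m → 0ℚ ≤ weight a k m
  0≤weight a k m = 0≤* (0≤ι (numerator a k m)) (0≤* (0≤1/k! (a ℕ.+ a ℕ.+ k)) (0≤* (0≤1/k! a) (0≤1/k! a)))

  private
    weight-* : ∀ a k m → weight a k m * ι ((a ℕ.+ a ℕ.+ k) ! ℕ.* (a ! ℕ.* a !)) ≡
                         ι (numerator a k m)
    weight-* a k m = begin
      top * (1/ b ! * (1/ a ! * 1/ a !)) * ι (b ! ℕ.* (a ! ℕ.* a !))
        ≡⟨ cong (top * (1/ b ! * (1/ a ! * 1/ a !)) *_) (trans (ι-* (b !) (a ! ℕ.* a !)) (cong (ι (b !) *_) (ι-* (a !) (a !)))) ⟩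
      top * (1/ b ! * (1/ a ! * 1/ a !)) * (ι (b !) * (ι (a !) * ι (a !)))
        ≡⟨ lemma top (1/ b !) (1/ a !) (ι (b !)) (ι (a !)) ⟩
      top * ((ι (b !) * 1/ b !) * ((ι (a !) * 1/ a !) * (ι (a !) * 1/ a !)))
        ≡⟨ cong₂ (λ x y → top * (x * (y * y))) (k!*1/k! b) (k!*1/k! a) ⟩
      top * 1ℚ
        ≡⟨ *-identityʳ top ⟩
      top ∎
      where
      open ≡-Reasoning
      b   = a ℕ.+ a ℕ.+ k
      top = ι (numerator a k m)
      lemma : ∀ t x y p q → t * (x * (y * y)) * (p * (q * q)) ≡ t * ((p * x) * ((q * y) * (q * y)))
      lemma = solve-∀ ℚ-ring

    0<denominator : ∀ a b → 0ℚ < ι (b ! ℕ.* (a ! ℕ.* a !))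
    0<denominator a b = 0<ι _ {{ℕ.m*n≢0 (b !) (a ! ℕ.* a !) {{b ℕ.!≢0}} {{ℕ.m*n≢0 (a !) (a !) {{a ℕ.!≢0}} {{a ℕ.!≢0}}}}}}

  weight-0 : ∀ a → weight a 0 0 ≡ ι (suc a)
  weight-0 a = ≤-antisym
    (*-cancelʳ (0<denominator a (a ℕ.+ a ℕ.+ 0)) (≤-reflexive eq))
    (*-cancelʳ (0<denominator a (a ℕ.+ a ℕ.+ 0)) (≤-reflexive (sym eq)))
    where
    lemma : ∀ f g s → f ℕ.* (g ℕ.* (s ℕ.* f)) ≡ s ℕ.* (g ℕ.* (f ℕ.* f))
    lemma = ℕ-solver.solve-∀
    eq : weight a 0 0 * ι ((a ℕ.+ a ℕ.+ 0) ! ℕ.* (a ! ℕ.* a !)) ≡ ι (suc a) * ι ((a ℕ.+ a ℕ.+ 0) ! ℕ.* (a ! ℕ.* a !))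
    eq = trans (weight-* a 0 0) (trans
      (cong (λ z → ι (z ! ℕ.* ((a ℕ.+ a ℕ.+ 0) ! ℕ.* (suc z) !))) (ℕ.+-identityʳ a))
      (trans (cong ι (lemma (a !) ((a ℕ.+ a ℕ.+ 0) !) (suc a))) (ι-* (suc a) ((a ℕ.+ a ℕ.+ 0) ! ℕ.* (a ! ℕ.* a !)))))

  private
    !-upper : ∀ a k → (a ℕ.+ k) ! ℕ.≤ a ! ℕ.* (a ℕ.+ k) ℕ.^ k
    !-upper a zero    = ℕ.≤-reflexive (trans (cong _! (ℕ.+-identityʳ a)) (sym (ℕ.*-identityʳ (a !))))
    !-upper a (suc k) = begin
      (a ℕ.+ suc k) !                                    ≡⟨ cong _! (ℕ.+-suc a k) ⟩
      suc (a ℕ.+ k) ℕ.* (a ℕ.+ k) !                      ≤⟨ ℕ.*-monoʳ-≤ (suc (a ℕ.+ k)) (!-upper a k) ⟩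
      suc (a ℕ.+ k) ℕ.* (a ! ℕ.* (a ℕ.+ k) ℕ.^ k)        ≤⟨ ℕ.*-monoʳ-≤ (suc (a ℕ.+ k)) (ℕ.*-monoʳ-≤ (a !) (ℕ.^-monoˡ-≤ k (ℕ.n≤1+n (a ℕ.+ k)))) ⟩
      suc (a ℕ.+ k) ℕ.* (a ! ℕ.* suc (a ℕ.+ k) ℕ.^ k)    ≡⟨ lemma (suc (a ℕ.+ k)) (a !) (suc (a ℕ.+ k) ℕ.^ k) ⟩
      a ! ℕ.* suc (a ℕ.+ k) ℕ.^ suc k                    ≡⟨ cong (λ z → a ! ℕ.* z ℕ.^ suc k) (ℕ.+-suc a k) ⟨
      a ! ℕ.* (a ℕ.+ suc k) ℕ.^ suc k                    ∎
      where
      open ℕ.≤-Reasoning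
      lemma : ∀ s f p → s ℕ.* (f ℕ.* p) ≡ f ℕ.* (s ℕ.* p)
      lemma = ℕ-solver.solve-∀

    !-lower : ∀ {d} b i → d ℕ.≤ b → b ! ℕ.* d ℕ.^ i ℕ.≤ (b ℕ.+ i) !
    !-lower     b zero    _   = ℕ.≤-reflexive (trans (ℕ.*-identityʳ (b !)) (cong _! (sym (ℕ.+-identityʳ b))))
    !-lower {d} b (suc i) d≤b = begin
      b ! ℕ.* (d ℕ.* d ℕ.^ i)          ≡⟨ lemma (b !) d (d ℕ.^ i) ⟩
      d ℕ.* (b ! ℕ.* d ℕ.^ i)          ≤⟨ ℕ.*-mono-≤ (ℕ.≤-trans d≤b (ℕ.m≤n⇒m≤1+n (ℕ.m≤m+n b i))) (!-lower b i d≤b) ⟩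
      suc (b ℕ.+ i) ℕ.* (b ℕ.+ i) !    ≡⟨ cong _! (ℕ.+-suc b i) ⟨
      (b ℕ.+ suc i) !                  ∎
      where
      open ℕ.≤-Reasoning
      lemma : ∀ f s p → f ℕ.* (s ℕ.* p) ≡ s ℕ.* (f ℕ.* p)
      lemma = ℕ-solver.solve-∀

  -- The case k = m + i and m = suc j.
  module _ (a j i d n : ℕ) (n≡ : n ≡ suc (a ℕ.+ (suc j ℕ.+ i))) (d+j≤a : d ℕ.+ j ℕ.≤ a) where

    private
      k = suc j ℕ.+ i
      m = suc j
      c = a ℕ.∸ j

      j≤a : j ℕ.≤ a
      j≤a = ℕ.≤-trans (ℕ.m≤n+m j d) d+j≤a

      c+j≡a : c ℕ.+ j ≡ a
      c+j≡a = ℕ.m∸n+n≡m j≤a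

      rest≡c : suc (a ℕ.+ k) ℕ.∸ (k ℕ.+ m) ≡ c
      rest≡c = trans (cong (suc (a ℕ.+ k) ℕ.∸_) (ℕ.+-suc k j))
        (trans (cong (ℕ._∸ (k ℕ.+ j)) (ℕ.+-comm a k)) (ℕ.[m+n]∸[m+o]≡n∸o k a j))

      -- Three quotients of factorials: `(a + k)! / a!` is at most `n ^ k`, while
      -- `(2a + k)! / (2a + m)!` and `a! / c!` are at least `(2d) ^ i` and `d ^ j`. For `d` near `n`
      -- the weight is thus about `n * 2 ^ (m - k)`.
      core : (a ℕ.+ k) ! ℕ.* ((a ℕ.+ a ℕ.+ m) ! ℕ.* c !) ℕ.* (d ℕ.^ j ℕ.* (2 ℕ.* d) ℕ.^ i) ℕ.≤
             n ℕ.^ k ℕ.* ((a ℕ.+ a ℕ.+ k) ! ℕ.* (a ! ℕ.* a !))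
      core = begin
        (a ℕ.+ k) ! ℕ.* ((a ℕ.+ a ℕ.+ m) ! ℕ.* c !) ℕ.* (d ℕ.^ j ℕ.* (2 ℕ.* d) ℕ.^ i)
          ≡⟨ lemma ((a ℕ.+ k) !) ((a ℕ.+ a ℕ.+ m) !) (c !) (d ℕ.^ j) ((2 ℕ.* d) ℕ.^ i) ⟩
        (a ℕ.+ k) ! ℕ.* (((a ℕ.+ a ℕ.+ m) ! ℕ.* (2 ℕ.* d) ℕ.^ i) ℕ.* (c ! ℕ.* d ℕ.^ j))
          ≤⟨ ℕ.*-mono-≤ (ℕ.≤-trans (!-upper a k) (ℕ.*-monoʳ-≤ (a !) (ℕ.^-monoˡ-≤ k (ℕ.≤-trans (ℕ.n≤1+n _) (ℕ.≤-reflexive (sym n≡))))))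
              (ℕ.*-mono-≤ (ℕ.≤-trans (!-lower (a ℕ.+ a ℕ.+ m) i 2d≤) (ℕ.≤-reflexive (cong _! (ℕ.+-assoc (a ℕ.+ a) m i))))
                (ℕ.≤-trans (!-lower c j d≤c) (ℕ.≤-reflexive (cong _! c+j≡a)))) ⟩
        a ! ℕ.* n ℕ.^ k ℕ.* ((a ℕ.+ a ℕ.+ k) ! ℕ.* a !)
          ≡⟨ lemma′ (a !) (n ℕ.^ k) ((a ℕ.+ a ℕ.+ k) !) ⟩
        n ℕ.^ k ℕ.* ((a ℕ.+ a ℕ.+ k) ! ℕ.* (a ! ℕ.* a !)) ∎
        where
        open ℕ.≤-Reasoning
        d≤c : d ℕ.≤ c
        d≤c = ℕ.+-cancelʳ-≤ j d c (ℕ.≤-trans d+j≤a (ℕ.≤-reflexive (sym c+j≡a)))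
        d≤a : d ℕ.≤ a
        d≤a = ℕ.≤-trans (ℕ.m≤m+n d j) d+j≤a
        2d≤ : 2 ℕ.* d ℕ.≤ a ℕ.+ a ℕ.+ m
        2d≤ = ℕ.≤-trans (ℕ.≤-reflexive (cong (d ℕ.+_) (ℕ.+-identityʳ d))) (ℕ.≤-trans (ℕ.+-mono-≤ d≤a d≤a) (ℕ.m≤m+n (a ℕ.+ a) m))
        lemma : ∀ p q r s t → p ℕ.* (q ℕ.* r) ℕ.* (s ℕ.* t) ≡ p ℕ.* ((q ℕ.* t) ℕ.* (r ℕ.* s))
        lemma = ℕ-solver.solve-∀
        lemma′ : ∀ f p g → f ℕ.* p ℕ.* (g ℕ.* f) ≡ p ℕ.* (g ℕ.* (f ℕ.* f))
        lemma′ = ℕ-solver.solve-∀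

      bound : weight a k m * ι (d ℕ.^ j ℕ.* (2 ℕ.* d) ℕ.^ i) ≤ ι (n ℕ.^ k)
      bound = *-cancelʳ (0<denominator a (a ℕ.+ a ℕ.+ k)) (begin
        weight a k m * ι (d ℕ.^ j ℕ.* (2 ℕ.* d) ℕ.^ i) * ι D
          ≡⟨ lemma (weight a k m) (ι (d ℕ.^ j ℕ.* (2 ℕ.* d) ℕ.^ i)) (ι D) ⟩
        weight a k m * ι D * ι (d ℕ.^ j ℕ.* (2 ℕ.* d) ℕ.^ i)
          ≡⟨ cong (_* ι (d ℕ.^ j ℕ.* (2 ℕ.* d) ℕ.^ i)) (trans (weight-* a k m)
              (cong (λ z → ι ((a ℕ.+ k) ! ℕ.* ((a ℕ.+ a ℕ.+ m) ! ℕ.* z !))) rest≡c)) ⟩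
        ι ((a ℕ.+ k) ! ℕ.* ((a ℕ.+ a ℕ.+ m) ! ℕ.* c !)) * ι (d ℕ.^ j ℕ.* (2 ℕ.* d) ℕ.^ i)
          ≡⟨ ι-* ((a ℕ.+ k) ! ℕ.* ((a ℕ.+ a ℕ.+ m) ! ℕ.* c !)) (d ℕ.^ j ℕ.* (2 ℕ.* d) ℕ.^ i) ⟨
        ι ((a ℕ.+ k) ! ℕ.* ((a ℕ.+ a ℕ.+ m) ! ℕ.* c !) ℕ.* (d ℕ.^ j ℕ.* (2 ℕ.* d) ℕ.^ i))
          ≤⟨ ι-mono core ⟩
        ι (n ℕ.^ k ℕ.* D)
          ≡⟨ ι-* (n ℕ.^ k) D ⟩
        ι (n ℕ.^ k) * ι D ∎)
        where
        open ≤-Reasoning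
        D = (a ℕ.+ a ℕ.+ k) ! ℕ.* (a ! ℕ.* a !)
        lemma : ∀ x y z → x * y * z ≡ x * z * y
        lemma = solve-∀ ℚ-ring

    -- θ stands for d / n, which tends to 1.
    weight-main : ∀ {θ K} → 0ℚ ≤ θ → θ ≤ 1ℚ → θ * ι n ≡ ι d → suc j ℕ.+ i ℕ.≤ K →
                  weight a (suc j ℕ.+ i) (suc j) * ι 2 ^ (suc j ℕ.+ i) * θ ^ K ≤ ι n * ι 2 ^ suc j
    weight-main {θ} {K} 0≤θ θ≤1 θn≡d k≤K = *-cancelʳ 0<n^ (begin
      W * ι 2 ^ k * θ ^ K * ι n ^ (j ℕ.+ i)
        -- `core` contains `j + i` factors `d`, and one `θ` for each turns `n` into `d`. The surplus
        -- powers of `θ` are at most 1 and are dropped.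
        ≤⟨ *-monoʳ (0≤^ (0≤ι n) (j ℕ.+ i)) (*-monoˡ (0≤* (0≤weight a k m) (0≤^ (0≤ι 2) k)) (^-anti 0≤θ θ≤1 (ℕ.≤-trans (ℕ.n≤1+n _) k≤K))) ⟩
      W * ι 2 ^ k * θ ^ (j ℕ.+ i) * ι n ^ (j ℕ.+ i)
        ≡⟨ cong (_* ι n ^ (j ℕ.+ i)) (cong₂ (λ x y → W * x * y) (^-+ (ι 2) (suc j) i) (^-+ θ j i)) ⟩
      W * (ι 2 ^ suc j * ι 2 ^ i) * (θ ^ j * θ ^ i) * ι n ^ (j ℕ.+ i)
        ≡⟨ cong (W * (ι 2 ^ suc j * ι 2 ^ i) * (θ ^ j * θ ^ i) *_) (^-+ (ι n) j i) ⟩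
      W * (ι 2 ^ suc j * ι 2 ^ i) * (θ ^ j * θ ^ i) * (ι n ^ j * ι n ^ i)
        ≡⟨ lemma W (ι 2 ^ suc j) (ι 2 ^ i) (θ ^ j) (θ ^ i) (ι n ^ j) (ι n ^ i) ⟩
      W * ((θ ^ j * ι n ^ j) * (ι 2 ^ i * (θ ^ i * ι n ^ i))) * ι 2 ^ suc j
        ≡⟨ cong (λ z → W * z * ι 2 ^ suc j) (begin-equality
            (θ ^ j * ι n ^ j) * (ι 2 ^ i * (θ ^ i * ι n ^ i))
              ≡⟨ cong₂ (λ x y → x * (ι 2 ^ i * y)) (power j) (power i) ⟩
            ι d ^ j * (ι 2 ^ i * ι d ^ i)
              ≡⟨ cong (ι d ^ j *_) (trans (sym (^-* (ι 2) (ι d) i)) (cong (_^ i) (sym (ι-* 2 d)))) ⟩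
            ι d ^ j * ι (2 ℕ.* d) ^ i
              ≡⟨ cong₂ _*_ (sym (ι-^ d j)) (sym (ι-^ (2 ℕ.* d) i)) ⟩
            ι (d ℕ.^ j) * ι ((2 ℕ.* d) ℕ.^ i)
              ≡⟨ ι-* (d ℕ.^ j) ((2 ℕ.* d) ℕ.^ i) ⟨
            ι (d ℕ.^ j ℕ.* (2 ℕ.* d) ℕ.^ i) ∎) ⟩
      W * ι (d ℕ.^ j ℕ.* (2 ℕ.* d) ℕ.^ i) * ι 2 ^ suc j
        ≤⟨ *-monoʳ (0≤^ (0≤ι 2) (suc j)) bound ⟩
      ι (n ℕ.^ k) * ι 2 ^ suc j
        ≡⟨ cong (_* ι 2 ^ suc j) (ι-^ n k) ⟩
      ι n * ι n ^ (j ℕ.+ i) * ι 2 ^ suc j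
        ≡⟨ lemma′ (ι n) (ι n ^ (j ℕ.+ i)) (ι 2 ^ suc j) ⟩
      ι n * ι 2 ^ suc j * ι n ^ (j ℕ.+ i) ∎)
      where
      open ≤-Reasoning
      W = weight a k m
      power : ∀ e → θ ^ e * ι n ^ e ≡ ι d ^ e
      power e = trans (sym (^-* θ (ι n) e)) (cong (_^ e) θn≡d)
      0<n^ : 0ℚ < ι n ^ (j ℕ.+ i)
      0<n^ = subst (0ℚ <_) (ι-^ n (j ℕ.+ i)) (0<ι (n ℕ.^ (j ℕ.+ i)) {{ℕ.m^n≢0 n (j ℕ.+ i) {{subst ℕ.NonZero (sym n≡) _}}}})
      lemma : ∀ w a b c d e f → w * (a * b) * (c * d) * (e * f) ≡ w * ((c * e) * (b * (d * f))) * a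
      lemma = solve-∀ ℚ-ring
      lemma′ : ∀ a b c → a * b * c ≡ a * c * b
      lemma′ = solve-∀ ℚ-ring

-- Crude estimates for the classes with many shared edges

module Tail where

  open import Defs using (1/_!; 0≤1/k!)
  open Rationals
  open Words
  open Weights
  import Data.Integer.Base as ℤ
  open import Data.Nat.Base as ℕ using (ℕ; zero; suc; _!)
  open import Data.Nat.Combinatorics using (_C_; nCk+nC[k+1]≡[n+1]C[k+1])
  import Data.Nat.Properties as ℕ
  import Data.Nat.Tactic.RingSolver as ℕ-solver
  open import Data.Rational.Base hiding (1/_)
  open import Data.Rational.Properties
  open import Tactic.RingSolver using (solve-∀)

  C-mono-suc : ∀ n j → n C j ℕ.≤ suc n C j
  C-mono-suc n zero    = ℕ.≤-refl
  C-mono-suc n (suc j) = ℕ.≤-trans (ℕ.m≤n+m (n C suc j) (n C j)) (ℕ.≤-reflexive (nCk+nC[k+1]≡[n+1]C[k+1] n j))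

  C-mono : ∀ n b j → n C j ℕ.≤ (b ℕ.+ n) C j
  C-mono n zero    j = ℕ.≤-refl
  C-mono n (suc b) j = ℕ.≤-trans (C-mono n b j) (C-mono-suc (b ℕ.+ n) j)

  C-absorb : ∀ n j → suc j ℕ.* (suc n C suc j) ≡ suc n ℕ.* (n C j)
  C-absorb zero    zero    = refl
  C-absorb zero    (suc j) = ℕ.*-zeroʳ j
  C-absorb (suc n) j       = begin
    suc j ℕ.* (suc (suc n) C suc j)
      ≡⟨ cong (suc j ℕ.*_) (nCk+nC[k+1]≡[n+1]C[k+1] (suc n) j) ⟨
    suc j ℕ.* ((suc n C j) ℕ.+ (suc n C suc j))
      ≡⟨ ℕ.*-distribˡ-+ (suc j) (suc n C j) (suc n C suc j) ⟩
    suc j ℕ.* (suc n C j) ℕ.+ suc j ℕ.* (suc n C suc j)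
      ≡⟨ cong (suc j ℕ.* (suc n C j) ℕ.+_) (C-absorb n j) ⟩
    suc n C j ℕ.+ j ℕ.* (suc n C j) ℕ.+ suc n ℕ.* (n C j)
      ≡⟨ ℕ.+-assoc (suc n C j) _ _ ⟩
    suc n C j ℕ.+ (j ℕ.* (suc n C j) ℕ.+ suc n ℕ.* (n C j))
      ≡⟨ cong (suc n C j ℕ.+_) (lower j) ⟩
    suc (suc n) ℕ.* (suc n C j) ∎
    where
    open ≡-Reasoning
    lower : ∀ j → j ℕ.* (suc n C j) ℕ.+ suc n ℕ.* (n C j) ≡ suc n ℕ.* (suc n C j)
    lower zero    = refl
    lower (suc j) = trans (cong (ℕ._+ suc n ℕ.* (n C suc j)) (C-absorb n j))
      (trans (sym (ℕ.*-distribˡ-+ (suc n) (n C j) (n C suc j))) (cong (suc n ℕ.*_) (nCk+nC[k+1]≡[n+1]C[k+1] n j)))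

  C-ratio : ∀ n j → suc n ℕ.* (n C j) ℕ.+ j ℕ.* (suc n C j) ≡ suc n ℕ.* (suc n C j)
  C-ratio n zero    = ℕ.+-identityʳ _
  C-ratio n (suc j) = begin
    suc n ℕ.* (n C suc j) ℕ.+ suc j ℕ.* (suc n C suc j)  ≡⟨ cong (suc n ℕ.* (n C suc j) ℕ.+_) (C-absorb n j) ⟩
    suc n ℕ.* (n C suc j) ℕ.+ suc n ℕ.* (n C j)          ≡⟨ ℕ.*-distribˡ-+ (suc n) (n C suc j) (n C j) ⟨
    suc n ℕ.* (n C suc j ℕ.+ n C j)                      ≡⟨ cong (suc n ℕ.*_) (trans (ℕ.+-comm (n C suc j) (n C j)) (nCk+nC[k+1]≡[n+1]C[k+1] n j)) ⟩
    suc n ℕ.* (suc n C suc j)                            ∎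
    where open ≡-Reasoning

  binomialSum : ∀ {x} → 0ℚ ≤ x → ∀ k J → Σ< J (λ j → ι (k C j) * x ^ j) ≤ (1ℚ + x) ^ k
  binomialSum {x} 0≤x k zero = 0≤^ (0≤+ (nonNegative⁻¹ 1ℚ) 0≤x) k
  binomialSum {x} 0≤x zero (suc J) = ≤-reflexive (begin
    Σ< (suc J) (λ j → ι (0 C j) * x ^ j)         ≡⟨ Σ<-shift J _ ⟩
    1ℚ * 1ℚ + Σ< J (λ j → 0ℚ * x ^ suc j)        ≡⟨ cong (1ℚ * 1ℚ +_) (trans (Σ<-cong J (λ {j} _ → *-zeroˡ (x ^ suc j))) (Σ<-0 J)) ⟩
    1ℚ                                           ∎)
    where open ≡-Reasoning
  binomialSum {x} 0≤x (suc k) (suc J) = begin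
    Σ< (suc J) (λ j → ι (suc k C j) * x ^ j)
      ≡⟨ Σ<-shift J _ ⟩
    1ℚ * 1ℚ + Σ< J (λ j → ι (suc k C suc j) * x ^ suc j)
      ≡⟨ cong (1ℚ * 1ℚ +_) (trans (Σ<-cong J (λ {j} _ → pascal j)) (Σ<-+ J (λ j → ι (k C suc j) * x ^ suc j) (λ j → x * (ι (k C j) * x ^ j)))) ⟩
    1ℚ * 1ℚ + (Σ< J (λ j → ι (k C suc j) * x ^ suc j) + Σ< J (λ j → x * (ι (k C j) * x ^ j)))
      ≡⟨ +-assoc (1ℚ * 1ℚ) (Σ< J (λ j → ι (k C suc j) * x ^ suc j)) _ ⟨
    1ℚ * 1ℚ + Σ< J (λ j → ι (k C suc j) * x ^ suc j) + Σ< J (λ j → x * (ι (k C j) * x ^ j))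
      ≡⟨ cong₂ _+_ (sym (Σ<-shift J (λ j → ι (k C j) * x ^ j))) (Σ<-*ˡ J x (λ j → ι (k C j) * x ^ j)) ⟩
    Σ< (suc J) (λ j → ι (k C j) * x ^ j) + x * Σ< J (λ j → ι (k C j) * x ^ j)
      ≤⟨ +-mono-≤ (binomialSum 0≤x k (suc J)) (*-monoˡ 0≤x (binomialSum 0≤x k J)) ⟩
    (1ℚ + x) ^ k + x * (1ℚ + x) ^ k
      ≡⟨ cong (_+ x * (1ℚ + x) ^ k) (*-identityˡ ((1ℚ + x) ^ k)) ⟨
    1ℚ * (1ℚ + x) ^ k + x * (1ℚ + x) ^ k
      ≡⟨ *-distribʳ-+ ((1ℚ + x) ^ k) 1ℚ x ⟨
    (1ℚ + x) ^ suc k ∎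
    where
    open ≤-Reasoning
    lemma : ∀ a b x p → (a + b) * (x * p) ≡ b * (x * p) + x * (a * p)
    lemma = solve-∀ ℚ-ring
    pascal : ∀ j → ι (suc k C suc j) * x ^ suc j ≡ ι (k C suc j) * x ^ suc j + x * (ι (k C j) * x ^ j)
    pascal j = trans (cong (_* x ^ suc j) (trans (cong ι (sym (nCk+nC[k+1]≡[n+1]C[k+1] k j))) (ι-+ (k C j) (k C suc j))))
      (lemma (ι (k C j)) (ι (k C suc j)) x (x ^ j))

  private
    longRunCount-≤ : ∀ m k → longRunCount m (suc k) ℕ.≤ 2 ℕ.^ m ℕ.* (k C m)
    runCount-≤     : ∀ m k → runCount (suc m) (suc k) ℕ.≤ 2 ℕ.^ suc m ℕ.* (k C m)
    runCount-≤′    : ∀ m k → runCount m k ℕ.≤ 2 ℕ.^ m ℕ.* (k C m)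

    longRunCount-≤ zero    zero    = ℕ.≤-refl
    longRunCount-≤ (suc m) zero    = ℕ.z≤n
    longRunCount-≤ zero    (suc k) = ℕ.≤-trans (ℕ.≤-reflexive (longRunCount-suc 0 (suc k))) (longRunCount-≤ 0 k)
    longRunCount-≤ (suc m) (suc k) = begin
      longRunCount (suc m) (suc (suc k))
        ≡⟨ longRunCount-suc (suc m) (suc k) ⟩
      runCount (suc m) (suc k) ℕ.+ longRunCount (suc m) (suc k)
        ≤⟨ ℕ.+-mono-≤ (runCount-≤ m k) (longRunCount-≤ (suc m) k) ⟩
      2 ℕ.^ suc m ℕ.* (k C m) ℕ.+ 2 ℕ.^ suc m ℕ.* (k C suc m)
        ≡⟨ ℕ.*-distribˡ-+ (2 ℕ.^ suc m) (k C m) (k C suc m) ⟨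
      2 ℕ.^ suc m ℕ.* (k C m ℕ.+ k C suc m)
        ≡⟨ cong (2 ℕ.^ suc m ℕ.*_) (nCk+nC[k+1]≡[n+1]C[k+1] k m) ⟩
      2 ℕ.^ suc m ℕ.* (suc k C suc m) ∎
      where open ℕ.≤-Reasoning

    runCount-≤′ zero    zero    = ℕ.≤-refl
    runCount-≤′ zero    (suc k) = ℕ.z≤n
    runCount-≤′ (suc m) zero    = ℕ.z≤n
    runCount-≤′ (suc m) (suc k) = ℕ.≤-trans (runCount-≤ m k) (ℕ.*-monoʳ-≤ (2 ℕ.^ suc m)
      (ℕ.≤-trans (ℕ.m≤m+n (k C m) (k C suc m)) (ℕ.≤-reflexive (nCk+nC[k+1]≡[n+1]C[k+1] k m))))

    runCount-≤ m k = begin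
      runCount (suc m) (suc k)
        ≡⟨ runCount-suc m k ⟩
      runCount m k ℕ.+ longRunCount m (suc k)
        ≤⟨ ℕ.+-mono-≤ (runCount-≤′ m k) (longRunCount-≤ m k) ⟩
      2 ℕ.^ m ℕ.* (k C m) ℕ.+ 2 ℕ.^ m ℕ.* (k C m)
        ≡⟨ lemma (2 ℕ.^ m) (k C m) ⟩
      2 ℕ.^ suc m ℕ.* (k C m) ∎
      where
      open ℕ.≤-Reasoning
      lemma : ∀ p c → p ℕ.* c ℕ.+ p ℕ.* c ≡ 2 ℕ.* p ℕ.* c
      lemma = ℕ-solver.solve-∀

  -- For positive `k` there are `(k - 1) C m` compositions of `k` into `suc m` parts, and a part has
  -- at most two codes. The larger `k C m` gives one formula that covers `k = 0` too.
  runCount-bound : ∀ m k → runCount (suc m) k ℕ.≤ 2 ℕ.^ suc m ℕ.* (k C m)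
  runCount-bound m zero    = ℕ.z≤n
  runCount-bound m (suc k) = ℕ.≤-trans (runCount-≤ m k) (ℕ.*-monoʳ-≤ (2 ℕ.^ suc m) (C-mono-suc k m))

  private
    -- With `c` fixed, raising `j` raises `a = c + j` as well. The left side gains three factors, at
    -- most `3a + 4`, `3a + 3` and `3a + 2`; the right side gains
    -- `7 * (2a + 3) * (2a + 2) * (a + 1)`. For large `a` this compares 27 with 28, which is where 7
    -- comes from.
    !-ratio : ∀ j c → ((c ℕ.+ j) ℕ.+ (c ℕ.+ j) ℕ.+ suc j) ! ℕ.* c ! ℕ.≤ 7 ℕ.^ j ℕ.* (suc ((c ℕ.+ j) ℕ.+ (c ℕ.+ j)) ! ℕ.* (c ℕ.+ j) !)
    !-ratio zero    c = ℕ.≤-reflexive (trans (cong₂ (λ x y → x ! ℕ.* y !)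
      (ℕ.+-comm ((c ℕ.+ 0) ℕ.+ (c ℕ.+ 0)) 1) (sym (ℕ.+-identityʳ c)))
      (sym (ℕ.*-identityˡ (suc ((c ℕ.+ 0) ℕ.+ (c ℕ.+ 0)) ! ℕ.* (c ℕ.+ 0) !))))
    !-ratio (suc j) c = begin
      ((c ℕ.+ suc j) ℕ.+ (c ℕ.+ suc j) ℕ.+ suc (suc j)) ! ℕ.* c !
        ≡⟨ cong (λ y → y ! ℕ.* c !) (trans (cong (λ y → y ℕ.+ y ℕ.+ suc (suc j)) (ℕ.+-suc c j)) (index a j)) ⟩
      suc (suc (suc z)) ℕ.* (suc (suc z) ℕ.* (suc z ℕ.* z !)) ℕ.* c !
        ≡⟨ lemma (suc (suc (suc z))) (suc (suc z)) (suc z) (z !) (c !) ⟩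
      (suc (suc (suc z)) ℕ.* suc (suc z) ℕ.* suc z) ℕ.* (z ! ℕ.* c !)
        ≤⟨ ℕ.*-mono-≤ cubic (!-ratio j c) ⟩
      (7 ℕ.* (suc (suc s′) ℕ.* suc s′) ℕ.* suc a) ℕ.* (7 ℕ.^ j ℕ.* (s′ ! ℕ.* a !))
        ≡⟨ lemma′ (7 ℕ.^ j) (suc (suc s′)) (suc s′) (suc a) (s′ !) (a !) ⟩
      7 ℕ.^ suc j ℕ.* (suc (suc s′) ! ℕ.* suc a !)
        ≡⟨ cong₂ (λ x y → 7 ℕ.^ suc j ℕ.* (x ! ℕ.* y !)) (sym (trans (cong (λ y → suc (y ℕ.+ y)) (ℕ.+-suc c j)) (cong (suc ∘ suc) (ℕ.+-suc a a)))) (sym (ℕ.+-suc c j)) ⟩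
      7 ℕ.^ suc j ℕ.* (suc ((c ℕ.+ suc j) ℕ.+ (c ℕ.+ suc j)) ! ℕ.* (c ℕ.+ suc j) !) ∎
      where
      open ℕ.≤-Reasoning
      a  = c ℕ.+ j
      z  = a ℕ.+ a ℕ.+ suc j
      s′ = suc (a ℕ.+ a)
      index : ∀ a j → suc a ℕ.+ suc a ℕ.+ suc (suc j) ≡ suc (suc (suc (a ℕ.+ a ℕ.+ suc j)))
      index = ℕ-solver.solve-∀
      lemma : ∀ x y w f g → x ℕ.* (y ℕ.* (w ℕ.* f)) ℕ.* g ≡ (x ℕ.* y ℕ.* w) ℕ.* (f ℕ.* g)
      lemma = ℕ-solver.solve-∀
      lemma′ : ∀ p x y w f g → (7 ℕ.* (x ℕ.* y) ℕ.* w) ℕ.* (p ℕ.* (f ℕ.* g)) ≡ 7 ℕ.* p ℕ.* ((x ℕ.* (y ℕ.* f)) ℕ.* (w ℕ.* g))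
      lemma′ = ℕ-solver.solve-∀
      z≤ : z ℕ.≤ suc (a ℕ.+ a ℕ.+ a)
      z≤ = ℕ.≤-trans (ℕ.≤-reflexive (ℕ.+-suc (a ℕ.+ a) j)) (ℕ.s≤s (ℕ.+-monoʳ-≤ (a ℕ.+ a) (ℕ.m≤n+m j c)))
      polynomial : ∀ a → 7 ℕ.* ((3 ℕ.+ (a ℕ.+ a)) ℕ.* (2 ℕ.+ (a ℕ.+ a))) ℕ.* (1 ℕ.+ a) ≡
                   (4 ℕ.+ (a ℕ.+ a ℕ.+ a)) ℕ.* (3 ℕ.+ (a ℕ.+ a ℕ.+ a)) ℕ.* (2 ℕ.+ (a ℕ.+ a ℕ.+ a)) ℕ.+ (1 ℕ.+ a) ℕ.* (a ℕ.* a ℕ.+ 16 ℕ.* a ℕ.+ 18)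
      polynomial = ℕ-solver.solve-∀
      cubic : suc (suc (suc z)) ℕ.* suc (suc z) ℕ.* suc z ℕ.≤ 7 ℕ.* (suc (suc s′) ℕ.* suc s′) ℕ.* suc a
      cubic = ℕ.≤-trans (ℕ.*-mono-≤ (ℕ.*-mono-≤ (ℕ.s≤s (ℕ.s≤s (ℕ.s≤s z≤))) (ℕ.s≤s (ℕ.s≤s z≤))) (ℕ.s≤s z≤))
        (ℕ.≤-trans (ℕ.m≤m+n _ _) (ℕ.≤-reflexive (sym (polynomial a))))

  -- The product of (a + i) / (a + a + i) over 1 ≤ i ≤ k.
  R : ℕ → ℕ → ℚ
  R a k = ι ((k ℕ.+ a) ! ℕ.* (a ℕ.+ a) !) * (1/ k ℕ.+ (a ℕ.+ a) ! * 1/ a !)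

  0≤R : ∀ a k → 0ℚ ≤ R a k
  0≤R a k = 0≤* (0≤ι ((k ℕ.+ a) ! ℕ.* (a ℕ.+ a) !)) (0≤* (0≤1/k! (k ℕ.+ (a ℕ.+ a))) (0≤1/k! a))

  R-0 : ∀ a → R a 0 ≡ 1ℚ
  R-0 a = trans (cong (_* (1/ a ℕ.+ a ! * 1/ a !)) (ι-* (a !) ((a ℕ.+ a) !)))
    (trans (lemma (ι (a !)) (ι ((a ℕ.+ a) !)) (1/ a ℕ.+ a !) (1/ a !)) (cong₂ _*_ (k!*1/k! a) (k!*1/k! (a ℕ.+ a))))
    where
    lemma : ∀ p q x y → p * q * (x * y) ≡ p * y * (q * x)
    lemma = solve-∀ ℚ-ring

  R-suc : ∀ a k → ι (suc (k ℕ.+ (a ℕ.+ a))) * R a (suc k) ≡ ι (suc (k ℕ.+ a)) * R a k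
  R-suc a k = begin
    ι (suc b) * (ι (suc (k ℕ.+ a) ℕ.* (k ℕ.+ a) ! ℕ.* (a ℕ.+ a) !) * (1/ suc b ! * 1/ a !))
      ≡⟨ cong (λ z → ι (suc b) * (z * (1/ suc b ! * 1/ a !))) (trans (cong ι (ℕ.*-assoc (suc (k ℕ.+ a)) ((k ℕ.+ a) !) ((a ℕ.+ a) !))) (ι-* (suc (k ℕ.+ a)) ((k ℕ.+ a) ! ℕ.* (a ℕ.+ a) !))) ⟩
    ι (suc b) * (ι (suc (k ℕ.+ a)) * t * (1/ suc b ! * 1/ a !))
      ≡⟨ lemma (ι (suc b)) (ι (suc (k ℕ.+ a))) t (1/ suc b !) (1/ a !) ⟩
    ι (suc (k ℕ.+ a)) * (t * (ι (suc b) * 1/ suc b ! * 1/ a !))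
      ≡⟨ cong (λ z → ι (suc (k ℕ.+ a)) * (t * (z * 1/ a !))) (1/suc! b) ⟩
    ι (suc (k ℕ.+ a)) * R a k ∎
    where
    open ≡-Reasoning
    b = k ℕ.+ (a ℕ.+ a)
    t = ι ((k ℕ.+ a) ! ℕ.* (a ℕ.+ a) !)
    lemma : ∀ p q t x y → p * (q * t * (x * y)) ≡ q * (t * (p * x * y))
    lemma = solve-∀ ℚ-ring

  -- ⅔ bounds the factors `(a + i) / (2a + i)` of `R a k` for `i ≤ a`. ⅒ is chosen such that
  -- `(1 + ⅒)³ * ⅔` is still below 1, and `σ` is a round number above it.
  ⅔ σ ⅒ : ℚ
  ⅔ = ℤ.+ 2 / 3
  σ = ℤ.+ 9 / 10
  ⅒ = ℤ.+ 1 / 10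

  R-geometric : ∀ a k → k ℕ.≤ a → R a k ≤ ⅔ ^ k
  R-geometric a zero    _   = ≤-reflexive (R-0 a)
  R-geometric a (suc k) k<a = *-cancelʳ (0<ι (suc b)) (begin
    R a (suc k) * ι (suc b)            ≡⟨ *-comm (R a (suc k)) (ι (suc b)) ⟩
    ι (suc b) * R a (suc k)            ≡⟨ R-suc a k ⟩
    ι (suc (k ℕ.+ a)) * R a k          ≤⟨ *-mono (0≤ι (suc (k ℕ.+ a))) (0≤^ (nonNegative⁻¹ ⅔) k) two-thirds (R-geometric a k (ℕ.<⇒≤ k<a)) ⟩
    ⅔ * ι (suc b) * ⅔ ^ k              ≡⟨ lemma ⅔ (ι (suc b)) (⅔ ^ k) ⟩
    ⅔ ^ suc k * ι (suc b)              ∎)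
    where
    open ≤-Reasoning
    b = k ℕ.+ (a ℕ.+ a)
    lemma : ∀ p q r → p * q * r ≡ p * r * q
    lemma = solve-∀ ℚ-ring
    three : 3 ℕ.* suc (k ℕ.+ a) ℕ.≤ 2 ℕ.* suc b
    three = ℕ.≤-trans (ℕ.≤-reflexive (split k a)) (ℕ.≤-trans (ℕ.+-monoʳ-≤ (2 ℕ.+ 2 ℕ.* k ℕ.+ 3 ℕ.* a) k<a) (ℕ.≤-reflexive (merge k a)))
      where
      split : ∀ k a → 3 ℕ.* suc (k ℕ.+ a) ≡ 2 ℕ.+ 2 ℕ.* k ℕ.+ 3 ℕ.* a ℕ.+ suc k
      split = ℕ-solver.solve-∀
      merge : ∀ k a → 2 ℕ.+ 2 ℕ.* k ℕ.+ 3 ℕ.* a ℕ.+ a ≡ 2 ℕ.* suc (k ℕ.+ (a ℕ.+ a))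
      merge = ℕ-solver.solve-∀
    two-thirds : ι (suc (k ℕ.+ a)) ≤ ⅔ * ι (suc b)
    two-thirds = *-cancelʳ {r = ι 3} (0<ι 3) (begin
      ι (suc (k ℕ.+ a)) * ι 3    ≡⟨ trans (*-comm (ι (suc (k ℕ.+ a))) (ι 3)) (sym (ι-* 3 (suc (k ℕ.+ a)))) ⟩
      ι (3 ℕ.* suc (k ℕ.+ a))    ≤⟨ ι-mono three ⟩
      ι (2 ℕ.* suc b)            ≡⟨ ι-* 2 (suc b) ⟩
      ⅔ * ι 3 * ι (suc b)        ≡⟨ lemma ⅔ (ι 3) (ι (suc b)) ⟩
      ⅔ * ι (suc b) * ι 3        ∎)

  module _ (a j : ℕ) (j≤a : j ℕ.≤ a) where

    private
      W : ℕ → ℚ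
      W k = ι ((k ℕ.+ (a ℕ.+ a)) C j) * R a k

      -- The quotient of consecutive values is `(k + a + 1) / (k + 2a + 1 - j)`, at most 1 for
      -- `j ≤ a`. With `k C j` itself the quotient can exceed 1, hence the upper index shifted by
      -- `a + a`.
      W-decreasing : ∀ k → W (suc k) ≤ W k
      W-decreasing k = *-cancelʳ (0<ι (suc (k ℕ.+ a))) (+-cancel (c₁ * r₁ * ι j) (begin
        c₁ * r₁ * q + c₁ * r₁ * ι j     ≡⟨ *-distribˡ-+ (c₁ * r₁) q (ι j) ⟨
        c₁ * r₁ * (q + ι j)             ≤⟨ *-monoˡ (0≤* (0≤ι (suc b C j)) (0≤R a (suc k))) q+j≤ ⟩
        c₁ * r₁ * ι (suc b)             ≡⟨ lemma c₁ r₁ (ι (suc b)) ⟩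
        r₁ * (ι (suc b) * c₁)           ≡⟨ cong (r₁ *_) ratio ⟨
        r₁ * (ι (suc b) * c₀ + ι j * c₁) ≡⟨ lemma′ r₁ (ι (suc b)) c₀ (ι j) c₁ ⟩
        ι (suc b) * r₁ * c₀ + c₁ * r₁ * ι j ≡⟨ cong (λ z → z * c₀ + c₁ * r₁ * ι j) (R-suc a k) ⟩
        q * r₀ * c₀ + c₁ * r₁ * ι j     ≡⟨ cong (_+ c₁ * r₁ * ι j) (lemma″ q r₀ c₀) ⟩
        c₀ * r₀ * q + c₁ * r₁ * ι j     ∎))
        where
        open ≤-Reasoning
        b  = k ℕ.+ (a ℕ.+ a)
        q  = ι (suc (k ℕ.+ a))
        c₀ = ι (b C j)
        c₁ = ι (suc b C j)
        r₀ = R a k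
        r₁ = R a (suc k)
        q+j≤ : q + ι j ≤ ι (suc b)
        q+j≤ = ≤-trans (≤-reflexive (sym (ι-+ (suc (k ℕ.+ a)) j)))
          (ι-mono (ℕ.s≤s (ℕ.≤-trans (ℕ.≤-reflexive (ℕ.+-assoc k a j)) (ℕ.+-monoʳ-≤ k (ℕ.+-monoʳ-≤ a j≤a)))))
        ratio : ι (suc b) * c₀ + ι j * c₁ ≡ ι (suc b) * c₁
        ratio = trans (cong₂ _+_ (sym (ι-* (suc b) (b C j))) (sym (ι-* j (suc b C j))))
          (trans (sym (ι-+ (suc b ℕ.* (b C j)) (j ℕ.* (suc b C j)))) (trans (cong ι (C-ratio b j)) (ι-* (suc b) (suc b C j))))
        +-cancel : ∀ r {p q} → p + r ≤ q + r → p ≤ q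
        +-cancel r {p} {q} le = subst₂ _≤_ (undo p) (undo q) (+-monoˡ-≤ (- r) le)
          where
          undo : ∀ p → p + r + - r ≡ p
          undo p = trans (+-assoc p r (- r)) (trans (cong (λ z → p + z) (+-inverseʳ r)) (+-identityʳ p))
        lemma : ∀ c r s → c * r * s ≡ r * (s * c)
        lemma = solve-∀ ℚ-ring
        lemma′ : ∀ r s c j d → r * (s * c + j * d) ≡ s * r * c + d * r * j
        lemma′ = solve-∀ ℚ-ring
        lemma″ : ∀ q r c → q * r * c ≡ c * r * q
        lemma″ = solve-∀ ℚ-ring

      W-anti : ∀ k i → W (i ℕ.+ k) ≤ W k
      W-anti k zero    = ≤-refl
      W-anti k (suc i) = ≤-trans (W-decreasing (i ℕ.+ k)) (W-anti k i)

    large-k : ∀ k → a ℕ.≤ k → ι (k C j) * R a k ≤ ι ((a ℕ.+ (a ℕ.+ a)) C j) * ⅔ ^ a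
    large-k k a≤k = begin
      ι (k C j) * R a k                              ≤⟨ *-monoʳ (0≤R a k) (ι-mono (subst (λ b → k C j ℕ.≤ b C j) (ℕ.+-comm (a ℕ.+ a) k) (C-mono k (a ℕ.+ a) j))) ⟩
      W k                                            ≡⟨ cong W (ℕ.m∸n+n≡m a≤k) ⟨
      W (k ℕ.∸ a ℕ.+ a)                              ≤⟨ W-anti a (k ℕ.∸ a) ⟩
      W a                                            ≤⟨ *-monoˡ (0≤ι ((a ℕ.+ (a ℕ.+ a)) C j)) (R-geometric a a ℕ.≤-refl) ⟩
      ι ((a ℕ.+ (a ℕ.+ a)) C j) * ⅔ ^ a              ∎
      where open ≤-Reasoning

    -- `R a k` collects the factorials of the weight that depend on `k`; what is left is the
    -- quotient bounded in `!-ratio`, up to the factor `2a + 1`.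
    weight-R : ∀ k → weight a k (suc j) ≤ ι 7 ^ j * ι (suc (a ℕ.+ a)) * R a k
    weight-R k = begin
      ι (numerator a k (suc j)) * D
        ≤⟨ *-monoʳ (0≤* (0≤1/k! (a ℕ.+ a ℕ.+ k)) (0≤* (0≤1/k! a) (0≤1/k! a))) (ι-mono numerator-≤) ⟩
      ι (7 ℕ.^ j ℕ.* suc (a ℕ.+ a) ℕ.* ((k ℕ.+ a) ! ℕ.* (a ℕ.+ a) !) ℕ.* a !) * D
        ≡⟨ cong (_* D) (trans (ι-* (7 ℕ.^ j ℕ.* suc (a ℕ.+ a) ℕ.* ((k ℕ.+ a) ! ℕ.* (a ℕ.+ a) !)) (a !))
            (cong (_* ι (a !)) (trans (ι-* (7 ℕ.^ j ℕ.* suc (a ℕ.+ a)) ((k ℕ.+ a) ! ℕ.* (a ℕ.+ a) !))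
              (cong (_* t) (trans (ι-* (7 ℕ.^ j) (suc (a ℕ.+ a))) (cong (_* ι (suc (a ℕ.+ a))) (ι-^ 7 j))))))) ⟩
      ι 7 ^ j * ι (suc (a ℕ.+ a)) * t * ι (a !) * (1/ a ℕ.+ a ℕ.+ k ! * (1/ a ! * 1/ a !))
        ≡⟨ lemma (ι 7 ^ j) (ι (suc (a ℕ.+ a))) t (ι (a !)) (1/ a ℕ.+ a ℕ.+ k !) (1/ a !) ⟩
      ι 7 ^ j * ι (suc (a ℕ.+ a)) * (t * (1/ a ℕ.+ a ℕ.+ k ! * 1/ a !)) * (ι (a !) * 1/ a !)
        ≡⟨ cong₂ (λ b u → ι 7 ^ j * ι (suc (a ℕ.+ a)) * (t * (1/ b ! * 1/ a !)) * u) (ℕ.+-comm (a ℕ.+ a) k) (k!*1/k! a) ⟩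
      ι 7 ^ j * ι (suc (a ℕ.+ a)) * R a k * 1ℚ
        ≡⟨ *-identityʳ _ ⟩
      ι 7 ^ j * ι (suc (a ℕ.+ a)) * R a k ∎
      where
      open ≤-Reasoning
      D = 1/ a ℕ.+ a ℕ.+ k ! * (1/ a ! * 1/ a !)
      t = ι ((k ℕ.+ a) ! ℕ.* (a ℕ.+ a) !)
      c = a ℕ.∸ j
      lemma : ∀ p q t f x y → p * q * t * f * (x * (y * y)) ≡ p * q * (t * (x * y)) * (f * y)
      lemma = solve-∀ ℚ-ring
      rest≡c : suc (a ℕ.+ k) ℕ.∸ (k ℕ.+ suc j) ≡ c
      rest≡c = trans (cong (suc (a ℕ.+ k) ℕ.∸_) (ℕ.+-suc k j))
        (trans (cong (ℕ._∸ (k ℕ.+ j)) (ℕ.+-comm a k)) (ℕ.[m+n]∸[m+o]≡n∸o k a j))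
      ratio : (a ℕ.+ a ℕ.+ suc j) ! ℕ.* c ! ℕ.≤ 7 ℕ.^ j ℕ.* (suc (a ℕ.+ a) ! ℕ.* a !)
      ratio = subst (λ b → (b ℕ.+ b ℕ.+ suc j) ! ℕ.* c ! ℕ.≤ 7 ℕ.^ j ℕ.* (suc (b ℕ.+ b) ! ℕ.* b !)) (ℕ.m∸n+n≡m j≤a) (!-ratio j c)
      numerator-≤ : numerator a k (suc j) ℕ.≤ 7 ℕ.^ j ℕ.* suc (a ℕ.+ a) ℕ.* ((k ℕ.+ a) ! ℕ.* (a ℕ.+ a) !) ℕ.* a !
      numerator-≤ = ℕ.≤-trans (ℕ.≤-reflexive (cong₂ (λ x y → x ! ℕ.* ((a ℕ.+ a ℕ.+ suc j) ! ℕ.* y !)) (ℕ.+-comm a k) rest≡c))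
        (ℕ.≤-trans (ℕ.*-monoʳ-≤ ((k ℕ.+ a) !) ratio)
          (ℕ.≤-reflexive (rearrange ((k ℕ.+ a) !) (7 ℕ.^ j) (suc (a ℕ.+ a)) ((a ℕ.+ a) !) (a !))))
        where
        rearrange : ∀ f p s g h → f ℕ.* (p ℕ.* ((s ℕ.* g) ℕ.* h)) ≡ p ℕ.* s ℕ.* (f ℕ.* g) ℕ.* h
        rearrange = ℕ-solver.solve-∀

-- The sum over all classes with many shared edges

module TailSum where

  open Counting using (𝟙; 𝟙≤1; 𝟙-no)
  open import Defs using (1/_!; 0≤1/k!)
  open Rationals
  open Words
  open Weights
  open Tail
  open import Data.Nat.Base as ℕ using (ℕ; zero; suc; _!)
  open import Data.Nat.Combinatorics using (_C_)
  import Data.Nat.Properties as ℕ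
  import Data.Nat.Tactic.RingSolver as ℕ-solver
  open import Data.Rational.Base hiding (1/_)
  open import Data.Rational.Properties
  open import Tactic.RingSolver using (solve-∀)

  -- Classes with more than suc (a + k) prescribed vertices are empty.
  entry : ℕ → ℕ → ℕ → ℚ
  entry a k m = ι (𝟙 (k ℕ.+ m ℕ.≤? suc (a ℕ.+ k))) * (ι (runCount m k) * 1/ m ! * weight a k m)

  entries : ℕ → ℕ → ℚ
  entries a k = Σ< (suc k) (entry a k)

  -- Up to `j = y` the factor `y ^ y` suffices alone; beyond, each step multiplies the left side by
  -- `y` and the right side by more than `y`.
  ^-!-bound : ∀ y j → y ℕ.^ j ℕ.≤ y ℕ.^ y ℕ.* j !
  ^-!-bound zero    zero    = ℕ.≤-refl
  ^-!-bound zero    (suc j) = ℕ.z≤n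
  ^-!-bound (suc y) zero    = ℕ.*-mono-≤ {1} (ℕ.m^n>0 (suc y) (suc y)) ℕ.≤-refl
  ^-!-bound (suc y) (suc j) with suc j ℕ.≤? suc y
  ... | yes j≤y = ℕ.≤-trans (ℕ.^-monoʳ-≤ (suc y) j≤y) (ℕ.m≤m*n (suc y ℕ.^ suc y) (suc j !) {{suc j ℕ.!≢0}})
  ... | no  j≰y = ℕ.≤-trans (ℕ.*-mono-≤ (ℕ.<⇒≤ (ℕ.≰⇒> j≰y)) (^-!-bound (suc y) j)) (ℕ.≤-reflexive (lemma (suc j) (suc y ℕ.^ suc y) (j !)))
    where
    lemma : ∀ s p f → s ℕ.* (p ℕ.* f) ≡ p ℕ.* (s ℕ.* f)
    lemma = ℕ-solver.solve-∀

  -- 10 is `1 / (1 - σ)`, and the second summand is the tail of the series from `M` on.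
  geometric : ∀ M → Σ< M (σ ^_) + ι 10 * σ ^ M ≡ ι 10
  geometric zero    = refl
  geometric (suc M) = begin
    Σ< M (σ ^_) + σ ^ M + ι 10 * (σ * σ ^ M)      ≡⟨ lemma (Σ< M (σ ^_)) (σ ^ M) (ι 10) σ ⟩
    Σ< M (σ ^_) + (1ℚ + ι 10 * σ) * σ ^ M         ≡⟨⟩
    Σ< M (σ ^_) + ι 10 * σ ^ M                    ≡⟨ geometric M ⟩
    ι 10                                          ∎
    where
    open ≡-Reasoning
    lemma : ∀ s t c x → s + t + c * (x * t) ≡ s + (1ℚ + c * x) * t
    lemma = solve-∀ ℚ-ring

  -- The whole series sums to 2 * 90 + 10 = 190, and the second summand is its tail from `M` on.
  arithmetic-geometric : ∀ M → Σ< M (λ a → ι (suc (a ℕ.+ a)) * σ ^ a) + (ι 20 * ι M + ι 190) * σ ^ M ≡ ι 190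
  arithmetic-geometric zero    = refl
  arithmetic-geometric (suc M) = begin
    S + ι (suc (M ℕ.+ M)) * t + (ι 20 * ι (suc M) + ι 190) * (σ * t)
      ≡⟨ cong₂ (λ p q → S + p * t + (ι 20 * q + ι 190) * (σ * t))
          (trans (ι-suc (M ℕ.+ M)) (cong (1ℚ +_) (ι-+ M M))) (ι-suc M) ⟩
    S + (1ℚ + (ι M + ι M)) * t + (ι 20 * (1ℚ + ι M) + ι 190) * (σ * t)
      ≡⟨ lemma S t (ι M) (ι 20) (ι 190) σ ⟩
    S + ((1ℚ + (ι M + ι M)) + (ι 20 * σ) * (1ℚ + ι M) + ι 190 * σ) * t
      ≡⟨⟩
    S + ((1ℚ + (ι M + ι M)) + ι 18 * (1ℚ + ι M) + ι 171) * t
      ≡⟨ cong (λ p → S + p * t) (lemma′ (ι M) (ι 18) (ι 171)) ⟩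
    S + (ι 20 * ι M + ι 190) * t
      ≡⟨ arithmetic-geometric M ⟩
    ι 190 ∎
    where
    open ≡-Reasoning
    S = Σ< M (λ a → ι (suc (a ℕ.+ a)) * σ ^ a)
    t = σ ^ M
    lemma : ∀ S t m c d s → S + (1ℚ + (m + m)) * t + (c * (1ℚ + m) + d) * (s * t) ≡ S + ((1ℚ + (m + m)) + (c * s) * (1ℚ + m) + d * s) * t
    lemma = solve-∀ ℚ-ring
    lemma′ : ∀ m c d → (1ℚ + (m + m)) + c * (1ℚ + m) + d ≡ (1ℚ + 1ℚ + c) * m + (1ℚ + c + d)
    lemma′ = solve-∀ ℚ-ring

  0≤σ^ : ∀ k → 0ℚ ≤ σ ^ k
  0≤σ^ = 0≤^ (nonNegative⁻¹ σ)

  -- 140 = 2 * 7 * 10: the 2 is from runCount-bound, the 7 from weight-R, and the 10 pays for the powers of ⅒.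
  module _ (A : ℕ) (A-bound : ∀ j → 140 ℕ.^ j ℕ.≤ A ℕ.* j !) where

    private
      scale : ℕ → ℚ
      scale a = ι 2 * ι A * ι (suc (a ℕ.+ a))

      0≤scale : ∀ a → 0ℚ ≤ scale a
      0≤scale a = 0≤* (0≤* (0≤ι 2) (0≤ι A)) (0≤ι (suc (a ℕ.+ a)))

      14^ : ∀ j → ι 14 ^ j * 1/ j ! ≤ ι A * ⅒ ^ j
      14^ j = begin
        ι 14 ^ j * 1/ j !                    ≡⟨ cong (_* 1/ j !) (^-* (ι 140) ⅒ j) ⟩
        ι 140 ^ j * ⅒ ^ j * 1/ j !           ≡⟨ cong (λ z → z * ⅒ ^ j * 1/ j !) (ι-^ 140 j) ⟨
        ι (140 ℕ.^ j) * ⅒ ^ j * 1/ j !       ≤⟨ *-monoʳ (0≤1/k! j) (*-monoʳ (0≤^ (nonNegative⁻¹ ⅒) j) (ι-mono (A-bound j))) ⟩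
        ι (A ℕ.* j !) * ⅒ ^ j * 1/ j !       ≡⟨ cong (λ z → z * ⅒ ^ j * 1/ j !) (ι-* A (j !)) ⟩
        ι A * ι (j !) * ⅒ ^ j * 1/ j !       ≡⟨ lemma (ι A) (ι (j !)) (⅒ ^ j) (1/ j !) ⟩
        ι A * ⅒ ^ j * (ι (j !) * 1/ j !)     ≡⟨ cong (ι A * ⅒ ^ j *_) (k!*1/k! j) ⟩
        ι A * ⅒ ^ j * 1ℚ                     ≡⟨ *-identityʳ _ ⟩
        ι A * ⅒ ^ j                          ∎
        where
        open ≤-Reasoning
        lemma : ∀ a f x r → a * f * x * r ≡ a * x * (f * r)
        lemma = solve-∀ ℚ-ring

      1/suc!≤ : ∀ j → 1/ suc j ! ≤ 1/ j !
      1/suc!≤ j = begin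
        1/ suc j !                ≡⟨ *-identityˡ _ ⟨
        1ℚ * 1/ suc j !           ≤⟨ *-monoʳ (0≤1/k! (suc j)) (ι-mono {1} {suc j} (ℕ.s≤s ℕ.z≤n)) ⟩
        ι (suc j) * 1/ suc j !    ≡⟨ 1/suc! j ⟩
        1/ j !                    ∎
        where open ≤-Reasoning

      entry-suc : ∀ a k j → j ℕ.≤ a → entry a k (suc j) ≤ scale a * (⅒ ^ j * (ι (k C j) * R a k))
      entry-suc a k j j≤a = begin
        ι (𝟙 (k ℕ.+ suc j ℕ.≤? suc (a ℕ.+ k))) * (ι (runCount (suc j) k) * 1/ suc j ! * weight a k (suc j))
          ≤⟨ *-mono (0≤ι (𝟙 (k ℕ.+ suc j ℕ.≤? suc (a ℕ.+ k)))) (0≤* (0≤* (0≤ι (2 ℕ.^ suc j ℕ.* (k C j))) (0≤1/k! j)) (0≤* (0≤* (0≤^ (0≤ι 7) j) (0≤ι (suc (a ℕ.+ a)))) (0≤R a k)))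
              (ι-mono (𝟙≤1 (k ℕ.+ suc j ℕ.≤? suc (a ℕ.+ k))))
              (*-mono (0≤* (0≤ι (runCount (suc j) k)) (0≤1/k! (suc j))) (0≤* (0≤* (0≤^ (0≤ι 7) j) (0≤ι (suc (a ℕ.+ a)))) (0≤R a k))
                (*-mono (0≤ι (runCount (suc j) k)) (0≤1/k! j) (ι-mono (runCount-bound j k)) (1/suc!≤ j))
                (weight-R a j j≤a k)) ⟩
        1ℚ * (ι (2 ℕ.^ suc j ℕ.* (k C j)) * 1/ j ! * (ι 7 ^ j * ι (suc (a ℕ.+ a)) * R a k))
          ≡⟨ trans (*-identityˡ _) (cong (λ z → z * 1/ j ! * (ι 7 ^ j * ι (suc (a ℕ.+ a)) * R a k))
              (trans (ι-* (2 ℕ.^ suc j) (k C j)) (cong (_* ι (k C j)) (ι-^ 2 (suc j))))) ⟩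
        ι 2 * ι 2 ^ j * ι (k C j) * 1/ j ! * (ι 7 ^ j * ι (suc (a ℕ.+ a)) * R a k)
          ≡⟨ lemma (ι 2) (ι 2 ^ j) (ι (k C j)) (1/ j !) (ι 7 ^ j) (ι (suc (a ℕ.+ a))) (R a k) ⟩
        ι 2 * ι (suc (a ℕ.+ a)) * ((ι 2 ^ j * ι 7 ^ j) * 1/ j !) * (ι (k C j) * R a k)
          ≡⟨ cong (λ z → ι 2 * ι (suc (a ℕ.+ a)) * (z * 1/ j !) * (ι (k C j) * R a k)) (^-* (ι 2) (ι 7) j) ⟨
        ι 2 * ι (suc (a ℕ.+ a)) * (ι 14 ^ j * 1/ j !) * (ι (k C j) * R a k)
          ≤⟨ *-monoʳ (0≤* (0≤ι (k C j)) (0≤R a k)) (*-monoˡ (0≤* (0≤ι 2) (0≤ι (suc (a ℕ.+ a)))) (14^ j)) ⟩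
        ι 2 * ι (suc (a ℕ.+ a)) * (ι A * ⅒ ^ j) * (ι (k C j) * R a k)
          ≡⟨ lemma′ (ι 2) (ι (suc (a ℕ.+ a))) (ι A) (⅒ ^ j) (ι (k C j) * R a k) ⟩
        scale a * (⅒ ^ j * (ι (k C j) * R a k)) ∎
        where
        open ≤-Reasoning
        lemma : ∀ t p c f s w r → t * p * c * f * (s * w * r) ≡ t * w * ((p * s) * f) * (c * r)
        lemma = solve-∀ ℚ-ring
        lemma′ : ∀ t w a x y → t * w * (a * x) * y ≡ t * a * w * (x * y)
        lemma′ = solve-∀ ℚ-ring

      entry-≤ : ∀ a k {B : ℕ → ℚ} → (∀ j → 0ℚ ≤ B j) → (∀ j → j ℕ.≤ a → ι (k C j) * R a k ≤ B j) →
                ∀ j → entry a k (suc j) ≤ scale a * (⅒ ^ j * B j)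
      entry-≤ a k {B} 0≤B B-bound j = go (j ℕ.≤? a)
        where
        rest = ι (runCount (suc j) k) * 1/ suc j ! * weight a k (suc j)
        too-many : j ℕ.≰ a → k ℕ.+ suc j ℕ.≰ suc (a ℕ.+ k)
        too-many j≰a le = j≰a (ℕ.+-cancelˡ-≤ k j a (ℕ.≤-trans (ℕ.s≤s⁻¹ (subst (ℕ._≤ suc (a ℕ.+ k)) (ℕ.+-suc k j) le)) (ℕ.≤-reflexive (ℕ.+-comm a k))))
        go : Dec (j ℕ.≤ a) → entry a k (suc j) ≤ scale a * (⅒ ^ j * B j)
        go (yes j≤a) = ≤-trans (entry-suc a k j j≤a)
          (*-monoˡ (0≤scale a) (*-monoˡ (0≤^ (nonNegative⁻¹ ⅒) j) (B-bound j j≤a)))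
        go (no  j≰a) = ≤-trans (≤-reflexive (trans (cong (λ z → ι z * rest) (𝟙-no (k ℕ.+ suc j ℕ.≤? suc (a ℕ.+ k)) (too-many j≰a))) (*-zeroˡ rest)))
          (0≤* (0≤scale a) (0≤* (0≤^ (nonNegative⁻¹ ⅒) j) (0≤B j)))

      entries-≤ : ∀ a k b (q : ℚ) → 0ℚ ≤ q → (∀ j → j ℕ.≤ a → ι (suc k C j) * R a (suc k) ≤ ι (b C j) * q) →
                  entries a (suc k) ≤ scale a * ((1ℚ + ⅒) ^ b * q)
      entries-≤ a k b q 0≤q bound = begin
        Σ< (suc (suc k)) (entry a (suc k))
          ≡⟨ Σ<-shift (suc k) (entry a (suc k)) ⟩
        entry a (suc k) 0 + Σ< (suc k) (entry a (suc k) ∘ suc)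
          -- Without a run there is no shared edge: `runCount 0 (suc k)` is 0.
          ≡⟨ cong (_+ Σ< (suc k) (entry a (suc k) ∘ suc)) (zero-entry (ι (𝟙 (suc k ℕ.+ 0 ℕ.≤? suc (a ℕ.+ suc k)))) (1/ 0 !) (weight a (suc k) 0)) ⟩
        0ℚ + Σ< (suc k) (entry a (suc k) ∘ suc)
          ≡⟨ +-identityˡ _ ⟩
        Σ< (suc k) (entry a (suc k) ∘ suc)
          ≤⟨ Σ<-mono (suc k) (λ {j} _ → entry-≤ a (suc k) (λ j → 0≤* (0≤ι (b C j)) 0≤q) bound j) ⟩
        Σ< (suc k) (λ j → scale a * (⅒ ^ j * (ι (b C j) * q)))
          ≡⟨ Σ<-*ˡ (suc k) (scale a) _ ⟩
        scale a * Σ< (suc k) (λ j → ⅒ ^ j * (ι (b C j) * q))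
          ≡⟨ cong (scale a *_) (trans (Σ<-cong (suc k) (λ {j} _ → lemma (⅒ ^ j) (ι (b C j)) q)) (Σ<-*ʳ (suc k) q (λ j → ι (b C j) * ⅒ ^ j))) ⟩
        scale a * (Σ< (suc k) (λ j → ι (b C j) * ⅒ ^ j) * q)
          ≤⟨ *-monoˡ (0≤scale a) (*-monoʳ 0≤q (binomialSum (nonNegative⁻¹ ⅒) b (suc k))) ⟩
        scale a * ((1ℚ + ⅒) ^ b * q) ∎
        where
        open ≤-Reasoning
        zero-entry : ∀ g f w → g * (0ℚ * f * w) ≡ 0ℚ
        zero-entry g f w = trans (cong (λ z → g * (z * w)) (*-zeroˡ f)) (trans (cong (g *_) (*-zeroˡ w)) (*-zeroʳ g))
        lemma : ∀ x c q → x * (c * q) ≡ c * x * q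
        lemma = solve-∀ ℚ-ring

    entries-bound : ∀ a k → entries a (suc k) ≤ ι 2 * ι A * ι (suc (a ℕ.+ a)) * (σ ^ suc k + σ ^ a)
    entries-bound a k = [ small , large ]′ (ℕ.≤-total (suc k) a)
     where
     open ≤-Reasoning
     small : suc k ℕ.≤ a → entries a (suc k) ≤ scale a * (σ ^ suc k + σ ^ a)
     small k≤a = begin
      entries a (suc k)
        ≤⟨ entries-≤ a k (suc k) (⅔ ^ suc k) (0≤^ (nonNegative⁻¹ ⅔) (suc k))
            (λ j _ → *-monoˡ (0≤ι (suc k C j)) (R-geometric a (suc k) k≤a)) ⟩
      scale a * ((1ℚ + ⅒) ^ suc k * ⅔ ^ suc k)
        ≡⟨ cong (scale a *_) (^-* (1ℚ + ⅒) ⅔ (suc k)) ⟨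
      scale a * ((1ℚ + ⅒) * ⅔) ^ suc k
        ≤⟨ *-monoˡ (0≤scale a) (≤-trans (^-mono (nonNegative⁻¹ ((1ℚ + ⅒) * ⅔)) (from-yes ((1ℚ + ⅒) * ⅔ ≤? σ)) (suc k)) (p≤p+q (0≤σ^ a))) ⟩
      scale a * (σ ^ suc k + σ ^ a) ∎
     large : a ℕ.≤ suc k → entries a (suc k) ≤ scale a * (σ ^ suc k + σ ^ a)
     large a≤k = begin
      entries a (suc k)
        ≤⟨ entries-≤ a k (a ℕ.+ (a ℕ.+ a)) (⅔ ^ a) (0≤^ (nonNegative⁻¹ ⅔) a) (λ j j≤a → large-k a j j≤a (suc k) a≤k) ⟩
      scale a * ((1ℚ + ⅒) ^ (a ℕ.+ (a ℕ.+ a)) * ⅔ ^ a)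
        ≡⟨ cong (scale a *_) (trans (cong (_* ⅔ ^ a) (trans (^-+ (1ℚ + ⅒) a (a ℕ.+ a)) (cong ((1ℚ + ⅒) ^ a *_) (^-+ (1ℚ + ⅒) a a))))
            (trans (cong (λ z → (1ℚ + ⅒) ^ a * z * ⅔ ^ a) (sym (^-* (1ℚ + ⅒) (1ℚ + ⅒) a)))
              (trans (cong (_* ⅔ ^ a) (sym (^-* (1ℚ + ⅒) ((1ℚ + ⅒) * (1ℚ + ⅒)) a))) (sym (^-* ((1ℚ + ⅒) * ((1ℚ + ⅒) * (1ℚ + ⅒))) ⅔ a))))) ⟩
      scale a * ((1ℚ + ⅒) * ((1ℚ + ⅒) * (1ℚ + ⅒)) * ⅔) ^ a
        -- Here the binomial sum has upper index `3a`, and 1.331 * ⅔ is less than 0.89. This is the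
        -- range that determines `σ`; for `k ≤ a` the base is only 11/15.
        ≤⟨ *-monoˡ (0≤scale a) (≤-trans (^-mono (nonNegative⁻¹ ((1ℚ + ⅒) * ((1ℚ + ⅒) * (1ℚ + ⅒)) * ⅔)) (from-yes ((1ℚ + ⅒) * ((1ℚ + ⅒) * (1ℚ + ⅒)) * ⅔ ≤? σ)) a) (p≤q+p (0≤σ^ (suc k)))) ⟩
      scale a * (σ ^ suc k + σ ^ a) ∎

    -- All classes with more than K shared edges, for paths on suc K + M vertices.
    tailSum : ∀ K M → Σ< M (λ i → entries (M ℕ.∸ suc i) (suc K ℕ.+ i)) ≤ ι A * (ι 380 + ι 40 * ι (suc K ℕ.+ M) * σ ^ suc K)
    tailSum K M = begin
      Σ< M (λ i → entries (M ℕ.∸ suc i) (suc K ℕ.+ i))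
        ≤⟨ Σ<-mono M (λ {i} i<M → one i i<M) ⟩
      Σ< M (λ i → c * (ι 2 * ι n * σ ^ suc K * σ ^ i + g (M ℕ.∸ suc i)))
        ≡⟨ trans (Σ<-*ˡ M c _) (cong (c *_) (Σ<-+ M (λ i → ι 2 * ι n * σ ^ suc K * σ ^ i) (λ i → g (M ℕ.∸ suc i)))) ⟩
      c * (Σ< M (λ i → ι 2 * ι n * σ ^ suc K * σ ^ i) + Σ< M (λ i → g (M ℕ.∸ suc i)))
        ≡⟨ cong (c *_) (cong₂ _+_ (Σ<-*ˡ M (ι 2 * ι n * σ ^ suc K) (σ ^_)) (Σ<-reverse M g)) ⟩
      c * (ι 2 * ι n * σ ^ suc K * Σ< M (σ ^_) + Σ< M g)
        ≤⟨ *-monoˡ 0≤c (+-mono-≤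
            (*-monoˡ (0≤* (0≤* (0≤ι 2) (0≤ι n)) (0≤σ^ (suc K))) (≤-trans (p≤p+q (0≤* (0≤ι 10) (0≤σ^ M))) (≤-reflexive (geometric M))))
            (≤-trans (p≤p+q (0≤* (0≤+ (0≤* (0≤ι 20) (0≤ι M)) (0≤ι 190)) (0≤σ^ M))) (≤-reflexive (arithmetic-geometric M)))) ⟩
      c * (ι 2 * ι n * σ ^ suc K * ι 10 + ι 190)
        ≡⟨ lemma (ι 2) (ι A) (ι n) (σ ^ suc K) (ι 10) (ι 190) ⟩
      ι A * (ι 2 * ι 190 + ι 2 * ι 2 * ι 10 * ι n * σ ^ suc K)
        ≡⟨⟩
      ι A * (ι 380 + ι 40 * ι n * σ ^ suc K) ∎
      where
      open ≤-Reasoning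
      n = suc K ℕ.+ M
      c = ι 2 * ι A
      0≤c = 0≤* (0≤ι 2) (0≤ι A)
      g : ℕ → ℚ
      g a = ι (suc (a ℕ.+ a)) * σ ^ a
      lemma : ∀ t a n s d e → t * a * (t * n * s * d + e) ≡ a * (t * e + t * t * d * n * s)
      lemma = solve-∀ ℚ-ring
      2a+1≤ : ∀ {i} → i ℕ.< M → suc ((M ℕ.∸ suc i) ℕ.+ (M ℕ.∸ suc i)) ℕ.≤ 2 ℕ.* n
      2a+1≤ {i} i<M = ℕ.≤-trans (ℕ.+-mono-≤ (ℕ.≤-trans (ℕ.+-monoʳ-≤ 1 (ℕ.m∸n≤m M (suc i))) (ℕ.s≤s (ℕ.m≤n+m M K)))
        (ℕ.≤-trans (ℕ.m∸n≤m M (suc i)) (ℕ.m≤n+m M (suc K)))) (ℕ.≤-reflexive (cong (n ℕ.+_) (sym (ℕ.+-identityʳ n))))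
      one : ∀ i → i ℕ.< M → entries (M ℕ.∸ suc i) (suc K ℕ.+ i) ≤ c * (ι 2 * ι n * σ ^ suc K * σ ^ i + g (M ℕ.∸ suc i))
      one i i<M = begin
        entries a (suc (K ℕ.+ i))
          ≤⟨ entries-bound a (K ℕ.+ i) ⟩
        c * ι (suc (a ℕ.+ a)) * (σ ^ (suc K ℕ.+ i) + σ ^ a)
          ≡⟨ lemma₁ c (ι (suc (a ℕ.+ a))) (σ ^ (suc K ℕ.+ i)) (σ ^ a) ⟩
        c * (ι (suc (a ℕ.+ a)) * σ ^ (suc K ℕ.+ i) + g a)
          ≤⟨ *-monoˡ 0≤c (+-monoˡ-≤ (g a) (*-monoʳ (0≤σ^ (suc K ℕ.+ i)) (≤-trans (ι-mono (2a+1≤ i<M)) (≤-reflexive (ι-* 2 n))))) ⟩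
        c * (ι 2 * ι n * σ ^ (suc K ℕ.+ i) + g a)
          ≡⟨ cong (λ z → c * (z + g a)) (trans (cong (ι 2 * ι n *_) (^-+ σ (suc K) i)) (sym (*-assoc (ι 2 * ι n) (σ ^ suc K) (σ ^ i)))) ⟩
        c * (ι 2 * ι n * σ ^ suc K * σ ^ i + g a) ∎
        where
        a = M ℕ.∸ suc i
        lemma₁ : ∀ c w x y → c * w * (x + y) ≡ c * (w * x + w * y)
        lemma₁ = solve-∀ ℚ-ring

  -- Any explicit rate of convergence to 0 serves to choose `K`. The 9 makes the induction work:
  -- `9 * (10 + K) ≤ 10 * (9 + K)`.
  σ-decay : ∀ K → σ ^ K * ι (9 ℕ.+ K) ≤ ι 9
  σ-decay zero    = ≤-refl
  σ-decay (suc K) = begin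
    σ * σ ^ K * ι (9 ℕ.+ suc K)           ≡⟨ lemma σ (σ ^ K) (ι (9 ℕ.+ suc K)) ⟩
    σ ^ K * (σ * ι (9 ℕ.+ suc K))         ≤⟨ *-monoˡ (0≤σ^ K) (*-cancelʳ {r = ι 10} (0<ι 10) (begin
        σ * ι (9 ℕ.+ suc K) * ι 10        ≡⟨ lemma′ σ (ι (9 ℕ.+ suc K)) (ι 10) ⟩
        σ * ι 10 * ι (9 ℕ.+ suc K)        ≡⟨ ι-* 9 (9 ℕ.+ suc K) ⟨
        ι (9 ℕ.* (9 ℕ.+ suc K))           ≤⟨ ι-mono (ℕ.≤-trans (ℕ.m≤m+n _ K) (ℕ.≤-reflexive (arith K))) ⟩
        ι ((9 ℕ.+ K) ℕ.* 10)              ≡⟨ ι-* (9 ℕ.+ K) 10 ⟩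
        ι (9 ℕ.+ K) * ι 10                ∎)) ⟩
    σ ^ K * ι (9 ℕ.+ K)                   ≤⟨ σ-decay K ⟩
    ι 9                                   ∎
    where
    open ≤-Reasoning
    lemma : ∀ s p q → s * p * q ≡ p * (s * q)
    lemma = solve-∀ ℚ-ring
    lemma′ : ∀ s p q → s * p * q ≡ s * q * p
    lemma′ = solve-∀ ℚ-ring
    arith : ∀ K → 9 ℕ.* (9 ℕ.+ suc K) ℕ.+ K ≡ (9 ℕ.+ K) ℕ.* 10
    arith = ℕ-solver.solve-∀

-- Bounds on the class sums

module Assembly where

  open Counting
  open import Defs using (1/_!; 0≤1/k!; edgeOrderings; Enumeration)
  open Rationals
  open Words
  open SecondMoment
  open GoodCount
  open Exponential
  open RunSums
  open Weights
  open TailSum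
  open import Data.Nat.Base as ℕ using (ℕ; zero; suc; _!)
  import Data.Nat.Properties as ℕ
  import Data.Nat.Tactic.RingSolver as ℕ-solver
  open import Data.Rational.Base hiding (1/_)
  open import Data.Rational.Properties
  open import Tactic.RingSolver using (solve-∀)

  module _ (N : ℕ) where

    private
      n = suc N
      open Enumeration (edgeOrderings n) using () renaming (elements to Ω)
      total-Ω = ι (length Ω)

    module _ (k m : ℕ) (k≤N : k ℕ.≤ N) {P : List (Fin n)} where

      private
        a = N ℕ.∸ k

        a+k≡N : a ℕ.+ k ≡ N
        a+k≡N = ℕ.m∸n+n≡m k≤N

        guard : ℕ
        guard = 𝟙 (k ℕ.+ m ℕ.≤? suc (a ℕ.+ k))

        G : ℚ
        G = ι guard * ι ((n ℕ.∸ (k ℕ.+ m)) !)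

        wordSum : ∀ {c} → (∀ w → ι (goodCount N k m P w) * c ≤ G) → ∀ {ρs} → ρs ∈ runs m k →
                  ι (∑ (words a a ρs) (goodCount N k m P)) * c ≤ ι ((a ℕ.+ a ℕ.+ m) !) * (1/ a ! * (1/ a ! * 1/ m !)) * G
        wordSum {c} good≤ {ρs} ρs∈ = begin
          ι (∑ (words a a ρs) (goodCount N k m P)) * c
            ≤⟨ ι-∑-≤ (words a a ρs) (goodCount N k m P) (λ {w} _ → good≤ w) ⟩
          L * G
            ≡⟨ *-identityʳ _ ⟨
          L * G * (1ℚ * (1ℚ * 1ℚ))
            ≡⟨ cong₂ (λ x y → L * G * (x * (x * y))) (k!*1/k! a) (k!*1/k! m) ⟨
          L * G * ((ι (a !) * 1/ a !) * ((ι (a !) * 1/ a !) * (ι (m !) * 1/ m !)))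
            ≡⟨ lemma L G (ι (a !)) (1/ a !) (ι (m !)) (1/ m !) ⟩
          L * (ι (a !) * (ι (a !) * ι (m !))) * (1/ a ! * (1/ a ! * 1/ m !)) * G
            ≡⟨ cong (λ z → z * (1/ a ! * (1/ a ! * 1/ m !)) * G) (begin-equality
                L * (ι (a !) * (ι (a !) * ι (m !)))       ≡⟨ cong (λ z → L * (ι (a !) * z)) (ι-* (a !) (m !)) ⟨
                L * (ι (a !) * ι (a ! ℕ.* m !))           ≡⟨ cong (L *_) (ι-* (a !) (a ! ℕ.* m !)) ⟨
                L * ι (a ! ℕ.* (a ! ℕ.* m !))             ≡⟨ ι-* (length (words a a ρs)) (a ! ℕ.* (a ! ℕ.* m !)) ⟨
                ι (length (words a a ρs) ℕ.* (a ! ℕ.* (a ! ℕ.* m !))) ≡⟨ cong ι (length-wordsʳ N k m ρs∈) ⟩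
                ι ((a ℕ.+ a ℕ.+ m) !)                     ∎) ⟩
          ι ((a ℕ.+ a ℕ.+ m) !) * (1/ a ! * (1/ a ! * 1/ m !)) * G ∎
          where
          open ≤-Reasoning
          L = ι (length (words a a ρs))
          lemma : ∀ l g f x h y → l * g * ((f * x) * ((f * x) * (h * y))) ≡ l * (f * (f * h)) * (x * (x * y)) * g
          lemma = solve-∀ ℚ-ring

      -- `c` is the gain from excluding further shared edges: 1 for the tail, where it is forgone,
      -- and a partial sum of the exponential series at `2θ²` for the main part.
      class-entry : ∀ {c} → 0ℚ ≤ c → (∀ w → ι (goodCount N k m P w) * c ≤ G) →
                    ι (classSum N k m P) * (ι (N !) * c) ≤ total-Ω * entry a k m
      class-entry {c} 0≤c good≤ = begin
        ι S * (ι (N !) * c)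
          ≡⟨ *-identityˡ _ ⟨
        1ℚ * (ι S * (ι (N !) * c))
          ≡⟨ cong (_* (ι S * (ι (N !) * c))) (k!*1/k! b) ⟨
        ι (b !) * 1/ b ! * (ι S * (ι (N !) * c))
          ≡⟨ lemma (ι (b !)) (1/ b !) (ι S) (ι (N !)) c ⟩
        1/ b ! * ι (N !) * (ι (b !) * ι S * c)
          ≡⟨ cong (λ z → 1/ b ! * ι (N !) * (z * c)) (ι-* (b !) S) ⟨
        1/ b ! * ι (N !) * (ι (b ! ℕ.* S) * c)
          ≤⟨ *-monoˡ 0≤f (*-monoʳ 0≤c (≤-trans (ι-mono (classSum-bound N k m P)) (≤-reflexive (ι-* T (length Ω))))) ⟩
        1/ b ! * ι (N !) * (ι T * total-Ω * c)
          ≡⟨ cong (1/ b ! * ι (N !) *_) (lemma′ (ι T) total-Ω c) ⟩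
        1/ b ! * ι (N !) * (total-Ω * (ι T * c))
          ≤⟨ *-monoˡ 0≤f (*-monoˡ (0≤ι (length Ω)) (ι-∑-≤ (runs m k) _ (wordSum good≤))) ⟩
        1/ b ! * ι (N !) * (total-Ω * (ι (runCount m k) * (ι ((a ℕ.+ a ℕ.+ m) !) * (1/ a ! * (1/ a ! * 1/ m !)) * G)))
          ≡⟨ lemma″ (1/ b !) (ι (N !)) total-Ω (ι (runCount m k)) (ι ((a ℕ.+ a ℕ.+ m) !)) (1/ a !) (1/ m !) (ι guard) (ι ((n ℕ.∸ (k ℕ.+ m)) !)) ⟩
        total-Ω * (ι guard * (ι (runCount m k) * 1/ m ! * (ι (N !) * (ι ((a ℕ.+ a ℕ.+ m) !) * ι ((n ℕ.∸ (k ℕ.+ m)) !)) * (1/ b ! * (1/ a ! * 1/ a !)))))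
          ≡⟨ cong (λ z → total-Ω * (ι guard * (ι (runCount m k) * 1/ m ! * (z * (1/ b ! * (1/ a ! * 1/ a !)))))) top ⟩
        total-Ω * entry a k m ∎
        where
        open ≤-Reasoning
        b = a ℕ.+ a ℕ.+ k
        S = classSum N k m P
        T = ∑ (runs m k) (λ ρs → ∑ (words a a ρs) (goodCount N k m P))
        0≤f : 0ℚ ≤ 1/ b ! * ι (N !)
        0≤f = 0≤* (0≤1/k! b) (0≤ι (N !))
        lemma : ∀ f x s g c → f * x * (s * (g * c)) ≡ x * g * (f * s * c)
        lemma = solve-∀ ℚ-ring
        lemma′ : ∀ t w c → t * w * c ≡ w * (t * c)
        lemma′ = solve-∀ ℚ-ring
        lemma″ : ∀ x f w r g y z q h → x * f * (w * (r * (g * (y * (y * z)) * (q * h)))) ≡ w * (q * (r * z * (f * (g * h) * (x * (y * y)))))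
        lemma″ = solve-∀ ℚ-ring
        top : ι (N !) * (ι ((a ℕ.+ a ℕ.+ m) !) * ι ((n ℕ.∸ (k ℕ.+ m)) !)) ≡ ι (numerator a k m)
        top = trans (cong (ι (N !) *_) (sym (ι-* ((a ℕ.+ a ℕ.+ m) !) ((n ℕ.∸ (k ℕ.+ m)) !))))
          (trans (sym (ι-* (N !) ((a ℕ.+ a ℕ.+ m) ! ℕ.* (n ℕ.∸ (k ℕ.+ m)) !)))
            (cong (λ z → ι (z ! ℕ.* ((a ℕ.+ a ℕ.+ m) ! ℕ.* (suc z ℕ.∸ (k ℕ.+ m)) !))) (sym a+k≡N)))

      module _ (P∈ : P ∈ H N) where

        private
          guarded : ∀ w {c} → 0ℚ ≤ c → (ι (goodCount N k m P w) * c ≤ ι ((n ℕ.∸ (k ℕ.+ m)) !)) → ι (goodCount N k m P w) * c ≤ G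
          guarded w {c} 0≤c le = [ empty , nonempty ]′ (goodCount-bound N k m P∈ w)
            where
            empty : goodCount N k m P w ≡ 0 → ι (goodCount N k m P w) * c ≤ G
            empty eq = ≤-trans (≤-reflexive (trans (cong (λ z → ι z * c) eq) (*-zeroˡ c))) (0≤* (0≤ι guard) (0≤ι ((n ℕ.∸ (k ℕ.+ m)) !)))
            nonempty : k ℕ.+ m ℕ.≤ n × _ → ι (goodCount N k m P w) * c ≤ G
            nonempty (k+m≤n , _) = ≤-trans le (≤-reflexive (sym (trans
                  (cong (λ z → ι z * ι ((n ℕ.∸ (k ℕ.+ m)) !)) (𝟙-yes (k ℕ.+ m ℕ.≤? suc (a ℕ.+ k)) (subst (λ z → k ℕ.+ m ℕ.≤ suc z) (sym a+k≡N) k+m≤n)))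
                  (*-identityˡ (ι ((n ℕ.∸ (k ℕ.+ m)) !))))))

        class-tail : ι (classSum N k m P) * ι (N !) ≤ total-Ω * entry a k m
        class-tail = subst (λ z → ι (classSum N k m P) * z ≤ total-Ω * entry a k m) (*-identityʳ (ι (N !)))
          (class-entry (nonNegative⁻¹ 1ℚ) λ w → guarded w (nonNegative⁻¹ 1ℚ) (good≤ w))
          where
          good≤ : ∀ w → ι (goodCount N k m P w) * 1ℚ ≤ ι ((n ℕ.∸ (k ℕ.+ m)) !)
          good≤ w = ≤-trans (≤-reflexive (*-identityʳ (ι (goodCount N k m P w)))) (ι-mono
            ([ (λ eq → ℕ.≤-trans (ℕ.≤-reflexive eq) ℕ.z≤n) , proj₂ ]′ (goodCount-bound N k m P∈ w)))

        class-main : ∀ {d θ K} → d ℕ.+ (45 ℕ.+ 2 ℕ.* (k ℕ.+ m)) ℕ.≤ n → 0ℚ ≤ θ → θ * ι n ≡ ι d →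
                     ι (classSum N k m P) * (ι (N !) * E (ι 2 * (θ * θ)) K) ≤ total-Ω * entry a k m
        class-main {d} {θ} {K} d≤ 0≤θ θn≡d = class-entry 0≤E λ w → guarded w 0≤E (good≤ w)
          where
          0≤l : 0ℚ ≤ ι 2 * (θ * θ)
          0≤l = 0≤* (0≤ι 2) (0≤* 0≤θ 0≤θ)
          0≤E : 0ℚ ≤ E (ι 2 * (θ * θ)) K
          0≤E = 0≤Σ< (suc K) (0≤term (ι 2 * (θ * θ)) 0≤l)
          lemma : ∀ t x y → t * (x * x) * (y * y) ≡ t * ((x * y) * (x * y))
          lemma = solve-∀ ℚ-ring
          l*n² : ι 2 * (θ * θ) * ι (n ℕ.* n) ≡ ι (2 ℕ.* (d ℕ.* d))
          l*n² = begin
            ι 2 * (θ * θ) * ι (n ℕ.* n)        ≡⟨ cong (ι 2 * (θ * θ) *_) (ι-* n n) ⟩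
            ι 2 * (θ * θ) * (ι n * ι n)        ≡⟨ lemma (ι 2) θ (ι n) ⟩
            ι 2 * ((θ * ι n) * (θ * ι n))      ≡⟨ cong (λ z → ι 2 * (z * z)) θn≡d ⟩
            ι 2 * (ι d * ι d)                  ≡⟨ cong (ι 2 *_) (ι-* d d) ⟨
            ι 2 * ι (d ℕ.* d)                  ≡⟨ ι-* 2 (d ℕ.* d) ⟨
            ι (2 ℕ.* (d ℕ.* d))                ∎
            where open ≡-Reasoning
          good≤ : ∀ w → ι (goodCount N k m P w) * E (ι 2 * (θ * θ)) K ≤ ι ((n ℕ.∸ (k ℕ.+ m)) !)
          good≤ w = [ (λ eq → ≤-trans (≤-reflexive (trans (cong (λ z → ι z * E (ι 2 * (θ * θ)) K) eq) (*-zeroˡ (E (ι 2 * (θ * θ)) K)))) (0≤ι ((n ℕ.∸ (k ℕ.+ m)) !)))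
                    , (λ hc → hitCounts-bound hc (0<ι (n ℕ.* n)) 0≤l l*n² K) ]′ (goodCount-hits N k m P∈ w d d≤)

  module _ (K N d : ℕ) (d≡ : d ℕ.+ (45 ℕ.+ 4 ℕ.* K) ≡ suc N) {θ : ℚ} (0≤θ : 0ℚ ≤ θ) (θ≤1 : θ ≤ 1ℚ) (θn≡d : θ * ι (suc N) ≡ ι d) where

    private
      n = suc N

      2^½^ : ∀ k → ι 2 ^ k * ½ ^ k ≡ 1ℚ
      2^½^ k = trans (sym (^-* (ι 2) ½ k)) (1^ k)

      K≤N : K ℕ.≤ N
      K≤N = ℕ.s≤s⁻¹ (ℕ.≤-trans (ℕ.≤-trans (ℕ.s≤s (ℕ.≤-trans (ℕ.m≤n*m K 4) (ℕ.m≤n+m (4 ℕ.* K) 44))) (ℕ.m≤n+m (45 ℕ.+ 4 ℕ.* K) d)) (ℕ.≤-reflexive d≡))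

      term-bound : ℕ → ℕ → ℚ
      term-bound m k = ι n * term (ι 2) m * (ι (runCount m k) * ½ ^ k)

      0≤term-bound : ∀ m k → 0ℚ ≤ term-bound m k
      0≤term-bound m k = 0≤* (0≤* (0≤ι n) (0≤term (ι 2) (0≤ι 2) m)) (0≤* (0≤ι (runCount m k)) (0≤^ (nonNegative⁻¹ ½) k))

      weight-≤ : ∀ m k → m ℕ.≤ k → k ℕ.≤ K → runCount m k ≡ 0 ⊎ weight (N ℕ.∸ k) k m * θ ^ K ≤ ι n * ι 2 ^ m * ½ ^ k
      weight-≤ zero    (suc k) _ _ = inj₁ refl
      weight-≤ zero    zero    _ _ = inj₂ (begin
        weight N 0 0 * θ ^ K      ≡⟨ cong (_* θ ^ K) (weight-0 N) ⟩
        ι n * θ ^ K               ≤⟨ *-monoˡ (0≤ι n) (^-anti 0≤θ θ≤1 (ℕ.z≤n {K})) ⟩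
        ι n * 1ℚ                  ≡⟨ cong (ι n *_) (*-identityʳ 1ℚ) ⟨
        ι n * (1ℚ * 1ℚ)           ≡⟨ *-assoc (ι n) 1ℚ 1ℚ ⟨
        ι n * 1ℚ * 1ℚ             ∎)
        where open ≤-Reasoning
      weight-≤ (suc j) k m≤k k≤K = inj₂ (begin
        W * θ ^ K                              ≡⟨ *-identityʳ _ ⟨
        W * θ ^ K * 1ℚ                         ≡⟨ cong (W * θ ^ K *_) (2^½^ k) ⟨
        W * θ ^ K * (ι 2 ^ k * ½ ^ k)          ≡⟨ lemma W (θ ^ K) (ι 2 ^ k) (½ ^ k) ⟩
        W * ι 2 ^ k * θ ^ K * ½ ^ k            ≤⟨ *-monoʳ (0≤^ (nonNegative⁻¹ ½) k) main ⟩
        ι n * ι 2 ^ suc j * ½ ^ k              ∎)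
        where
        open ≤-Reasoning
        a = N ℕ.∸ k
        W = weight a k (suc j)
        i = k ℕ.∸ suc j
        k≡ : suc j ℕ.+ i ≡ k
        k≡ = ℕ.m+[n∸m]≡n m≤k
        n≡ : n ≡ suc (a ℕ.+ k)
        n≡ = cong suc (sym (ℕ.m∸n+n≡m (ℕ.≤-trans k≤K K≤N)))
        lemma : ∀ w t p h → w * t * (p * h) ≡ w * p * t * h
        lemma = solve-∀ ℚ-ring
        -- As `j < k ≤ K`, the margin `45 + 4 * K` between `d` and `n` leaves room for `j + suc k`.
        d+j≤a : d ℕ.+ j ℕ.≤ a
        d+j≤a = ℕ.+-cancelʳ-≤ (suc k) (d ℕ.+ j) a (subst₂ ℕ._≤_ (sym (ℕ.+-assoc d j (suc k))) (trans d≡ (trans n≡ (sym (ℕ.+-suc a k))))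
          (ℕ.+-monoʳ-≤ d (ℕ.≤-trans (ℕ.+-mono-≤ (ℕ.≤-trans (ℕ.n≤1+n j) (ℕ.≤-trans m≤k k≤K)) (ℕ.s≤s k≤K)) small)))
          where
          small : K ℕ.+ suc K ℕ.≤ 45 ℕ.+ 4 ℕ.* K
          small = ℕ.≤-trans (ℕ.m≤m+n (K ℕ.+ suc K) (44 ℕ.+ 2 ℕ.* K)) (ℕ.≤-reflexive (arith K))
            where
            arith : ∀ K → K ℕ.+ suc K ℕ.+ (44 ℕ.+ 2 ℕ.* K) ≡ 45 ℕ.+ 4 ℕ.* K
            arith = ℕ-solver.solve-∀
        main : W * ι 2 ^ k * θ ^ K ≤ ι n * ι 2 ^ suc j
        main = subst (λ k → weight a k (suc j) * ι 2 ^ k * θ ^ K ≤ ι n * ι 2 ^ suc j) k≡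
          (weight-main a j i d n (trans n≡ (cong (λ z → suc (a ℕ.+ z)) (sym k≡))) d+j≤a 0≤θ θ≤1 θn≡d (ℕ.≤-trans (ℕ.≤-reflexive k≡) k≤K))

      entry-main : ∀ m k → m ℕ.≤ k → k ℕ.≤ K → entry (N ℕ.∸ k) k m * θ ^ K ≤ term-bound m k
      entry-main m k m≤k k≤K = [ none , some ]′ (weight-≤ m k m≤k k≤K)
        where
        g = ι (𝟙 (k ℕ.+ m ℕ.≤? suc (N ℕ.∸ k ℕ.+ k)))
        W = weight (N ℕ.∸ k) k m
        zero′ : ∀ g f w t → g * (0ℚ * f * w) * t ≡ 0ℚ
        zero′ = solve-∀ ℚ-ring
        lemma : ∀ r f w t → 1ℚ * (r * f * w) * t ≡ r * f * (w * t)
        lemma = solve-∀ ℚ-ring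
        lemma′ : ∀ r f n p h → r * f * (n * p * h) ≡ n * (p * f) * (r * h)
        lemma′ = solve-∀ ℚ-ring
        none : runCount m k ≡ 0 → entry (N ℕ.∸ k) k m * θ ^ K ≤ term-bound m k
        none eq = ≤-trans (≤-reflexive (trans (cong (λ z → g * (ι z * 1/ m ! * W) * θ ^ K) eq) (zero′ g (1/ m !) W (θ ^ K)))) (0≤term-bound m k)
        some : W * θ ^ K ≤ ι n * ι 2 ^ m * ½ ^ k → entry (N ℕ.∸ k) k m * θ ^ K ≤ term-bound m k
        some le = begin
          g * (ι (runCount m k) * 1/ m ! * W) * θ ^ K
            ≤⟨ *-monoʳ (0≤^ 0≤θ K) (*-monoʳ (0≤* (0≤* (0≤ι (runCount m k)) (0≤1/k! m)) (0≤weight (N ℕ.∸ k) k m)) (ι-mono (𝟙≤1 (k ℕ.+ m ℕ.≤? suc (N ℕ.∸ k ℕ.+ k))))) ⟩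
          1ℚ * (ι (runCount m k) * 1/ m ! * W) * θ ^ K
            ≡⟨ lemma (ι (runCount m k)) (1/ m !) W (θ ^ K) ⟩
          ι (runCount m k) * 1/ m ! * (W * θ ^ K)
            ≤⟨ *-monoˡ (0≤* (0≤ι (runCount m k)) (0≤1/k! m)) le ⟩
          ι (runCount m k) * 1/ m ! * (ι n * ι 2 ^ m * ½ ^ k)
            ≡⟨ lemma′ (ι (runCount m k)) (1/ m !) (ι n) (ι 2 ^ m) (½ ^ k) ⟩
          term-bound m k ∎
          where open ≤-Reasoning

    -- The terms being nonnegative, the range `m ≤ k ≤ K` may be enlarged to a square and the sums
    -- exchanged. For fixed `m`, `runSum` then gives `(2 * 3/2) ^ m / m!`, a term of the exponential
    -- series at 3.
    mainSum : Σ< (suc K) (λ k → entries (N ℕ.∸ k) k) * θ ^ K ≤ ι n * E (ι 3) K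
    mainSum = begin
      Σ< (suc K) (λ k → entries (N ℕ.∸ k) k) * θ ^ K
        ≡⟨ Σ<-*ʳ (suc K) (θ ^ K) _ ⟨
      Σ< (suc K) (λ k → entries (N ℕ.∸ k) k * θ ^ K)
        ≡⟨ Σ<-cong (suc K) (λ {k} _ → sym (Σ<-*ʳ (suc k) (θ ^ K) (entry (N ℕ.∸ k) k))) ⟩
      Σ< (suc K) (λ k → Σ< (suc k) (λ m → entry (N ℕ.∸ k) k m * θ ^ K))
        ≤⟨ Σ<-mono (suc K) (λ {k} k<K → ≤-trans
            (Σ<-mono (suc k) (λ {m} m<k → entry-main m k (ℕ.s≤s⁻¹ m<k) (ℕ.s≤s⁻¹ k<K)))
            (Σ<-extend (λ m → 0≤term-bound m k) k<K)) ⟩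
      Σ< (suc K) (λ k → Σ< (suc K) (λ m → term-bound m k))
        ≡⟨ Σ<-swap (suc K) (suc K) (λ k m → term-bound m k) ⟩
      Σ< (suc K) (λ m → Σ< (suc K) (term-bound m))
        ≤⟨ Σ<-mono (suc K) (λ {m} _ → begin
            Σ< (suc K) (term-bound m)
              ≡⟨ Σ<-*ˡ (suc K) (ι n * term (ι 2) m) (λ k → ι (runCount m k) * ½ ^ k) ⟩
            ι n * term (ι 2) m * Σ< (suc K) (λ k → ι (runCount m k) * ½ ^ k)
              ≤⟨ *-monoˡ (0≤* (0≤ι n) (0≤term (ι 2) (0≤ι 2) m)) (runSum m (suc K)) ⟩
            ι n * term (ι 2) m * (1ℚ + ½) ^ m
              ≡⟨ lemma (ι n) (ι 2 ^ m) (1/ m !) ((1ℚ + ½) ^ m) ⟩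
            ι n * (ι 2 ^ m * (1ℚ + ½) ^ m * 1/ m !)
              ≡⟨ cong (λ z → ι n * (z * 1/ m !)) (^-* (ι 2) (1ℚ + ½) m) ⟨
            ι n * term (ι 3) m ∎) ⟩
      Σ< (suc K) (λ m → ι n * term (ι 3) m)
        ≡⟨ Σ<-*ˡ (suc K) (ι n) (term (ι 3)) ⟩
      ι n * E (ι 3) K ∎
      where
      open ≤-Reasoning
      lemma : ∀ n p f q → n * (p * f) * q ≡ n * (p * q * f)
      lemma = solve-∀ ℚ-ring

-- Lower bound for the number of orderings with an increasing Hamiltonian path

module LowerBound where

  open Counting
  open import Defs
  open Rationals
  open SecondMoment
  open Exponential
  open Tail using (σ)
  open TailSum
  open Assembly
  open import Data.Nat.Base as ℕ using (ℕ; zero; suc; _!)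
  import Data.Nat.Properties as ℕ
  import Data.Nat.Tactic.RingSolver as ℕ-solver
  open import Data.Rational.Base hiding (1/_)
  open import Data.Rational.Properties
  open import Tactic.RingSolver using (solve-∀)

  module _ {A : Set} (xs : List A) (f : A → ℕ) where

    private
      S₁ = ∑ xs f
      S₂ = ∑ xs (λ x → f x ℕ.* f x)
      D  = ∑ xs (λ x → 𝟙 (0 ℕ.<? f x))

      2ab≤ : ∀ a b → 2 ℕ.* (a ℕ.* b) ℕ.≤ a ℕ.* a ℕ.+ b ℕ.* b
      2ab≤ a b = [ ordered a b , (λ b≤a → subst₂ ℕ._≤_ (cong (2 ℕ.*_) (ℕ.*-comm b a)) (ℕ.+-comm (b ℕ.* b) (a ℕ.* a)) (ordered b a b≤a)) ]′ (ℕ.≤-total a b)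
        where
        square : ∀ a c → 2 ℕ.* (a ℕ.* (a ℕ.+ c)) ℕ.+ c ℕ.* c ≡ a ℕ.* a ℕ.+ (a ℕ.+ c) ℕ.* (a ℕ.+ c)
        square = ℕ-solver.solve-∀
        ordered : ∀ a b → a ℕ.≤ b → 2 ℕ.* (a ℕ.* b) ℕ.≤ a ℕ.* a ℕ.+ b ℕ.* b
        ordered a b a≤b = subst (λ b → 2 ℕ.* (a ℕ.* b) ℕ.≤ a ℕ.* a ℕ.+ b ℕ.* b) (ℕ.m+[n∸m]≡n a≤b)
          (ℕ.≤-trans (ℕ.m≤m+n _ ((b ℕ.∸ a) ℕ.* (b ℕ.∸ a))) (ℕ.≤-reflexive (square a (b ℕ.∸ a))))

      pointwise : ∀ y → 2 ℕ.* (S₁ ℕ.* y ℕ.* S₂) ℕ.≤ S₁ ℕ.* S₁ ℕ.* (y ℕ.* y) ℕ.+ S₂ ℕ.* S₂ ℕ.* 𝟙 (0 ℕ.<? y)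
      pointwise zero    = ℕ.≤-trans (ℕ.≤-reflexive (cong (λ z → 2 ℕ.* (z ℕ.* S₂)) (ℕ.*-zeroʳ S₁))) ℕ.z≤n
      pointwise (suc y) = ℕ.≤-trans (2ab≤ (S₁ ℕ.* suc y) S₂) (ℕ.≤-reflexive (lemma S₁ (suc y) S₂))
        where
        lemma : ∀ s y t → s ℕ.* y ℕ.* (s ℕ.* y) ℕ.+ t ℕ.* t ≡ s ℕ.* s ℕ.* (y ℕ.* y) ℕ.+ t ℕ.* t ℕ.* 1
        lemma = ℕ-solver.solve-∀

      scaled : S₂ ℕ.* (S₁ ℕ.* S₁) ℕ.≤ S₂ ℕ.* (S₂ ℕ.* D)
      scaled = ℕ.+-cancelˡ-≤ (S₂ ℕ.* (S₁ ℕ.* S₁)) _ _ (begin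
        S₂ ℕ.* (S₁ ℕ.* S₁) ℕ.+ S₂ ℕ.* (S₁ ℕ.* S₁)
          ≡⟨ lemma S₁ S₂ ⟩
        2 ℕ.* S₁ ℕ.* S₂ ℕ.* ∑ xs f
          ≡⟨ ∑-*ˡ (2 ℕ.* S₁ ℕ.* S₂) xs f ⟨
        ∑ xs (λ x → 2 ℕ.* S₁ ℕ.* S₂ ℕ.* f x)
          ≤⟨ ∑-mono xs (λ {x} _ → ℕ.≤-trans (ℕ.≤-reflexive (lemma′ S₁ S₂ (f x))) (pointwise (f x))) ⟩
        ∑ xs (λ x → S₁ ℕ.* S₁ ℕ.* (f x ℕ.* f x) ℕ.+ S₂ ℕ.* S₂ ℕ.* 𝟙 (0 ℕ.<? f x))
          ≡⟨ ∑-+ xs _ _ ⟩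
        ∑ xs (λ x → S₁ ℕ.* S₁ ℕ.* (f x ℕ.* f x)) ℕ.+ ∑ xs (λ x → S₂ ℕ.* S₂ ℕ.* 𝟙 (0 ℕ.<? f x))
          ≡⟨ cong₂ ℕ._+_ (∑-*ˡ (S₁ ℕ.* S₁) xs _) (∑-*ˡ (S₂ ℕ.* S₂) xs _) ⟩
        S₁ ℕ.* S₁ ℕ.* S₂ ℕ.+ S₂ ℕ.* S₂ ℕ.* D
          ≡⟨ cong₂ ℕ._+_ (ℕ.*-comm (S₁ ℕ.* S₁) S₂) (ℕ.*-assoc S₂ S₂ D) ⟩
        S₂ ℕ.* (S₁ ℕ.* S₁) ℕ.+ S₂ ℕ.* (S₂ ℕ.* D) ∎)
        where
        open ℕ.≤-Reasoning
        lemma : ∀ s t → t ℕ.* (s ℕ.* s) ℕ.+ t ℕ.* (s ℕ.* s) ≡ 2 ℕ.* s ℕ.* t ℕ.* s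
        lemma = ℕ-solver.solve-∀
        lemma′ : ∀ s t y → 2 ℕ.* s ℕ.* t ℕ.* y ≡ 2 ℕ.* (s ℕ.* y ℕ.* t)
        lemma′ = ℕ-solver.solve-∀

      S₁≤S₂ : S₁ ℕ.≤ S₂
      S₁≤S₂ = ∑-mono xs (λ {x} _ → m≤m² (f x))
        where
        m≤m² : ∀ m → m ℕ.≤ m ℕ.* m
        m≤m² zero    = ℕ.z≤n
        m≤m² (suc m) = ℕ.m≤m*n (suc m) (suc m)

    -- The Cauchy-Schwarz inequality for `f` and the indicator of `f > 0`, without division: for
    -- positive `y`, twice `S₁ * y * S₂` is at most `(S₁ * y)² + S₂²`. Summing over `xs` leaves a
    -- common factor `S₂` to cancel.
    square-of-∑ : ∑ xs f ℕ.* ∑ xs f ℕ.≤ ∑ xs (λ x → f x ℕ.* f x) ℕ.* ∑ xs (λ x → 𝟙 (0 ℕ.<? f x))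
    square-of-∑ = cancel S₂ refl
      where
      cancel : ∀ s → S₂ ≡ s → S₁ ℕ.* S₁ ℕ.≤ S₂ ℕ.* D
      -- `S₂` cannot be cancelled here, but `S₁ ≤ S₂` holds for natural numbers and forces `S₁` to
      -- vanish.
      cancel zero    eq = ℕ.≤-trans (ℕ.≤-reflexive (cong (ℕ._* S₁) (ℕ.n≤0⇒n≡0 (ℕ.≤-trans S₁≤S₂ (ℕ.≤-reflexive eq))))) ℕ.z≤n
      cancel (suc s) eq = ℕ.*-cancelˡ-≤ S₂ {{subst ℕ.NonZero (sym eq) _}} scaled

  -- Bernoulli's inequality with `δ` for `1 - θ`. Used with `L = 3K`, it removes all the powers of
  -- `θ` at once.
  bernoulli : ∀ {θ δ} → 0ℚ ≤ θ → 0ℚ ≤ δ → θ + δ ≡ 1ℚ → ∀ L → 1ℚ ≤ θ ^ L + ι L * δ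
  bernoulli {θ} {δ} 0≤θ 0≤δ eq zero    = ≤-reflexive (trans (sym (+-identityʳ 1ℚ)) (cong (λ z → 1ℚ + z) (sym (*-zeroˡ δ))))
  bernoulli {θ} {δ} 0≤θ 0≤δ eq (suc L) = begin
    1ℚ                                        ≡⟨ eq ⟨
    θ + δ                                     ≡⟨ cong (_+ δ) (*-identityʳ θ) ⟨
    θ * 1ℚ + δ                                ≤⟨ +-monoˡ-≤ δ (*-monoˡ 0≤θ (bernoulli 0≤θ 0≤δ eq L)) ⟩
    θ * (θ ^ L + ι L * δ) + δ                 ≤⟨ p≤p+q (0≤* 0≤δ (0≤* (0≤ι L) 0≤δ)) ⟩
    θ * (θ ^ L + ι L * δ) + δ + δ * (ι L * δ) ≡⟨ lemma θ (θ ^ L) (ι L * δ) δ ⟩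
    θ * θ ^ L + ((θ + δ) * (ι L * δ) + δ)     ≡⟨ cong (λ z → θ * θ ^ L + (z * (ι L * δ) + δ)) eq ⟩
    θ * θ ^ L + (1ℚ * (ι L * δ) + δ)          ≡⟨ lemma′ (θ * θ ^ L) (ι L) δ ⟩
    θ ^ suc L + (1ℚ + ι L) * δ                ≡⟨ cong (λ z → θ ^ suc L + z * δ) (ι-suc L) ⟨
    θ ^ suc L + ι (suc L) * δ                 ∎
    where
    open ≤-Reasoning
    lemma : ∀ t p l d → t * (p + l) + d + d * l ≡ t * p + ((t + d) * l + d)
    lemma = solve-∀ ℚ-ring
    lemma′ : ∀ p l d → p + (1ℚ * (l * d) + d) ≡ p + (1ℚ + l) * d
    lemma′ = solve-∀ ℚ-ring

  module _ (A : ℕ) (A-bound : ∀ j → 140 ℕ.^ j ℕ.≤ A ℕ.* j !) (K M d : ℕ) where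

    private
      n = suc K ℕ.+ M
      N = K ℕ.+ M
      open Enumeration (edgeOrderings n) using () renaming (elements to Ω)
      W = ι (length Ω)

    module _ {θ : ℚ} (d≡ : d ℕ.+ (45 ℕ.+ 4 ℕ.* K) ≡ n) (0≤θ : 0ℚ ≤ θ) (θ≤1 : θ ≤ 1ℚ) (θn≡d : θ * ι n ≡ ι d)
             {ε : ℚ} (tail-small : ι A * (ι 380 + ι 40 * ι n * σ ^ suc K) ≤ ε * ι n) where

      private
        Θ = θ ^ K

        0≤Θ : 0ℚ ≤ Θ
        0≤Θ = 0≤^ 0≤θ K

        0≤W : 0ℚ ≤ W
        0≤W = 0≤ι (length Ω)

        φ = E (ι 2 * (θ * θ)) K

        -- For finite `n` the exchanges have mean at least `2θ²`; passing to 2 costs `θ²` to the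
        -- power `K`.
        ΘΘE2≤φ : Θ * Θ * E (ι 2) K ≤ φ
        ΘΘE2≤φ = ≤-trans (≤-reflexive (cong (_* E (ι 2) K) (sym (^-* θ θ K))))
          (E-scale {ι 2} {θ * θ} (0≤ι 2) (0≤* 0≤θ 0≤θ) (≤-trans (*-mono 0≤θ (nonNegative⁻¹ 1ℚ) θ≤1 θ≤1) (≤-reflexive (*-identityʳ 1ℚ))) K)

        0<E2 : 0ℚ < E (ι 2) K
        0<E2 = <-≤-trans (positive⁻¹ 1ℚ) (≤-trans (≤-reflexive (sym (+-identityˡ (1ℚ * 1ℚ))))
          (Σ<-extend (0≤term (ι 2) (0≤ι 2)) (ℕ.s≤s (ℕ.z≤n {K}))))

        E3≤ : E (ι 3) K ≤ E (ι 2) K * expSum K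
        E3≤ = ≤-trans (E-+ {ι 2} {1ℚ} (0≤ι 2) (nonNegative⁻¹ 1ℚ) K) (≤-reflexive (cong (E (ι 2) K *_) (E-1 K)))

        class : List (Fin n) → ℕ → ℚ
        class P k = Σ< (suc k) (λ m → ι (classSum N k m P))

        0≤class : ∀ P k → 0ℚ ≤ class P k
        0≤class P k = 0≤Σ< (suc k) (λ m → 0≤ι (classSum N k m P))

        scale-class : ∀ P k c → class P k * c ≡ Σ< (suc k) (λ m → ι (classSum N k m P) * c)
        scale-class P k c = sym (Σ<-*ʳ (suc k) c (λ m → ι (classSum N k m P)))

        total-class : ∀ P → ι (∑ (upTo n) (λ k → ∑ (upTo (suc k)) (λ m → classSum N k m P))) ≡
                      Σ< (suc K) (class P) + Σ< M (λ i → class P (suc K ℕ.+ i))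
        total-class P = trans (ι-∑-upTo n (λ k → ∑ (upTo (suc k)) (λ m → classSum N k m P))) (trans (Σ<-cong n (λ {k} _ → ι-∑-upTo (suc k) (λ m → classSum N k m P))) (Σ<-split (suc K) M (class P)))

      module _ {P : List (Fin n)} (P∈ : P ∈ H N) where

        private
          c = ι (N !)

          0≤c : 0ℚ ≤ c
          0≤c = 0≤ι (N !)

          main tail : ℚ
          main = Σ< (suc K) (class P)
          tail = Σ< M (λ i → class P (suc K ℕ.+ i))

          0≤main : 0ℚ ≤ main
          0≤main = 0≤Σ< (suc K) (0≤class P)

          0≤tail : 0ℚ ≤ tail
          0≤tail = 0≤Σ< M (λ i → 0≤class P (suc K ℕ.+ i))

          tail-bound : tail * c ≤ W * (ε * ι n)
          tail-bound = begin
            tail * c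
              ≡⟨ Σ<-*ʳ M c (λ i → class P (suc K ℕ.+ i)) ⟨
            Σ< M (λ i → class P (suc K ℕ.+ i) * c)
              ≤⟨ Σ<-mono M (λ {i} i<M → one i i<M) ⟩
            Σ< M (λ i → W * entries (M ℕ.∸ suc i) (suc K ℕ.+ i))
              ≡⟨ Σ<-*ˡ M W _ ⟩
            W * Σ< M (λ i → entries (M ℕ.∸ suc i) (suc K ℕ.+ i))
              ≤⟨ *-monoˡ 0≤W (≤-trans (tailSum A A-bound K M) tail-small) ⟩
            W * (ε * ι n) ∎
            where
            open ≤-Reasoning
            rest : ∀ i → N ℕ.∸ (suc K ℕ.+ i) ≡ M ℕ.∸ suc i
            rest i = trans (cong (N ℕ.∸_) (sym (ℕ.+-suc K i))) (ℕ.[m+n]∸[m+o]≡n∸o K M (suc i))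
            one : ∀ i → i ℕ.< M → class P (suc K ℕ.+ i) * c ≤ W * entries (M ℕ.∸ suc i) (suc K ℕ.+ i)
            one i i<M = begin
              class P k * c                                    ≡⟨ scale-class P k c ⟩
              Σ< (suc k) (λ m → ι (classSum N k m P) * c)      ≤⟨ Σ<-mono (suc k) (λ {m} _ → class-tail N k m k≤N P∈) ⟩
              Σ< (suc k) (λ m → W * entry (N ℕ.∸ k) k m)       ≡⟨ Σ<-*ˡ (suc k) W (entry (N ℕ.∸ k) k) ⟩
              W * entries (N ℕ.∸ k) k                          ≡⟨ cong (λ a → W * entries a k) (rest i) ⟩
              W * entries (M ℕ.∸ suc i) k                      ∎
              where
              k = suc K ℕ.+ i
              k≤N : k ℕ.≤ N
              k≤N = ℕ.≤-trans (ℕ.≤-reflexive (sym (ℕ.+-suc K i))) (ℕ.+-monoʳ-≤ K i<M)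

          room : ∀ {k m} → m ℕ.≤ k → k ℕ.≤ K → d ℕ.+ (45 ℕ.+ 2 ℕ.* (k ℕ.+ m)) ℕ.≤ n
          room {k} {m} m≤k k≤K = ℕ.≤-trans (ℕ.+-monoʳ-≤ d (ℕ.+-monoʳ-≤ 45 (ℕ.≤-trans (ℕ.*-monoʳ-≤ 2 (ℕ.+-mono-≤ k≤K (ℕ.≤-trans m≤k k≤K))) (ℕ.≤-reflexive (arith K))))) (ℕ.≤-reflexive d≡)
            where
            arith : ∀ K → 2 ℕ.* (K ℕ.+ K) ≡ 4 ℕ.* K
            arith = ℕ-solver.solve-∀

          main-φ : main * (c * φ) ≤ W * Σ< (suc K) (λ k → entries (N ℕ.∸ k) k)
          main-φ = begin
            main * (c * φ)
              ≡⟨ Σ<-*ʳ (suc K) (c * φ) (class P) ⟨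
            Σ< (suc K) (λ k → class P k * (c * φ))
              ≤⟨ Σ<-mono (suc K) (λ {k} k<K → begin
                  class P k * (c * φ)                                ≡⟨ scale-class P k (c * φ) ⟩
                  Σ< (suc k) (λ m → ι (classSum N k m P) * (c * φ))  ≤⟨ Σ<-mono (suc k) (λ {m} m<k → class-main N k m (ℕ.≤-trans (ℕ.s≤s⁻¹ k<K) (ℕ.m≤m+n K M)) P∈ {d} {θ} {K}
                                                                          (room (ℕ.s≤s⁻¹ m<k) (ℕ.s≤s⁻¹ k<K)) 0≤θ θn≡d) ⟩
                  Σ< (suc k) (λ m → W * entry (N ℕ.∸ k) k m)         ≡⟨ Σ<-*ˡ (suc k) W (entry (N ℕ.∸ k) k) ⟩
                  W * entries (N ℕ.∸ k) k                            ∎) ⟩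
            Σ< (suc K) (λ k → W * entries (N ℕ.∸ k) k)
              ≡⟨ Σ<-*ˡ (suc K) W (λ k → entries (N ℕ.∸ k) k) ⟩
            W * Σ< (suc K) (λ k → entries (N ℕ.∸ k) k) ∎
            where open ≤-Reasoning

          -- Here `E (ι 2) K` cancels: it comes from the exchanges on the left and from `E3≤` on the
          -- right, and `expSum K` is left over. Two factors `Θ` pay for the mean 2, the third for
          -- the weights.
          main-bound : main * (c * (Θ * Θ * Θ)) ≤ W * (expSum K * ι n)
          main-bound = *-cancelʳ 0<E2 (begin
            main * (c * (Θ * Θ * Θ)) * E (ι 2) K
              ≡⟨ lemma main c Θ (E (ι 2) K) ⟩
            main * (c * (Θ * Θ * E (ι 2) K)) * Θ
              ≤⟨ *-monoʳ 0≤Θ (*-monoˡ 0≤main (*-monoˡ 0≤c ΘΘE2≤φ)) ⟩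
            main * (c * φ) * Θ
              ≤⟨ *-monoʳ 0≤Θ main-φ ⟩
            W * Σ< (suc K) (λ k → entries (N ℕ.∸ k) k) * Θ
              ≡⟨ *-assoc W _ Θ ⟩
            W * (Σ< (suc K) (λ k → entries (N ℕ.∸ k) k) * Θ)
              ≤⟨ *-monoˡ 0≤W (≤-trans (mainSum K N d d≡ 0≤θ θ≤1 θn≡d) (*-monoˡ (0≤ι n) E3≤)) ⟩
            W * (ι n * (E (ι 2) K * expSum K))
              ≡⟨ lemma′ W (ι n) (E (ι 2) K) (expSum K) ⟩
            W * (expSum K * ι n) * E (ι 2) K ∎)
            where
            open ≤-Reasoning
            lemma : ∀ m c t e → m * (c * (t * t * t)) * e ≡ m * (c * (t * t * e)) * t
            lemma = solve-∀ ℚ-ring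
            lemma′ : ∀ w n e f → w * (n * (e * f)) ≡ w * (f * n) * e
            lemma′ = solve-∀ ℚ-ring

          Θ³≤1 : Θ * Θ * Θ ≤ 1ℚ
          Θ³≤1 = ≤-trans (*-mono (0≤* 0≤Θ 0≤Θ) 0≤1 (≤-trans (*-mono 0≤Θ 0≤1 Θ≤1 Θ≤1) (≤-reflexive (*-identityʳ 1ℚ))) Θ≤1) (≤-reflexive (*-identityʳ 1ℚ))
            where
            0≤1 = nonNegative⁻¹ 1ℚ
            Θ≤1 : Θ ≤ 1ℚ
            Θ≤1 = ^-anti 0≤θ θ≤1 (ℕ.z≤n {K})

        path-bound : ι (∑ (upTo n) (λ k → ∑ (upTo (suc k)) (λ m → classSum N k m P))) * (c * (Θ * Θ * Θ)) ≤ W * ((expSum K + ε) * ι n)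
        path-bound = begin
          ι (∑ (upTo n) (λ k → ∑ (upTo (suc k)) (λ m → classSum N k m P))) * (c * (Θ * Θ * Θ))
            ≡⟨ cong (_* (c * (Θ * Θ * Θ))) (total-class P) ⟩
          (main + tail) * (c * (Θ * Θ * Θ))
            ≡⟨ *-distribʳ-+ (c * (Θ * Θ * Θ)) main tail ⟩
          main * (c * (Θ * Θ * Θ)) + tail * (c * (Θ * Θ * Θ))
            ≤⟨ +-mono-≤ main-bound (≤-trans (*-monoˡ 0≤tail (≤-trans (*-monoˡ 0≤c Θ³≤1) (≤-reflexive (*-identityʳ c)))) tail-bound) ⟩
          W * (expSum K * ι n) + W * (ε * ι n)
            ≡⟨ lemma W (expSum K) (ι n) ε ⟩
          W * ((expSum K + ε) * ι n) ∎
          where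
          open ≤-Reasoning
          lemma : ∀ w e n f → w * (e * n) + w * (f * n) ≡ w * ((e + f) * n)
          lemma = solve-∀ ℚ-ring

      private
        S₂ = ∑ Ω (λ f → X N f ℕ.* X N f)
        D  = ∑ Ω (λ f → 𝟙 (0 ℕ.<? X N f))

        0<N! : 0ℚ < ι (N !)
        0<N! = 0<ι (N !) {{N ℕ.!≢0}}

        second-moment-bound : ι S₂ * (Θ * Θ * Θ) ≤ ι n * (W * ((expSum K + ε) * ι n))
        second-moment-bound = *-cancelʳ 0<N! (begin
          ι S₂ * (Θ * Θ * Θ) * ι (N !)
            ≡⟨ lemma (ι S₂) (Θ * Θ * Θ) (ι (N !)) ⟩
          ι S₂ * (ι (N !) * (Θ * Θ * Θ))
            ≤⟨ *-monoʳ (0≤* (0≤ι (N !)) (0≤* (0≤* 0≤Θ 0≤Θ) 0≤Θ)) (ι-mono (secondMoment N)) ⟩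
          ι (∑ (H N) (λ P → ∑ (upTo n) (λ k → ∑ (upTo (suc k)) (λ m → classSum N k m P)))) * (ι (N !) * (Θ * Θ * Θ))
            ≤⟨ ι-∑-≤ (H N) _ path-bound ⟩
          ι (length (H N)) * G
            ≡⟨ cong (λ l → ι l * G) (length-H N) ⟩
          ι (n !) * G
            ≡⟨ cong (_* G) (ι-* n (N !)) ⟩
          ι n * ι (N !) * G
            ≡⟨ lemma′ (ι n) (ι (N !)) G ⟩
          ι n * G * ι (N !) ∎)
          where
          open ≤-Reasoning
          G = W * ((expSum K + ε) * ι n)
          lemma : ∀ s t f → s * t * f ≡ s * (f * t)
          lemma = solve-∀ ℚ-ring
          lemma′ : ∀ n f g → n * f * g ≡ n * g * f
          lemma′ = solve-∀ ℚ-ring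

        first-moment : ι (∑ Ω (X N)) ≡ ι n * W
        first-moment = trans (cong ι (ℕ.*-cancelˡ-≡ (∑ Ω (X N)) (n ℕ.* length Ω) (N !) {{N ℕ.!≢0}}
          (trans (firstMoment N) (lemma n (N !) (length Ω))))) (ι-* n (length Ω))
          where
          lemma : ∀ n f w → n ℕ.* f ℕ.* w ≡ f ℕ.* (n ℕ.* w)
          lemma = ℕ-solver.solve-∀

      positive-count : 0ℚ ≤ ε → W * (Θ * Θ * Θ) ≤ ι D * (expSum K + ε)
      positive-count 0≤ε = *-cancelʳ {r = ι n * ι n * W} 0<n²W (begin
        W * (Θ * Θ * Θ) * (ι n * ι n * W)
          ≡⟨ lemma W (Θ * Θ * Θ) (ι n) ⟩
        (ι n * W) * (ι n * W) * (Θ * Θ * Θ)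
          ≡⟨ cong (λ z → z * z * (Θ * Θ * Θ)) first-moment ⟨
        ι (∑ Ω (X N)) * ι (∑ Ω (X N)) * (Θ * Θ * Θ)
          ≡⟨ cong (_* (Θ * Θ * Θ)) (ι-* (∑ Ω (X N)) (∑ Ω (X N))) ⟨
        ι (∑ Ω (X N) ℕ.* ∑ Ω (X N)) * (Θ * Θ * Θ)
          ≤⟨ *-monoʳ (0≤* (0≤* 0≤Θ 0≤Θ) 0≤Θ) (≤-trans (ι-mono (square-of-∑ Ω (X N))) (≤-reflexive (ι-* S₂ D))) ⟩
        ι S₂ * ι D * (Θ * Θ * Θ)
          ≡⟨ lemma′ (ι S₂) (ι D) (Θ * Θ * Θ) ⟩
        ι D * (ι S₂ * (Θ * Θ * Θ))
          ≤⟨ *-monoˡ (0≤ι D) second-moment-bound ⟩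
        ι D * (ι n * (W * ((expSum K + ε) * ι n)))
          ≡⟨ lemma″ (ι D) (ι n) W (expSum K + ε) ⟩
        ι D * (expSum K + ε) * (ι n * ι n * W) ∎)
        where
        open ≤-Reasoning
        0<* : ∀ {p q} → 0ℚ < p → 0ℚ < q → 0ℚ < p * q
        0<* {p} {q} 0<p 0<q = subst (_< p * q) (*-zeroʳ p) (*-monoʳ-<-pos p {{positive 0<p}} 0<q)
        0<n²W : 0ℚ < ι n * ι n * W
        0<n²W = 0<* (0<* (0<ι n) (0<ι n)) (0<ι (length Ω) {{edgeOrderings-nonZero n}})
        lemma : ∀ w t n → w * t * (n * n * w) ≡ (n * w) * (n * w) * t
        lemma = solve-∀ ℚ-ring
        lemma′ : ∀ s d t → s * d * t ≡ d * (s * t)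
        lemma′ = solve-∀ ℚ-ring
        lemma″ : ∀ d n w e → d * (n * (w * (e * n))) ≡ d * e * (n * n * w)
        lemma″ = solve-∀ ℚ-ring

-- Choice of the constants and passage to the limit

open Counting
open import Defs
open Rationals
open SecondMoment using (X; X-positive)
open Tail using (σ)
open TailSum
open LowerBound
import Data.Integer.Base as ℤ
import Data.Integer.Properties as ℤ
import Data.List.Properties as List
open import Data.Nat.Base as ℕ using (ℕ; suc; _!)
import Data.Nat.Properties as ℕ
open import Data.Rational.Base as ℚ hiding (1/_)
open import Data.Rational.Properties
import Data.Rational.Unnormalised.Base as ℚᵘ
import Data.Rational.Unnormalised.Properties as ℚᵘ
open import Tactic.RingSolver using (solve-∀)

-- Abstract, lest 140 ^ 140 be evaluated.
abstract
  140^-bound : ∃ λ A → ∀ j → 140 ℕ.^ j ℕ.≤ A ℕ.* j !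
  140^-bound = 140 ℕ.^ 140 , ^-!-bound 140

/-*ι : ∀ a b .{{_ : ℕ.NonZero b}} → ℤ.+ a / b * ι b ≡ ι a
/-*ι a (suc b) = toℚᵘ-injective (begin-equality
  toℚᵘ (ℤ.+ a / suc b * ι (suc b))                         ≃⟨ toℚᵘ-homo-* (ℤ.+ a / suc b) (ι (suc b)) ⟩
  toℚᵘ (ℤ.+ a / suc b) ℚᵘ.* toℚᵘ (ι (suc b))               ≃⟨ ℚᵘ.*-cong (toℚᵘ-fromℚᵘ (ℚᵘ.mkℚᵘ (ℤ.+ a) b)) (toℚᵘ-fromℚᵘ (ℚᵘ.mkℚᵘ (ℤ.+ suc b) 0)) ⟩
  ℚᵘ.mkℚᵘ (ℤ.+ a) b ℚᵘ.* ℚᵘ.mkℚᵘ (ℤ.+ suc b) 0             ≃⟨ ℚᵘ.*≡* (trans (ℤ.*-identityʳ _) (cong (λ z → ℤ.+ a ℤ.* ℤ.+ suc z) (sym (ℕ.*-identityʳ b)))) ⟩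
  ℚᵘ.mkℚᵘ (ℤ.+ a) 0                                        ≃⟨ toℚᵘ-fromℚᵘ (ℚᵘ.mkℚᵘ (ℤ.+ a) 0) ⟨
  toℚᵘ (ι a)                                               ∎)
  where open ℚᵘ.≤-Reasoning

module _ (N : ℕ) where

  private
    n = suc N
    open Enumeration (edgeOrderings n) using () renaming (elements to Ω)
    p  = increasingHamiltonianProbability n
    D′ = length (filter (hasIncreasingHamiltonianPath? {n}) Ω)
    W  = ι (length Ω)

    0<W : 0ℚ < W
    0<W = 0<ι (length Ω) {{edgeOrderings-nonZero n}}

    p*W : p * W ≡ ι D′
    p*W = /-*ι D′ (length Ω) {{edgeOrderings-nonZero n}}

  0≤probability : 0ℚ ≤ p
  0≤probability = *-cancelʳ 0<W (≤-trans (≤-reflexive (*-zeroˡ W)) (≤-trans (0≤ι D′) (≤-reflexive (sym p*W))))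

  probability≤1 : p ≤ 1ℚ
  probability≤1 = *-cancelʳ 0<W (≤-trans (≤-reflexive p*W) (≤-trans
    (ι-mono (List.length-filter (hasIncreasingHamiltonianPath? {n}) Ω)) (≤-reflexive (sym (*-identityˡ W)))))

  probability-lower : ∀ {q r} → 0ℚ ≤ r → W * q ≤ ι (∑ Ω (λ f → 𝟙 (0 ℕ.<? X N f))) * r → q ≤ p * r
  probability-lower {q} {r} 0≤r le = *-cancelʳ 0<W (begin
    q * W                                             ≡⟨ *-comm q W ⟩
    W * q                                             ≤⟨ le ⟩
    ι (∑ Ω (λ f → 𝟙 (0 ℕ.<? X N f))) * r              ≤⟨ *-monoʳ 0≤r (ι-mono (∑-mono Ω (λ {f} _ → 𝟙-mono (0 ℕ.<? X N f) (hasIncreasingHamiltonianPath? f) (X-positive N f)))) ⟩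
    ι (∑ Ω (𝟙 ∘ hasIncreasingHamiltonianPath?)) * r   ≡⟨ cong (λ z → ι z * r) (length-filter hasIncreasingHamiltonianPath? Ω) ⟨
    ι D′ * r                                          ≡⟨ cong (_* r) p*W ⟨
    p * W * r                                         ≡⟨ lemma p W r ⟩
    p * r * W                                         ∎)
    where
    open ≤-Reasoning
    lemma : ∀ p w r → p * w * r ≡ p * r * w
    lemma = solve-∀ ℚ-ring

module _ (j : ℕ) where

  private
    instance _ = 1≤⇒nonZero (1≤expSum j)
    i = inv e 1≤expSum j

    i*expSum : i * expSum j ≡ 1ℚ
    i*expSum = *-inverseˡ (expSum j)

    0≤i : 0ℚ ≤ i
    0≤i = nonNegative⁻¹ i {{pos⇒nonNeg i {{1/pos⇒pos (expSum j) {{positive (<-≤-trans (positive⁻¹ 1ℚ) (1≤expSum j))}}}}}}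

    i≤1 : i ≤ 1ℚ
    i≤1 = begin
      i              ≡⟨ *-identityʳ i ⟨
      i * 1ℚ         ≤⟨ *-monoˡ 0≤i (1≤expSum j) ⟩
      i * expSum j   ≡⟨ i*expSum ⟩
      1ℚ             ∎
      where open ≤-Reasoning

  reciprocal-≤ : ∀ {p ε} → 0ℚ ≤ ε → 1ℚ ≤ p * expSum j + ε → i ≤ p + ε
  reciprocal-≤ {p} {ε} 0≤ε le = begin
    i                              ≡⟨ *-identityʳ i ⟨
    i * 1ℚ                         ≤⟨ *-monoˡ 0≤i le ⟩
    i * (p * expSum j + ε)         ≡⟨ lemma i p (expSum j) ε ⟩
    p * (i * expSum j) + i * ε     ≤⟨ +-mono-≤ (≤-reflexive (trans (cong (p *_) i*expSum) (*-identityʳ p)))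
                                       (≤-trans (*-monoʳ 0≤ε i≤1) (≤-reflexive (*-identityˡ ε))) ⟩
    p + ε                          ∎
    where
    open ≤-Reasoning
    lemma : ∀ i p x e → i * (p * x + e) ≡ p * (i * x) + i * e
    lemma = solve-∀ ℚ-ring

-- It suffices to treat n = suc K + M for a K depending on ε only.
module _ (ε : ℚ) (0<ε : 0ℚ < ε) where

  private
    A       = proj₁ 140^-bound
    A-bound = proj₂ 140^-bound

    half : ∀ {q} → 0ℚ < q → 0ℚ < q * ½
    half {q} 0<q = subst (_< q * ½) (*-zeroʳ q) (*-monoʳ-<-pos q {{positive 0<q}} (positive⁻¹ ½))

    halves : ∀ q → q * ½ + q * ½ ≡ q
    halves q = trans (sym (*-distribˡ-+ q ½ ½)) (*-identityʳ q)

    -- One half of `ε` goes to Bernoulli's inequality. The other goes to the tail, which divides it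
    -- evenly between its constant part and the part that is linear in `n`.
    ε₁ = ε * ½
    ε₂ = ε₁ * ½

    0<ε₁ : 0ℚ < ε₁
    0<ε₁ = half 0<ε

    0<ε₂ : 0ℚ < ε₂
    0<ε₂ = half 0<ε₁

    -- 40 is the coefficient of `σ ^ suc K` in `tailSum`, 9 the bound in `σ-decay`.
    archK = archimedean ε₂ 0<ε₂ (A ℕ.* (40 ℕ.* 9))

  K : ℕ
  K = proj₁ archK

  private
    c = 45 ℕ.+ 4 ℕ.* K
    -- The exponent of `θ` in `Θ * Θ * Θ`.
    L = K ℕ.+ (K ℕ.+ K)

    arch₁ = archimedean ε₂ 0<ε₂ (A ℕ.* 380)
    arch₂ = archimedean ε₁ 0<ε₁ (L ℕ.* c)

    σ-small : ι A * ι 40 * σ ^ suc K ≤ ε₂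
    σ-small = *-cancelʳ (0<ι (9 ℕ.+ suc K)) (begin
      ι A * ι 40 * σ ^ suc K * ι (9 ℕ.+ suc K)      ≡⟨ *-assoc (ι A * ι 40) (σ ^ suc K) (ι (9 ℕ.+ suc K)) ⟩
      ι A * ι 40 * (σ ^ suc K * ι (9 ℕ.+ suc K))    ≤⟨ *-monoˡ (0≤* (0≤ι A) (0≤ι 40)) (σ-decay (suc K)) ⟩
      ι A * ι 40 * ι 9                              ≡⟨ trans (*-assoc (ι A) (ι 40) (ι 9)) (sym (ι-* A (40 ℕ.* 9))) ⟩
      ι (A ℕ.* (40 ℕ.* 9))                          ≤⟨ proj₂ archK (9 ℕ.+ suc K) (ℕ.≤-trans (ℕ.n≤1+n K) (ℕ.m≤n+m (suc K) 9)) ⟩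
      ε₂ * ι (9 ℕ.+ suc K)                          ∎)
      where open ≤-Reasoning

  threshold : ℕ
  threshold = c ℕ.+ (proj₁ arch₁ ℕ.+ proj₁ arch₂)

  K<threshold : suc K ℕ.≤ threshold
  K<threshold = ℕ.≤-trans (ℕ.s≤s (ℕ.≤-trans (ℕ.m≤n*m K 4) (ℕ.m≤n+m (4 ℕ.* K) 44))) (ℕ.m≤m+n c _)

  module _ (M : ℕ) (large : threshold ℕ.≤ suc K ℕ.+ M) where

    private
      N = K ℕ.+ M
      n = suc N
      d = n ℕ.∸ c
      p = increasingHamiltonianProbability n

      -- The reciprocal of `n` as `(n - 1)! / n!`, so that the identities for `1/ n !` apply.
      n⁻¹ = ι (N !) * 1/ n !

      n*n⁻¹ : ι n * n⁻¹ ≡ 1ℚ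
      n*n⁻¹ = trans (lemma (ι n) (ι (N !)) (1/ n !)) (trans (cong (ι (N !) *_) (1/suc! N)) (k!*1/k! N))
        where
        lemma : ∀ a b c → a * (b * c) ≡ b * (a * c)
        lemma = solve-∀ ℚ-ring

      0≤n⁻¹ : 0ℚ ≤ n⁻¹
      0≤n⁻¹ = 0≤* (0≤ι (N !)) (0≤1/k! n)

      d+c≡n : d ℕ.+ c ≡ n
      d+c≡n = ℕ.m∸n+n≡m (ℕ.≤-trans (ℕ.m≤m+n c _) large)

      θ δ : ℚ
      θ = ι d * n⁻¹
      δ = ι c * n⁻¹

      cancel-n : ∀ x → ι x * n⁻¹ * ι n ≡ ι x
      cancel-n x = trans (lemma (ι x) n⁻¹ (ι n)) (trans (cong (ι x *_) n*n⁻¹) (*-identityʳ (ι x)))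
        where
        lemma : ∀ a b c → a * b * c ≡ a * (c * b)
        lemma = solve-∀ ℚ-ring

      θ+δ≡1 : θ + δ ≡ 1ℚ
      θ+δ≡1 = trans (sym (*-distribʳ-+ n⁻¹ (ι d) (ι c))) (trans (cong (_* n⁻¹) (trans (sym (ι-+ d c)) (cong ι d+c≡n))) n*n⁻¹)

      0≤θ : 0ℚ ≤ θ
      0≤θ = 0≤* (0≤ι d) 0≤n⁻¹

      0≤δ : 0ℚ ≤ δ
      0≤δ = 0≤* (0≤ι c) 0≤n⁻¹

      θ≤1 : θ ≤ 1ℚ
      θ≤1 = ≤-trans (p≤p+q 0≤δ) (≤-reflexive θ+δ≡1)

      0≤ε₁ : 0ℚ ≤ ε₁
      0≤ε₁ = <⇒≤ 0<ε₁

      tail-small : ι A * (ι 380 + ι 40 * ι n * σ ^ suc K) ≤ ε₁ * ι n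
      tail-small = begin
        ι A * (ι 380 + ι 40 * ι n * σ ^ suc K)             ≡⟨ lemma (ι A) (ι 380) (ι 40) (ι n) (σ ^ suc K) ⟩
        ι A * ι 380 + ι A * ι 40 * σ ^ suc K * ι n         ≡⟨ cong (_+ ι A * ι 40 * σ ^ suc K * ι n) (ι-* A 380) ⟨
        ι (A ℕ.* 380) + ι A * ι 40 * σ ^ suc K * ι n       ≤⟨ +-mono-≤ (proj₂ arch₁ n (ℕ.≤-trans (ℕ.m≤m+n (proj₁ arch₁) (proj₁ arch₂)) (ℕ.≤-trans (ℕ.m≤n+m _ c) large)))
                                                                (*-monoʳ (0≤ι n) σ-small) ⟩
        ε₂ * ι n + ε₂ * ι n                                ≡⟨ *-distribʳ-+ (ι n) ε₂ ε₂ ⟨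
        (ε₂ + ε₂) * ι n                                    ≡⟨ cong (_* ι n) (halves ε₁) ⟩
        ε₁ * ι n                                           ∎
        where
        open ≤-Reasoning
        lemma : ∀ a s f n t → a * (s + f * n * t) ≡ a * s + a * f * t * n
        lemma = solve-∀ ℚ-ring

      Lδ≤ε₁ : ι L * δ ≤ ε₁
      Lδ≤ε₁ = *-cancelʳ {r = ι n} (0<ι n) (begin
        ι L * δ * ι n         ≡⟨ trans (*-assoc (ι L) δ (ι n)) (cong (ι L *_) (cancel-n c)) ⟩
        ι L * ι c             ≡⟨ ι-* L c ⟨
        ι (L ℕ.* c)           ≤⟨ proj₂ arch₂ n (ℕ.≤-trans (ℕ.m≤n+m (proj₁ arch₂) (proj₁ arch₁)) (ℕ.≤-trans (ℕ.m≤n+m _ c) large)) ⟩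
        ε₁ * ι n              ∎)
        where open ≤-Reasoning

      cube : θ ^ L ≡ θ ^ K * θ ^ K * θ ^ K
      cube = trans (^-+ θ K (K ℕ.+ K)) (trans (cong (θ ^ K *_) (^-+ θ K K)) (sym (*-assoc (θ ^ K) (θ ^ K) (θ ^ K))))

    1≤p*expSum+ε : 1ℚ ≤ p * expSum K + ε
    1≤p*expSum+ε = begin
      1ℚ
        ≤⟨ bernoulli 0≤θ 0≤δ θ+δ≡1 L ⟩
      θ ^ L + ι L * δ
        ≤⟨ +-mono-≤ (≤-trans (≤-reflexive cube) (probability-lower N (0≤+ (≤-trans (nonNegative⁻¹ 1ℚ) (1≤expSum K)) 0≤ε₁)
            (positive-count A A-bound K M d d+c≡n 0≤θ θ≤1 (cancel-n d) tail-small 0≤ε₁))) Lδ≤ε₁ ⟩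
      p * (expSum K + ε₁) + ε₁
        ≡⟨ cong (_+ ε₁) (*-distribˡ-+ p (expSum K) ε₁) ⟩
      p * expSum K + p * ε₁ + ε₁
        ≤⟨ +-monoˡ-≤ ε₁ (+-monoʳ-≤ (p * expSum K) (≤-trans (*-monoʳ 0≤ε₁ (probability≤1 N)) (≤-reflexive (*-identityˡ ε₁)))) ⟩
      p * expSum K + ε₁ + ε₁
        ≡⟨ trans (+-assoc (p * expSum K) ε₁ ε₁) (cong (λ z → p * expSum K + z) (halves ε)) ⟩
      p * expSum K + ε ∎
      where open ≤-Reasoning

    -- The bound on `n` must depend on `ε` only, and so the cut-off stays at `K` while the
    -- approximants of 1/e run on. As `expSum` increases, the inequality at `K` persists for all
    -- later `j`.
    1/e-bound : ∀ j → K ℕ.≤ j → inv e 1≤expSum j ≤ p + ε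
    1/e-bound j K≤j = reciprocal-≤ j {p} {ε} (<⇒≤ 0<ε) (≤-trans 1≤p*expSum+ε
      (+-monoˡ-≤ ε (*-monoˡ (0≤probability N) (expSum-mono (ℕ.≤⇒≤′ K≤j)))))

theorem2 : ∀ (ε : ℚ) → 0ℚ ℚ.< ε →
    ∃ λ (N : ℕ) → ∀ (n : ℕ) → N ℕ.≤ n →
      1/e ≤ᴿ fromℚ (increasingHamiltonianProbability n ℚ.+ ε)
theorem2 ε 0<ε = threshold ε 0<ε , λ n N≤n ε′ 0<ε′ → K ε 0<ε , λ j K≤j →
  ≤-trans (bound n N≤n j K≤j) (p≤p+q (<⇒≤ 0<ε′))
  where
  bound : ∀ n → threshold ε 0<ε ℕ.≤ n → ∀ j → K ε 0<ε ℕ.≤ j → inv e 1≤expSum j ≤ increasingHamiltonianProbability n + ε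
  bound n N≤n j K≤j = subst (λ n → inv e 1≤expSum j ≤ increasingHamiltonianProbability n + ε) n≡
    (1/e-bound ε 0<ε (n ℕ.∸ suc (K ε 0<ε)) (ℕ.≤-trans N≤n (ℕ.≤-reflexive (sym n≡))) j K≤j)
    where
    n≡ : suc (K ε 0<ε) ℕ.+ (n ℕ.∸ suc (K ε 0<ε)) ≡ n
    n≡ = ℕ.m+[n∸m]≡n (ℕ.≤-trans (K<threshold ε 0<ε) N≤n)
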